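{- For all integers $k\ge 3$ and $1\le \ell<k$ such that $(k-\ell)\nmid k$ and every $0<\Delta<1$, there exists $\gamma>0$ such that the following holds for all sufficiently large $n\in(k-\ell)\mathbb{N}$, where $s=\lceil \frac{k}{k-\ell}\rceil$. Suppose that $\mathcal{H}=(V,E)$ is an $n$-vertex $k$-graph. If $\mathcal{H}$ is not $\Delta$-extremal and satisfies $$\delta_{k-1}(\mathcal{H})\ge \left(\frac{1}{s(k-\ell)}-\gamma\right)n,$$ then $\mathcal{H}$ contains a Hamilton $\ell$-cycle.
   Context: A $k$-graph ($k$-uniform hypergraph) $\mathcal{H}=(V,E)$ has a finite vertex set $V$ and edge set $E\subseteq\binom{V}{k}$. For a $(k-1)$-set $S\subseteq V$, $\deg_{\mathcal{H}}(S)$ is the number of vertices $v\in V\setminus S$ with $S\cup\{v\}\in E$, and the minimum co-degree $\delta_{k-1}(\mathcal{H})$ is the minimum of $\deg_{\mathcal{H}}(S)$ over all $(k-1)$-sets $S\subseteq V$. For $B\subseteq V$, $e(B)$ is the number of edges of $\mathcal{H}$ contained in $B$. For $\Delta>0$ (and given $k,\ell$, $s=\lceil \frac{k}{k-\ell}\rceil$), an $n$-vertex $k$-graph $\mathcal{H}$ is called $\Delta$-extremal if there is a set $B\subseteq V(\mathcal{H})$ such that $|B|=\left\lfloor\left(1-\frac{1}{s(k-\ell)}\right)n\right\rfloor$ and $e(B)\le \Delta n^k$. A $k$-graph is a ($k$-uniform) $\ell$-cycle if there is a cyclic ordering of its vertices such that every edge consists of $k$ consecutive vertices and two consecutive edges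 share exactly $\ell$ vertices. $\mathcal{H}$ contains a Hamilton $\ell$-cycle if it contains an $\ell$-cycle as a spanning subhypergraph. -}

module Defs where

open import Data.Bool.Base using (true; false)
open import Data.Fin.Base as Fin using (Fin; toℕ)
open import Data.Fin.Permutation using (Permutation′; _⟨$⟩ʳ_)
open import Data.Fin.Properties using (nonZeroIndex)
open import Data.Fin.Subset using (Subset; _∈_; _∪_; _∩_; ⁅_⁆; ⋃; ∣_∣)
open import Data.Fin.Subset.Properties using (_∈?_; _⊆?_)
open import Data.Integer.Base using (+_)
open import Data.List.Base using (List; []; _∷_; _++_; map; filter; length; allFin; upTo)
open import Data.List.Extrema.Nat using (min)
open import Data.Nat.Base as ℕ using (ℕ; suc; _+_; _*_; _∸_; _^_; _<_; s≤s; z≤n; NonZero; >-nonZero)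
open import Data.Nat.DivMod using (_/_; _mod_; m≥n⇒m/n>0)
open import Data.Nat.Properties as ℕ using (m<n⇒0<n∸m; +-monoˡ-≤; m*n≢0; module ≤-Reasoning)
open import Data.Product.Base using (Σ-syntax; ∃-syntax; _×_)
open import Data.Rational.Base as ℚ using (ℚ; 1ℚ; floor)
open import Data.Vec.Base as Vec using ()
open import Function.Bundles using (_⇔_)
open import Relation.Binary.Core using (_Preserves_⟶_)
open import Relation.Binary.PropositionalEquality using (_≡_)
open import Relation.Nullary.Decidable using (¬?; _×-dec_)
open import Relation.Unary using (Decidable)

fromℕ : ℕ → ℚ
fromℕ n = + n ℚ./ 1

-- The vertex set of an n-vertex k-graph is taken to be Fin n.
-- Membership in the (finite) edge set is decidable.
record KGraph (k n : ℕ) : Set₁ where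
  field
    Edge    : Subset n → Set
    edge?   : Decidable Edge
    uniform : ∀ {e} → Edge e → ∣ e ∣ ≡ k

open KGraph public

-- Every subset of Fin n, listed exactly once.
subsets : ∀ n → List (Subset n)
subsets 0       = Vec.[] ∷ []
subsets (suc n) = map (false Vec.∷_) (subsets n) ++ map (true Vec.∷_) (subsets n)

module _ {k n : ℕ} (H : KGraph k n) where

  deg : Subset n → ℕ
  deg S = length (filter (λ v → ¬? (v ∈? S) ×-dec edge? H (S ∪ ⁅ v ⁆)) (allFin n))

  -- `min` needs a default, used for the empty list. As deg S ≤ n always, the
  -- default n does not affect the minimum when some (k-1)-set exists.
  minCodegree : ℕ
  minCodegree = min n (map deg (filter (λ S → ∣ S ∣ ℕ.≟ k ∸ 1) (subsets n)))

  edgesWithin : Subset n → ℕ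
  edgesWithin B = length (filter (λ e → edge? H e ×-dec e ⊆? B) (subsets n))

⌈_/_⌉ : (m d : ℕ) .{{_ : NonZero d}} → ℕ
⌈ m / d ⌉ = (m + (d ∸ 1)) / d

module _ (k ℓ : ℕ) (ℓ<k : ℓ < k) where

  k∸ℓ-nonZero : NonZero (k ∸ ℓ)
  k∸ℓ-nonZero = >-nonZero (m<n⇒0<n∸m ℓ<k)

  s : ℕ
  s = ⌈ k / (k ∸ ℓ) ⌉ {{k∸ℓ-nonZero}}

  s-nonZero : NonZero s
  s-nonZero = >-nonZero (m≥n⇒m/n>0 {{k∸ℓ-nonZero}} (begin
    k ∸ ℓ              ≡⟨ ℕ.suc-pred (k ∸ ℓ) {{k∸ℓ-nonZero}} ⟨
    1 + (k ∸ ℓ ∸ 1)    ≤⟨ +-monoˡ-≤ _ (ℕ.≤-trans (s≤s z≤n) ℓ<k) ⟩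
    k + (k ∸ ℓ ∸ 1)    ∎))
    where open ≤-Reasoning

  threshold : ℚ
  threshold = (+ 1 ℚ./ (s * (k ∸ ℓ))) {{m*n≢0 s (k ∸ ℓ) {{s-nonZero}} {{k∸ℓ-nonZero}}}}

  -- Nothing is lost by letting Δ range over ℚ instead of ℝ: a k-graph that is
  -- not Δ-extremal is not Δ′-extremal for any Δ′ ≤ Δ.
  Extremal : ∀ {n} → ℚ → KGraph k n → Set
  Extremal {n} Δ H = Σ[ B ∈ Subset n ]
      + ∣ B ∣ ≡ floor ((1ℚ ℚ.- threshold) ℚ.* fromℕ n)
    × fromℕ (edgesWithin H B) ℚ.≤ Δ ℚ.* fromℕ (n ^ k)

infixl 6 _⊕_

_⊕_ : ∀ {n} → Fin n → ℕ → Fin n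
_⊕_ {n} p j = ((toℕ p + j) mod n) {{nonZeroIndex p}}

-- The k consecutive vertices from position p on, in the cyclic ordering in
-- which position i is occupied by the vertex π ⟨$⟩ʳ i.
segment : ∀ {n} → Permutation′ n → ℕ → Fin n → Subset n
segment π k p = ⋃ (map (λ j → ⁅ π ⟨$⟩ʳ (p ⊕ j) ⁆) (upTo k))

-- The edges are ordered cyclically by their starting positions, and
-- "consecutive edges" refers to this order. The field `covering` (no isolated
-- vertices) is part of the usual meaning of an ℓ-cycle; without it the empty
-- k-graph, or two edges sharing ℓ vertices plus isolated vertices, would qualify.
record IsCycle (ℓ : ℕ) {k n : ℕ} (C : KGraph k n) : Set where
  field
    order      : Permutation′ n
    size       : ℕ
    start      : Fin size → Fin n
    increasing : start Preserves Fin._<_ ⟶ Fin._<_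
    edges      : ∀ e → Edge C e ⇔ (∃[ i ] e ≡ segment order k (start i))
    covering   : ∀ v → ∃[ i ] v ∈ segment order k (start i)
    sharing    : ∀ i → ∣ segment order k (start i) ∩ segment order k (start (i ⊕ 1)) ∣ ≡ ℓ

HasHamiltonCycle : ℕ → ∀ {k n} → KGraph k n → Set₁
HasHamiltonCycle ℓ {k} {n} H =
  Σ[ C ∈ KGraph k n ] IsCycle ℓ C × (∀ {e} → Edge C e → Edge H e)

{-# OPTIONS --safe #-}
-- Let d = k − ℓ, s = ⌈k / d⌉ and k = (s − 1) d + r, so that 0 < r < d. Label position j d + o (o < d) by a token depending on o and
-- on j modulo s if o < r, modulo s − 1 otherwise. Every window of length k starting at a multiple of d contains each of the k tokens
-- once, yet token 0 occurs only once in s d positions. So a box, that is k lists of vertices all of whose transversals are edges,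
-- contains long ℓ-paths; and boxes abound in any set of k-tuples of positive density, by the power mean inequality.
-- Tiles: for every weight on the vertices some ℓ-path of bounded length carries hardly more than its share. As token 0 is rare, its
-- vertices may be heavier than the others: somewhat heavier common neighbours of light (k − 1)-sets S give such a box. If N(S) has
-- few of them then, the codegree being nearly n / (s d), almost all vertices outside N(S) are light, and non-extremality
-- yields a light box avoiding N(S). Choosing tiles that are light for a multiplicative-weights potential covers most of the
-- vertices while codegrees and non-extremality persist in the rest, without randomness or regularity.
-- Connections: two paths are joined through vertices each of which completes an edge, with any residue of the length; averaging
-- over the solutions of this system of constraints finds the vertices in a box.
-- Absorption: in Q = s (s − 1) blocks of length d token r occurs once more often than token 0. Transposing these tokens in the
-- middle of a path takes in a vertex in the role of token 0 and releases one in the role of token r. The Q d vertices released by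
-- Q d such gadgets prolong a path by Q blocks, so that any Q d vertices can be absorbed.

module Submission where

import Algebra.Properties.CommutativeSemigroup as CommutativeSemigroup
open import Data.Bool.Base as Bool using (Bool; true; false; not; _∧_)
import Data.Bool.Properties as Boolₚ
open import Data.Empty using (⊥; ⊥-elim)
open import Data.Fin.Base as Fin using (Fin; toℕ; fromℕ<)
open import Data.Fin.Permutation using (Permutation′; permutation)
import Data.Fin.Properties as Finₚ
open import Data.Fin.Subset as Subset using (Subset; ⁅_⁆; _∪_; _∩_; ⋃; ∣_∣)
import Data.Fin.Subset.Properties as Subsetₚ
import Data.Integer.Base as ℤ
import Data.Integer.Properties as ℤₚ
import Data.Integer.Tactic.RingSolver as ℤ-Solver
open import Data.List.Base using (List; []; _∷_; [_]; _++_; map; concat; concatMap; length; filter; filterᵇ; allFin; upTo; take; drop; replicate; lookup; applyUpTo)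
open import Data.List.Extrema.Nat using (min≤v⁺)
open import Data.List.Membership.DecPropositional using (_∈?_)
open import Data.List.Membership.Propositional using (_∈_; _∉_)
open import Data.List.Membership.Propositional.Properties using (∈-map⁺; ∈-map⁻; ∈-++⁺ˡ; ∈-++⁺ʳ; ∈-++⁻; ∈-concat⁺′; ∈-concat⁻′; ∈-filter⁺; ∈-filter⁻; ∈-∃++; ∈-allFin)
open import Data.List.Properties using (map-id; concat-++; length-++; length-map; map-++; ++-assoc; ++-identityʳ; map-∘; map-cong; length-take; length-drop; take++drop≡id; length-replicate; length-tabulate; take-map; drop-map; take-all)
open import Data.List.Relation.Binary.Permutation.Propositional as Perm using (_↭_; ↭-refl; ↭-sym; ↭-trans; ↭-reflexive; prep; swap)
open import Data.List.Relation.Binary.Permutation.Propositional.Properties as Permₚ using (∈-resp-↭; All-resp-↭; ↭-length; shift; shifts; drop-∷)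
open import Data.List.Relation.Binary.Pointwise as Pw using (Pointwise; []; _∷_; Pointwise-length)
open import Data.List.Relation.Unary.All as All using (All; []; _∷_)
import Data.List.Relation.Unary.All.Properties as Allₚ
open import Data.List.Relation.Unary.AllPairs as AllPairs using ([]; _∷_)
open import Data.List.Relation.Unary.Any as Any using (Any; here; there) renaming (index to index-of)
import Data.List.Relation.Unary.Any.Properties as Anyₚ
import Data.List.Relation.Unary.Unique.DecPropositional as UniqueDec
open import Data.List.Relation.Unary.Unique.Propositional using (Unique)
import Data.List.Relation.Unary.Unique.Propositional.Properties as Uniqueₚ
open import Data.Nat.Base using (ℕ; zero; suc; pred; _+_; _*_; _∸_; _^_; _≤_; _<_; z≤n; s≤s; NonZero; _⊓_; >-nonZero)
open import Data.Nat.DivMod using (_/_; _%_; m≡m%n+[m/n]*n; m%n<n; [m+kn]%n≡m%n; [m+n]%n≡m%n; m*n%n≡0; m<n⇒m%n≡m; m/n*n≤m; /-mono-≤; m*n/n≡m; +-distrib-/-∣ʳ; m<n⇒m/n≡0; m<n*o⇒m/o<n; n%n≡0; m*n/o*n≡m/o; m*n/m*o≡n/o)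
open import Data.Nat.Divisibility using (_∣_; divides; n∣m*n; ∣m+n∣m⇒∣n; m%n≡0⇒n∣m)
open import Data.Nat.Properties
open import Data.Nat.Tactic.RingSolver using (solve-∀)
open import Data.Product.Base using (Σ-syntax; ∃₂; ∃-syntax; _×_; _,_; proj₁; proj₂)
open import Data.Rational.Base as ℚ using (ℚ; mkℚ; 0ℚ; 1ℚ; toℚᵘ; floor; ↧ₙ_)
import Data.Rational.Properties as ℚₚ
open import Data.Rational.Unnormalised.Base as ℚᵘ using (mkℚᵘ; *≡*; *≤*; *<*)
import Data.Rational.Unnormalised.Properties as ℚᵘₚ
open import Data.Sum.Base using (_⊎_; inj₁; inj₂)
open import Data.Unit.Base using (⊤; tt)
import Data.Vec.Base as Vec
open import Data.Vec.Properties as Vecₚ using (∷-injectiveʳ)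
open import Defs using (KGraph; Edge; edge?; uniform; subsets; deg; minCodegree; edgesWithin; HasHamiltonCycle; segment; _⊕_; fromℕ; threshold; Extremal; k∸ℓ-nonZero; s-nonZero)
open import Function.Base using (_∘_; id)
open import Function.Bundles using (mk⇔)
open import Relation.Binary.PropositionalEquality using (_≡_; _≢_; refl; sym; trans; cong; cong₂; subst; subst₂; module ≡-Reasoning)
open import Relation.Nullary.Decidable using (Dec; yes; no; does; ¬?; _×-dec_; dec-true; T?)
open import Relation.Nullary.Negation using (¬_)
open import Relation.Unary using (Decidable)
open CommutativeSemigroup +-commutativeSemigroup using () renaming (x∙yz≈y∙xz to +-exchange; interchange to +-interchange)
open CommutativeSemigroup *-commutativeSemigroup using () renaming (x∙yz≈y∙xz to *-exchange; interchange to *-interchange)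

-- That `k ∸ ℓ` does not divide `k` enters as 0 < r < d: every block then carries tokens of two
-- coprime periods, s and s - 1. Both global steps rest on this. By the Chinese remainder theorem
-- every token shares some block with token 0 or token r, so a path can drift from one edge to any
-- other, two tokens at a time; and over s (s - 1) blocks the periods give different frequencies,
-- the surplus that an absorber exploits. A word repeats its tokens but a path must not repeat
-- vertices. So tiles, connections and absorbers are found as boxes: a positive density of solutions
-- in boundedly many variables yields a blow-up, in which each occurrence of a token takes a new
-- vertex of its row. The frequency of token 0 in a tile matches the codegree threshold 1 / (s d),
-- which balances the weight argument: if the vertices of a link of this density exceed a quantile
-- by more than s d D, they use up the whole allowance of D per vertex, and hardly any vertex
-- outside the link can be heavy. Everything is an inequality between natural numbers with
-- denominators cleared; density at least 1 / C reads u ^ r ≤ C * count.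

variable
  A B : Set

-- Finite sums and the enumeration of tuples

⟦_⟧ : Bool → ℕ
⟦ true ⟧ = 1
⟦ false ⟧ = 0

⟦⟧≤1 : ∀ b → ⟦ b ⟧ ≤ 1
⟦⟧≤1 true = ≤-refl
⟦⟧≤1 false = z≤n

⟦∧⟧ : ∀ b c → ⟦ b ∧ c ⟧ ≡ ⟦ b ⟧ * ⟦ c ⟧
⟦∧⟧ true c = sym (*-identityˡ _)
⟦∧⟧ false c = refl

⟦⟧>0 : ∀ {b} → 0 < ⟦ b ⟧ → b ≡ true
⟦⟧>0 {true} _ = refl

∧-true : ∀ {a b} → a ∧ b ≡ true → a ≡ true × b ≡ true
∧-true {true} {true} _ = refl , refl

∑ : List A → (A → ℕ) → ℕ
∑ [] f = 0
∑ (x ∷ xs) f = f x + ∑ xs f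

∑-cong : ∀ (xs : List A) {f g : A → ℕ} → (∀ x → f x ≡ g x) → ∑ xs f ≡ ∑ xs g
∑-cong [] eq = refl
∑-cong (x ∷ xs) eq = cong₂ _+_ (eq x) (∑-cong xs eq)

∑-mono-∈ : ∀ (xs : List A) {f g : A → ℕ} → (∀ {x} → x ∈ xs → f x ≤ g x) → ∑ xs f ≤ ∑ xs g
∑-mono-∈ [] le = z≤n
∑-mono-∈ (x ∷ xs) le = +-mono-≤ (le (here refl)) (∑-mono-∈ xs (le ∘ there))

∑-mono : ∀ (xs : List A) {f g : A → ℕ} → (∀ x → f x ≤ g x) → ∑ xs f ≤ ∑ xs g
∑-mono xs le = ∑-mono-∈ xs (λ {x} _ → le x)

∑-cong-∈ : ∀ (xs : List A) {f g : A → ℕ} → (∀ {x} → x ∈ xs → f x ≡ g x) → ∑ xs f ≡ ∑ xs g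
∑-cong-∈ xs eq = ≤-antisym (∑-mono-∈ xs (≤-reflexive ∘ eq)) (∑-mono-∈ xs (≤-reflexive ∘ sym ∘ eq))

∑-+ : ∀ (xs : List A) (f g : A → ℕ) → ∑ xs (λ x → f x + g x) ≡ ∑ xs f + ∑ xs g
∑-+ [] f g = refl
∑-+ (x ∷ xs) f g = trans (cong (f x + g x +_) (∑-+ xs f g)) (+-interchange (f x) (g x) (∑ xs f) (∑ xs g))

∑-*ˡ : ∀ (xs : List A) c (f : A → ℕ) → ∑ xs (λ x → c * f x) ≡ c * ∑ xs f
∑-*ˡ [] c f = sym (*-zeroʳ c)
∑-*ˡ (x ∷ xs) c f = trans (cong (c * f x +_) (∑-*ˡ xs c f)) (sym (*-distribˡ-+ c (f x) _))

∑-*ʳ : ∀ (xs : List A) c (f : A → ℕ) → ∑ xs (λ x → f x * c) ≡ ∑ xs f * c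
∑-*ʳ xs c f = trans (∑-cong xs (λ x → *-comm (f x) c)) (trans (∑-*ˡ xs c f) (*-comm c _))

∑-const : ∀ (xs : List A) c → ∑ xs (λ _ → c) ≡ length xs * c
∑-const [] c = refl
∑-const (x ∷ xs) c = cong (c +_) (∑-const xs c)

∑-1 : ∀ (xs : List A) → ∑ xs (λ _ → 1) ≡ length xs
∑-1 xs = trans (∑-const xs 1) (*-identityʳ _)

∑-≤ : ∀ (xs : List A) {f : A → ℕ} {c} → (∀ {x} → x ∈ xs → f x ≤ c) → ∑ xs f ≤ length xs * c
∑-≤ xs {c = c} le = ≤-trans (∑-mono-∈ xs le) (≤-reflexive (∑-const xs c))

∑-++ : ∀ (xs ys : List A) (f : A → ℕ) → ∑ (xs ++ ys) f ≡ ∑ xs f + ∑ ys f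
∑-++ [] ys f = refl
∑-++ (x ∷ xs) ys f = trans (cong (f x +_) (∑-++ xs ys f)) (sym (+-assoc (f x) _ _))

∑-map : ∀ (g : A → B) xs (f : B → ℕ) → ∑ (map g xs) f ≡ ∑ xs (f ∘ g)
∑-map g [] f = refl
∑-map g (x ∷ xs) f = cong (f (g x) +_) (∑-map g xs f)

∑-concatMap : ∀ (g : A → List B) xs (f : B → ℕ) → ∑ (concatMap g xs) f ≡ ∑ xs (λ x → ∑ (g x) f)
∑-concatMap g [] f = refl
∑-concatMap g (x ∷ xs) f = trans (∑-++ (g x) _ f) (cong (∑ (g x) f +_) (∑-concatMap g xs f))

∑-concat : ∀ (xss : List (List A)) (f : A → ℕ) → ∑ (concat xss) f ≡ ∑ xss (λ xs → ∑ xs f)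
∑-concat [] f = refl
∑-concat (xs ∷ xss) f = trans (∑-++ xs _ f) (cong (∑ xs f +_) (∑-concat xss f))

∑-zero : ∀ (xs : List A) → ∑ xs (λ _ → 0) ≡ 0
∑-zero xs = trans (∑-const xs 0) (*-zeroʳ (length xs))

∑-swap : ∀ (xs : List A) (ys : List B) (f : A → B → ℕ) →
    ∑ xs (λ x → ∑ ys (f x)) ≡ ∑ ys (λ y → ∑ xs (λ x → f x y))
∑-swap [] ys f = sym (∑-zero ys)
∑-swap (x ∷ xs) ys f = trans (cong (∑ ys (f x) +_) (∑-swap xs ys f)) (sym (∑-+ ys _ _))

∑-↭ : ∀ {xs ys : List A} (f : A → ℕ) → xs ↭ ys → ∑ xs f ≡ ∑ ys f
∑-↭ f Perm.refl = refl
∑-↭ f (prep x p) = cong (f x +_) (∑-↭ f p)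
∑-↭ f (swap x y p) = trans (cong (λ z → f x + (f y + z)) (∑-↭ f p)) (+-exchange (f x) (f y) _)
∑-↭ f (Perm.trans p q) = trans (∑-↭ f p) (∑-↭ f q)

∈⇒≤∑ : ∀ {xs : List A} {x} (f : A → ℕ) → x ∈ xs → f x ≤ ∑ xs f
∈⇒≤∑ f (here refl) = m≤m+n _ _
∈⇒≤∑ f (there x∈) = ≤-trans (∈⇒≤∑ f x∈) (m≤n+m _ _)

∑-pick< : ∀ (xs : List A) {f g : A → ℕ} → ∑ xs f < ∑ xs g → ∃[ x ] x ∈ xs × f x < g x
∑-pick< (x ∷ xs) {f} {g} lt with f x <? g x
... | yes p = x , here refl , p
... | no ¬p with y , y∈ , q ← ∑-pick< xs (+-cancelˡ-< (g x) _ _ (≤-<-trans (+-monoˡ-≤ _ (≮⇒≥ ¬p)) lt)) = y , there y∈ , q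

∑-pick≤ : ∀ (xs : List A) {f g : A → ℕ} → 0 < length xs → ∑ xs f ≤ ∑ xs g → ∃[ x ] x ∈ xs × f x ≤ g x
∑-pick≤ xs {f} {g} ne le =
  let y , y∈ , q = ∑-pick< xs {f} {λ x → suc (g x)} (≤-<-trans le lt) in y , y∈ , ≤-pred q
  where
  lt : ∑ xs g < ∑ xs (λ x → 1 + g x)
  lt = subst (∑ xs g <_) (sym (trans (∑-+ xs (λ _ → 1) g) (cong (_+ ∑ xs g) (∑-1 xs)))) (m<n+m _ ne)

∑-filter : ∀ (p : A → Bool) (xs : List A) → ∑ xs (λ x → ⟦ p x ⟧) ≡ length (filterᵇ p xs)
∑-filter p [] = refl
∑-filter p (x ∷ xs) with p x
... | true = cong suc (∑-filter p xs)
... | false = ∑-filter p xs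

tuples : List A → ℕ → List (List A)
tuples us zero = [ [] ]
tuples us (suc N) = concatMap (λ a → map (a ∷_) (tuples us N)) us

∑-tuples : ∀ (us : List A) N (f : List A → ℕ) → ∑ (tuples us (suc N)) f ≡ ∑ us (λ a → ∑ (tuples us N) (f ∘ (a ∷_)))
∑-tuples us N f = trans (∑-concatMap _ us f) (∑-cong us (λ a → ∑-map (a ∷_) (tuples us N) f))

length-tuples : ∀ (us : List A) N → length (tuples us N) ≡ length us ^ N
length-tuples us zero = refl
length-tuples us (suc N) = begin
  length (tuples us (suc N)) ≡⟨ ∑-1 (tuples us (suc N)) ⟨
  ∑ (tuples us (suc N)) (λ _ → 1) ≡⟨ ∑-tuples us N _ ⟩
  ∑ us (λ a → ∑ (tuples us N) (λ _ → 1)) ≡⟨ ∑-cong us (λ _ → trans (∑-1 (tuples us N)) (length-tuples us N)) ⟩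
  ∑ us (λ _ → length us ^ N) ≡⟨ ∑-const us _ ⟩
  length us * length us ^ N ∎
  where open ≡-Reasoning

∈-tuples⁻ : ∀ (us : List A) N {xs} → xs ∈ tuples us N → length xs ≡ N × All (_∈ us) xs
∈-tuples⁻ us zero (here refl) = refl , []
∈-tuples⁻ us (suc N) xs∈ with _ , xs∈′ , l∈ ← ∈-concat⁻′ (map (λ a → map (a ∷_) (tuples us N)) us) xs∈
  with a , a∈ , refl ← ∈-map⁻ _ l∈ with ys , ys∈ , refl ← ∈-map⁻ _ xs∈′
  with len , all ← ∈-tuples⁻ us N ys∈ = cong suc len , a∈ ∷ all

∈-tuples⁺ : ∀ (us : List A) {xs} → All (_∈ us) xs → xs ∈ tuples us (length xs)
∈-tuples⁺ us [] = here refl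
∈-tuples⁺ us (x∈ ∷ all) = ∈-concat⁺′ (∈-map⁺ (_ ∷_) (∈-tuples⁺ us all)) (∈-map⁺ _ x∈)

-- Chebyshev's sum inequality and power means

^-distribʳ-* : ∀ p a b → (a * b) ^ p ≡ a ^ p * b ^ p
^-distribʳ-* zero a b = refl
^-distribʳ-* (suc p) a b = trans (cong (a * b *_) (^-distribʳ-* p a b)) (*-interchange a b (a ^ p) (b ^ p))

rearrangement : ∀ {a b x y} → a ≤ b → x ≤ y → a * y + b * x ≤ a * x + b * y
rearrangement {a} {b} {x} {y} a≤b x≤y with c , refl ← m≤n⇒∃[o]m+o≡n a≤b = begin
  a * y + (a + c) * x ≡⟨ eq₁ a c x y ⟩
  a * x + a * y + c * x ≤⟨ +-monoʳ-≤ (a * x + a * y) (*-monoʳ-≤ c x≤y) ⟩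
  a * x + a * y + c * y ≡⟨ eq₂ a c x y ⟩
  a * x + (a + c) * y ∎
  where
  open ≤-Reasoning
  eq₁ : ∀ a c x y → a * y + (a + c) * x ≡ a * x + a * y + c * x
  eq₁ = solve-∀
  eq₂ : ∀ a c x y → a * x + a * y + c * y ≡ a * x + (a + c) * y
  eq₂ = solve-∀

-- `a` and `a ^ p` are similarly ordered, so it is best to pair each number with its own power. This
-- is the two-term case that `chebyshev` sums over all pairs of entries.
mixed-powers : ∀ a b p → a * b ^ p + b * a ^ p ≤ a * a ^ p + b * b ^ p
mixed-powers a b p with ≤-total a b
... | inj₁ a≤b = rearrangement a≤b (^-monoˡ-≤ p a≤b)
... | inj₂ b≤a = subst₂ _≤_ (+-comm (b * a ^ p) _) (+-comm (b * b ^ p) _) (rearrangement b≤a (^-monoˡ-≤ p b≤a))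

∑∑-product : ∀ (xs : List A) (f g : A → ℕ) → ∑ xs (λ x → ∑ xs (λ y → f x * g y)) ≡ ∑ xs f * ∑ xs g
∑∑-product xs f g = trans (∑-cong xs (λ x → ∑-*ˡ xs (f x) g)) (∑-*ʳ xs (∑ xs g) f)

chebyshev : ∀ (xs : List A) (f : A → ℕ) p → ∑ xs f * ∑ xs (λ x → f x ^ p) ≤ length xs * ∑ xs (λ x → f x ^ suc p)
chebyshev xs f p = *-cancelˡ-≤ 2 (begin
  2 * (F * G) ≡⟨ eq₁ F G ⟩
  F * G + G * F ≡⟨ cong₂ _+_ (∑∑-product xs f fᵖ) (∑∑-product xs fᵖ f) ⟨
  ∑ xs (λ x → ∑ xs (λ y → f x * fᵖ y)) + ∑ xs (λ x → ∑ xs (λ y → fᵖ x * f y))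
    ≡⟨ ∑-+ xs _ _ ⟨
  ∑ xs (λ x → ∑ xs (λ y → f x * fᵖ y) + ∑ xs (λ y → fᵖ x * f y))
    ≡⟨ ∑-cong xs (λ x → ∑-+ xs _ _) ⟨
  ∑ xs (λ x → ∑ xs (λ y → f x * fᵖ y + fᵖ x * f y)) ≤⟨ ∑-mono xs (λ x → ∑-mono xs (λ y →
    ≤-trans (≤-reflexive (cong (f x * fᵖ y +_) (*-comm (fᵖ x) (f y)))) (mixed-powers (f x) (f y) p))) ⟩
  ∑ xs (λ x → ∑ xs (λ y → f x * fᵖ x + f y * fᵖ y)) ≡⟨ ∑-cong xs (λ x → ∑-+ xs _ _) ⟩
  ∑ xs (λ x → ∑ xs (λ y → f x * fᵖ x) + H) ≡⟨ ∑-cong xs (λ x → cong (_+ H) (∑-const xs _)) ⟩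
  ∑ xs (λ x → N * (f x * fᵖ x) + H) ≡⟨ ∑-+ xs _ _ ⟩
  ∑ xs (λ x → N * (f x * fᵖ x)) + ∑ xs (λ _ → H) ≡⟨ cong₂ _+_ (∑-*ˡ xs N _) (∑-const xs H) ⟩
  N * H + N * H ≡⟨ eq₂ N H ⟩
  2 * (N * H) ∎)
  where
  open ≤-Reasoning
  fᵖ = λ x → f x ^ p
  F = ∑ xs f
  G = ∑ xs fᵖ
  N = length xs
  H = ∑ xs (λ x → f x ^ suc p)
  eq₁ : ∀ a b → 2 * (a * b) ≡ a * b + b * a
  eq₁ = solve-∀
  eq₂ : ∀ a b → a * b + a * b ≡ 2 * (a * b)
  eq₂ = solve-∀

-- Convexity of the p-th power. Both sides carry powers of the length in place of quotients, which
-- also covers the empty list; each induction step spends one factor `F` on `chebyshev`.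
power-mean : ∀ (xs : List A) (f : A → ℕ) p → ∑ xs f ^ p * length xs ≤ length xs ^ p * ∑ xs (λ x → f x ^ p)
power-mean xs f zero = ≤-reflexive (cong (_+ 0) (sym (∑-1 xs)))
power-mean xs f (suc p) = begin
  F * F ^ p * N ≡⟨ *-assoc F (F ^ p) N ⟩
  F * (F ^ p * N) ≤⟨ *-monoʳ-≤ F (power-mean xs f p) ⟩
  F * (N ^ p * ∑ xs (λ x → f x ^ p)) ≡⟨ eq₁ F (N ^ p) _ ⟩
  N ^ p * (F * ∑ xs (λ x → f x ^ p)) ≤⟨ *-monoʳ-≤ (N ^ p) (chebyshev xs f p) ⟩
  N ^ p * (N * ∑ xs (λ x → f x ^ suc p)) ≡⟨ eq₂ (N ^ p) N _ ⟩
  N * N ^ p * ∑ xs (λ x → f x ^ suc p) ∎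
  where
  open ≤-Reasoning
  F = ∑ xs f
  N = length xs
  eq₁ : ∀ a b c → a * (b * c) ≡ b * (a * c)
  eq₁ = solve-∀
  eq₂ : ∀ a b c → a * (b * c) ≡ b * a * c
  eq₂ = solve-∀

-- Boxes of transversals and their density

allᵇ : (A → Bool) → List A → Bool
allᵇ p [] = true
allᵇ p (x ∷ xs) = p x ∧ allᵇ p xs

allᵇ-∈ : ∀ (p : A → Bool) {xs x} → allᵇ p xs ≡ true → x ∈ xs → p x ≡ true
allᵇ-∈ p all (here refl) = proj₁ (∧-true all)
allᵇ-∈ p all (there x∈) = allᵇ-∈ p (proj₂ (∧-true all)) x∈

∈-allᵇ : ∀ (p : A → Bool) xs → (∀ {x} → x ∈ xs → p x ≡ true) → allᵇ p xs ≡ true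
∈-allᵇ p [] all = refl
∈-allᵇ p (x ∷ xs) all rewrite all (here refl) = ∈-allᵇ p xs (all ∘ there)

-- boxed R rows says that R holds for every choice of one entry from each row.
boxed : (List A → Bool) → List (List A) → Bool
boxed R [] = R []
boxed R (row ∷ rows) = boxed (λ xs → allᵇ (λ v → R (v ∷ xs)) row) rows

boxed-sound : ∀ (R : List A → Bool) rows {xs} → boxed R rows ≡ true → Pointwise _∈_ xs rows → R xs ≡ true
boxed-sound R [] eq [] = eq
boxed-sound R (row ∷ rows) eq (x∈ ∷ xs∈) = allᵇ-∈ _ (boxed-sound _ rows eq xs∈) x∈

module _ (us : List A) where
  private
    u = length us

  count : ∀ r → (List A → Bool) → ℕ
  count r R = ∑ (tuples us r) (λ xs → ⟦ R xs ⟧)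

  boxes : ∀ M r → List (List (List A))
  boxes M r = tuples (tuples us M) r

  ∑-allᵇ : ∀ (p : A → Bool) M → ∑ (tuples us M) (λ row → ⟦ allᵇ p row ⟧) ≡ ∑ us (λ v → ⟦ p v ⟧) ^ M
  ∑-allᵇ p zero = refl
  ∑-allᵇ p (suc M) = begin
    ∑ (tuples us (suc M)) (λ row → ⟦ allᵇ p row ⟧) ≡⟨ ∑-tuples us M _ ⟩
    ∑ us (λ v → ∑ (tuples us M) (λ row → ⟦ p v ∧ allᵇ p row ⟧)) ≡⟨ ∑-cong us (λ v → ∑-cong (tuples us M) (λ row → ⟦∧⟧ (p v) _)) ⟩
    ∑ us (λ v → ∑ (tuples us M) (λ row → ⟦ p v ⟧ * ⟦ allᵇ p row ⟧)) ≡⟨ ∑-cong us (λ v → ∑-*ˡ (tuples us M) ⟦ p v ⟧ _) ⟩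
    ∑ us (λ v → ⟦ p v ⟧ * ∑ (tuples us M) (λ row → ⟦ allᵇ p row ⟧)) ≡⟨ ∑-*ʳ us _ _ ⟩
    ∑ us (λ v → ⟦ p v ⟧) * ∑ (tuples us M) (λ row → ⟦ allᵇ p row ⟧) ≡⟨ cong (∑ us (λ v → ⟦ p v ⟧) *_) (∑-allᵇ p M) ⟩
    ∑ us (λ v → ⟦ p v ⟧) * ∑ us (λ v → ⟦ p v ⟧) ^ M ∎
    where open ≡-Reasoning

  -- Duplicate the coordinates one at a time, using the power mean inequality twice per step.
  box-count : ∀ (R : List A → Bool) M r → 0 < u →
      count r R ^ (M ^ r) * u ^ (r * M) ≤ ∑ (boxes M r) (λ z → ⟦ boxed R z ⟧) * u ^ (r * M ^ r)
  box-count R M zero 0<u = ≤-reflexive (cong (_* 1) (*-identityʳ (count zero R)))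
  box-count R M (suc r) 0<u = *-cancelʳ-≤ _ _ (u ^ (r * P)) {{>-nonZero (m^n>0 u {{>-nonZero 0<u}} (r * P))}} (begin
    C ^ (M * P) * u ^ (M + r * M) * u ^ (r * P)
      ≡⟨ cong₂ (λ a b → a * b * u ^ (r * P)) (sym (^-*-assoc C M P)) (^-distribˡ-+-* u M (r * M)) ⟩
    (C ^ M) ^ P * (u ^ M * u ^ (r * M)) * u ^ (r * P)
      ≡⟨ cong ((C ^ M) ^ P * (u ^ M * u ^ (r * M)) *_) (sym (^-*-assoc u r P)) ⟩
    (C ^ M) ^ P * (u ^ M * u ^ (r * M)) * (u ^ r) ^ P
      ≡⟨ eq₁ ((C ^ M) ^ P) (u ^ M) (u ^ (r * M)) ((u ^ r) ^ P) ⟩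
    (C ^ M) ^ P * (u ^ r) ^ P * u ^ (r * M) * u ^ M
      ≡⟨ cong (λ a → a * u ^ (r * M) * u ^ M) (sym (^-distribʳ-* P (C ^ M) (u ^ r))) ⟩
    (C ^ M * u ^ r) ^ P * u ^ (r * M) * u ^ M
      ≤⟨ *-monoˡ-≤ (u ^ M) (*-monoˡ-≤ (u ^ (r * M)) (^-monoˡ-≤ P first)) ⟩
    ((u ^ r) ^ M * T) ^ P * u ^ (r * M) * u ^ M
      ≡⟨ cong (λ a → a * u ^ (r * M) * u ^ M) (^-distribʳ-* P ((u ^ r) ^ M) T) ⟩
    ((u ^ r) ^ M) ^ P * T ^ P * u ^ (r * M) * u ^ M
      ≡⟨ eq₂ (((u ^ r) ^ M) ^ P) (T ^ P) (u ^ (r * M)) (u ^ M) ⟩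
    ((u ^ r) ^ M) ^ P * (u ^ (r * M) * (T ^ P * u ^ M))
      ≤⟨ *-monoʳ-≤ (((u ^ r) ^ M) ^ P) (*-monoʳ-≤ (u ^ (r * M)) second) ⟩
    ((u ^ r) ^ M) ^ P * (u ^ (r * M) * ((u ^ M) ^ P * ∑ rows (λ row → c row ^ P)))
      ≡⟨ eq₃ (((u ^ r) ^ M) ^ P) (u ^ (r * M)) ((u ^ M) ^ P) _ ⟩
    ((u ^ r) ^ M) ^ P * (u ^ M) ^ P * (∑ rows (λ row → c row ^ P) * u ^ (r * M))
      ≤⟨ *-monoʳ-≤ (((u ^ r) ^ M) ^ P * (u ^ M) ^ P) third ⟩
    ((u ^ r) ^ M) ^ P * (u ^ M) ^ P * (Bx * u ^ (r * P))
      ≡⟨ eq₄ (((u ^ r) ^ M) ^ P) ((u ^ M) ^ P) Bx (u ^ (r * P)) ⟩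
    Bx * ((u ^ M) ^ P * ((u ^ r) ^ M) ^ P) * u ^ (r * P)
      ≡⟨ cong (λ a → Bx * a * u ^ (r * P)) powers ⟩
    Bx * u ^ (M * P + r * (M * P)) * u ^ (r * P) ∎)
    where
    open ≤-Reasoning
    P = M ^ r
    C = count (suc r) R
    Bx = ∑ (boxes M (suc r)) (λ z → ⟦ boxed R z ⟧)
    rows = tuples us M
    R′ : List A → List A → Bool
    R′ row xs = allᵇ (λ v → R (v ∷ xs)) row
    c = λ row → count r (R′ row)
    g = λ xs → ∑ us (λ v → ⟦ R (v ∷ xs) ⟧)
    T = ∑ rows c
    eq₁ : ∀ a b c e → a * (b * c) * e ≡ a * e * c * b
    eq₁ = solve-∀
    eq₂ : ∀ a b c e → a * b * c * e ≡ a * (c * (b * e))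
    eq₂ = solve-∀
    eq₃ : ∀ a b c e → a * (b * (c * e)) ≡ a * c * (e * b)
    eq₃ = solve-∀
    eq₄ : ∀ a b c e → a * b * (c * e) ≡ c * (b * a) * e
    eq₄ = solve-∀
    powers : (u ^ M) ^ P * ((u ^ r) ^ M) ^ P ≡ u ^ (M * P + r * (M * P))
    powers = trans (cong₂ _*_ (^-*-assoc u M P) (trans (^-*-assoc (u ^ r) M P) (^-*-assoc u r (M * P))))
        (sym (^-distribˡ-+-* u (M * P) (r * (M * P))))
    T≡ : T ≡ ∑ (tuples us r) (λ xs → g xs ^ M)
    T≡ = trans (∑-swap rows (tuples us r) _) (∑-cong (tuples us r) (λ xs → ∑-allᵇ (λ v → R (v ∷ xs)) M))
    C≡ : C ≡ ∑ (tuples us r) g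
    C≡ = trans (∑-tuples us r _) (∑-swap us (tuples us r) _)
    -- For fixed `xs` a good row is an independent choice of `M` good vertices, so `T` is the sum of
    -- the powers g xs ^ M: convexity over `xs`. The second use, over the rows, produces the
    -- exponent `P` with which the induction hypothesis bounds each row.
    first : C ^ M * u ^ r ≤ (u ^ r) ^ M * T
    first = subst₂ _≤_ (cong₂ (λ a b → a ^ M * b) (sym C≡) (length-tuples us r))
        (cong₂ (λ a b → a ^ M * b) (length-tuples us r) (sym T≡)) (power-mean (tuples us r) g M)
    second : T ^ P * u ^ M ≤ (u ^ M) ^ P * ∑ rows (λ row → c row ^ P)
    second = subst (λ a → T ^ P * a ≤ a ^ P * ∑ rows (λ row → c row ^ P)) (length-tuples us M) (power-mean rows c P)
    third : ∑ rows (λ row → c row ^ P) * u ^ (r * M) ≤ Bx * u ^ (r * P)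
    third = begin
      ∑ rows (λ row → c row ^ P) * u ^ (r * M) ≡⟨ ∑-*ʳ rows _ _ ⟨
      ∑ rows (λ row → c row ^ P * u ^ (r * M)) ≤⟨ ∑-mono rows (λ row → box-count (R′ row) M r 0<u) ⟩
      ∑ rows (λ row → ∑ (boxes M r) (λ z → ⟦ boxed (R′ row) z ⟧) * u ^ (r * P))
        ≡⟨ ∑-*ʳ rows _ _ ⟩
      ∑ rows (λ row → ∑ (boxes M r) (λ z → ⟦ boxed (R′ row) z ⟧)) * u ^ (r * P)
        ≡⟨ cong (_* u ^ (r * P)) (∑-tuples rows r _) ⟨
      Bx * u ^ (r * P) ∎

  -- The form used from here on: a relation of density 1 / C has boxes of density at least the
  -- reciprocal of C ^ (M ^ r), a bound that does not depend on the number of vertices.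
  box-density : ∀ (R : List A → Bool) M r C → 0 < u → u ^ r ≤ C * count r R →
      u ^ (r * M) ≤ C ^ (M ^ r) * ∑ (boxes M r) (λ z → ⟦ boxed R z ⟧)
  box-density R M r C 0<u dense = *-cancelʳ-≤ _ _ (u ^ (r * P)) {{>-nonZero (m^n>0 u {{>-nonZero 0<u}} (r * P))}} (begin
    u ^ (r * M) * u ^ (r * P) ≡⟨ cong (u ^ (r * M) *_) (^-*-assoc u r P) ⟨
    u ^ (r * M) * (u ^ r) ^ P ≤⟨ *-monoʳ-≤ (u ^ (r * M)) (^-monoˡ-≤ P dense) ⟩
    u ^ (r * M) * (C * count r R) ^ P ≡⟨ cong (u ^ (r * M) *_) (^-distribʳ-* P C (count r R)) ⟩
    u ^ (r * M) * (C ^ P * count r R ^ P) ≡⟨ eq (u ^ (r * M)) (C ^ P) (count r R ^ P) ⟩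
    C ^ P * (count r R ^ P * u ^ (r * M)) ≤⟨ *-monoʳ-≤ (C ^ P) (box-count R M r 0<u) ⟩
    C ^ P * (Bx * u ^ (r * P)) ≡⟨ *-assoc (C ^ P) Bx _ ⟨
    C ^ P * Bx * u ^ (r * P) ∎)
    where
    open ≤-Reasoning
    P = M ^ r
    Bx = ∑ (boxes M r) (λ z → ⟦ boxed R z ⟧)
    eq : ∀ a b c → a * (b * c) ≡ b * (c * a)
    eq = solve-∀

-- Boxes of new and distinct vertices

⟨_∈_⟩ : ∀ {n} → Fin n → List (Fin n) → Bool
⟨ x ∈ W ⟩ = does (_∈?_ Finₚ._≟_ x W)

⟨∈⟩-sound : ∀ {n} {x : Fin n} {W} → ⟨ x ∈ W ⟩ ≡ true → x ∈ W
⟨∈⟩-sound {x = x} {W} eq with _∈?_ Finₚ._≟_ x W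
... | yes p = p

⟨∈⟩-complete : ∀ {n} {x : Fin n} {W} → x ∈ W → ⟨ x ∈ W ⟩ ≡ true
⟨∈⟩-complete {x = x} {W} = dec-true (_∈?_ Finₚ._≟_ x W)

⟨∉⟩-sound : ∀ {n} {x : Fin n} {W} → not ⟨ x ∈ W ⟩ ≡ true → x ∉ W
⟨∉⟩-sound {x = x} {W} eq with _∈?_ Finₚ._≟_ x W
... | no ¬p = ¬p

∑-∈-unique : ∀ {n} (us : List (Fin n)) W → Unique us → ∑ us (λ x → ⟦ ⟨ x ∈ W ⟩ ⟧) ≤ length W
∑-∈-unique us W uniq = begin
  ∑ us (λ x → ⟦ ⟨ x ∈ W ⟩ ⟧) ≤⟨ ∑-mono us (λ x → bound x W) ⟩
  ∑ us (λ x → ∑ W (λ w → ⟦ does (x Finₚ.≟ w) ⟧)) ≡⟨ ∑-swap us W _ ⟩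
  ∑ W (λ w → ∑ us (λ x → ⟦ does (x Finₚ.≟ w) ⟧)) ≤⟨ ∑-mono W (λ w → once w uniq) ⟩
  ∑ W (λ w → 1) ≡⟨ ∑-1 W ⟩
  length W ∎
  where
  open ≤-Reasoning
  bound : ∀ x W → ⟦ ⟨ x ∈ W ⟩ ⟧ ≤ ∑ W (λ w → ⟦ does (x Finₚ.≟ w) ⟧)
  bound x W with _∈?_ Finₚ._≟_ x W
  ... | no _ = z≤n
  ... | yes x∈ = ≤-trans hit (∈⇒≤∑ _ x∈)
    where
    hit : 1 ≤ ⟦ does (x Finₚ.≟ x) ⟧
    hit with x Finₚ.≟ x
    ... | yes _ = ≤-refl
    ... | no ¬p = ⊥-elim (¬p refl)
  none : ∀ w {us} → All (w ≢_) us → ∑ us (λ x → ⟦ does (x Finₚ.≟ w) ⟧) ≡ 0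
  none w [] = refl
  none w {x ∷ _} (≢ ∷ ≢s) with x Finₚ.≟ w
  ... | yes p = ⊥-elim (≢ (sym p))
  ... | no _ = none w ≢s
  once : ∀ w {us} → Unique us → ∑ us (λ x → ⟦ does (x Finₚ.≟ w) ⟧) ≤ 1
  once w [] = z≤n
  once w {x ∷ _} (≢s ∷ un) with x Finₚ.≟ w
  ... | yes refl = s≤s (≤-reflexive (none x ≢s))
  ... | no _ = once w un

fresh : ∀ {n} → List (Fin n) → List (Fin n) → Bool
fresh W [] = true
fresh W (x ∷ xs) = not ⟨ x ∈ W ⟩ ∧ fresh (x ∷ W) xs

fresh-avoids : ∀ {n} (W : List (Fin n)) xs → fresh W xs ≡ true → All (_∉ W) xs
fresh-avoids W [] eq = []
fresh-avoids W (x ∷ xs) eq with a , b ← ∧-true {not ⟨ x ∈ W ⟩} eq =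
  ⟨∉⟩-sound a ∷ All.map (_∘ there) (fresh-avoids (x ∷ W) xs b)

fresh-unique : ∀ {n} (W : List (Fin n)) xs → fresh W xs ≡ true → Unique xs
fresh-unique W [] eq = []
fresh-unique W (x ∷ xs) eq with a , b ← ∧-true {not ⟨ x ∈ W ⟩} eq =
  All.map (λ ∉ x≡ → ∉ (here (sym x≡))) (fresh-avoids (x ∷ W) xs b) ∷ fresh-unique (x ∷ W) xs b

module _ {n} (us : List (Fin n)) (uniq : Unique us) where
  private
    u = length us

  -- Union bound: the entry chosen after i others meets `W` or one of these in at most
  -- `length W + i` of u cases. The factor u on the left replaces a division.
  stale-count : ∀ W N → ∑ (tuples us N) (λ xs → ⟦ not (fresh W xs) ⟧) * u ≤ N * (length W + N) * u ^ N
  stale-count W zero = z≤n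
  stale-count W (suc N) = begin
    ∑ (tuples us (suc N)) (λ xs → ⟦ not (fresh W xs) ⟧) * u
      ≡⟨ cong (_* u) (∑-tuples us N _) ⟩
    ∑ us (λ x → ∑ (tuples us N) (λ xs → ⟦ not (not ⟨ x ∈ W ⟩ ∧ fresh (x ∷ W) xs) ⟧)) * u
      ≤⟨ *-monoˡ-≤ u (∑-mono us λ x → ∑-mono (tuples us N) λ xs → split ⟨ x ∈ W ⟩ (fresh (x ∷ W) xs)) ⟩
    ∑ us (λ x → ∑ (tuples us N) (λ xs → ⟦ ⟨ x ∈ W ⟩ ⟧ + ⟦ not (fresh (x ∷ W) xs) ⟧)) * u
      ≡⟨ cong (_* u) (trans (∑-cong us (λ x → ∑-+ (tuples us N) _ _)) (∑-+ us _ _)) ⟩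
    (∑ us (λ x → ∑ (tuples us N) (λ xs → ⟦ ⟨ x ∈ W ⟩ ⟧)) + ∑ us (λ x → ∑ (tuples us N) (λ xs → ⟦ not (fresh (x ∷ W) xs) ⟧))) * u
      ≡⟨ *-distribʳ-+ u (∑ us (λ x → ∑ (tuples us N) (λ xs → ⟦ ⟨ x ∈ W ⟩ ⟧))) _ ⟩
    ∑ us (λ x → ∑ (tuples us N) (λ xs → ⟦ ⟨ x ∈ W ⟩ ⟧)) * u + ∑ us (λ x → ∑ (tuples us N) (λ xs → ⟦ not (fresh (x ∷ W) xs) ⟧)) * u
      ≤⟨ +-mono-≤ (*-monoˡ-≤ u hits) rest ⟩
    length W * u ^ N * u + u * (N * (suc (length W) + N) * u ^ N)
      ≡⟨ eq₁ (length W) N u (u ^ N) ⟩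
    (length W + N * (suc (length W) + N)) * (u * u ^ N)
      ≤⟨ *-monoˡ-≤ (u * u ^ N) (≤-trans (m≤m+n _ (1 + N)) (≤-reflexive (eq₂ (length W) N))) ⟩
    suc N * (length W + suc N) * (u * u ^ N) ∎
    where
    open ≤-Reasoning
    split : ∀ a b → ⟦ not (not a ∧ b) ⟧ ≤ ⟦ a ⟧ + ⟦ not b ⟧
    split true b = s≤s z≤n
    split false b = ≤-refl
    hits : ∑ us (λ x → ∑ (tuples us N) (λ xs → ⟦ ⟨ x ∈ W ⟩ ⟧)) ≤ length W * u ^ N
    hits = begin
      ∑ us (λ x → ∑ (tuples us N) (λ xs → ⟦ ⟨ x ∈ W ⟩ ⟧)) ≡⟨ ∑-swap us (tuples us N) _ ⟩
      ∑ (tuples us N) (λ _ → ∑ us (λ x → ⟦ ⟨ x ∈ W ⟩ ⟧)) ≤⟨ ∑-≤ (tuples us N) (λ _ → ∑-∈-unique us W uniq) ⟩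
      length (tuples us N) * length W ≡⟨ trans (*-comm _ (length W)) (cong (length W *_) (length-tuples us N)) ⟩
      length W * u ^ N ∎
    rest : ∑ us (λ x → ∑ (tuples us N) (λ xs → ⟦ not (fresh (x ∷ W) xs) ⟧)) * u ≤ u * (N * (suc (length W) + N) * u ^ N)
    rest = begin
      ∑ us (λ x → ∑ (tuples us N) (λ xs → ⟦ not (fresh (x ∷ W) xs) ⟧)) * u ≡⟨ ∑-*ʳ us u _ ⟨
      ∑ us (λ x → ∑ (tuples us N) (λ xs → ⟦ not (fresh (x ∷ W) xs) ⟧) * u) ≤⟨ ∑-≤ us (λ {x} _ → stale-count (x ∷ W) N) ⟩
      u * (N * (suc (length W) + N) * u ^ N) ∎
    eq₁ : ∀ w N u p → w * p * u + u * (N * (suc w + N) * p) ≡ (w + N * (suc w + N)) * (u * p)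
    eq₁ = solve-∀
    eq₂ : ∀ w N → w + N * (suc w + N) + (1 + N) ≡ suc N * (w + suc N)
    eq₂ = solve-∀

∑-tuples-++ : ∀ (us : List A) M N (f : List A → ℕ) →
    ∑ (tuples us (M + N)) f ≡ ∑ (tuples us M) (λ xs → ∑ (tuples us N) (λ ys → f (xs ++ ys)))
∑-tuples-++ us zero N f = sym (+-identityʳ _)
∑-tuples-++ us (suc M) N f = begin
  ∑ (tuples us (suc M + N)) f ≡⟨ ∑-tuples us (M + N) f ⟩
  ∑ us (λ a → ∑ (tuples us (M + N)) (f ∘ (a ∷_))) ≡⟨ ∑-cong us (λ a → ∑-tuples-++ us M N _) ⟩
  ∑ us (λ a → ∑ (tuples us M) (λ xs → ∑ (tuples us N) (λ ys → f (a ∷ xs ++ ys)))) ≡⟨ ∑-tuples us M _ ⟨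
  ∑ (tuples us (suc M)) (λ xs → ∑ (tuples us N) (λ ys → f (xs ++ ys))) ∎
  where open ≡-Reasoning

∑-boxes-concat : ∀ (us : List A) M r (f : List A → ℕ) → ∑ (boxes us M r) (f ∘ concat) ≡ ∑ (tuples us (r * M)) f
∑-boxes-concat us M zero f = refl
∑-boxes-concat us M (suc r) f = begin
  ∑ (boxes us M (suc r)) (f ∘ concat) ≡⟨ ∑-tuples (tuples us M) r _ ⟩
  ∑ (tuples us M) (λ row → ∑ (boxes us M r) (λ z → f (row ++ concat z))) ≡⟨ ∑-cong (tuples us M) (λ row → ∑-boxes-concat us M r (f ∘ (row ++_))) ⟩
  ∑ (tuples us M) (λ row → ∑ (tuples us (r * M)) (λ ys → f (row ++ ys))) ≡⟨ ∑-tuples-++ us M (r * M) f ⟨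
  ∑ (tuples us (M + r * M)) f ∎
  where open ≡-Reasoning

module _ {n} (us : List (Fin n)) (uniq : Unique us) (M r : ℕ) where
  private
    u = length us
    N = r * M

  -- At least u ^ N / K boxes satisfy `R`, and by `big` at most u ^ N / (2 K) are stale, so at least
  -- half of the bound survives.
  fresh-box-density : ∀ (R : List (Fin n) → Bool) W C → 0 < u → u ^ r ≤ C * count us r R →
    2 * C ^ (M ^ r) * (N * (length W + N)) ≤ u →
    u ^ N ≤ 2 * C ^ (M ^ r) * ∑ (boxes us M r) (λ z → ⟦ fresh W (concat z) ⟧ * ⟦ boxed R z ⟧)
  fresh-box-density R W C 0<u dense big = *-cancelˡ-≤ u {{>-nonZero 0<u}} (+-cancelʳ-≤ (u * u ^ N) _ _ (begin
    u * u ^ N + u * u ^ N ≡⟨ eq₁ u (u ^ N) ⟩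
    2 * (u * u ^ N) ≤⟨ *-monoʳ-≤ 2 (*-monoʳ-≤ u (box-density us R M r C 0<u dense)) ⟩
    2 * (u * (K * ∑ (boxes us M r) (λ z → ⟦ boxed R z ⟧))) ≤⟨ *-monoʳ-≤ 2 (*-monoʳ-≤ u (*-monoʳ-≤ K split)) ⟩
    2 * (u * (K * (G + S))) ≡⟨ eq₂ u K G S ⟩
    u * (2 * K * G) + 2 * K * (S * u) ≤⟨ +-monoʳ-≤ (u * (2 * K * G)) (*-monoʳ-≤ (2 * K) stale) ⟩
    u * (2 * K * G) + 2 * K * (N * (length W + N) * u ^ N) ≡⟨ cong (u * (2 * K * G) +_) (*-assoc (2 * K) _ _) ⟨
    u * (2 * K * G) + 2 * K * (N * (length W + N)) * u ^ N ≤⟨ +-monoʳ-≤ (u * (2 * K * G)) (*-monoˡ-≤ (u ^ N) big) ⟩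
    u * (2 * K * G) + u * u ^ N ∎))
    where
    open ≤-Reasoning
    K = C ^ (M ^ r)
    G = ∑ (boxes us M r) (λ z → ⟦ fresh W (concat z) ⟧ * ⟦ boxed R z ⟧)
    S = ∑ (boxes us M r) (λ z → ⟦ not (fresh W (concat z)) ⟧)
    stale : S * u ≤ N * (length W + N) * u ^ N
    stale = subst (λ a → a * u ≤ N * (length W + N) * u ^ N) (sym (∑-boxes-concat us M r (λ xs → ⟦ not (fresh W xs) ⟧)))
        (stale-count us uniq W N)
    cases : ∀ a b → ⟦ b ⟧ ≤ ⟦ a ⟧ * ⟦ b ⟧ + ⟦ not a ⟧
    cases true b = ≤-trans (m≤m+n ⟦ b ⟧ 0) (m≤m+n _ 0)
    cases false b = ⟦⟧≤1 b
    split : ∑ (boxes us M r) (λ z → ⟦ boxed R z ⟧) ≤ G + S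
    split = ≤-trans (∑-mono (boxes us M r) (λ z → cases (fresh W (concat z)) (boxed R z))) (≤-reflexive (∑-+ (boxes us M r) _ _))
    eq₁ : ∀ u p → u * p + u * p ≡ 2 * (u * p)
    eq₁ = solve-∀
    eq₂ : ∀ u K G S → 2 * (u * (K * (G + S))) ≡ u * (2 * K * G) + 2 * K * (S * u)
    eq₂ = solve-∀

  record FreshBox (R : List (Fin n) → Bool) : Set where
    field
      rows : List (List (Fin n))
      number : length rows ≡ r
      widths : All (λ row → length row ≡ M) rows
      within : All (All (_∈ us)) rows
      distinct : Unique (concat rows)
      holds : boxed R rows ≡ true

  ∈-boxes : ∀ {z} → z ∈ boxes us M r → length z ≡ r × All (λ row → length row ≡ M) z × All (All (_∈ us)) z
  ∈-boxes z∈ with len , all ← ∈-tuples⁻ (tuples us M) r z∈ =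
    len , All.map (proj₁ ∘ ∈-tuples⁻ us M) all , All.map (proj₂ ∘ ∈-tuples⁻ us M) all

  fresh-box : ∀ (R : List (Fin n) → Bool) C → u ^ r ≤ C * count us r R → 2 * C ^ (M ^ r) * (N * N) < u → FreshBox R
  fresh-box R C dense big = found (∑-pick< (boxes us M r) positive)
    where
    0<u : 0 < u
    0<u = ≤-<-trans z≤n big
    0<uᴺ : 0 < u ^ N
    0<uᴺ = m^n>0 u {{>-nonZero 0<u}} N
    good : List (List (Fin n)) → ℕ
    good z = ⟦ fresh [] (concat z) ⟧ * ⟦ boxed R z ⟧
    positive : ∑ (boxes us M r) (λ _ → 0) < ∑ (boxes us M r) good
    positive = subst (_< ∑ (boxes us M r) good) (sym (∑-zero (boxes us M r)))
      (n≢0⇒n>0 λ G≡0 → <-irrefl (sym (*-zeroʳ (2 * C ^ (M ^ r))))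
        (<-≤-trans 0<uᴺ (subst (λ g → u ^ N ≤ 2 * C ^ (M ^ r) * g) G≡0 (fresh-box-density R [] C 0<u dense (<⇒≤ big)))))
    found : ∃[ z ] z ∈ boxes us M r × 0 < good z → FreshBox R
    found (z , z∈ , pos) with len , wid , win ← ∈-boxes z∈ with fresh [] (concat z) in f | boxed R z in b
    ... | true | true = record
      { rows = z ; number = len ; widths = wid ; within = win ; distinct = fresh-unique [] _ f ; holds = b }

-- Multiplicative weights

bernoulli : ∀ y N → y ^ N * (y + N) ≤ y * suc y ^ N
bernoulli y zero = ≤-reflexive (eq y)
  where
  eq : ∀ y → 1 * (y + 0) ≡ y * 1
  eq = solve-∀
bernoulli y (suc N) = begin
  y * y ^ N * (y + suc N) ≡⟨ eq₁ y (y ^ N) N ⟩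
  y * (y ^ N * (y + N)) + y * y ^ N ≤⟨ +-mono-≤ (*-monoʳ-≤ y (bernoulli y N)) (*-monoʳ-≤ y (^-monoˡ-≤ N (n≤1+n y))) ⟩
  y * (y * suc y ^ N) + y * suc y ^ N ≡⟨ eq₂ y (suc y ^ N) ⟩
  y * (suc y * suc y ^ N) ∎
  where
  open ≤-Reasoning
  eq₁ : ∀ y p N → y * p * (y + suc N) ≡ y * (p * (y + N)) + y * p
  eq₁ = solve-∀
  eq₂ : ∀ y p → y * (y * p) + y * p ≡ y * (suc y * p)
  eq₂ = solve-∀

-- In quotients this is (1 + 1 / y′) ^ c ≤ 1 + c / y: an upper bound for a power, valid as long as c
-- ≤ y′ - y. Together with `bernoulli` it replaces exponential and logarithm in the potential
-- argument.
bernoulli-dual : ∀ y′ y c → y + c ≤ y′ → suc y′ ^ c * y ≤ y′ ^ c * (y + c)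
bernoulli-dual y′ y zero le = ≤-reflexive (cong (1 *_) (sym (+-identityʳ y)))
bernoulli-dual y′ y (suc c) le = begin
  suc y′ * suc y′ ^ c * y ≡⟨ *-assoc (suc y′) (suc y′ ^ c) y ⟩
  suc y′ * (suc y′ ^ c * y) ≤⟨ *-monoʳ-≤ (suc y′) (bernoulli-dual y′ y c le′) ⟩
  suc y′ * (y′ ^ c * (y + c)) ≡⟨ eq₁ y′ (y′ ^ c) (y + c) ⟩
  y′ ^ c * (y′ * (y + c) + (y + c)) ≤⟨ *-monoʳ-≤ (y′ ^ c) (+-monoʳ-≤ (y′ * (y + c)) le′) ⟩
  y′ ^ c * (y′ * (y + c) + y′) ≡⟨ eq₂ y′ (y′ ^ c) y c ⟩
  y′ * y′ ^ c * (y + suc c) ∎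
  where
  open ≤-Reasoning
  le′ : y + c ≤ y′
  le′ = ≤-trans (+-monoʳ-≤ y (n≤1+n c)) le
  eq₁ : ∀ y p x → suc y * (p * x) ≡ p * (y * x + x)
  eq₁ = solve-∀
  eq₂ : ∀ y′ p y c → p * (y′ * (y + c) + y′) ≡ y′ * p * (y + suc c)
  eq₂ = solve-∀

-- Multiplicative weights: the potential of a test is the product of Y + cost over the chosen items,
-- and each item is chosen so that the total potential grows by at most the factor (Y + a) / Y.
module GuidedSelection {Test Item : Set} (Θ : List Test) (cost : Test → Item → ℕ) (Valid : List Item → Set)
  (cmax a Y N L q : ℕ) (0<Y : 0 < Y) (small : length Θ ≤ 2 ^ L) (rate : a * (Y + cmax) ≤ N * Y)
  (initial : Valid []) (bounded : ∀ θ {i h} → Valid (i ∷ h) → cost θ i ≤ cmax) (shrink : ∀ {i h} → Valid (i ∷ h) → Valid h)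
  (step : ∀ h → Valid h → length h < q → ∀ φ → (∀ θ → 0 < φ θ) →
    ∃[ i ] Valid (i ∷ h) × ∑ Θ (λ θ → φ θ * cost θ i) ≤ a * ∑ Θ φ)
  where
  open ≤-Reasoning

  private
    Y′ = Y + cmax

    instance
      Y≢0 : NonZero Y
      Y≢0 = >-nonZero 0<Y
      Y′≢0 : NonZero Y′
      Y′≢0 = >-nonZero (≤-trans 0<Y (m≤m+n Y cmax))

    potential : List Item → Test → ℕ
    potential [] θ = 1
    potential (i ∷ h) θ = potential h θ * (Y + cost θ i)

    potential>0 : ∀ h θ → 0 < potential h θ
    potential>0 [] θ = ≤-refl
    potential>0 (i ∷ h) θ = *-mono-≤ (potential>0 h θ) (≤-trans 0<Y (m≤m+n Y _))

    choose : ∀ m → m ≤ q → ∃[ h ] Valid h × length h ≡ m × ∑ Θ (potential h) ≤ length Θ * (Y + a) ^ m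
    choose zero m≤q = [] , initial , refl , ≤-reflexive (∑-const Θ 1)
    choose (suc m) m≤q with h , valid , refl , le ← choose m (<⇒≤ m≤q)
      with i , valid′ , le′ ← step h valid m≤q (potential h) (potential>0 h) = i ∷ h , valid′ , refl , (begin
        ∑ Θ (λ θ → potential h θ * (Y + cost θ i)) ≡⟨ ∑-cong Θ (λ θ → *-distribˡ-+ (potential h θ) Y _) ⟩
        ∑ Θ (λ θ → potential h θ * Y + potential h θ * cost θ i) ≡⟨ ∑-+ Θ _ _ ⟩
        ∑ Θ (λ θ → potential h θ * Y) + ∑ Θ (λ θ → potential h θ * cost θ i)
        ≤⟨ +-mono-≤ (≤-reflexive (∑-*ʳ Θ Y _)) le′ ⟩
        ∑ Θ (potential h) * Y + a * ∑ Θ (potential h) ≡⟨ eq (∑ Θ (potential h)) Y a ⟩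
        (Y + a) * ∑ Θ (potential h) ≤⟨ *-monoʳ-≤ (Y + a) le ⟩
        (Y + a) * (length Θ * (Y + a) ^ length h) ≡⟨ *-exchange (Y + a) (length Θ) _ ⟩
        length Θ * ((Y + a) * (Y + a) ^ length h) ∎)
      where
      eq : ∀ p Y a → p * Y + a * p ≡ (Y + a) * p
      eq = solve-∀

    total : Test → List Item → ℕ
    total θ h = ∑ h (cost θ)

    -- Each factor 1 + c / Y of the normalised potential is at least (1 + 1 / Y′) ^ c because c ≤
    -- cmax. The total cost thus becomes an exponent of one fixed base.
    potential-lower : ∀ θ h → Valid h → suc Y′ ^ total θ h * Y ^ length h ≤ Y′ ^ total θ h * potential h θ
    potential-lower θ [] valid = ≤-refl
    potential-lower θ (i ∷ h) valid = begin
      suc Y′ ^ (c + t) * (Y * Y ^ length h) ≡⟨ cong (_* (Y * Y ^ length h)) (^-distribˡ-+-* (suc Y′) c t) ⟩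
      suc Y′ ^ c * suc Y′ ^ t * (Y * Y ^ length h) ≡⟨ eq₁ (suc Y′ ^ c) (suc Y′ ^ t) Y (Y ^ length h) ⟩
      suc Y′ ^ c * Y * (suc Y′ ^ t * Y ^ length h) ≤⟨ *-mono-≤ (bernoulli-dual Y′ Y c (+-monoʳ-≤ Y (bounded θ valid)))
        (potential-lower θ h (shrink valid)) ⟩
      Y′ ^ c * (Y + c) * (Y′ ^ t * potential h θ) ≡⟨ eq₂ (Y′ ^ c) (Y + c) (Y′ ^ t) (potential h θ) ⟩
      Y′ ^ c * Y′ ^ t * (potential h θ * (Y + c)) ≡⟨ cong (_* (potential h θ * (Y + c))) (^-distribˡ-+-* Y′ c t) ⟨
      Y′ ^ (c + t) * (potential h θ * (Y + c)) ∎
      where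
      c = cost θ i
      t = total θ h
      eq₁ : ∀ a b c e → a * b * (c * e) ≡ a * c * (b * e)
      eq₁ = solve-∀
      eq₂ : ∀ a b c e → a * b * (c * e) ≡ a * c * (e * b)
      eq₂ = solve-∀

    -- The upper bound in the same base. By `rate` and Bernoulli, the growth 1 + a / Y of one step
    -- is at most (1 + 1 / Y′) ^ N; by `doubling`, the number of tests, at most 2 ^ L, is at most (1
    -- + 1 / Y′) ^ (Y′ L). Comparing exponents then gives `select`.
    growth : (Y + a) * Y′ ^ N ≤ Y * suc Y′ ^ N
    growth = *-cancelˡ-≤ Y′ (begin
      Y′ * ((Y + a) * Y′ ^ N) ≡⟨ eq₁ Y′ Y a (Y′ ^ N) ⟩
      Y′ ^ N * (Y * Y′ + a * Y′) ≤⟨ *-monoʳ-≤ (Y′ ^ N) (+-monoʳ-≤ (Y * Y′) rate) ⟩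
      Y′ ^ N * (Y * Y′ + N * Y) ≡⟨ eq₂ Y′ Y N (Y′ ^ N) ⟩
      Y * (Y′ ^ N * (Y′ + N)) ≤⟨ *-monoʳ-≤ Y (bernoulli Y′ N) ⟩
      Y * (Y′ * suc Y′ ^ N) ≡⟨ *-exchange Y Y′ (suc Y′ ^ N) ⟩
      Y′ * (Y * suc Y′ ^ N) ∎)
      where
      eq₁ : ∀ y′ y a p → y′ * ((y + a) * p) ≡ p * (y * y′ + a * y′)
      eq₁ = solve-∀
      eq₂ : ∀ y′ y n p → p * (y * y′ + n * y) ≡ y * (p * (y′ + n))
      eq₂ = solve-∀

    doubling : 2 * Y′ ^ Y′ ≤ suc Y′ ^ Y′
    doubling = *-cancelˡ-≤ Y′ (≤-trans (≤-reflexive (eq Y′ (Y′ ^ Y′))) (bernoulli Y′ Y′))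
      where
      eq : ∀ y p → y * (2 * p) ≡ p * (y + y)
      eq = solve-∀

    m = N * q + Y′ * L

    upper : ∀ {θ h} → θ ∈ Θ → length h ≡ q → ∑ Θ (potential h) ≤ length Θ * (Y + a) ^ q →
        potential h θ * Y′ ^ m ≤ Y ^ q * suc Y′ ^ m
    upper {θ} {h} θ∈ refl le = begin
      potential h θ * Y′ ^ m ≤⟨ *-monoˡ-≤ (Y′ ^ m) (≤-trans (∈⇒≤∑ (potential h) θ∈) (≤-trans le (*-monoˡ-≤ _ small))) ⟩
      2 ^ L * (Y + a) ^ q * Y′ ^ m ≡⟨ cong (2 ^ L * (Y + a) ^ q *_) (powers Y′) ⟩
      2 ^ L * (Y + a) ^ q * ((Y′ ^ N) ^ q * (Y′ ^ Y′) ^ L) ≡⟨ eq (2 ^ L) ((Y + a) ^ q) ((Y′ ^ N) ^ q) _ ⟩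
      (Y + a) ^ q * (Y′ ^ N) ^ q * (2 ^ L * (Y′ ^ Y′) ^ L) ≡⟨ cong₂ _*_ (^-distribʳ-* q (Y + a) (Y′ ^ N)) (^-distribʳ-* L 2 (Y′ ^ Y′)) ⟨
      ((Y + a) * Y′ ^ N) ^ q * (2 * Y′ ^ Y′) ^ L ≤⟨ *-mono-≤ (^-monoˡ-≤ q growth) (^-monoˡ-≤ L doubling) ⟩
      (Y * suc Y′ ^ N) ^ q * (suc Y′ ^ Y′) ^ L ≡⟨ cong (_* (suc Y′ ^ Y′) ^ L) (^-distribʳ-* q Y (suc Y′ ^ N)) ⟩
      Y ^ q * (suc Y′ ^ N) ^ q * (suc Y′ ^ Y′) ^ L ≡⟨ *-assoc (Y ^ q) _ _ ⟩
      Y ^ q * ((suc Y′ ^ N) ^ q * (suc Y′ ^ Y′) ^ L) ≡⟨ cong (Y ^ q *_) (powers (suc Y′)) ⟨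
      Y ^ q * suc Y′ ^ m ∎
      where
      powers : ∀ y → y ^ m ≡ (y ^ N) ^ q * (y ^ Y′) ^ L
      powers y = trans (^-distribˡ-+-* y (N * q) (Y′ * L)) (cong₂ _*_ (sym (^-*-assoc y N q)) (sym (^-*-assoc y Y′ L)))
      eq : ∀ a b c e → a * b * (c * e) ≡ b * c * (a * e)
      eq = solve-∀

    total≤ : ∀ {θ h} → θ ∈ Θ → Valid h → length h ≡ q → ∑ Θ (potential h) ≤ length Θ * (Y + a) ^ q → total θ h ≤ m
    total≤ {θ} {h} θ∈ valid refl le = ≮⇒≥ λ m<C → <⇒≱ (contra m<C) (*-cancelʳ-≤ _ _ (Y ^ q) {{m^n≢0 Y q}} (begin
      suc Y′ ^ C * Y′ ^ m * Y ^ q ≡⟨ eq₁ (suc Y′ ^ C) (Y′ ^ m) (Y ^ q) ⟩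
      suc Y′ ^ C * Y ^ q * Y′ ^ m ≤⟨ *-monoˡ-≤ (Y′ ^ m) (potential-lower θ h valid) ⟩
      Y′ ^ C * potential h θ * Y′ ^ m ≡⟨ *-assoc (Y′ ^ C) _ _ ⟩
      Y′ ^ C * (potential h θ * Y′ ^ m) ≤⟨ *-monoʳ-≤ (Y′ ^ C) (upper {h = h} θ∈ refl le) ⟩
      Y′ ^ C * (Y ^ q * suc Y′ ^ m) ≡⟨ eq₂ (Y′ ^ C) (Y ^ q) (suc Y′ ^ m) ⟩
      Y′ ^ C * suc Y′ ^ m * Y ^ q ∎))
      where
      C = total θ h
      eq₁ : ∀ a b c → a * b * c ≡ a * c * b
      eq₁ = solve-∀
      eq₂ : ∀ a b c → a * (b * c) ≡ a * c * b
      eq₂ = solve-∀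
      contra : m < C → Y′ ^ C * suc Y′ ^ m < suc Y′ ^ C * Y′ ^ m
      contra m<C with j , eq ← m≤n⇒∃[o]m+o≡n m<C = begin-strict
        Y′ ^ C * suc Y′ ^ m ≡⟨ cong (_* suc Y′ ^ m) (split Y′) ⟩
        Y′ ^ m * Y′ ^ suc j * suc Y′ ^ m ≡⟨ eq₁ (Y′ ^ m) _ _ ⟩
        Y′ ^ m * suc Y′ ^ m * Y′ ^ suc j <⟨ *-monoʳ-< (Y′ ^ m * suc Y′ ^ m) {{m*n≢0 _ _ {{m^n≢0 Y′ m}} {{m^n≢0 (suc Y′) m}}}} (^-monoˡ-< (suc j) ≤-refl) ⟩
        Y′ ^ m * suc Y′ ^ m * suc Y′ ^ suc j ≡⟨ eq₃ (Y′ ^ m) (suc Y′ ^ m) _ ⟩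
        suc Y′ ^ m * suc Y′ ^ suc j * Y′ ^ m ≡⟨ cong (_* Y′ ^ m) (split (suc Y′)) ⟨
        suc Y′ ^ C * Y′ ^ m ∎
        where
        split : ∀ y → y ^ C ≡ y ^ m * y ^ suc j
        split y = trans (cong (y ^_) (trans (sym eq) (sym (+-suc m j)))) (^-distribˡ-+-* y m (suc j))
        eq₃ : ∀ a b c → a * b * c ≡ b * c * a
        eq₃ = solve-∀

  select : ∃[ h ] Valid h × length h ≡ q × (∀ {θ} → θ ∈ Θ → ∑ h (cost θ) ≤ N * q + (Y + cmax) * L)
  select with h , valid , len , le ← choose q ≤-refl = h , valid , len , λ θ∈ → total≤ θ∈ valid len le

-- Ranges, prefixes and repetition-free lists

range : ℕ → ℕ → List ℕ
range a zero = []
range a (suc m) = a ∷ range (suc a) m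

length-range : ∀ a m → length (range a m) ≡ m
length-range a zero = refl
length-range a (suc m) = cong suc (length-range (suc a) m)

length-map-range : ∀ (f : ℕ → A) a m → length (map f (range a m)) ≡ m
length-map-range f a m = trans (length-map f (range a m)) (length-range a m)

range-++ : ∀ a m p → range a (m + p) ≡ range a m ++ range (a + m) p
range-++ a zero p = cong (λ b → range b p) (sym (+-identityʳ a))
range-++ a (suc m) p = cong (a ∷_) (trans (range-++ (suc a) m p) (cong (λ b → range (suc a) m ++ range b p) (sym (+-suc a m))))

map-range-++ : ∀ (f : ℕ → A) a x N → map f (range a (x + N)) ≡ map f (range a x) ++ map f (range (a + x) N)
map-range-++ f a x N = trans (cong (map f) (range-++ a x N)) (map-++ f (range a x) _)

map-range-cong : ∀ {f g : ℕ → A} a b m → (∀ i → i < m → f (a + i) ≡ g (b + i)) → map f (range a m) ≡ map g (range b m)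
map-range-cong a b zero eq = refl
map-range-cong {f = f} {g} a b (suc m) eq = cong₂ _∷_
  (subst₂ (λ x y → f x ≡ g y) (+-identityʳ a) (+-identityʳ b) (eq 0 (s≤s z≤n)))
  (map-range-cong (suc a) (suc b) m (λ i i<m → subst₂ (λ x y → f x ≡ g y) (+-suc a i) (+-suc b i) (eq (suc i) (s≤s i<m))))

∈-range⁻ : ∀ a m {x} → x ∈ range a m → ∃[ i ] i < m × x ≡ a + i
∈-range⁻ a (suc m) (here refl) = 0 , s≤s z≤n , sym (+-identityʳ a)
∈-range⁻ a (suc m) (there x∈) with i , i< , refl ← ∈-range⁻ (suc a) m x∈ = suc i , s≤s i< , sym (+-suc a i)

∈-range⁺ : ∀ a {m i} → i < m → a + i ∈ range a m
∈-range⁺ a {suc m} {zero} _ = here (+-identityʳ a)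
∈-range⁺ a {suc m} {suc i} (s≤s i<m) = there (subst (_∈ range (suc a) m) (sym (+-suc a i)) (∈-range⁺ (suc a) i<m))

unique-range : ∀ a m → Unique (range a m)
unique-range a zero = []
unique-range a (suc m) = All.tabulate (λ x∈ a≡x → case x∈ a≡x) ∷ unique-range (suc a) m
  where
  case : ∀ {x} → x ∈ range (suc a) m → a ≡ x → ⊥
  case x∈ refl with i , _ , eq ← ∈-range⁻ (suc a) m x∈ = m≢1+m+n a eq

unique-resp-↭ : ∀ {xs ys : List A} → xs ↭ ys → Unique xs → Unique ys
unique-resp-↭ Perm.refl u = u
unique-resp-↭ (prep x p) (x∉ ∷ u) = All-resp-↭ p x∉ ∷ unique-resp-↭ p u
unique-resp-↭ (swap x y p) ((x≢y ∷ x∉) ∷ y∉ ∷ u) =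
  ((x≢y ∘ sym) ∷ All-resp-↭ p y∉) ∷ All-resp-↭ p x∉ ∷ unique-resp-↭ p u
unique-resp-↭ (Perm.trans p q) u = unique-resp-↭ q (unique-resp-↭ p u)

unique-map : ∀ (f : A → B) {xs} → (∀ {x y} → x ∈ xs → y ∈ xs → f x ≡ f y → x ≡ y) → Unique xs → Unique (map f xs)
unique-map f inj [] = []
unique-map f inj (x∉ ∷ un) = Allₚ.map⁺ (All.tabulate (λ y∈ eq → All.lookup x∉ y∈ (inj (here refl) (there y∈) eq))) ∷ unique-map f (λ x∈ y∈ → inj (there x∈) (there y∈)) un

unique-map-injective : ∀ (f : A → B) {xs x y} → Unique (map f xs) → x ∈ xs → y ∈ xs → f x ≡ f y → x ≡ y
unique-map-injective f (x∉ ∷ u) (here refl) (here refl) eq = refl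
unique-map-injective f (x∉ ∷ u) (here refl) (there y∈) eq = ⊥-elim (All.lookup x∉ (∈-map⁺ f y∈) eq)
unique-map-injective f (x∉ ∷ u) (there x∈) (here refl) eq = ⊥-elim (All.lookup x∉ (∈-map⁺ f x∈) (sym eq))
unique-map-injective f (x∉ ∷ u) (there x∈) (there y∈) eq = unique-map-injective f u x∈ y∈ eq

drop-++ʳ : ∀ (xs : List A) m {ys} → drop (length xs + m) (xs ++ ys) ≡ drop m ys
drop-++ʳ [] m = refl
drop-++ʳ (x ∷ xs) m = drop-++ʳ xs m

take-++ˡ : ∀ p (xs : List A) {ys} → p ≤ length xs → take p (xs ++ ys) ≡ take p xs
take-++ˡ zero xs le = refl
take-++ˡ (suc p) (x ∷ xs) (s≤s le) = cong (x ∷_) (take-++ˡ p xs le)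

take-drop-++ˡ : ∀ p m (xs : List A) {ys} → m + p ≤ length xs → take p (drop m (xs ++ ys)) ≡ take p (drop m xs)
take-drop-++ˡ p zero xs le = take-++ˡ p xs le
take-drop-++ˡ zero (suc m) [] ()
take-drop-++ˡ p (suc m) (x ∷ xs) (s≤s le) = take-drop-++ˡ p m xs le

take-range : ∀ p a m → p ≤ m → take p (range a m) ≡ range a p
take-range zero a m le = refl
take-range (suc p) a (suc m) (s≤s le) = cong (a ∷_) (take-range p (suc a) m le)

drop-range : ∀ j a m → drop j (range a (j + m)) ≡ range (a + j) m
drop-range zero a m = cong (λ b → range b m) (sym (+-identityʳ a))
drop-range (suc j) a m = trans (drop-range j (suc a) m) (cong (λ b → range b m) (sym (+-suc a j)))

pointwise-take : ∀ {R : A → B → Set} p {xs ys} → Pointwise R xs ys → Pointwise R (take p xs) (take p ys)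
pointwise-take zero rs = []
pointwise-take (suc p) [] = []
pointwise-take (suc p) (r ∷ rs) = r ∷ pointwise-take p rs

pointwise-drop : ∀ {R : A → B → Set} p {xs ys} → Pointwise R xs ys → Pointwise R (drop p xs) (drop p ys)
pointwise-drop zero rs = rs
pointwise-drop (suc p) [] = []
pointwise-drop (suc p) (r ∷ rs) = pointwise-drop p rs

pointwise-↭ : ∀ {R : A → B → Set} {xs xs′ ys} → xs ↭ xs′ → Pointwise R xs ys → ∃[ ys′ ] Pointwise R xs′ ys′ × ys ↭ ys′
pointwise-↭ Perm.refl rs = _ , rs , ↭-refl
pointwise-↭ (prep x p) (r ∷ rs) with _ , rs′ , q ← pointwise-↭ p rs = _ , r ∷ rs′ , prep _ q
pointwise-↭ (swap x y p) (r₁ ∷ r₂ ∷ rs) with _ , rs′ , q ← pointwise-↭ p rs = _ , r₂ ∷ r₁ ∷ rs′ , swap _ _ q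
pointwise-↭ (Perm.trans p p′) rs with _ , rs′ , q ← pointwise-↭ p rs with _ , rs″ , q′ ← pointwise-↭ p′ rs′ = _ , rs″ , ↭-trans q q′

-- Words read in windows of length k

record Shape : Set where
  field
    s₂ r₁ e₁ : ℕ

-- A window of length k starts at every multiple of d.
module Words (σ : Shape) where
  open Shape σ public
  S r e d k k₁ ℓ t Q : ℕ
  S = 2 + s₂
  r = suc r₁
  e = suc e₁
  d = r + e
  k = suc s₂ * d + r
  k₁ = r₁ + e + s₂ * d + r
  ℓ = s₂ * d + r
  t = S * d
  Q = suc s₂ * S

  k≡d+ℓ : k ≡ d + ℓ
  k≡d+ℓ = +-assoc d (s₂ * d) r

  letters : (ℕ → A) → List A
  letters α = map α (range 0 k)

  length-letters : ∀ (α : ℕ → A) → length (letters α) ≡ k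
  length-letters α = length-map-range α 0 k

  Chain : (List A → Set) → List A → Set
  Chain G xs = ∀ j → j * d + k ≤ length xs → G (take k (drop (j * d) xs))

  -- A window that starts before block `a` ends by position a d + ℓ, hence inside as ++ o; a later
  -- one lies in o ++ bs. This is why an overlap of ℓ letters suffices for gluing.
  chain-++ : ∀ {G : List A → Set} as o bs a → length as ≡ a * d → ℓ ≤ length o →
      Chain G (as ++ o) → Chain G (o ++ bs) → Chain G (as ++ o ++ bs)
  chain-++ {G = G} as o bs a |as| ℓ≤o left right j le with j * d + k ≤? length (as ++ o)
  ... | yes p = subst G (sym (trans (cong (λ l → take k (drop (j * d) l)) (sym (++-assoc as o bs))) (take-drop-++ˡ k (j * d) (as ++ o) p)))
      (left j p)
  ... | no ¬p = subst G (sym eq) (right j′ fits)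
    where
    open ≤-Reasoning
    past : a * d + ℓ < j * d + (d + ℓ)
    past = begin-strict
      a * d + ℓ ≤⟨ +-mono-≤ (≤-reflexive (sym |as|)) ℓ≤o ⟩
      length as + length o ≡⟨ length-++ as ⟨
      length (as ++ o) <⟨ ≰⇒> ¬p ⟩
      j * d + k ≡⟨ cong (j * d +_) k≡d+ℓ ⟩
      j * d + (d + ℓ) ∎
    a≤j : a ≤ j
    a≤j = ≤-pred (*-cancelʳ-< d a (suc j) (+-cancelʳ-< ℓ (a * d) (suc j * d) (subst (a * d + ℓ <_) (assoc (j * d) d ℓ) past)))
      where
      assoc : ∀ x y z → x + (y + z) ≡ y + x + z
      assoc = solve-∀
    j′ = proj₁ (m≤n⇒∃[o]m+o≡n a≤j)
    start≡ : j * d ≡ length as + j′ * d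
    start≡ = trans (cong (_* d) (sym (proj₂ (m≤n⇒∃[o]m+o≡n a≤j)))) (trans (*-distribʳ-+ d a j′) (cong (_+ j′ * d) (sym |as|)))
    eq : take k (drop (j * d) (as ++ o ++ bs)) ≡ take k (drop (j′ * d) (o ++ bs))
    eq = cong (take k) (trans (cong (λ m → drop m (as ++ o ++ bs)) start≡) (drop-++ʳ as (j′ * d)))
    fits : j′ * d + k ≤ length (o ++ bs)
    fits = +-cancelˡ-≤ (length as) _ _ (begin
      length as + (j′ * d + k) ≡⟨ +-assoc (length as) (j′ * d) k ⟨
      length as + j′ * d + k ≡⟨ cong (_+ k) start≡ ⟨
      j * d + k ≤⟨ le ⟩
      length (as ++ o ++ bs) ≡⟨ length-++ as ⟩
      length as + length (o ++ bs) ∎)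

  chain-suffix : ∀ {G : List A → Set} xs ys a → length xs ≡ a * d → Chain G (xs ++ ys) → Chain G ys
  chain-suffix {G = G} xs ys a |xs| ch j le = subst G (cong (take k) (trans (cong (λ m → drop m (xs ++ ys)) start≡) (drop-++ʳ xs (j * d))))
    (ch (a + j) (subst₂ _≤_ (trans (sym (+-assoc (length xs) (j * d) k)) (cong (_+ k) (sym start≡))) (sym (length-++ xs)) (+-monoʳ-≤ (length xs) le)))
    where
    start≡ : (a + j) * d ≡ length xs + j * d
    start≡ = trans (*-distribʳ-+ d a j) (cong (_+ j * d) (sym |xs|))

  chain-single : ∀ {G : List A → Set} xs → length xs ≡ k → G xs → Chain G xs
  chain-single {G = G} xs |xs| g zero le = subst G (sym (take-all k xs (≤-reflexive |xs|))) g
  chain-single {G = G} xs |xs| g (suc j) le = ⊥-elim (<⇒≱ (m<n+m k {suc j * d} (s≤s z≤n)) (≤-trans le (≤-reflexive |xs|)))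

  chain-short : ∀ {G : List A → Set} xs → length xs ≡ ℓ → Chain G xs
  chain-short xs |xs| j le = ⊥-elim (<⇒≱ (≤-trans (m<n+m ℓ {d} (s≤s z≤n)) (≤-reflexive (sym k≡d+ℓ))) (≤-trans (m≤n+m k (j * d)) (≤-trans le (≤-reflexive |xs|))))

  window-range : ∀ (f : ℕ → A) x {N} j → j * d + k ≤ N → take k (drop (j * d) (map f (range x N))) ≡ map f (range (x + j * d) k)
  window-range f x {N} j le with p , eq ← m≤n⇒∃[o]m+o≡n le = begin
    take k (drop (j * d) (map f (range x N))) ≡⟨ cong (take k) (drop-map (j * d) _) ⟩
    take k (map f (drop (j * d) (range x N))) ≡⟨ cong (λ m → take k (map f (drop (j * d) (range x m)))) (trans (sym eq) (+-assoc (j * d) k p)) ⟩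
    take k (map f (drop (j * d) (range x (j * d + (k + p))))) ≡⟨ cong (λ l → take k (map f l)) (drop-range (j * d) x (k + p)) ⟩
    take k (map f (range (x + j * d) (k + p))) ≡⟨ take-map k _ ⟩
    map f (take k (range (x + j * d) (k + p))) ≡⟨ cong (map f) (take-range k _ _ (m≤m+n k p)) ⟩
    map f (range (x + j * d) k) ∎
    where open ≡-Reasoning

  chain-range : ∀ {G : List A → Set} (f : ℕ → A) x N → (∀ j → j * d + k ≤ N → G (map f (range (x + j * d) k))) → Chain G (map f (range x N))
  chain-range {G = G} f x N win j le = subst G (sym (window-range f x j N≥)) (win j N≥)
    where
    N≥ : j * d + k ≤ N
    N≥ = ≤-trans le (≤-reflexive (trans (length-map f (range x N)) (length-range x N)))

  chain-pointwise : ∀ {R : A → B → Set} {G : List A → Set} {H : List B → Set} →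
      (∀ {xs ys} → G xs → Pointwise R xs ys → H ys) → ∀ {xs ys} → Pointwise R xs ys → Chain G xs → Chain H ys
  chain-pointwise lift {xs} {ys} rs ch j le =
    lift (ch j (≤-trans le (≤-reflexive (sym (Pointwise-length rs))))) (pointwise-take k (pointwise-drop (j * d) rs))

  chain-map : ∀ {G H : List A → Set} → (∀ {xs} → G xs → H xs) → ∀ {xs} → Chain G xs → Chain H xs
  chain-map lift ch j le = lift (ch j le)

-- The token word and switching between assignments

if? : ∀ {P : Set} → Dec P → A → A → A
if? (yes _) x y = x
if? (no _) x y = y

-- The token at position x = j d + o (o < d): tokens with offset o < r recur with period S blocks, the others with period S − 1.
module Tokens (σ : Shape) where
  open Words σ

  tok : ℕ → ℕ → ℕ
  tok j o = if? (o <? r) (j % S * d + o) (j % suc s₂ * d + o)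

  c : ℕ → ℕ
  c x = tok (x / d) (x % d)

  tokens : ℕ → ℕ → List ℕ
  tokens a N = map c (range a N)

  tok-long : ∀ j {o} → o < r → tok j o ≡ j % S * d + o
  tok-long j {o} o<r with o <? r
  ... | yes _ = refl
  ... | no ¬p = ⊥-elim (¬p o<r)

  tok-short : ∀ j {o} → r ≤ o → tok j o ≡ j % suc s₂ * d + o
  tok-short j {o} r≤o with o <? r
  ... | yes p = ⊥-elim (<⇒≱ p r≤o)
  ... | no _ = refl

  div-block : ∀ j {o} → o < d → (j * d + o) / d ≡ j
  div-block j {o} o<d = begin
    (j * d + o) / d ≡⟨ cong (_/ d) (+-comm (j * d) o) ⟩
    (o + j * d) / d ≡⟨ +-distrib-/-∣ʳ o (n∣m*n j {d}) ⟩
    o / d + j * d / d ≡⟨ cong₂ _+_ (m<n⇒m/n≡0 o<d) (m*n/n≡m j d) ⟩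
    j ∎
    where open ≡-Reasoning

  mod-block : ∀ j {o} → o < d → (j * d + o) % d ≡ o
  mod-block j {o} o<d = trans (cong (_% d) (+-comm (j * d) o)) (trans ([m+kn]%n≡m%n o j d) (m<n⇒m%n≡m o<d))

  c-tok : ∀ j {o} → o < d → c (j * d + o) ≡ tok j o
  c-tok j o<d = cong₂ tok (div-block j o<d) (mod-block j o<d)

  position : ∀ x → ∃₂ λ j o → o < d × x ≡ j * d + o
  position x = x / d , x % d , m%n<n x d , trans (m≡m%n+[m/n]*n x d) (+-comm (x % d) _)

  r<d : r < d
  r<d = m<m+n r (s≤s z≤n)

  c-shift-long : ∀ j {o} → o < r → c ((S + j) * d + o) ≡ c (j * d + o)
  c-shift-long j {o} o<r = begin
    c ((S + j) * d + o) ≡⟨ trans (c-tok (S + j) o<d) (tok-long (S + j) o<r) ⟩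
    (S + j) % S * d + o ≡⟨ cong (λ m → m * d + o) (trans (cong (_% S) (+-comm S j)) ([m+n]%n≡m%n j S)) ⟩
    j % S * d + o ≡⟨ trans (c-tok j o<d) (tok-long j o<r) ⟨
    c (j * d + o) ∎
    where
    open ≡-Reasoning
    o<d = <-trans o<r r<d

  c-shift-short : ∀ j {o} → r ≤ o → o < d → c ((suc s₂ + j) * d + o) ≡ c (j * d + o)
  c-shift-short j {o} r≤o o<d = begin
    c ((suc s₂ + j) * d + o) ≡⟨ trans (c-tok (suc s₂ + j) o<d) (tok-short (suc s₂ + j) r≤o) ⟩
    (suc s₂ + j) % suc s₂ * d + o ≡⟨ cong (λ m → m * d + o) (trans (cong (_% suc s₂) (+-comm (suc s₂) j)) ([m+n]%n≡m%n j (suc s₂))) ⟩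
    j % suc s₂ * d + o ≡⟨ trans (c-tok j o<d) (tok-short j r≤o) ⟨
    c (j * d + o) ∎
    where open ≡-Reasoning

  add-blocks : ∀ a j o → a * d + (j * d + o) ≡ (a + j) * d + o
  add-blocks a j o = trans (sym (+-assoc (a * d) (j * d) o)) (cong (_+ o) (sym (*-distribʳ-+ d a j)))

  c-period : ∀ m x → c (m * Q * d + x) ≡ c x
  c-period m x with j , o , o<d , refl ← position x = trans (cong c (add-blocks (m * Q) j o)) (trans (c-tok (m * Q + j) o<d) (trans same (sym (c-tok j o<d))))
    where
    same : tok (m * Q + j) o ≡ tok j o
    same with o <? r
    ... | yes _ = cong (λ a → a * d + o) (trans (cong (_% S) (trans (+-comm (m * Q) j) (cong (j +_) (sym (*-assoc m (suc s₂) S))))) ([m+kn]%n≡m%n j (m * suc s₂) S))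
    ... | no _ = cong (λ a → a * d + o) (trans (cong (_% suc s₂) (trans (+-comm (m * Q) j) (cong (j +_) (trans (cong (m *_) (*-comm (suc s₂) S)) (sym (*-assoc m S (suc s₂)))))))
        ([m+kn]%n≡m%n j (m * S) (suc s₂)))

  c-id : ∀ {x} → x < k → c x ≡ x
  c-id {x} x<k with j , o , o<d , refl ← position x with o <? r
  ... | yes o<r = trans (c-tok j o<d) (trans (tok-long j o<r) (cong (λ m → m * d + o) (m<n⇒m%n≡m j<S)))
    where
    j<S : j < S
    j<S = *-cancelʳ-< d j S (≤-<-trans (m≤m+n (j * d) o) (<-trans x<k (subst (k <_) (+-comm (suc s₂ * d) d) (+-monoʳ-< (suc s₂ * d) r<d))))
  ... | no o≮r = trans (c-tok j o<d) (trans (tok-short j r≤o) (cong (λ m → m * d + o) (m<n⇒m%n≡m j<S)))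
    where
    r≤o = ≮⇒≥ o≮r
    j<S : j < suc s₂
    j<S = *-cancelʳ-< d j (suc s₂) (+-cancelʳ-< r (j * d) (suc s₂ * d) (≤-<-trans (+-monoʳ-≤ (j * d) r≤o) x<k))

  c<k : ∀ x → c x < k
  c<k x with x % d <? r
  ... | yes o<r = +-mono-≤-< (*-monoˡ-≤ d (≤-pred (m%n<n (x / d) S))) o<r
  ... | no _ = <-≤-trans (+-monoʳ-< (x / d % suc s₂ * d) (m%n<n x d))
      (≤-trans (≤-trans (≤-reflexive (+-comm (x / d % suc s₂ * d) d)) (*-monoˡ-≤ d (m%n<n (x / d) (suc s₂)))) (m≤m+n (suc s₂ * d) r))

  -- Sliding a window by one block drops the block on the left and gains the one on the right. The
  -- first r tokens dropped return s blocks later, at the end of the gained stretch, the e others s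
  -- - 1 blocks later, at its beginning. As k = (s - 1) d + r, the gain is a rotation of the loss.
  block-↭ : ∀ j → tokens (j * d) d ↭ tokens (j * d + k) d
  block-↭ j = begin
    tokens (j * d) d ≡⟨ map-range-++ c (j * d) r e ⟩
    tokens (j * d) r ++ tokens (j * d + r) e ≡⟨ cong₂ _++_ (map-range-cong _ _ r long) (map-range-cong _ _ e short) ⟩
    tokens (j * d + k + e) r ++ tokens (j * d + k) e ↭⟨ Permₚ.++-comm (tokens (j * d + k + e) r) _ ⟩
    tokens (j * d + k) e ++ tokens (j * d + k + e) r ≡⟨ map-range-++ c (j * d + k) e r ⟨
    tokens (j * d + k) (e + r) ≡⟨ cong (λ m → tokens (j * d + k) m) (+-comm e r) ⟩
    tokens (j * d + k) d ∎
    where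
    open Perm.PermutationReasoning
    long : ∀ i → i < r → c (j * d + i) ≡ c (j * d + k + e + i)
    long i i<r = trans (sym (c-shift-long j i<r)) (cong c (eq s₂ r e j i))
      where
      eq : ∀ s₂ r e j i → (suc (suc s₂) + j) * (r + e) + i ≡ j * (r + e) + (suc s₂ * (r + e) + r) + e + i
      eq = solve-∀
    short : ∀ i → i < e → c (j * d + r + i) ≡ c (j * d + k + i)
    short i i<e = trans (cong c (+-assoc (j * d) r i)) (trans (sym (c-shift-short j (m≤m+n r i) (+-monoʳ-< r i<e))) (cong c (eq s₂ r e j i)))
      where
      eq : ∀ s₂ r e j i → (suc s₂ + j) * (r + e) + (r + i) ≡ j * (r + e) + (suc s₂ * (r + e) + r) + i
      eq = solve-∀

  window-↭ : ∀ j → tokens (j * d) k ↭ range 0 k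
  window-↭ zero = ↭-reflexive (trans (map-range-cong {f = c} {g = id} 0 0 k (λ i i<k → c-id i<k)) (map-id-local (range 0 k)))
    where
    map-id-local : ∀ (xs : List ℕ) → map id xs ≡ xs
    map-id-local [] = refl
    map-id-local (x ∷ xs) = cong (x ∷_) (map-id-local xs)
  window-↭ (suc j) = ↭-trans (begin
    tokens (suc j * d) k ≡⟨ cong₂ (λ a b → tokens a b) (+-comm d (j * d)) (trans k≡d+ℓ (+-comm d ℓ)) ⟩
    tokens (j * d + d) (ℓ + d) ≡⟨ map-range-++ c (j * d + d) ℓ d ⟩
    tokens (j * d + d) ℓ ++ tokens (j * d + d + ℓ) d ≡⟨ cong (λ a → tokens (j * d + d) ℓ ++ tokens a d) (trans (+-assoc (j * d) d ℓ) (cong (j * d +_) (sym k≡d+ℓ))) ⟩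
    tokens (j * d + d) ℓ ++ tokens (j * d + k) d ↭⟨ Permₚ.++⁺ˡ (tokens (j * d + d) ℓ) (↭-sym (block-↭ j)) ⟩
    tokens (j * d + d) ℓ ++ tokens (j * d) d ↭⟨ Permₚ.++-comm (tokens (j * d + d) ℓ) _ ⟩
    tokens (j * d) d ++ tokens (j * d + d) ℓ ≡⟨ map-range-++ c (j * d) d ℓ ⟨
    tokens (j * d) (d + ℓ) ≡⟨ cong (λ a → tokens (j * d) a) k≡d+ℓ ⟨
    tokens (j * d) k ∎) (window-↭ j)
    where open Perm.PermutationReasoning

  c-injective : ∀ j {x y} → j * d ≤ x → x < j * d + k → j * d ≤ y → y < j * d + k → c x ≡ c y → x ≡ y
  c-injective j {x} {y} x≥ x< y≥ y< = unique-map-injective c (unique-resp-↭ (↭-sym (window-↭ j)) (unique-range 0 k)) (in-window x≥ x<) (in-window y≥ y<)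
    where
    in-window : ∀ {z} → j * d ≤ z → z < j * d + k → z ∈ range (j * d) k
    in-window z≥ z< with i , refl ← m≤n⇒∃[o]m+o≡n z≥ = ∈-range⁺ (j * d) (+-cancelˡ-< (j * d) i k z<)

  -- Follow the assignment α up to and including block j₀ and the assignment α′ afterwards.
  switch : (ℕ → A) → (ℕ → A) → ℕ → ℕ → A
  switch α α′ j₀ x = if? (x <? suc j₀ * d) (α (c x)) (α′ (c x))

  switch-before : ∀ (α α′ : ℕ → A) j₀ {x} → x < suc j₀ * d → switch α α′ j₀ x ≡ α (c x)
  switch-before α α′ j₀ {x} lt with x <? suc j₀ * d
  ... | yes _ = refl
  ... | no ¬p = ⊥-elim (¬p lt)

  switch-after : ∀ (α α′ : ℕ → A) j₀ {x} → suc j₀ * d ≤ x → switch α α′ j₀ x ≡ α′ (c x)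
  switch-after α α′ j₀ {x} le with x <? suc j₀ * d
  ... | yes p = ⊥-elim (<⇒≱ p le)
  ... | no _ = refl

  module _ (α α′ : ℕ → A) (j₀ : ℕ) (differ : ∀ {x} → x < k → α x ≡ α′ x ⊎ ∃[ i ] i < d × x ≡ c (j₀ * d + i)) where

    -- Suppose a position of the window behind block `j₀` had a token on which `α` and `α′` differ.
    -- That token also occurs in block `j₀`, at another position of the same window, against
    -- `c-injective`. So the switch becomes visible only when block `j₀` has left the window.
    switch-early : ∀ j {i} → j ≤ j₀ → i < k → switch α α′ j₀ (j * d + i) ≡ α (c (j * d + i))
    switch-early j {i} j≤j₀ i<k with j * d + i <? suc j₀ * d
    ... | yes _ = refl
    ... | no ¬p with differ (c<k (j * d + i))
    ... | inj₁ eq = sym eq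
    ... | inj₂ (i′ , i′<d , eq) = ⊥-elim (<-irrefl (sym same) y<x)
      where
      y<x : j₀ * d + i′ < j * d + i
      y<x = <-≤-trans (subst (j₀ * d + i′ <_) (+-comm (j₀ * d) d) (+-monoʳ-< (j₀ * d) i′<d)) (≮⇒≥ ¬p)
      same : j * d + i ≡ j₀ * d + i′
      same = c-injective j (m≤m+n (j * d) i) (+-monoʳ-< (j * d) i<k)
          (≤-trans (*-monoˡ-≤ d j≤j₀) (m≤m+n (j₀ * d) i′)) (<-trans y<x (+-monoʳ-< (j * d) i<k)) eq

    switch-chain : ∀ {G : List A → Set} → (∀ {xs ys} → xs ↭ ys → G xs → G ys) →
        G (map α (range 0 k)) → G (map α′ (range 0 k)) → ∀ N → Chain G (map (switch α α′ j₀) (range 0 N))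
    switch-chain {G = G} resp g g′ N = chain-range {G = G} _ 0 N window
      where
      window : ∀ j → j * d + k ≤ N → G (map (switch α α′ j₀) (range (j * d) k))
      window j le with j ≤? j₀
      ... | yes j≤j₀ = subst G (sym (trans (map-range-cong (j * d) (j * d) k (λ i i<k → switch-early j j≤j₀ i<k)) (map-∘ (range (j * d) k))))
          (resp (↭-sym (Permₚ.map⁺ α (window-↭ j))) g)
      ... | no j≰j₀ = subst G (sym (trans (map-range-cong (j * d) (j * d) k (λ i i<k → switch-after α α′ j₀ (≤-trans (*-monoˡ-≤ d (≰⇒> j≰j₀)) (m≤m+n (j * d) i)))) (map-∘ (range (j * d) k))))
          (resp (↭-sym (Permₚ.map⁺ α′ (window-↭ j))) g′)

-- Token counts and the words of absorbers and tiles

shift₂ : ∀ (us vs : List A) {w ws} → us ++ vs ++ w ∷ ws ↭ w ∷ us ++ vs ++ ws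
shift₂ us vs {w} {ws} = ↭-trans (Permₚ.++⁺ˡ us (shift w vs ws)) (shift w us (vs ++ ws))

∑-range-shift : ∀ (g : ℕ → ℕ) a b m → (∀ i → g (a + i) ≡ g (b + i)) → ∑ (range a m) g ≡ ∑ (range b m) g
∑-range-shift g a b zero eq = refl
∑-range-shift g a b (suc m) eq = cong₂ _+_ (subst₂ (λ x y → g x ≡ g y) (+-identityʳ a) (+-identityʳ b) (eq 0))
  (∑-range-shift g (suc a) (suc b) m (λ i → subst₂ (λ x y → g x ≡ g y) (+-suc a i) (+-suc b i) (eq (suc i))))

∑-periodic : ∀ (g : ℕ → ℕ) P a → (∀ x → g (P + x) ≡ g x) → ∀ N → ∑ (range a (N * P)) g ≡ N * ∑ (range a P) g
∑-periodic g P a per zero = refl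
∑-periodic g P a per (suc N) = begin
  ∑ (range a (P + N * P)) g ≡⟨ cong (λ xs → ∑ xs g) (range-++ a P (N * P)) ⟩
  ∑ (range a P ++ range (a + P) (N * P)) g ≡⟨ ∑-++ (range a P) _ g ⟩
  ∑ (range a P) g + ∑ (range (a + P) (N * P)) g ≡⟨ cong (∑ (range a P) g +_) (∑-range-shift g (a + P) a (N * P) shift-period) ⟩
  ∑ (range a P) g + ∑ (range a (N * P)) g ≡⟨ cong (∑ (range a P) g +_) (∑-periodic g P a per N) ⟩
  ∑ (range a P) g + N * ∑ (range a P) g ∎
  where
  open ≡-Reasoning
  shift-period : ∀ i → g (a + P + i) ≡ g (a + i)
  shift-period i = trans (cong g (eq a P i)) (per (a + i))
    where
    eq : ∀ a P i → a + P + i ≡ P + (a + i)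
    eq = solve-∀

∑-range-point : ∀ y m → y < m → ∑ (range 0 m) (λ x → if? (x ≟ y) 1 0) ≡ 1
∑-range-point y m y<m = go 0 m y<m z≤n
  where
  none : ∀ a m → y < a → ∑ (range a m) (λ x → if? (x ≟ y) 1 0) ≡ 0
  none a zero lt = refl
  none a (suc m) lt with a ≟ y
  ... | yes refl = ⊥-elim (<-irrefl refl lt)
  ... | no _ = none (suc a) m (m<n⇒m<1+n lt)
  go : ∀ a m → y < a + m → a ≤ y → ∑ (range a m) (λ x → if? (x ≟ y) 1 0) ≡ 1
  go a zero lt le = ⊥-elim (<⇒≱ lt (subst (_≤ y) (sym (+-identityʳ a)) le))
  go a (suc m) lt le with a ≟ y
  ... | yes refl = cong suc (none (suc a) m ≤-refl)
  ... | no a≢y = go (suc a) m (subst (y <_) (+-suc a m) lt) (≤∧≢⇒< le a≢y)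

++-cancelˡ-↭ : ∀ (xs : List A) {ys zs} → xs ++ ys ↭ xs ++ zs → ys ↭ zs
++-cancelˡ-↭ [] p = p
++-cancelˡ-↭ (x ∷ xs) p = ++-cancelˡ-↭ xs (drop-∷ p)

transposition : ℕ → ℕ → ℕ → ℕ
transposition a b x = if? (x ≟ a) b (if? (x ≟ b) a x)

transposition-fix : ∀ {a b x} → x ≢ a → x ≢ b → transposition a b x ≡ x
transposition-fix {a} {b} {x} x≢a x≢b with x ≟ a
... | yes p = ⊥-elim (x≢a p)
... | no _ with x ≟ b
... | yes p = ⊥-elim (x≢b p)
... | no _ = refl

-- The copies of `a` and `b` exchanged by the transposition are added on both sides, so that no
-- multiset has to be subtracted.
transposition-↭ : ∀ a b → a ≢ b → ∀ xs →
  let p = ∑ xs (λ x → if? (x ≟ a) 1 0); q = ∑ xs (λ x → if? (x ≟ b) 1 0) in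
  replicate p a ++ replicate q b ++ map (transposition a b) xs ↭ replicate q a ++ replicate p b ++ xs
transposition-↭ a b a≢b [] = ↭-refl
transposition-↭ a b a≢b (x ∷ xs) with ih ← transposition-↭ a b a≢b xs with x ≟ a | x ≟ b
... | yes refl | yes p = ⊥-elim (a≢b p)
... | yes refl | no _ = begin
  x ∷ replicate p x ++ replicate q b ++ b ∷ map τ xs ↭⟨ prep x (shift₂ (replicate p x) (replicate q b)) ⟩
  x ∷ b ∷ replicate p x ++ replicate q b ++ map τ xs ↭⟨ prep x (prep b ih) ⟩
  x ∷ b ∷ replicate q x ++ replicate p b ++ xs ↭⟨ swap x b ↭-refl ⟩
  b ∷ x ∷ replicate q x ++ replicate p b ++ xs ↭⟨ prep b (shift₂ (replicate q x) (replicate p b)) ⟨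
  b ∷ replicate q x ++ replicate p b ++ x ∷ xs ↭⟨ shift b (replicate q x) (replicate p b ++ x ∷ xs) ⟨
  replicate q x ++ b ∷ replicate p b ++ x ∷ xs ∎
  where
  open Perm.PermutationReasoning
  τ = transposition x b
  p = ∑ xs (λ y → if? (y ≟ x) 1 0)
  q = ∑ xs (λ y → if? (y ≟ b) 1 0)
... | no _ | yes refl = begin
  replicate p a ++ x ∷ replicate q x ++ a ∷ map τ xs ↭⟨ shift x (replicate p a) _ ⟩
  x ∷ replicate p a ++ replicate q x ++ a ∷ map τ xs ↭⟨ prep x (shift₂ (replicate p a) (replicate q x)) ⟩
  x ∷ a ∷ replicate p a ++ replicate q x ++ map τ xs ↭⟨ prep x (prep a ih) ⟩
  x ∷ a ∷ replicate q a ++ replicate p x ++ xs ↭⟨ swap x a ↭-refl ⟩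
  a ∷ x ∷ replicate q a ++ replicate p x ++ xs ↭⟨ prep a (shift₂ (replicate q a) (replicate p x)) ⟨
  a ∷ replicate q a ++ replicate p x ++ x ∷ xs ∎
  where
  open Perm.PermutationReasoning
  τ = transposition a x
  p = ∑ xs (λ y → if? (y ≟ a) 1 0)
  q = ∑ xs (λ y → if? (y ≟ x) 1 0)
... | no _ | no _ = begin
  replicate p a ++ replicate q b ++ x ∷ map τ xs ↭⟨ shift₂ (replicate p a) (replicate q b) ⟩
  x ∷ replicate p a ++ replicate q b ++ map τ xs ↭⟨ prep x ih ⟩
  x ∷ replicate q a ++ replicate p b ++ xs ↭⟨ shift₂ (replicate q a) (replicate p b) ⟨
  replicate q a ++ replicate p b ++ x ∷ xs ∎
  where
  open Perm.PermutationReasoning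
  τ = transposition a b
  p = ∑ xs (λ y → if? (y ≟ a) 1 0)
  q = ∑ xs (λ y → if? (y ≟ b) 1 0)

-- This is the exchange an absorber performs: after the transposition one more letter `a` is
-- consumed and one letter `b` is left over.
transposition-surplus : ∀ a b → a ≢ b → ∀ xs → ∑ xs (λ x → if? (x ≟ b) 1 0) ≡ suc (∑ xs (λ x → if? (x ≟ a) 1 0)) →
    b ∷ map (transposition a b) xs ↭ a ∷ xs
transposition-surplus a b a≢b xs eq = ++-cancelˡ-↭ (replicate p a ++ replicate p b) (begin
  (replicate p a ++ replicate p b) ++ b ∷ map τ xs ≡⟨ ++-assoc (replicate p a) _ _ ⟩
  replicate p a ++ replicate p b ++ b ∷ map τ xs ↭⟨ Permₚ.++⁺ˡ (replicate p a) (shift b (replicate p b) _) ⟩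
  replicate p a ++ replicate (suc p) b ++ map τ xs ↭⟨ subst (λ q → replicate p a ++ replicate q b ++ map τ xs ↭ replicate q a ++ replicate p b ++ xs) eq (transposition-↭ a b a≢b xs) ⟩
  a ∷ replicate p a ++ replicate p b ++ xs ≡⟨ cong (a ∷_) (++-assoc (replicate p a) _ _) ⟨
  a ∷ (replicate p a ++ replicate p b) ++ xs ↭⟨ shift a (replicate p a ++ replicate p b) xs ⟨
  (replicate p a ++ replicate p b) ++ a ∷ xs ∎)
  where
  open Perm.PermutationReasoning
  τ = transposition a b
  p = ∑ xs (λ x → if? (x ≟ a) 1 0)

module Gadgets (σ : Shape) where
  open Words σ
  open Tokens σ

  Q₁ D : ℕ
  Q₁ = suc s₂ + s₂ * S
  D = Q * d

  Rainbow : List ℕ → Set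
  Rainbow xs = xs ↭ range 0 k

  rainbow-resp : ∀ {xs ys} → xs ↭ ys → Rainbow xs → Rainbow ys
  rainbow-resp p q = ↭-trans (↭-sym p) q

  token-chain : ∀ j N → Chain Rainbow (tokens (j * d) N)
  token-chain j N = chain-range {G = Rainbow} c (j * d) N
    (λ j′ _ → subst (λ x → tokens x k ↭ range 0 k) (*-distribʳ-+ d j j′) (window-↭ (j + j′)))

  c-range-period : ∀ m x N → tokens (m * Q * d + x) N ≡ tokens x N
  c-range-period m x N = map-range-cong (m * Q * d + x) x N (λ i _ → trans (cong c (+-assoc (m * Q * d) x i)) (c-period m (x + i)))

  c-short≢0 : ∀ j {o} → r ≤ o → o < d → c (j * d + o) ≢ 0
  c-short≢0 j {o} r≤o o<d eq = <⇒≢ (<-≤-trans (s≤s z≤n) (≤-trans r≤o (m≤n+m o (j % suc s₂ * d)))) (sym (trans (sym (trans (c-tok j o<d) (tok-short j r≤o))) eq))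

  c-long≢r : ∀ j {o} → o < r → c (j * d + o) ≢ r
  c-long≢r j {o} o<r eq = <⇒≢ o<r (trans (sym (mod-block (j % S) (<-trans o<r r<d))) (trans (cong (_% d) (trans (sym (trans (c-tok j (<-trans o<r r<d)) (tok-long j o<r))) eq)) (m<n⇒m%n≡m r<d)))

  is-0 is-r : ℕ → ℕ
  is-0 x = if? (x ≟ 0) 1 0
  is-r x = if? (x ≟ r) 1 0

  if?-no : ∀ {P : Set} (P? : Dec P) {x y : A} → ¬ P → if? P? x y ≡ y
  if?-no (yes p) ¬p = ⊥-elim (¬p p)
  if?-no (no _) ¬p = refl

  is-0-periodic : ∀ x → is-0 (c (t + x)) ≡ is-0 (c x)
  is-0-periodic x with j , o , o<d , refl ← position x with o <? r
  ... | yes o<r = cong is-0 (trans (cong c (add-blocks S j o)) (c-shift-long j o<r))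
  ... | no o≮r = trans (cong (is-0 ∘ c) (add-blocks S j o)) (trans (if?-no (_ ≟ 0) (c-short≢0 (S + j) (≮⇒≥ o≮r) o<d)) (sym (if?-no (_ ≟ 0) (c-short≢0 j (≮⇒≥ o≮r) o<d))))

  is-r-periodic : ∀ x → is-r (c (suc s₂ * d + x)) ≡ is-r (c x)
  is-r-periodic x with j , o , o<d , refl ← position x with o <? r
  ... | yes o<r = trans (cong (is-r ∘ c) (add-blocks (suc s₂) j o)) (trans (if?-no (_ ≟ r) (c-long≢r (suc s₂ + j) o<r)) (sym (if?-no (_ ≟ r) (c-long≢r j o<r))))
  ... | no o≮r = cong is-r (trans (cong c (add-blocks (suc s₂) j o)) (c-shift-short j (≮⇒≥ o≮r) o<d))

  d≤suc-s₂*d : d ≤ suc s₂ * d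
  d≤suc-s₂*d = m≤m+n d (s₂ * d)

  r<k : r < k
  r<k = <-≤-trans r<d (≤-trans d≤suc-s₂*d (m≤m+n (suc s₂ * d) r))

  is-0-sum : ∑ (range 0 t) (is-0 ∘ c) ≡ 1
  is-0-sum = trans (∑-cong-∈ (range 0 t) pointwise) (∑-range-point 0 t (s≤s z≤n))
    where
    pointwise : ∀ {x} → x ∈ range 0 t → is-0 (c x) ≡ if? (x ≟ 0) 1 0
    pointwise {x} x∈ with i , i<t , refl ← ∈-range⁻ 0 t x∈ with j , o , o<d , refl ← position x with o <? r
    ... | no o≮r = trans (if?-no (_ ≟ 0) (c-short≢0 j (≮⇒≥ o≮r) o<d)) (sym (if?-no (j * d + o ≟ 0) (λ eq → o≮r (subst (_< r) (sym (m+n≡0⇒n≡0 (j * d) eq)) (s≤s z≤n)))))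
    ... | yes o<r = cong is-0 (c-id (+-mono-≤-< (*-monoˡ-≤ d (≤-pred (*-cancelʳ-< d j S (≤-<-trans (m≤m+n (j * d) o) i<t)))) o<r))

  is-r-sum : ∑ (range 0 (suc s₂ * d)) (is-r ∘ c) ≡ 1
  is-r-sum = trans (∑-cong-∈ (range 0 (suc s₂ * d)) pointwise) (∑-range-point r (suc s₂ * d) (<-≤-trans r<d d≤suc-s₂*d))
    where
    pointwise : ∀ {x} → x ∈ range 0 (suc s₂ * d) → is-r (c x) ≡ if? (x ≟ r) 1 0
    pointwise x∈ with i , i< , refl ← ∈-range⁻ 0 (suc s₂ * d) x∈ = cong is-r (c-id (<-≤-trans i< (m≤m+n (suc s₂ * d) r)))

  surplus : ∑ (tokens 0 D) is-r ≡ suc (∑ (tokens 0 D) is-0)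
  surplus = begin
    ∑ (tokens 0 D) is-r ≡⟨ ∑-map c (range 0 D) is-r ⟩
    ∑ (range 0 D) (is-r ∘ c) ≡⟨ cong (λ N → ∑ (range 0 N) (is-r ∘ c)) (eq₁ s₂ d) ⟩
    ∑ (range 0 (S * (suc s₂ * d))) (is-r ∘ c) ≡⟨ ∑-periodic (is-r ∘ c) (suc s₂ * d) 0 is-r-periodic S ⟩
    S * ∑ (range 0 (suc s₂ * d)) (is-r ∘ c) ≡⟨ cong (S *_) is-r-sum ⟩
    S * 1 ≡⟨ cong suc (cong (suc s₂ *_) is-0-sum) ⟨
    suc (suc s₂ * ∑ (range 0 t) (is-0 ∘ c)) ≡⟨ cong suc (∑-periodic (is-0 ∘ c) t 0 is-0-periodic (suc s₂)) ⟨
    suc (∑ (range 0 (suc s₂ * t)) (is-0 ∘ c)) ≡⟨ cong (λ N → suc (∑ (range 0 N) (is-0 ∘ c))) (*-assoc (suc s₂) S d) ⟨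
    suc (∑ (range 0 D) (is-0 ∘ c)) ≡⟨ cong suc (∑-map c (range 0 D) is-0) ⟨
    suc (∑ (tokens 0 D) is-0) ∎
    where
    open ≡-Reasoning
    eq₁ : ∀ s d → suc s * suc (suc s) * d ≡ suc (suc s) * (suc s * d)
    eq₁ = solve-∀

  τ : ℕ → ℕ
  τ = transposition 0 r

  -- A word of 3 D + ℓ tokens, cut just behind blocks Q and 2 Q. These blocks read 0, ..., d - 1 and
  -- thus contain both 0 and r, which is what a switch to `τ` and back requires; exactly Q blocks
  -- lie between the cuts.
  before middle after : List ℕ
  before = tokens 0 (D + d)
  middle = tokens d (Q₁ * d) ++ tokens 0 d
  after = tokens d (Q₁ * d + ℓ)

  middle-↭ : middle ↭ tokens 0 D
  middle-↭ = ↭-trans (Permₚ.++-comm (tokens d (Q₁ * d)) _)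
    (↭-reflexive (sym (map-range-++ c 0 d (Q₁ * d))))

  middle-surplus : r ∷ map τ middle ↭ 0 ∷ middle
  middle-surplus = transposition-surplus 0 r (λ ()) middle
    (trans (∑-↭ is-r middle-↭) (trans surplus (cong suc (sym (∑-↭ is-0 middle-↭)))))

  exchange-before : Chain Rainbow (before ++ middle ++ after)
  exchange-before = subst (Chain Rainbow) word (token-chain 0 (D + d + (Q₁ * d + (d + (Q₁ * d + ℓ)))))
    where
    D+ : ∀ x N → tokens (D + x) N ≡ tokens x N
    D+ x N = trans (cong (λ m → tokens (m * d + x) N) (sym (*-identityˡ Q))) (c-range-period 1 x N)
    2D+ : ∀ x N → tokens (D + d + Q₁ * d + x) N ≡ tokens x N
    2D+ x N = trans (cong (λ m → tokens m N) (trans (cong (_+ x) (+-assoc D d (Q₁ * d))) (+-assoc D D x))) (trans (D+ (D + x) N) (D+ x N))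
    word : tokens 0 (D + d + (Q₁ * d + (d + (Q₁ * d + ℓ)))) ≡ before ++ middle ++ after
    word = trans (map-range-++ c 0 (D + d) _) (cong (before ++_) (trans (map-range-++ c (D + d) (Q₁ * d) _) (trans
      (cong₂ _++_ (D+ d (Q₁ * d)) (trans (map-range-++ c (D + d + Q₁ * d) d _) (cong₂ _++_
        (trans (cong (λ m → tokens m d) (sym (+-identityʳ (D + d + Q₁ * d)))) (2D+ 0 d)) (2D+ d _))))
      (sym (++-assoc (tokens d (Q₁ * d)) (tokens 0 d) after)))))

  τ-fix : ∀ {x} → r < x → τ x ≡ x
  τ-fix r<x = transposition-fix (λ eq → <⇒≱ r<x (≤-trans (≤-reflexive eq) z≤n)) (λ eq → <⇒≢ r<x (sym eq))

  τ-differ : ∀ j → j ≡ 0 ⊎ j ≡ Q → ∀ {x} → x < k → x ≡ τ x ⊎ ∃[ i ] i < d × x ≡ c (j * d + i)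
  τ-differ j j≡ {x} x<k with x <? d
  ... | yes x<d = inj₂ (x , x<d , sym (at j≡))
    where
    at : j ≡ 0 ⊎ j ≡ Q → c (j * d + x) ≡ x
    at (inj₁ refl) = c-id x<k
    at (inj₂ refl) = trans (trans (cong (λ m → c (m * d + x)) (sym (*-identityˡ Q))) (c-period 1 x)) (c-id x<k)
  ... | no x≮d = inj₁ (sym (τ-fix (<-≤-trans r<d (≮⇒≥ x≮d))))

  rainbow-τ : Rainbow (letters τ)
  rainbow-τ = drop-∷ (drop-∷ (subst₂ (λ p q → replicate p 0 ++ replicate q r ++ letters τ ↭ replicate q 0 ++ replicate p r ++ range 0 k)
    (∑-range-point 0 k (s≤s z≤n)) (∑-range-point r k r<k) (transposition-↭ 0 r (λ ()) (range 0 k))))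

  exchange-after : Chain Rainbow (before ++ map τ middle ++ after)
  exchange-after = subst (Chain Rainbow) word
    (chain-++ {G = Rainbow} (map f (range 0 (D + D))) (letters g) (map g (range k (Q₁ * d))) (Q + Q) |as| ℓ≤ left right)
    where
    f g : ℕ → ℕ
    f = switch id τ Q
    g = switch τ id 0
    id-rainbow : Rainbow (letters id)
    id-rainbow = ↭-reflexive (map-id (range 0 k))
    |as| : length (map f (range 0 (D + D))) ≡ (Q + Q) * d
    |as| = trans (length-map f (range 0 (D + D))) (trans (length-range 0 (D + D)) (sym (*-distribʳ-+ d Q Q)))
    ℓ≤ : ℓ ≤ length (letters g)
    ℓ≤ = subst (ℓ ≤_) (sym (length-map-range g 0 k)) (subst (ℓ ≤_) (sym k≡d+ℓ) (m≤n+m ℓ d))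
    suc-Q≤ : ∀ {i} → suc Q * d ≤ D + D + i
    suc-Q≤ {i} = ≤-trans (≤-reflexive (+-comm d D)) (≤-trans (+-monoʳ-≤ D (m≤m+n d (Q₁ * d))) (m≤m+n (D + D) i))
    c-2D+ : ∀ i → c (D + D + i) ≡ c i
    c-2D+ i = trans (cong c (trans (cong (_+ i) (sym (*-distribʳ-+ d Q Q))) (cong (λ m → m * d + i) (sym (cong (Q +_) (*-identityˡ Q)))))) (c-period 2 i)
    -- The overlap of the two switches. Behind its first block one word still applies `τ` while the
    -- other has returned to `id`; they agree because the tokens d, ..., k - 1 exceed r and are
    -- fixed by `τ`.
    agree : ∀ i → i < k → f (D + D + i) ≡ g (0 + i)
    agree i i<k with i <? d
    ... | yes i<d = trans (switch-after id τ Q (suc-Q≤ {i})) (trans (cong τ (c-2D+ i)) (sym (switch-before τ id 0 (subst (i <_) (sym (+-identityʳ d)) i<d))))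
    ... | no i≮d = trans (switch-after id τ Q (suc-Q≤ {i})) (trans (cong τ (trans (c-2D+ i) (c-id i<k))) (trans (τ-fix (<-≤-trans r<d (≮⇒≥ i≮d)))
        (sym (trans (switch-after τ id 0 (subst (_≤ i) (sym (+-identityʳ d)) (≮⇒≥ i≮d))) (c-id i<k)))))
    left : Chain Rainbow (map f (range 0 (D + D)) ++ letters g)
    left = subst (Chain Rainbow) (trans (map-range-++ f 0 (D + D) k) (cong (map f (range 0 (D + D)) ++_) (map-range-cong (D + D) 0 k agree)))
      (switch-chain id τ Q (τ-differ Q (inj₂ refl)) {G = Rainbow} rainbow-resp id-rainbow rainbow-τ (D + D + k))
    right : Chain Rainbow (letters g ++ map g (range k (Q₁ * d)))
    right = subst (Chain Rainbow) (map-range-++ g 0 k (Q₁ * d)) (switch-chain τ id 0 (λ x<k → flip-differ (τ-differ 0 (inj₁ refl) x<k)) {G = Rainbow} rainbow-resp rainbow-τ id-rainbow (k + Q₁ * d))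
      where
      flip-differ : ∀ {x} {Z : Set} → x ≡ τ x ⊎ Z → τ x ≡ x ⊎ Z
      flip-differ (inj₁ eq) = inj₁ (sym eq)
      flip-differ (inj₂ z) = inj₂ z
    first : map f (range 0 (D + D)) ≡ before ++ map τ (tokens d (Q₁ * d))
    first = trans (cong (λ N → map f (range 0 N)) (sym (+-assoc D d (Q₁ * d)))) (trans (map-range-++ f 0 (D + d) (Q₁ * d)) (cong₂ _++_
      (map-range-cong 0 0 (D + d) (λ i i< → switch-before id τ Q (subst (i <_) (+-comm D d) i<)))
      (trans (map-range-cong (D + d) d (Q₁ * d) (λ i _ → trans (switch-after id τ Q (≤-trans (≤-reflexive (+-comm d D)) (m≤m+n (D + d) i)))
        (cong τ (trans (cong c (trans (+-assoc D d i) (cong (λ m → m * d + (d + i)) (sym (*-identityˡ Q))))) (c-period 1 (d + i))))))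
        (map-∘ (range d (Q₁ * d))))))
    second : letters g ++ map g (range k (Q₁ * d)) ≡ map τ (tokens 0 d) ++ after
    second = trans (sym (map-range-++ g 0 k (Q₁ * d))) (trans (cong (λ N → map g (range 0 N)) total) (trans (map-range-++ g 0 d (Q₁ * d + ℓ)) (cong₂ _++_
      (trans (map-range-cong 0 0 d (λ i i<d → switch-before τ id 0 (subst (i <_) (sym (+-identityʳ d)) i<d))) (map-∘ (range 0 d)))
      (map-range-cong d d (Q₁ * d + ℓ) (λ i _ → switch-after τ id 0 (≤-trans (≤-reflexive (+-identityʳ d)) (m≤m+n d i)))))))
      where
      total : k + Q₁ * d ≡ d + (Q₁ * d + ℓ)
      total = trans (cong (_+ Q₁ * d) k≡d+ℓ) (trans (+-assoc d ℓ (Q₁ * d)) (cong (d +_) (+-comm ℓ (Q₁ * d))))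
    word : map f (range 0 (D + D)) ++ letters g ++ map g (range k (Q₁ * d)) ≡ before ++ map τ middle ++ after
    word = trans (cong₂ _++_ first second) (trans (++-assoc before _ _) (cong (before ++_)
      (trans (sym (++-assoc (map τ (tokens d (Q₁ * d))) _ after)) (cong (_++ after) (sym (map-++ τ (tokens d (Q₁ * d)) _))))))

  loop-before : Chain Rainbow (tokens 0 D ++ tokens 0 ℓ)
  loop-before = subst (Chain Rainbow) (trans (map-range-++ c 0 D ℓ) (cong (tokens 0 D ++_) shift-D)) (token-chain 0 (D + ℓ))
    where
    shift-D : tokens D ℓ ≡ tokens 0 ℓ
    shift-D = trans (cong (λ m → tokens m ℓ) (trans (cong (_* d) (sym (*-identityˡ Q))) (sym (+-identityʳ _)))) (c-range-period 1 0 ℓ)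

  -- Compared with `loop-before` a second period is inserted: `D` positions with tokens c 0, ..., c
  -- (D - 1), to be filled by the vertices that the `D` gadgets release.
  loop-after : Chain Rainbow (tokens 0 D ++ tokens 0 D ++ tokens 0 ℓ)
  loop-after = subst (Chain Rainbow) (trans (map-range-++ c 0 D (D + ℓ)) (cong (tokens 0 D ++_)
      (trans (shift-D (D + ℓ)) (trans (map-range-++ c 0 D ℓ) (cong (tokens 0 D ++_) (shift-D ℓ))))))
    (token-chain 0 (D + (D + ℓ)))
    where
    shift-D : ∀ N → tokens D N ≡ tokens 0 N
    shift-D N = trans (cong (λ m → tokens m N) (trans (cong (_* d) (sym (*-identityˡ Q))) (sym (+-identityʳ _)))) (c-range-period 1 0 N)

  -- Starting at block 1 keeps token 0 out of the r surplus positions at the end, so that it occurs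
  -- exactly `B` times. The surplus makes the length congruent to ℓ modulo d, as for every path that
  -- begins and ends with ℓ vertices to be glued.
  tile-word : ℕ → List ℕ
  tile-word B = tokens d (B * t + r)

  tile-chain : ∀ B → Chain Rainbow (tile-word B)
  tile-chain B = subst (λ x → Chain Rainbow (tokens x (B * t + r))) (*-identityˡ d) (token-chain 1 (B * t + r))

  tile-zeros : ∀ B → ∑ (tile-word B) is-0 ≡ B
  tile-zeros B = begin
    ∑ (tile-word B) is-0 ≡⟨ ∑-map c (range d (B * t + r)) is-0 ⟩
    ∑ (range d (B * t + r)) g ≡⟨ cong (λ xs → ∑ xs g) (range-++ d (B * t) r) ⟩
    ∑ (range d (B * t) ++ range (d + B * t) r) g ≡⟨ ∑-++ (range d (B * t)) _ g ⟩
    ∑ (range d (B * t)) g + ∑ (range (d + B * t) r) g ≡⟨ cong₂ _+_ (∑-periodic g t d is-0-periodic B) tail-zero ⟩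
    B * ∑ (range d t) g + 0 ≡⟨ trans (+-identityʳ _) (cong (B *_) once) ⟩
    B * 1 ≡⟨ *-identityʳ B ⟩
    B ∎
    where
    open ≡-Reasoning
    g = is-0 ∘ c
    periods : ∀ B x → g (B * t + x) ≡ g x
    periods zero x = refl
    periods (suc B) x = trans (cong g (+-assoc t (B * t) x)) (trans (is-0-periodic (B * t + x)) (periods B x))
    once : ∑ (range d t) g ≡ 1
    once = +-cancelˡ-≡ (∑ (range 0 d) g) _ _ (begin
      ∑ (range 0 d) g + ∑ (range d t) g ≡⟨ trans (cong (λ xs → ∑ xs g) (range-++ 0 d t)) (∑-++ (range 0 d) _ g) ⟨
      ∑ (range 0 (d + t)) g ≡⟨ cong (λ N → ∑ (range 0 N) g) (+-comm d t) ⟩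
      ∑ (range 0 (t + d)) g ≡⟨ trans (cong (λ xs → ∑ xs g) (range-++ 0 t d)) (∑-++ (range 0 t) _ g) ⟩
      ∑ (range 0 t) g + ∑ (range t d) g ≡⟨ cong₂ _+_ is-0-sum (∑-range-shift g t 0 d is-0-periodic) ⟩
      1 + ∑ (range 0 d) g ≡⟨ +-comm 1 _ ⟩
      ∑ (range 0 d) g + 1 ∎)
    tail-zero : ∑ (range (d + B * t) r) g ≡ 0
    tail-zero = trans (∑-range-shift g (d + B * t) d r (λ i → trans (cong g (regroup d (B * t) i)) (periods B (d + i))))
      (trans (∑-cong-∈ (range d r) vanish) (∑-zero (range d r)))
      where
      regroup : ∀ a b i → a + b + i ≡ b + (a + i)
      regroup = solve-∀
      vanish : ∀ {x} → x ∈ range d r → g x ≡ 0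
      vanish x∈ with i , i<r , refl ← ∈-range⁻ d r x∈ =
        trans (cong is-0 (c-id (<-≤-trans (+-monoʳ-< d i<r) (+-monoˡ-≤ r d≤suc-s₂*d)))) refl

-- Placing words in boxes

∑-tuples-∑ : ∀ (us : List A) N (g : A → ℕ) → ∑ (tuples us (suc N)) (λ y → ∑ y g) ≡ suc N * length us ^ N * ∑ us g
∑-tuples-∑ us N g = begin
  ∑ (tuples us (suc N)) (λ y → ∑ y g) ≡⟨ ∑-tuples us N _ ⟩
  ∑ us (λ a → ∑ (tuples us N) (λ y → g a + ∑ y g)) ≡⟨ ∑-cong us (λ a → trans (∑-+ (tuples us N) _ _) (cong (_+ rest N) (trans (∑-const (tuples us N) (g a)) (cong (_* g a) (length-tuples us N))))) ⟩
  ∑ us (λ a → u ^ N * g a + rest N) ≡⟨ trans (∑-+ us _ _) (cong₂ _+_ (∑-*ˡ us (u ^ N) g) (∑-const us (rest N))) ⟩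
  u ^ N * ∑ us g + u * rest N ≡⟨ cong (u ^ N * ∑ us g +_) (rest-eq N) ⟩
  u ^ N * ∑ us g + N * u ^ N * ∑ us g ≡⟨ eq N (u ^ N) (∑ us g) ⟩
  suc N * u ^ N * ∑ us g ∎
  where
  open ≡-Reasoning
  u = length us
  rest : ℕ → ℕ
  rest N = ∑ (tuples us N) (λ y → ∑ y g)
  rest-eq : ∀ N → u * rest N ≡ N * u ^ N * ∑ us g
  rest-eq zero = *-zeroʳ u
  rest-eq (suc N) = trans (cong (u *_) (∑-tuples-∑ us N g)) (ex u N (u ^ N) (∑ us g))
    where
    ex : ∀ u N p g → u * (suc N * p * g) ≡ suc N * (u * p) * g
    ex = solve-∀
  eq : ∀ N p g → p * g + N * p * g ≡ suc N * p * g
  eq = solve-∀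

unique-++⁻ : ∀ (xs : List A) {ys} → Unique (xs ++ ys) → Unique xs × Unique ys × (∀ {v} → v ∈ xs → v ∉ ys)
unique-++⁻ [] un = [] , un , λ ()
unique-++⁻ (x ∷ xs) (x∉ ∷ un) with un₁ , un₂ , dis ← unique-++⁻ xs un =
  All.tabulate (λ v∈ → All.lookup x∉ (∈-++⁺ˡ v∈)) ∷ un₁ , un₂ ,
  λ { (here refl) v∈ → All.lookup x∉ (∈-++⁺ʳ xs v∈) refl ; (there v∈) v∈′ → dis v∈ v∈′ }

unique-++⁺ : ∀ {xs ys : List A} → Unique xs → Unique ys → (∀ {v} → v ∈ xs → v ∉ ys) → Unique (xs ++ ys)
unique-++⁺ [] un₂ dis = un₂
unique-++⁺ (x∉ ∷ un₁) un₂ dis =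
  All.tabulate (λ {v} v∈ x≡v → split (∈-++⁻ _ v∈) x≡v) ∷ unique-++⁺ un₁ un₂ (dis ∘ there)
  where
  split : ∀ {v} → v ∈ _ ⊎ v ∈ _ → _ ≡ v → ⊥
  split (inj₁ v∈) refl = All.lookup x∉ v∈ refl
  split (inj₂ v∈) refl = dis (here refl) v∈

data Entry {A : Set} : List A → ℕ → A → Set where
  here : ∀ {x xs} → Entry (x ∷ xs) 0 x
  there : ∀ {x xs i v} → Entry xs i v → Entry (x ∷ xs) (suc i) v

entry-exists : ∀ (xs : List A) {i} → i < length xs → ∃[ v ] Entry xs i v
entry-exists (x ∷ xs) {zero} i< = x , here
entry-exists (x ∷ xs) {suc i} (s≤s i<) with v , en ← entry-exists xs i< = v , there en

entry-∈ : ∀ {xs : List A} {i v} → Entry xs i v → v ∈ xs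
entry-∈ here = here refl
entry-∈ (there en) = there (entry-∈ en)

entry-index : ∀ {xs : List A} {i j v} → Unique xs → Entry xs i v → Entry xs j v → i ≡ j
entry-index un here here = refl
entry-index (x∉ ∷ _) here (there en) = ⊥-elim (All.lookup x∉ (entry-∈ en) refl)
entry-index (x∉ ∷ _) (there en) here = ⊥-elim (All.lookup x∉ (entry-∈ en) refl)
entry-index (_ ∷ un) (there en) (there en′) = cong suc (entry-index un en en′)

entry-column : ∀ {z : List (List A)} {c c′ row row′ i i′ v} → Unique (concat z) →
    Entry z c row → Entry row i v → Entry z c′ row′ → Entry row′ i′ v → i ≡ i′
entry-column {z = row ∷ z} un here en here en′ = entry-index (proj₁ (unique-++⁻ row un)) en en′
entry-column {z = row ∷ z} un here en (there cn′) en′ =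
  ⊥-elim (proj₂ (proj₂ (unique-++⁻ row un)) (entry-∈ en) (∈-concat⁺′ (entry-∈ en′) (entry-∈ cn′)))
entry-column {z = row ∷ z} un (there cn) en here en′ =
  ⊥-elim (proj₂ (proj₂ (unique-++⁻ row un)) (entry-∈ en′) (∈-concat⁺′ (entry-∈ en) (entry-∈ cn)))
entry-column {z = row ∷ z} un (there cn) en (there cn′) en′ = entry-column (proj₁ (proj₂ (unique-++⁻ row un))) cn en cn′ en′

Row : List (List A) → ℕ → A → Set
Row z c v = ∃[ row ] Entry z c row × v ∈ row

-- Place the i-th letter of a word in column i of the row it names.
place : ∀ (z : List (List A)) M toks → All (λ row → length row ≡ M) z → length toks ≤ M → All (_< length z) toks → Unique (concat z) →
    ∃[ vs ] Pointwise (Row z) toks vs × Unique vs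
place {A = A} z M toks wid fits scope un = let vs , ps , un-vs , _ = go 0 toks fits scope in vs , ps , un-vs
  where
  Later : ℕ → A → Set
  Later a v = ∃[ i ] a ≤ i × ∃₂ λ c row → Entry z c row × Entry row i v
  go : ∀ a toks → a + length toks ≤ M → All (_< length z) toks →
      ∃[ vs ] Pointwise (Row z) toks vs × Unique vs × All (Later a) vs
  go a [] fits scope = [] , [] , [] , []
  go a (c ∷ toks) fits (c< ∷ scope)
    with row , cn ← entry-exists z c<
    with v , en ← entry-exists row (subst (a <_) (sym (All.lookup wid (entry-∈ cn))) (≤-trans (≤-trans (s≤s (m≤m+n a _)) (≤-reflexive (sym (+-suc a _)))) fits))
    with vs , ps , un-vs , later ← go (suc a) toks (≤-trans (≤-reflexive (sym (+-suc a _))) fits) scope =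
      v ∷ vs , (row , cn , entry-∈ en) ∷ ps ,
      All.map (λ { (i , a<i , c′ , row′ , cn′ , en′) refl → <⇒≢ a<i (entry-column un cn en cn′ en′) }) later ∷ un-vs ,
      (a , ≤-refl , c , row , cn , en) ∷ All.map (λ { (i , a<i , rest) → i , <⇒≤ a<i , rest }) later

rows-pointwise : ∀ (z : List (List A)) {vs} → Pointwise (Row z) (range 0 (length z)) vs → Pointwise _∈_ vs z
rows-pointwise z = go z 0 (λ _ p → p)
  where
  go : ∀ {R : ℕ → _ → Set} z′ a → (∀ {v} i → R (a + i) v → Row z′ i v) → ∀ {vs} → Pointwise R (range a (length z′)) vs → Pointwise _∈_ vs z′
  go [] a sub [] = []
  go {R = R} (row ∷ z′) a sub (p ∷ ps) with sub 0 (subst (λ b → R b _) (sym (+-identityʳ a)) p)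
  ... | _ , here , v∈ = v∈ ∷ go z′ (suc a) (λ {v} i q → later (sub (suc i) (subst (λ b → R b v) (sym (+-suc a i)) q))) ps
    where
    later : ∀ {i v} → Row (row ∷ z′) (suc i) v → Row z′ i v
    later (row′ , there cn , v∈) = row′ , cn , v∈

any-selection : ∀ (z : List (List A)) → All (λ row → 0 < length row) z → ∃[ xs ] Pointwise _∈_ xs z
any-selection [] [] = [] , []
any-selection ((x ∷ _) ∷ z) (_ ∷ ne) with xs , xs∈ ← any-selection z ne = x ∷ xs , here refl ∷ xs∈

selection : ∀ (z : List (List A)) → All (λ row → 0 < length row) z → ∀ {c v} → Row z c v → ∃[ xs ] Pointwise _∈_ xs z × Entry xs c v
selection (row ∷ z) (_ ∷ ne) {v = v} (_ , here , v∈) with xs , xs∈ ← any-selection z ne = v ∷ xs , v∈ ∷ xs∈ , here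
selection ((x ∷ _) ∷ z) (_ ∷ ne) (row′ , there cn , v∈) with xs , xs∈ , en ← selection z ne (row′ , cn , v∈) = x ∷ xs , here refl ∷ xs∈ , there en

pointwise-entry : ∀ {R : ℕ → A → Set} {a m vs c v} → Pointwise R (range a m) vs → Entry vs c v → R (a + c) v
pointwise-entry {R = R} {a} {suc m} (p ∷ ps) here = subst (λ b → R b _) (sym (+-identityʳ a)) p
pointwise-entry {R = R} {a} {suc m} {c = suc c} {v} (p ∷ ps) (there en) = subst (λ b → R b v) (sym (+-suc a c)) (pointwise-entry ps en)

least-threshold : ∀ {P : ℕ → Set} → (∀ y → Dec (P y)) → ∀ m → P m → ∃[ y ] P y × (∀ {x} → y ≡ suc x → ¬ P x)
least-threshold P? zero pm = 0 , pm , λ ()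
least-threshold P? (suc m) pm with P? m
... | yes p = least-threshold P? m p
... | no ¬p = suc m , pm , λ { refl → ¬p }

pointwise-∈ : ∀ {R : A → B → Set} {xs ys y} → Pointwise R xs ys → y ∈ ys → ∃[ x ] x ∈ xs × R x y
pointwise-∈ (r ∷ rs) (here refl) = _ , here refl , r
pointwise-∈ (r ∷ rs) (there y∈) with x , x∈ , r′ ← pointwise-∈ rs y∈ = x , there x∈ , r′

pointwise-∑ : ∀ {f : A → ℕ} {g : B → ℕ} {xs ys} → Pointwise (λ x y → g y ≤ f x) xs ys → ∑ ys g ≤ ∑ xs f
pointwise-∑ [] = z≤n
pointwise-∑ (r ∷ rs) = +-mono-≤ r (pointwise-∑ rs)

≤ᵇ-true : ∀ {m p} → m ≤ p → does (m ≤? p) ≡ true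
≤ᵇ-true {m} {p} = dec-true (m ≤? p)

true-≤ : ∀ {m p} → does (m ≤? p) ≡ true → m ≤ p
true-≤ {m} {p} eq = ≤ᵇ⇒≤ m p (subst Bool.T (sym eq) tt)

does-≤-false : ∀ {m p} → does (m ≤? p) ≡ false → p < m
does-≤-false eq = ≰⇒> λ le → case (trans (sym eq) (≤ᵇ-true le))
  where
  case : false ≡ true → ⊥
  case ()

Invariant : (List A → Bool) → Set
Invariant E = ∀ {xs ys} → xs ↭ ys → E xs ≡ true → E ys ≡ true

-- `N S` is only a part of the link of `S`. It will be cut down to at most n / t vertices, so that a
-- set of the size in the definition of extremality fits outside it.
record Host : Set where
  field
    {n} : ℕ
    a₀ : Fin n
    E : List (Fin n) → Bool
    E-resp : Invariant E
    N : List (Fin n) → Fin n → Bool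
    N⇒E : ∀ S v → N S v ≡ true → E (v ∷ S) ≡ true

-- Tiles from boxes

module Tiles (σ : Shape) (Γ : Host) where
  open Host Γ
  open Words σ
  open Tokens σ
  open Gadgets σ

  EChain : List (Fin n) → Set
  EChain = Chain (λ xs → E xs ≡ true)

  blow-chain : ∀ {P : ℕ → Fin n → Set} → (∀ {vs} → Pointwise P (range 0 k) vs → E vs ≡ true) →
      ∀ {toks vs} → Chain Rainbow toks → Pointwise P toks vs → EChain vs
  blow-chain {P} blow ch ps = chain-pointwise {R = P} {G = Rainbow} {H = λ xs → E xs ≡ true} lift ps ch
    where
    lift : ∀ {xs ys} → Rainbow xs → Pointwise P xs ys → E ys ≡ true
    lift rb ps with _ , ps′ , q ← pointwise-↭ rb ps = E-resp (↭-sym q) (blow ps′)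

  record Tile (U : List (Fin n)) (B : ℕ) : Set where
    field
      vertices : List (Fin n)
      distinct : Unique vertices
      within : All (_∈ U) vertices
      size : length vertices ≡ B * t + r
      chain : EChain vertices

  module _ {U : List (Fin n)} (uniq : Unique U) (B : ℕ) (R : List (Fin n) → Bool) (R⇒E : ∀ xs → R xs ≡ true → E xs ≡ true)
      (cost : ℕ → ℕ) (w : Fin n → ℕ)
      (light : ∀ xs → R xs ≡ true → length xs ≡ k → Pointwise (λ c v → w v ≤ cost c) (range 0 k) xs) where

    -- Every vertex of row c lies on some transversal, and that transversal satisfies `R`. So
    -- `light` bounds the weights in the whole row by `cost c`, and the weight of the tile by the
    -- cost of its word.
    tile-from-box : FreshBox U uniq (B * t + r) k R → Σ[ T ∈ Tile U B ] ∑ (Tile.vertices T) w ≤ ∑ (tile-word B) cost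
    tile-from-box fb =
      let vs , ps , un = place rows M (tile-word B) widths fits scope distinct in
      record
        { vertices = vs
        ; distinct = un
        ; within = All.tabulate (λ v∈ → let _ , _ , row , en , v∈row = pointwise-∈ ps v∈ in All.lookup (All.lookup within (entry-∈ en)) v∈row)
        ; size = trans (sym (Pointwise-length ps)) word-length
        ; chain = blow-chain blow (tile-chain B) ps
        } , pointwise-∑ (Pw.map cheap ps)
      where
      open FreshBox fb
      M = B * t + r
      word-length : length (tile-word B) ≡ M
      word-length = length-map-range c d M
      fits : length (tile-word B) ≤ M
      fits = ≤-reflexive word-length
      scope : All (_< length rows) (tile-word B)
      scope = Allₚ.map⁺ (All.universal (λ x → subst (c x <_) (sym number) (c<k x)) (range d M))
      blow : ∀ {vs} → Pointwise (Row rows) (range 0 k) vs → E vs ≡ true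
      blow ps = R⇒E _ (boxed-sound R rows holds (rows-pointwise rows (subst (λ m → Pointwise (Row rows) (range 0 m) _) (sym number) ps)))
      nonempty : All (λ row → 0 < length row) rows
      nonempty = All.map (λ eq → subst (0 <_) (sym eq) (<-≤-trans (s≤s z≤n) (m≤n+m r (B * t)))) widths
      cheap : ∀ {c v} → Row rows c v → w v ≤ cost c
      cheap row with xs , xs∈ , en ← selection rows nonempty row =
        pointwise-entry (light _ (boxed-sound R rows holds xs∈) (trans (Pointwise-length xs∈) number)) en

-- Light tiles for arbitrary weights

count-split : ∀ (xs : List A) (p q : A → Bool) → ∑ xs (λ x → ⟦ p x ∧ q x ⟧) + ∑ xs (λ x → ⟦ p x ∧ not (q x) ⟧) ≡ ∑ xs (λ x → ⟦ p x ⟧)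
count-split xs p q = trans (sym (∑-+ xs _ _)) (∑-cong xs (λ x → split (p x) (q x)))
  where
  split : ∀ a b → ⟦ a ∧ b ⟧ + ⟦ a ∧ not b ⟧ ≡ ⟦ a ⟧
  split true true = refl
  split true false = refl
  split false _ = refl

∧-trueʳ : ∀ b → b ∧ true ≡ b
∧-trueʳ true = refl
∧-trueʳ false = refl

∧-falseʳ : ∀ b → b ∧ false ≡ false
∧-falseʳ true = refl
∧-falseʳ false = refl

module _ {A : Set} (U : List A) (W : A → ℕ) where
  number-upto number-below : ℕ → ℕ
  number-upto y = ∑ U (λ v → ⟦ does (W v ≤? y) ⟧)
  number-below y = ∑ U (λ v → ⟦ not (does (y ≤? W v)) ⟧)

  -- A robust substitute for the minimum weight: a fraction 1 / H of the vertices does not exceed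
  -- it, enough to find boxes among them, while too few lie strictly below to disturb averages.
  quantile : ∀ H .{{_ : NonZero H}} → ∃[ y ] length U ≤ H * number-upto y × H * number-below y ≤ length U
  quantile H = let y , enough , minimal = least-threshold (λ y → length U ≤? H * number-upto y) (∑ U W) everything in y , enough , few y minimal
    where
    everything : length U ≤ H * number-upto (∑ U W)
    everything = ≤-trans (≤-reflexive (trans (sym (∑-1 U)) (sym (∑-cong-∈ U (λ {v} v∈ → cong ⟦_⟧ (≤ᵇ-true (∈⇒≤∑ W v∈))))))) (m≤n*m _ H)
    few : ∀ y → (∀ {x} → y ≡ suc x → ¬ (length U ≤ H * number-upto x)) → H * number-below y ≤ length U
    few zero minimal = ≤-trans (≤-reflexive (trans (cong (H *_) (trans (∑-cong U (λ v → cong (λ b → ⟦ not b ⟧) (≤ᵇ-true {0} {W v} z≤n))) (∑-zero U))) (*-zeroʳ H))) z≤n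
    few (suc x) minimal = ≤-trans (*-monoʳ-≤ H (∑-mono U (λ v → strictly (W v)))) (<⇒≤ (≰⇒> (minimal refl)))
      where
      strictly : ∀ m → ⟦ not (does (suc x ≤? m)) ⟧ ≤ ⟦ does (m ≤? x) ⟧
      strictly m with does (suc x ≤? m) in eq
      ... | true = z≤n
      ... | false = ≤-reflexive (sym (cong ⟦_⟧ (≤ᵇ-true (≤-pred (does-≤-false {suc x} {m} eq)))))

  -- Compare every weight with y; a heavy neighbour exceeds y by t D and a heavy vertex outside by D.
  ∑-excess : ∀ (N : A → Bool) t y D →
      length U * y + (t * ∑ U (λ v → ⟦ N v ∧ not (does (W v ≤? y + t * D)) ⟧) + ∑ U (λ v → ⟦ not (N v) ∧ not (does (W v ≤? y + D)) ⟧)) * D ≤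
      ∑ U W + y * number-below y
  ∑-excess N t y D = begin
    length U * y + (t * ∑ U heavy + ∑ U beyond) * D
      ≡⟨ cong₂ _+_ (∑-const U y) (trans (∑-*ʳ U D _) (cong (_* D) (trans (∑-+ U _ _) (cong (_+ ∑ U beyond) (∑-*ˡ U t _))))) ⟨
    ∑ U (λ _ → y) + ∑ U (λ v → (t * heavy v + beyond v) * D)
      ≡⟨ ∑-+ U _ _ ⟨
    ∑ U (λ v → y + (t * heavy v + beyond v) * D)
      ≤⟨ ∑-mono U pointwise ⟩
    ∑ U (λ v → W v + y * ⟦ not (does (y ≤? W v)) ⟧)
      ≡⟨ trans (∑-+ U _ _) (cong (∑ U W +_) (∑-*ˡ U y _)) ⟩
    ∑ U W + y * number-below y ∎
    where
    open ≤-Reasoning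
    heavy beyond : A → ℕ
    heavy v = ⟦ N v ∧ not (does (W v ≤? y + t * D)) ⟧
    beyond v = ⟦ not (N v) ∧ not (does (W v ≤? y + D)) ⟧
    base : ∀ m → y + 0 ≤ m + y * ⟦ not (does (y ≤? m)) ⟧
    base m with does (y ≤? m) in eq
    ... | true = ≤-trans (≤-reflexive (+-identityʳ y)) (≤-trans (true-≤ eq) (m≤m+n m _))
    ... | false = ≤-trans (≤-reflexive (trans (+-identityʳ y) (sym (*-identityʳ y)))) (m≤n+m _ m)
    pointwise : ∀ v → y + (t * heavy v + beyond v) * D ≤ W v + y * ⟦ not (does (y ≤? W v)) ⟧
    pointwise v with N v | does (W v ≤? y + t * D) in eqh | does (W v ≤? y + D) in eqa
    ... | true | true | _ = subst (λ z → y + (z + 0) * D ≤ W v + y * ⟦ not (does (y ≤? W v)) ⟧) (sym (*-zeroʳ t)) (base (W v))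
    ... | true | false | _ = ≤-trans (≤-reflexive (cong (λ z → y + z * D) (trans (+-identityʳ (t * 1)) (*-identityʳ t)))) (≤-trans (<⇒≤ (does-≤-false {W v} {y + t * D} eqh)) (m≤m+n (W v) _))
    ... | false | _ | true = subst (λ z → y + (z + 0) * D ≤ W v + y * ⟦ not (does (y ≤? W v)) ⟧) (sym (*-zeroʳ t)) (base (W v))
    ... | false | _ | false = ≤-trans (≤-reflexive (trans (cong (λ z → y + (z + 1) * D) (*-zeroʳ t)) (cong (y +_) (*-identityˡ D)))) (≤-trans (<⇒≤ (does-≤-false {W v} {y + D} eqa)) (m≤m+n (W v) _))

-- (2K + 1) y ≤ 2 (K + 1) K a, since at most a fraction 1/(2(K + 1)) of the weights lies below y.
quantile-bound : ∀ K u a y Y₀ → 0 < u → u * y ≤ K * u * a + y * Y₀ → 2 * suc K * Y₀ ≤ u → suc (2 * K) * y ≤ 2 * suc K * (K * a)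
quantile-bound K u a y Y₀ 0<u lower few = *-cancelˡ-≤ u {{>-nonZero 0<u}} (+-cancelʳ-≤ (u * y) _ _ (begin
  u * (suc (2 * K) * y) + u * y ≡⟨ eq₁ u K y ⟩
  2 * suc K * (u * y) ≤⟨ *-monoʳ-≤ (2 * suc K) lower ⟩
  2 * suc K * (K * u * a + y * Y₀) ≡⟨ eq₂ (2 * suc K) (K * u * a) y Y₀ ⟩
  2 * suc K * (K * u * a) + y * (2 * suc K * Y₀) ≤⟨ +-monoʳ-≤ (2 * suc K * (K * u * a)) (*-monoʳ-≤ y few) ⟩
  2 * suc K * (K * u * a) + y * u ≡⟨ eq₃ (2 * suc K) K u a y ⟩
  u * (2 * suc K * (K * a)) + u * y ∎))
  where
  open ≤-Reasoning
  eq₁ : ∀ u K y → u * (suc (2 * K) * y) + u * y ≡ 2 * suc K * (u * y)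
  eq₁ = solve-∀
  eq₂ : ∀ h x y z → h * (x + y * z) ≡ h * x + y * (h * z)
  eq₂ = solve-∀
  eq₃ : ∀ h K u a y → h * (K * u * a) + y * u ≡ u * (h * (K * a)) + u * y
  eq₃ = solve-∀

-- In the scale used later K a is the average weight and (K + 1) a the weight per vertex allowed to
-- a tile. That the quantile stays strictly below the latter yields the gap D > 0 in which the
-- excess of a vertex is measured.
quantile<average : ∀ K a y → 0 < a → suc (2 * K) * y ≤ 2 * suc K * (K * a) → y < suc K * a
quantile<average K a y 0<a bound = *-cancelˡ-< (suc (2 * K)) y (suc K * a) (≤-<-trans bound (subst (_< suc (2 * K) * (suc K * a)) (eq K a)
  (*-monoˡ-< (suc K * a) {{m*n≢0 (suc K) a {{_}} {{>-nonZero 0<a}}}} (n<1+n (2 * K)))))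
  where
  eq : ∀ K a → 2 * K * (suc K * a) ≡ 2 * suc K * (K * a)
  eq = solve-∀

-- The total weight, corrected by y Y₀ for the weights below the quantile, is at most u (y + D), and
-- each unit of `G` contributes D beyond u y.
excess-bound : ∀ K u a y Y₀ D G → 0 < D → y + D ≡ suc K * a → 2 * suc K * Y₀ ≤ u → u * y + G * D ≤ K * u * a + y * Y₀ → G ≤ u
excess-bound K u a y Y₀ D G 0<D y+D few excess = *-cancelʳ-≤ G u D {{>-nonZero 0<D}} (+-cancelˡ-≤ (u * y) _ _ (begin
  u * y + G * D ≤⟨ excess ⟩
  K * u * a + y * Y₀ ≤⟨ +-monoʳ-≤ (K * u * a) yY₀ ⟩
  K * u * a + u * a ≡⟨ eq K u a ⟩
  u * (suc K * a) ≡⟨ cong (u *_) y+D ⟨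
  u * (y + D) ≡⟨ *-distribˡ-+ u y D ⟩
  u * y + u * D ∎))
  where
  open ≤-Reasoning
  eq : ∀ K u a → K * u * a + u * a ≡ u * (suc K * a)
  eq = solve-∀
  eq′ : ∀ K a u → suc K * a * u + suc K * a * u ≡ 2 * suc K * (u * a)
  eq′ = solve-∀
  yY₀ : y * Y₀ ≤ u * a
  yY₀ = *-cancelˡ-≤ (2 * suc K) (begin
    2 * suc K * (y * Y₀) ≡⟨ *-exchange (2 * suc K) y Y₀ ⟩
    y * (2 * suc K * Y₀) ≤⟨ *-mono-≤ (≤-trans (m≤m+n y D) (≤-reflexive y+D)) few ⟩
    suc K * a * u ≤⟨ m≤m+n _ (suc K * a * u) ⟩
    suc K * a * u + suc K * a * u ≡⟨ eq′ K a u ⟩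
    2 * suc K * (u * a) ∎)

-- f and g count the moderate and the heavy vertices of a link of size about u / t, and `X` the
-- heavy vertices outside. If f is negligible then t g is almost u, which exhausts the bound and
-- leaves at most 2 u / Z for `X`.
few-beyond : ∀ Z u t f g X → Z * u ≤ u + Z * (t * (f + g)) → Z * t * f ≤ u → t * g + X ≤ u → Z * X ≤ u + u
few-beyond Z u t f g X degree sparse le = +-cancelʳ-≤ (Z * (t * g)) _ _ (begin
  Z * X + Z * (t * g) ≡⟨ eq₁ Z X (t * g) ⟩
  Z * (t * g + X) ≤⟨ *-monoʳ-≤ Z le ⟩
  Z * u ≤⟨ degree ⟩
  u + Z * (t * (f + g)) ≡⟨ eq₂ u Z t f g ⟩
  u + Z * t * f + Z * (t * g) ≤⟨ +-monoˡ-≤ (Z * (t * g)) (+-monoʳ-≤ u sparse) ⟩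
  u + u + Z * (t * g) ∎)
  where
  open ≤-Reasoning
  eq₁ : ∀ z x g → z * x + z * g ≡ z * (g + x)
  eq₁ = solve-∀
  eq₂ : ∀ u z t f g → u + z * (t * (f + g)) ≡ u + z * t * f + z * (t * g)
  eq₂ = solve-∀

-- Each tuple lost by insisting on light vertices contains one of the `X` others. At most k p X are
-- lost, no more than half of the u p / Δ tuples available.
light-density : ∀ Δ k u p c X → u * p ≤ Δ * (c + k * p * X) → 4 * (k * Δ) * X ≤ u + u → u * p ≤ 4 * Δ * c
light-density Δ k u p c X spread few = +-cancelʳ-≤ (2 * (u * p)) _ _ (begin
  u * p + 2 * (u * p) ≤⟨ m≤m+n _ (u * p) ⟩
  u * p + 2 * (u * p) + u * p ≡⟨ eq₁ (u * p) ⟩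
  4 * (u * p) ≤⟨ *-monoʳ-≤ 4 spread ⟩
  4 * (Δ * (c + k * p * X)) ≡⟨ eq₂ Δ c k p X ⟩
  4 * Δ * c + 4 * (k * Δ) * X * p ≤⟨ +-monoʳ-≤ (4 * Δ * c) (*-monoˡ-≤ p few) ⟩
  4 * Δ * c + (u + u) * p ≡⟨ cong (4 * Δ * c +_) (eq₃ u p) ⟩
  4 * Δ * c + 2 * (u * p) ∎)
  where
  open ≤-Reasoning
  eq₁ : ∀ x → x + 2 * x + x ≡ 4 * x
  eq₁ = solve-∀
  eq₂ : ∀ Δ c k p x → 4 * (Δ * (c + k * p * x)) ≡ 4 * Δ * c + 4 * (k * Δ) * x * p
  eq₂ = solve-∀
  eq₃ : ∀ u p → (u + u) * p ≡ 2 * (u * p)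
  eq₃ = solve-∀

module _ {A : Set} (U : List A) (k₁ : ℕ) where
  linked : (A → Bool) → (List A → A → Bool) → List A → Bool
  linked low near [] = false
  linked low near (v ∷ S) = allᵇ low S ∧ near S v

  -- Averaging over the tuples with low entries, of which there are at least (u / H) ^ k₁: if each
  -- of them had u / C near vertices or more, the linked tuples would be dense.
  sparse-link : ∀ (low : A → Bool) (near : List A → A → Bool) H C → length U ≤ H * ∑ U (λ v → ⟦ low v ⟧) →
      ¬ (length U ^ suc k₁ ≤ H ^ k₁ * C * count U (suc k₁) (linked low near)) →
      ∃[ S ] S ∈ tuples U k₁ × C * ∑ U (λ v → ⟦ near S v ⟧) < length U
  sparse-link low near H C many sparse =
    let S , S∈ , lt = ∑-pick< (tuples U k₁) {λ S → lows S * (C * f S)} {λ S → lows S * length U} sum<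
    in S , S∈ , *-cancelˡ-< (lows S) _ _ lt
    where
    open ≤-Reasoning
    lows f : List A → ℕ
    lows S = ⟦ allᵇ low S ⟧
    f S = ∑ U (λ v → ⟦ near S v ⟧)
    count≡ : count U (suc k₁) (linked low near) ≡ ∑ (tuples U k₁) (λ S → lows S * f S)
    count≡ = trans (∑-tuples U k₁ _) (trans (∑-swap U (tuples U k₁) _) (∑-cong (tuples U k₁) (λ S →
      trans (∑-cong U (λ v → ⟦∧⟧ (allᵇ low S) _)) (∑-*ˡ U (lows S) _))))
    exch : ∀ a b c → a * (b * c) ≡ b * (c * a)
    exch = solve-∀
    sum< : ∑ (tuples U k₁) (λ S → lows S * (C * f S)) < ∑ (tuples U k₁) (λ S → lows S * length U)
    sum< = *-cancelˡ-< (H ^ k₁) _ _ (begin-strict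
      H ^ k₁ * ∑ (tuples U k₁) (λ S → lows S * (C * f S)) ≡⟨ cong (H ^ k₁ *_) (trans (∑-cong (tuples U k₁) (λ S → *-exchange (lows S) C (f S))) (∑-*ˡ (tuples U k₁) C _)) ⟩
      H ^ k₁ * (C * ∑ (tuples U k₁) (λ S → lows S * f S)) ≡⟨ trans (sym (*-assoc (H ^ k₁) C _)) (cong (H ^ k₁ * C *_) (sym count≡)) ⟩
      H ^ k₁ * C * count U (suc k₁) (linked low near) <⟨ ≰⇒> sparse ⟩
      length U * length U ^ k₁ ≤⟨ *-monoʳ-≤ (length U) (^-monoˡ-≤ k₁ many) ⟩
      length U * (H * ∑ U (λ v → ⟦ low v ⟧)) ^ k₁ ≡⟨ cong (length U *_) (^-distribʳ-* k₁ H _) ⟩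
      length U * (H ^ k₁ * ∑ U (λ v → ⟦ low v ⟧) ^ k₁) ≡⟨ exch (length U) (H ^ k₁) _ ⟩
      H ^ k₁ * (∑ U (λ v → ⟦ low v ⟧) ^ k₁ * length U) ≡⟨ cong (λ z → H ^ k₁ * (z * length U)) (∑-allᵇ U low k₁) ⟨
      H ^ k₁ * (∑ (tuples U k₁) lows * length U) ≡⟨ cong (H ^ k₁ *_) (∑-*ʳ (tuples U k₁) (length U) lows) ⟨
      H ^ k₁ * ∑ (tuples U k₁) (λ S → lows S * length U) ∎)

  count-light : ∀ (E : List A → Bool) (near light : A → Bool) →
      count U (suc k₁) (λ y → allᵇ (not ∘ near) y ∧ E y) ≤
      count U (suc k₁) (λ y → allᵇ light y ∧ E y) + suc k₁ * length U ^ k₁ * ∑ U (λ v → ⟦ not (near v) ∧ not (light v) ⟧)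
  count-light E near light = begin
    count U (suc k₁) (λ y → allᵇ (not ∘ near) y ∧ E y) ≤⟨ ∑-mono (tuples U (suc k₁)) pointwise ⟩
    ∑ (tuples U (suc k₁)) (λ y → ⟦ allᵇ light y ∧ E y ⟧ + ∑ y beyond) ≡⟨ ∑-+ (tuples U (suc k₁)) _ _ ⟩
    count U (suc k₁) (λ y → allᵇ light y ∧ E y) + ∑ (tuples U (suc k₁)) (λ y → ∑ y beyond) ≡⟨ cong (count U (suc k₁) (λ y → allᵇ light y ∧ E y) +_) (∑-tuples-∑ U k₁ _) ⟩
    count U (suc k₁) (λ y → allᵇ light y ∧ E y) + suc k₁ * length U ^ k₁ * ∑ U beyond ∎
    where
    open ≤-Reasoning
    beyond : A → ℕ
    beyond v = ⟦ not (near v) ∧ not (light v) ⟧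
    covered : ∀ xs → ⟦ allᵇ (not ∘ near) xs ⟧ ≤ ⟦ allᵇ light xs ⟧ + ∑ xs beyond
    covered [] = s≤s z≤n
    covered (x ∷ xs) with near x | light x
    ... | true | _ = z≤n
    ... | false | true = covered xs
    ... | false | false = ≤-trans (⟦⟧≤1 (allᵇ (not ∘ near) xs)) (s≤s z≤n)
    pointwise : ∀ xs → ⟦ allᵇ (not ∘ near) xs ∧ E xs ⟧ ≤ ⟦ allᵇ light xs ∧ E xs ⟧ + ∑ xs beyond
    pointwise xs with E xs
    ... | true = subst₂ (λ a b → ⟦ a ⟧ ≤ ⟦ b ⟧ + ∑ xs beyond) (sym (∧-trueʳ _)) (sym (∧-trueʳ _)) (covered xs)
    ... | false = ≤-trans (≤-reflexive (cong ⟦_⟧ (∧-falseʳ (allᵇ (not ∘ near) xs)))) z≤n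

module Oracle (σ : Shape) (Γ : Host) (K Δ₂ B : ℕ) (0<K : 0 < K) (0<Δ₂ : 0 < Δ₂) where
  open Host Γ
  open Words σ
  open Tokens σ
  open Gadgets σ
  open Tiles σ Γ
  open ≤-Reasoning

  -- 1 / H is the level of the quantile. `Z₁` is such that 2 u / Z₁ exceptional vertices destroy at
  -- most half of the edges avoiding a link, so that density 1 / C₁ remains. With fewer than u / C₃
  -- moderate neighbours a link counts as heavy; `C₂` combines this with the loss in `sparse-link`.
  H Z₁ C₁ C₂ C₃ M : ℕ
  H = 2 * suc K
  Z₁ = 4 * (k * Δ₂)
  C₁ = 4 * Δ₂
  C₃ = Z₁ * t
  C₂ = H ^ k₁ * C₃
  M = B * t + r

  avoiding : List (Fin n) → List (Fin n) → Bool
  avoiding S y = allᵇ (not ∘ N S) y ∧ E y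

  -- What the nibble keeps alive on the uncovered set: links of relative size at least (1 - 1 / Z₁)
  -- / t, and, as the remnant of non-extremality, edges of density 1 / Δ₂ avoiding any given link.
  record Rich (U : List (Fin n)) : Set where
    field
      unique : Unique U
      degree : ∀ {S} → S ∈ tuples U k₁ → Z₁ * length U ≤ length U + Z₁ * (t * ∑ U (λ v → ⟦ N S v ⟧))
      spread : ∀ {S} → S ∈ tuples U k₁ → length U ^ k ≤ Δ₂ * count U k (avoiding S)
      large₁ : 2 * C₁ ^ (M ^ k) * ((k * M) * (k * M)) < length U
      large₂ : 2 * C₂ ^ (M ^ k) * ((k * M) * (k * M)) < length U

  module _ {U : List (Fin n)} (rich : Rich U) (w : Fin n → ℕ) where
    open Rich rich

    LightTile : Set
    LightTile = Σ[ T ∈ Tile U B ] K * length U * ∑ (Tile.vertices T) w ≤ suc K * M * ∑ U w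

    private
      W : Fin n → ℕ
      W v = K * length U * w v

      word-sum : ∀ x → ∑ (tile-word B) (λ _ → x) ≡ M * x
      word-sum x = trans (∑-const (tile-word B) x) (cong (_* x) (length-map-range c d M))

    module _ (y D : ℕ) (y+D : y + D ≡ suc K * ∑ U w) where
      light : Fin n → Bool
      light v = does (W v ≤? y + D)

      near : List (Fin n) → Fin n → Bool
      near S v = N S v ∧ does (W v ≤? y + t * D)

      R₁ R₂ : List (Fin n) → Bool
      R₁ xs = allᵇ light xs ∧ E xs
      R₂ = linked U k₁ (λ v → does (W v ≤? y)) near

      finish : (cost : ℕ → ℕ) → ∑ (tile-word B) cost ≤ M * (y + D) → Σ[ T ∈ Tile U B ] ∑ (Tile.vertices T) W ≤ ∑ (tile-word B) cost → LightTile
      finish cost le (T , le′) = T , (begin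
        K * length U * ∑ (Tile.vertices T) w ≡⟨ ∑-*ˡ (Tile.vertices T) (K * length U) w ⟨
        ∑ (Tile.vertices T) W ≤⟨ ≤-trans le′ le ⟩
        M * (y + D) ≡⟨ cong (M *_) y+D ⟩
        M * (suc K * ∑ U w) ≡⟨ trans (*-exchange M (suc K) _) (sym (*-assoc (suc K) M _)) ⟩
        suc K * M * ∑ U w ∎)

      dense₁ : length U ^ k ≤ C₁ * count U k R₁ → LightTile
      dense₁ dense = finish (λ _ → y + D) (≤-reflexive (word-sum (y + D)))
        (tile-from-box unique B R₁ (λ xs eq → proj₂ (∧-true {allᵇ light xs} eq)) (λ _ → y + D) W cheap (fresh-box U unique M k R₁ C₁ dense large₁))
        where
        all-light : ∀ xs a → (∀ {v} → v ∈ xs → W v ≤ y + D) → Pointwise (λ _ v → W v ≤ y + D) (range a (length xs)) xs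
        all-light [] a le = []
        all-light (x ∷ xs) a le = le (here refl) ∷ all-light xs (suc a) (le ∘ there)
        cheap : ∀ xs → R₁ xs ≡ true → length xs ≡ k → Pointwise (λ _ v → W v ≤ y + D) (range 0 k) xs
        cheap xs eq len = subst (λ m → Pointwise _ (range 0 m) xs) len
          (all-light xs 0 (λ v∈ → true-≤ (allᵇ-∈ light (proj₁ (∧-true {allᵇ light xs} eq)) v∈)))

      dense₂ : length U ^ k ≤ C₂ * count U k R₂ → LightTile
      dense₂ dense = finish cost total (tile-from-box unique B R₂ R₂⇒E cost W cheap (fresh-box U unique M k R₂ C₂ dense large₂))
        where
        cost : ℕ → ℕ
        -- Token 0 may exceed the quantile by t D, as it takes only `B` of the B t + r positions:
        -- this is at most D per vertex of the tile.
        cost c = y + t * D * is-0 c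
        total : ∑ (tile-word B) cost ≤ M * (y + D)
        total = begin
          ∑ (tile-word B) cost ≡⟨ trans (∑-+ (tile-word B) _ _) (cong₂ _+_ (word-sum y) (trans (∑-*ˡ (tile-word B) (t * D) is-0) (cong (t * D *_) (tile-zeros B)))) ⟩
          M * y + t * D * B ≡⟨ cong (M * y +_) (trans (*-comm (t * D) B) (sym (*-assoc B t D))) ⟩
          M * y + B * t * D ≤⟨ +-monoʳ-≤ (M * y) (*-monoˡ-≤ D (m≤m+n (B * t) r)) ⟩
          M * y + M * D ≡⟨ *-distribˡ-+ M y D ⟨
          M * (y + D) ∎
        low : Fin n → Bool
        low v = does (W v ≤? y)
        R₂⇒E : ∀ xs → R₂ xs ≡ true → E xs ≡ true
        R₂⇒E (v ∷ S) eq = N⇒E S v (proj₁ (∧-true {N S v} (proj₂ (∧-true {allᵇ low S} eq))))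
        rest : ∀ S a → (∀ {v} → v ∈ S → W v ≤ y) → Pointwise (λ c v → W v ≤ cost c) (range (suc a) (length S)) S
        rest [] a le = []
        rest (x ∷ S) a le = ≤-trans (le (here refl)) (m≤m+n y _) ∷ rest S (suc a) (le ∘ there)
        cheap : ∀ xs → R₂ xs ≡ true → length xs ≡ k → Pointwise (λ c v → W v ≤ cost c) (range 0 k) xs
        cheap (v ∷ S) eq len = subst (λ m → Pointwise (λ c v → W v ≤ cost c) (range 0 m) (v ∷ S)) len
          (≤-trans (true-≤ (proj₂ (∧-true {N S v} (proj₂ (∧-true {allᵇ low S} eq))))) (≤-reflexive (cong (y +_) (sym (*-identityʳ (t * D)))))
           ∷ rest S 0 (λ v∈ → true-≤ (allᵇ-∈ low (proj₁ (∧-true {allᵇ low S} eq)) v∈)))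

    light-tile : LightTile
    light-tile = from-quantile (quantile U W H)
      where
      u a : ℕ
      u = length U
      a = ∑ U w
      0<u : 0 < u
      0<u = ≤-<-trans z≤n large₁
      ∑W : ∑ U W ≡ K * u * a
      ∑W = ∑-*ˡ U (K * u) w
      from-quantile : ∃[ y ] u ≤ H * number-upto U W y × H * number-below U W y ≤ u → LightTile
      from-quantile (y , many , few) = decide (u ^ k ≤? C₂ * count U k (R₂ y D₀ y+D))
        where
        excess : ∀ P D → u * y + (t * ∑ U (λ v → ⟦ P v ∧ not (does (W v ≤? y + t * D)) ⟧) + ∑ U (λ v → ⟦ not (P v) ∧ not (does (W v ≤? y + D)) ⟧)) * D ≤ K * u * a + y * number-below U W y
        excess P D = ≤-trans (∑-excess U W P t y D) (≤-reflexive (cong (_+ y * number-below U W y) ∑W))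
        bound : suc (2 * K) * y ≤ 2 * suc K * (K * a)
        bound = quantile-bound K u a y _ 0<u (≤-trans (m≤m+n _ _) (excess (λ _ → true) 0)) few
        D₀ : ℕ
        D₀ = suc K * a ∸ y
        y+D : y + D₀ ≡ suc K * a
        y+D = m+[n∸m]≡n (below-average (a ≟ 0))
          where
          below-average : Dec (a ≡ 0) → y ≤ suc K * a
          below-average (no a≢0) = <⇒≤ (quantile<average K a y (n≢0⇒n>0 a≢0) bound)
          below-average (yes a≡0) = ≤-trans (m≤n*m y (suc (2 * K))) (≤-trans bound (≤-trans (≤-reflexive (trans (cong (λ z → 2 * suc K * (K * z)) a≡0) (trans (cong (2 * suc K *_) (*-zeroʳ K)) (*-zeroʳ (2 * suc K))))) z≤n))
        beyond : List (Fin n) → ℕ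
        beyond S = ∑ U (λ v → ⟦ not (N S v) ∧ not (light y D₀ y+D v) ⟧)
        Z₁-beyond : ∀ {S} → S ∈ tuples U k₁ → C₃ * ∑ U (λ v → ⟦ near y D₀ y+D S v ⟧) < u → Z₁ * beyond S ≤ u + u
        Z₁-beyond {S} S∈ sparse = by (a ≟ 0)
          where
          by : Dec (a ≡ 0) → Z₁ * beyond S ≤ u + u
          by (no a≢0) = few-beyond Z₁ u t _ _ (beyond S)
            (≤-trans (degree S∈) (≤-reflexive (cong (λ z → u + Z₁ * (t * z)) (sym (count-split U (N S) (λ v → does (W v ≤? y + t * D₀))))))) (<⇒≤ sparse)
            (excess-bound K u a y _ D₀ _ (m<n⇒0<n∸m (quantile<average K a y (n≢0⇒n>0 a≢0) bound)) y+D few (excess (N S) D₀))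
          by (yes a≡0) = ≤-trans (≤-reflexive (trans (cong (Z₁ *_) (trans (∑-cong-∈ U none) (∑-zero U))) (*-zeroʳ Z₁))) z≤n
            where
            none : ∀ {v} → v ∈ U → ⟦ not (N S v) ∧ not (light y D₀ y+D v) ⟧ ≡ 0
            none {v} v∈ = cong ⟦_⟧ (trans (cong (λ b → not (N S v) ∧ not b) (≤ᵇ-true (≤-trans (≤-reflexive (trans (cong (K * u *_) (n≤0⇒n≡0 (subst (w v ≤_) a≡0 (∈⇒≤∑ w v∈)))) (*-zeroʳ (K * u)))) z≤n))) (∧-falseʳ (not (N S v))))
        decide : Dec (u ^ k ≤ C₂ * count U k (R₂ y D₀ y+D)) → LightTile
        decide (yes p) = dense₂ y D₀ y+D p
        decide (no ¬p) = let S , S∈ , sparse = sparse-link U k₁ (λ v → does (W v ≤? y)) (near y D₀ y+D) H C₃ many ¬p in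
          dense₁ y D₀ y+D (light-density Δ₂ k u (u ^ k₁) (count U k (R₁ y D₀ y+D)) (beyond S)
            (≤-trans (spread S∈) (*-monoʳ-≤ Δ₂ (count-light U k₁ E (N S) (light y D₀ y+D)))) (Z₁-beyond S∈ sparse))

-- One phase: balanced removal of tiles

remove : ∀ {x : A} {xs} → x ∈ xs → ∃[ ys ] xs ↭ x ∷ ys
remove x∈ with ys , zs , refl ← ∈-∃++ x∈ = ys ++ zs , shift _ ys zs

∈-∷⁻ : ∀ {p q : A} {ws} → q ∈ p ∷ ws → p ≢ q → q ∈ ws
∈-∷⁻ (here refl) p≢ = ⊥-elim (p≢ refl)
∈-∷⁻ (there q∈) p≢ = q∈

subset-↭ : ∀ {ps us : List A} → Unique ps → All (_∈ us) ps → ∃[ vs ] us ↭ ps ++ vs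
subset-↭ {us = us} [] [] = us , ↭-refl
subset-↭ (p∉ ∷ un) (p∈ ∷ all) with ws , perm ← remove p∈ with vs , perm′ ← subset-↭ un (All.zipWith (λ { (p≢ , q∈) → ∈-∷⁻ (∈-resp-↭ perm q∈) p≢ }) (p∉ , all)) =
  vs , ↭-trans perm (prep _ perm′)

∑-tuples-↭ : ∀ {us vs : List A} k → us ↭ vs → (g : List A → ℕ) → ∑ (tuples us k) g ≡ ∑ (tuples vs k) g
∑-tuples-↭ zero perm g = refl
∑-tuples-↭ {us = us} {vs} (suc k) perm g = begin
  ∑ (tuples us (suc k)) g ≡⟨ ∑-tuples us k g ⟩
  ∑ us (λ a → ∑ (tuples us k) (g ∘ (a ∷_))) ≡⟨ ∑-cong us (λ a → ∑-tuples-↭ k perm _) ⟩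
  ∑ us (λ a → ∑ (tuples vs k) (g ∘ (a ∷_))) ≡⟨ ∑-↭ _ perm ⟩
  ∑ vs (λ a → ∑ (tuples vs k) (g ∘ (a ∷_))) ≡⟨ ∑-tuples vs k g ⟨
  ∑ (tuples vs (suc k)) g ∎
  where open ≡-Reasoning

equal : ∀ {n} → Fin n → Fin n → ℕ
equal v z = if? (v Finₚ.≟ z) 1 0

equal-refl : ∀ {n} (v : Fin n) → equal v v ≡ 1
equal-refl v with v Finₚ.≟ v
... | yes _ = refl
... | no ¬p = ⊥-elim (¬p refl)

∑-equal≤1 : ∀ {n} {us : List (Fin n)} → Unique us → ∀ z → ∑ us (λ v → equal v z) ≤ 1
∑-equal≤1 [] z = z≤n
∑-equal≤1 {us = x ∷ us} (x∉ ∷ un) z with x Finₚ.≟ z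
... | yes refl = s≤s (≤-reflexive (trans (∑-cong-∈ us (λ {v} v∈ → other (All.lookup x∉ v∈))) (∑-zero us)))
  where
  other : ∀ {v} → x ≢ v → equal v x ≡ 0
  other {v} x≢v with v Finₚ.≟ x
  ... | yes refl = ⊥-elim (x≢v refl)
  ... | no _ = refl
... | no _ = ∑-equal≤1 un z

equal-sym : ∀ {n} (v z : Fin n) → equal v z ≡ equal z v
equal-sym v z with v Finₚ.≟ z | z Finₚ.≟ v
... | yes _ | yes _ = refl
... | no _ | no _ = refl
... | yes refl | no ¬p = ⊥-elim (¬p refl)
... | no ¬p | yes refl = ⊥-elim (¬p refl)

∑-equal≤1′ : ∀ {n} {us : List (Fin n)} → Unique us → ∀ z → ∑ us (λ v → equal z v) ≤ 1
∑-equal≤1′ {us = us} un z = ≤-trans (≤-reflexive (∑-cong us (λ v → equal-sym z v))) (∑-equal≤1 un z)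

hits : ∀ {n} → List (Fin n) → List (Fin n) → ℕ
hits R y = ∑ y (λ z → ∑ R (λ v → equal v z))

-- A lost tuple is counted once for each of its entries in `R`. The overcount makes the loss
-- additive over the vertices of `R`, as a cost in the weights argument has to be.
∑-tuples-loss : ∀ {n} (R U : List (Fin n)) k (g : List (Fin n) → ℕ) →
    ∑ (tuples (R ++ U) k) g ≤ ∑ (tuples U k) g + ∑ (tuples (R ++ U) k) (λ y → g y * hits R y)
∑-tuples-loss R U zero g = m≤m+n _ _
∑-tuples-loss R U (suc k) g = begin
  ∑ (tuples (R ++ U) (suc k)) g
    ≡⟨ trans (∑-tuples (R ++ U) k g) (∑-++ R U _) ⟩
  ∑ R (λ a → ∑ Tk (g ∘ (a ∷_))) + ∑ U (λ a → ∑ Tk (g ∘ (a ∷_)))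
    ≤⟨ +-mono-≤ (∑-mono-∈ R (λ {a} a∈ → ∑-mono Tk (λ y → hit a∈ y))) (∑-mono U (λ a → ≤-trans (∑-tuples-loss R U k (g ∘ (a ∷_)))
    (+-monoʳ-≤ (∑ (tuples U k) (g ∘ (a ∷_))) (∑-mono Tk (λ y → *-monoʳ-≤ (g (a ∷ y)) (m≤n+m _ _)))))) ⟩
  ∑ R (λ a → ∑ Tk (λ y → G (a ∷ y))) + ∑ U (λ a → ∑ (tuples U k) (g ∘ (a ∷_)) + ∑ Tk (λ y → G (a ∷ y)))
    ≡⟨ cong (∑ R (λ a → ∑ Tk (λ y → G (a ∷ y))) +_) (∑-+ U _ _) ⟩
  ∑ R (λ a → ∑ Tk (λ y → G (a ∷ y))) + (∑ U (λ a → ∑ (tuples U k) (g ∘ (a ∷_))) + ∑ U (λ a → ∑ Tk (λ y → G (a ∷ y))))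
    ≡⟨ +-exchange (∑ R (λ a → ∑ Tk (λ y → G (a ∷ y)))) (∑ U (λ a → ∑ (tuples U k) (g ∘ (a ∷_)))) (∑ U (λ a → ∑ Tk (λ y → G (a ∷ y)))) ⟩
  ∑ U (λ a → ∑ (tuples U k) (g ∘ (a ∷_))) + (∑ R (λ a → ∑ Tk (λ y → G (a ∷ y))) + ∑ U (λ a → ∑ Tk (λ y → G (a ∷ y))))
    ≡⟨ cong₂ _+_ (∑-tuples U k g) (trans (∑-tuples (R ++ U) k G) (∑-++ R U _)) ⟨
  ∑ (tuples U (suc k)) g + ∑ (tuples (R ++ U) (suc k)) G ∎
  where
  open ≤-Reasoning
  Tk = tuples (R ++ U) k
  G = λ y → g y * hits R y
  hit : ∀ {a} → a ∈ R → ∀ y → g (a ∷ y) ≤ G (a ∷ y)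
  hit {a} a∈ y = m≤m*n (g (a ∷ y)) _ {{>-nonZero (≤-trans (≤-trans (≤-reflexive (sym (equal-refl a))) (∈⇒≤∑ (λ v → equal v a) a∈)) (m≤m+n _ (hits R y)))}}

record PhaseSetting : Set₁ where
  field
    {n} : ℕ
    k₁ p q L K : ℕ
    IsTile : List (Fin n) → Set
    size : ∀ {P} → IsTile P → length P ≡ p
    Θ : List (List (Fin n) → Bool)
    few : length Θ ≤ 2 ^ L
    0<p : 0 < p
    0<K : 0 < K
    U : List (Fin n)
    uniq : Unique U
    0<u : 0 < length U
    short : suc (2 * K) * (q * p) ≤ length U
    long : 2 * K * K * L ≤ q
    oracle : ∀ R U′ → U ↭ R ++ U′ → length R ≤ q * p → ∀ w →
        ∃[ P ] IsTile P × Unique P × All (_∈ U′) P × suc (2 * K) * length U′ * ∑ P w ≤ suc (suc (2 * K)) * p * ∑ U′ w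

module NibblePhase (Π : PhaseSetting) where
  open PhaseSetting Π
  open ≤-Reasoning

  private
    k u x Λ e₀ : ℕ
    k = suc k₁
    u = length U
    x = q * p
    Λ = k * u ^ k
    e₀ = p * Λ

    Test = List (Fin n) → Bool

    cnt : Test → ℕ
    cnt θ = count U k θ

    -- f θ v counts the tuples satisfying θ through v; f̂ pads u f so that its sum over U is at most u Λ for every test.
    f f̂ : Test → Fin n → ℕ
    f θ v = ∑ (tuples U k) (λ y → ⟦ θ y ⟧ * ∑ y (equal v))
    f̂ θ v = u * f θ v + (Λ ∸ k * cnt θ)

    cnt≤ : ∀ θ → cnt θ ≤ u ^ k
    cnt≤ θ = ≤-trans (∑-mono (tuples U k) (λ y → ⟦⟧≤1 (θ y))) (≤-reflexive (trans (∑-1 (tuples U k)) (length-tuples U k)))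

    pad : ∀ θ → (Λ ∸ k * cnt θ) + k * cnt θ ≡ Λ
    pad θ = m∸n+n≡m (*-monoʳ-≤ k (cnt≤ θ))

    f≤ : ∀ θ v → f θ v ≤ k * u ^ k₁
    f≤ θ v = begin
      f θ v ≤⟨ ∑-mono (tuples U k) (λ y → ≤-trans (*-monoˡ-≤ _ (⟦⟧≤1 (θ y))) (≤-reflexive (*-identityˡ _))) ⟩
      ∑ (tuples U k) (λ y → ∑ y (equal v)) ≡⟨ ∑-tuples-∑ U k₁ (equal v) ⟩
      k * u ^ k₁ * ∑ U (equal v) ≤⟨ *-monoʳ-≤ (k * u ^ k₁) (∑-equal≤1′ uniq v) ⟩
      k * u ^ k₁ * 1 ≡⟨ *-identityʳ _ ⟩
      k * u ^ k₁ ∎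

    f̂≤ : ∀ θ v → f̂ θ v ≤ 2 * Λ
    f̂≤ θ v = ≤-trans (+-mono-≤ (*-monoʳ-≤ u (f≤ θ v)) (m∸n≤m Λ (k * cnt θ))) (≤-reflexive (eq u k (u ^ k₁)))
      where
      eq : ∀ u k p → u * (k * p) + k * (u * p) ≡ 2 * (k * (u * p))
      eq = solve-∀

    ∑f : ∀ θ → ∑ U (f θ) ≤ k * cnt θ
    ∑f θ = begin
      ∑ U (f θ) ≡⟨ ∑-swap U (tuples U k) _ ⟩
      ∑ (tuples U k) (λ y → ∑ U (λ v → ⟦ θ y ⟧ * ∑ y (equal v))) ≡⟨ ∑-cong (tuples U k) (λ y → trans (∑-*ˡ U ⟦ θ y ⟧ _) (cong (⟦ θ y ⟧ *_) (∑-swap U y _))) ⟩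
      ∑ (tuples U k) (λ y → ⟦ θ y ⟧ * ∑ y (λ z → ∑ U (λ v → equal v z))) ≤⟨ ∑-mono-∈ (tuples U k) (λ {y} y∈ → *-monoʳ-≤ ⟦ θ y ⟧ (≤-trans (∑-≤ y (λ {z} _ → ∑-equal≤1 uniq z))
        (≤-reflexive (trans (*-identityʳ _) (proj₁ (∈-tuples⁻ U k y∈)))))) ⟩
      ∑ (tuples U k) (λ y → ⟦ θ y ⟧ * k) ≡⟨ trans (∑-*ʳ (tuples U k) k _) (*-comm _ k) ⟩
      k * cnt θ ∎

    ∑f̂ : ∀ θ → ∑ U (f̂ θ) ≤ u * Λ
    ∑f̂ θ = begin
      ∑ U (f̂ θ) ≡⟨ trans (∑-+ U _ _) (cong₂ _+_ (∑-*ˡ U u (f θ)) (∑-const U _)) ⟩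
      u * ∑ U (f θ) + u * (Λ ∸ k * cnt θ) ≤⟨ +-monoˡ-≤ _ (*-monoʳ-≤ u (∑f θ)) ⟩
      u * (k * cnt θ) + u * (Λ ∸ k * cnt θ) ≡⟨ trans (sym (*-distribˡ-+ u _ _)) (cong (u *_) (trans (+-comm (k * cnt θ) _) (pad θ))) ⟩
      u * Λ ∎

    cost : Test → List (Fin n) → ℕ
    cost θ P = K * ∑ P (f̂ θ)

    Valid : List (List (Fin n)) → Set
    Valid h = All IsTile h × ∃[ U′ ] U ↭ concat h ++ U′

    concat-length : ∀ {h} → All IsTile h → length (concat h) ≡ length h * p
    concat-length [] = refl
    concat-length {P ∷ h} (t ∷ ts) = trans (length-++ P) (cong₂ _+_ (size t) (concat-length ts))

    step : ∀ h → Valid h → length h < q → ∀ φ → (∀ θ → 0 < φ θ) →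
        ∃[ P ] Valid (P ∷ h) × ∑ Θ (λ θ → φ θ * cost θ P) ≤ suc K * e₀ * ∑ Θ φ
    step h (tiles , U′ , perm) lt φ _ = P , (tP ∷ tiles , U″ , perm″) , bound
      where
      w : Fin n → ℕ
      w v = ∑ Θ (λ θ → φ θ * f̂ θ v)
      R-short : length (concat h) ≤ x
      R-short = ≤-trans (≤-reflexive (concat-length tiles)) (*-monoˡ-≤ p (<⇒≤ lt))
      found = oracle (concat h) U′ perm R-short w
      P = proj₁ found
      tP = proj₁ (proj₂ found)
      unP = proj₁ (proj₂ (proj₂ found))
      inP = proj₁ (proj₂ (proj₂ (proj₂ found)))
      leP = proj₂ (proj₂ (proj₂ (proj₂ found)))
      U″ = proj₁ (subset-↭ unP inP)
      perm′ : U′ ↭ P ++ U″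
      perm′ = proj₂ (subset-↭ unP inP)
      perm″ : U ↭ (P ++ concat h) ++ U″
      perm″ = ↭-trans perm (↭-trans (Permₚ.++⁺ˡ (concat h) perm′) (↭-trans (shifts (concat h) P) (↭-reflexive (sym (++-assoc P (concat h) U″)))))
      u′ = length U′
      u-split : length (concat h) + u′ ≡ u
      u-split = trans (sym (length-++ (concat h))) (sym (↭-length perm))
      -- The phase removes at most a fraction 1 / (2 K + 1) of `U`. Passing from averages over the
      -- current set to averages over `U` costs a factor (2 K + 1) / (2 K), which with the accuracy
      -- (2 K + 2) / (2 K + 1) of the oracle makes (K + 1) / K.
      u′-large : 2 * K * u ≤ suc (2 * K) * u′
      u′-large = +-cancelˡ-≤ u _ _ (begin
        suc (2 * K) * u ≡⟨ cong (suc (2 * K) *_) (sym u-split) ⟩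
        suc (2 * K) * (length (concat h) + u′) ≡⟨ *-distribˡ-+ (suc (2 * K)) _ u′ ⟩
        suc (2 * K) * length (concat h) + suc (2 * K) * u′ ≤⟨ +-monoˡ-≤ _ (≤-trans (*-monoʳ-≤ (suc (2 * K)) R-short) short) ⟩
        u + suc (2 * K) * u′ ∎)
      w-mono : ∑ U′ w ≤ ∑ U w
      w-mono = ≤-trans (m≤n+m _ _) (≤-reflexive (trans (sym (∑-++ (concat h) U′ w)) (sym (∑-↭ w perm))))
      w-total : ∑ U w ≤ u * Λ * ∑ Θ φ
      w-total = begin
        ∑ U w ≡⟨ ∑-swap U Θ _ ⟩
        ∑ Θ (λ θ → ∑ U (λ v → φ θ * f̂ θ v)) ≡⟨ ∑-cong Θ (λ θ → ∑-*ˡ U (φ θ) (f̂ θ)) ⟩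
        ∑ Θ (λ θ → φ θ * ∑ U (f̂ θ)) ≤⟨ ∑-mono Θ (λ θ → *-monoʳ-≤ (φ θ) (∑f̂ θ)) ⟩
        ∑ Θ (λ θ → φ θ * (u * Λ)) ≡⟨ trans (∑-*ʳ Θ (u * Λ) φ) (*-comm _ (u * Λ)) ⟩
        u * Λ * ∑ Θ φ ∎
      w-P : ∑ Θ (λ θ → φ θ * cost θ P) ≡ K * ∑ P w
      w-P = begin-equality
        ∑ Θ (λ θ → φ θ * (K * ∑ P (f̂ θ))) ≡⟨ ∑-cong Θ (λ θ → trans (*-exchange (φ θ) K _) (cong (K *_) (sym (∑-*ˡ P (φ θ) (f̂ θ))))) ⟩
        ∑ Θ (λ θ → K * ∑ P (λ v → φ θ * f̂ θ v)) ≡⟨ ∑-*ˡ Θ K _ ⟩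
        K * ∑ Θ (λ θ → ∑ P (λ v → φ θ * f̂ θ v)) ≡⟨ cong (K *_) (∑-swap Θ P _) ⟩
        K * ∑ P w ∎
      bound : ∑ Θ (λ θ → φ θ * cost θ P) ≤ suc K * e₀ * ∑ Θ φ
      bound = ≤-trans (≤-reflexive w-P) (*-cancelˡ-≤ (2 * u) {{m*n≢0 2 u {{_}} {{>-nonZero 0<u}}}} (begin
        2 * u * (K * ∑ P w) ≡⟨ eq₁ u K (∑ P w) ⟩
        2 * K * u * ∑ P w ≤⟨ *-monoˡ-≤ (∑ P w) u′-large ⟩
        suc (2 * K) * u′ * ∑ P w ≤⟨ leP ⟩
        suc (suc (2 * K)) * p * ∑ U′ w ≤⟨ *-monoʳ-≤ (suc (suc (2 * K)) * p) (≤-trans w-mono w-total) ⟩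
        suc (suc (2 * K)) * p * (u * Λ * ∑ Θ φ) ≡⟨ eq₂ K p u Λ (∑ Θ φ) ⟩
        2 * u * (suc K * (p * Λ) * ∑ Θ φ) ∎))
        where
        eq₁ : ∀ u K s → 2 * u * (K * s) ≡ 2 * K * u * s
        eq₁ = solve-∀
        eq₂ : ∀ K p u Λ s → suc (suc (2 * K)) * p * (u * Λ * s) ≡ 2 * u * (suc K * (p * Λ) * s)
        eq₂ = solve-∀

    bounded : ∀ θ {P h} → Valid (P ∷ h) → cost θ P ≤ K * (p * (2 * Λ))
    bounded θ {P} (tP ∷ _ , _) = *-monoʳ-≤ K (≤-trans (∑-≤ P (λ {v} _ → f̂≤ θ v)) (≤-reflexive (cong (_* (2 * Λ)) (size tP))))

    shrink : ∀ {P h} → Valid (P ∷ h) → Valid h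
    shrink {P} {h} (_ ∷ tiles , U′ , perm) = tiles , P ++ U′ ,
      ↭-trans perm (↭-trans (↭-reflexive (++-assoc P (concat h) U′)) (shifts P (concat h)))

    0<e₀ : 0 < e₀
    0<e₀ = *-mono-≤ 0<p (*-mono-≤ (s≤s {0} {k₁} z≤n) (m^n>0 u {{>-nonZero 0<u}} k))

    -- The average cost is at most (K + 1) e₀ and the largest 2 K e₀. For this `Y` the condition of
    -- the selection holds with equality for (K + 2) e₀: the relative overhead cmax / Y is 1 / (K +
    -- 1).
    Y : ℕ
    Y = 2 * K * suc K * e₀

    rate : suc K * e₀ * (Y + K * (p * (2 * Λ))) ≤ (2 + K) * e₀ * Y
    rate = ≤-reflexive (eq K p Λ)
      where
      eq : ∀ K p Λ → suc K * (p * Λ) * (2 * K * suc K * (p * Λ) + K * (p * (2 * Λ))) ≡ (2 + K) * (p * Λ) * (2 * K * suc K * (p * Λ))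
      eq = solve-∀

  -- The point of `retained`: up to a fraction 5 / K of the largest possible loss, no test loses
  -- more tuples than it would, to first order, by the removal of q p random vertices.
  record PhaseResult : Set where
    field
      chosen : List (List (Fin n))
      rest : List (Fin n)
      tiles : All IsTile chosen
      number : length chosen ≡ q
      split : U ↭ concat chosen ++ rest
      retained : ∀ {θ} → θ ∈ Θ → K * (length U * count U k θ) ≤
          K * (length U * count rest k θ) + (K * (q * p * (k * count U k θ)) + 5 * (q * p * (k * length U ^ k)))

  phase : PhaseResult
  phase = conclude (GuidedSelection.select Θ cost Valid (K * (p * (2 * Λ))) (suc K * e₀) Y ((2 + K) * e₀) L q (*-mono-≤ (*-mono-≤ (*-mono-≤ (s≤s {0} {1} z≤n) 0<K) (s≤s {0} {K} z≤n)) 0<e₀) few rate ([] , U , ↭-refl) bounded (λ {i} {h} → shrink {i} {h}) step)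
    where
    conclude : ∃[ h ] Valid h × length h ≡ q × (∀ {θ} → θ ∈ Θ → ∑ h (cost θ) ≤ (2 + K) * e₀ * q + (Y + K * (p * (2 * Λ))) * L) → PhaseResult
    conclude (h , (tiles , U′ , perm) , len , total) = record
      { chosen = h ; rest = U′ ; tiles = tiles ; number = len ; split = perm ; retained = retained }
      where
      R = concat h
      retained : ∀ {θ} → θ ∈ Θ → K * (u * cnt θ) ≤ K * (u * count U′ k θ) + (K * (x * (k * cnt θ)) + 5 * (x * Λ))
      retained {θ} θ∈ = begin
        K * (u * cnt θ) ≤⟨ *-monoʳ-≤ K (*-monoʳ-≤ u loss) ⟩
        K * (u * (count U′ k θ + ∑ R (f θ))) ≡⟨ eq₁ K u _ _ ⟩
        K * (u * count U′ k θ) + K * (u * ∑ R (f θ)) ≤⟨ +-monoʳ-≤ _ consumed ⟩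
        K * (u * count U′ k θ) + (K * (x * (k * cnt θ)) + 5 * (x * Λ)) ∎
        where
        eq₁ : ∀ K u a b → K * (u * (a + b)) ≡ K * (u * a) + K * (u * b)
        eq₁ = solve-∀
        z = Λ ∸ k * cnt θ
        ∑R-f : ∑ R (f θ) ≡ ∑ (tuples U k) (λ y → ⟦ θ y ⟧ * hits R y)
        ∑R-f = trans (∑-swap R (tuples U k) _) (∑-cong (tuples U k) (λ y → trans (∑-*ˡ R ⟦ θ y ⟧ _) (cong (⟦ θ y ⟧ *_) (∑-swap R y _))))
        loss : cnt θ ≤ count U′ k θ + ∑ R (f θ)
        loss = begin
          cnt θ ≡⟨ ∑-tuples-↭ k perm _ ⟩
          ∑ (tuples (R ++ U′) k) (λ y → ⟦ θ y ⟧) ≤⟨ ∑-tuples-loss R U′ k _ ⟩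
          count U′ k θ + ∑ (tuples (R ++ U′) k) (λ y → ⟦ θ y ⟧ * hits R y) ≡⟨ cong (count U′ k θ +_) (trans (∑-tuples-↭ k (↭-sym perm) _) (sym ∑R-f)) ⟩
          count U′ k θ + ∑ R (f θ) ∎
        sum-f̂ : ∑ h (cost θ) ≡ K * (u * ∑ R (f θ) + x * z)
        sum-f̂ = begin-equality
          ∑ h (λ P → K * ∑ P (f̂ θ)) ≡⟨ trans (∑-*ˡ h K _) (cong (K *_) (sym (∑-concat h (f̂ θ)))) ⟩
          K * ∑ R (f̂ θ) ≡⟨ cong (K *_) (trans (∑-+ R _ _) (cong₂ _+_ (∑-*ˡ R u (f θ)) (∑-const R z))) ⟩
          K * (u * ∑ R (f θ) + length R * z) ≡⟨ cong (λ l → K * (u * ∑ R (f θ) + l * z)) (trans (concat-length tiles) (cong (_* p) len)) ⟩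
          K * (u * ∑ R (f θ) + x * z) ∎
        -- Origin of the 5: `long` bounds K q + 2 K K L by (K + 1) q, and (K + 2) (K + 1) ≤ K (K +
        -- 5) because K ≥ 1.
        total′ : K * (u * ∑ R (f θ) + x * z) ≤ (K + 5) * (x * Λ)
        total′ = *-cancelˡ-≤ K {{>-nonZero 0<K}} (begin
          K * (K * (u * ∑ R (f θ) + x * z)) ≤⟨ *-monoʳ-≤ K (≤-trans (≤-reflexive (sym sum-f̂)) (total θ∈)) ⟩
          K * ((2 + K) * e₀ * q + (Y + K * (p * (2 * Λ))) * L) ≡⟨ eq₂ K p Λ q L ⟩
          (2 + K) * (p * Λ) * (K * q + 2 * K * K * L) ≤⟨ *-monoʳ-≤ ((2 + K) * (p * Λ)) (+-monoʳ-≤ (K * q) long) ⟩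
          (2 + K) * (p * Λ) * (K * q + q) ≡⟨ eq₃ K p Λ q ⟩
          (K * K + 3 * K + 2) * (q * p * Λ) ≤⟨ *-monoˡ-≤ (q * p * Λ) (+-monoʳ-≤ (K * K + 3 * K) (*-monoʳ-≤ 2 0<K)) ⟩
          (K * K + 3 * K + 2 * K) * (q * p * Λ) ≡⟨ eq₄ K (q * p) Λ ⟩
          K * ((K + 5) * (q * p * Λ)) ∎)
          where
          eq₂ : ∀ K p Λ q L → K * ((2 + K) * (p * Λ) * q + (2 * K * suc K * (p * Λ) + K * (p * (2 * Λ))) * L) ≡ (2 + K) * (p * Λ) * (K * q + 2 * K * K * L)
          eq₂ = solve-∀
          eq₃ : ∀ K p Λ q → (2 + K) * (p * Λ) * (K * q + q) ≡ (K * K + 3 * K + 2) * (q * p * Λ)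
          eq₃ = solve-∀
          eq₄ : ∀ K x Λ → (K * K + 3 * K + 2 * K) * (x * Λ) ≡ K * ((K + 5) * (x * Λ))
          eq₄ = solve-∀
        consumed : K * (u * ∑ R (f θ)) ≤ K * (x * (k * cnt θ)) + 5 * (x * Λ)
        consumed = +-cancelʳ-≤ (K * (x * z)) _ _ (begin
          K * (u * ∑ R (f θ)) + K * (x * z) ≡⟨ *-distribˡ-+ K _ _ ⟨
          K * (u * ∑ R (f θ) + x * z) ≤⟨ total′ ⟩
          (K + 5) * (x * Λ) ≡⟨ cong (λ l → (K + 5) * (x * l)) (sym (pad θ)) ⟩
          (K + 5) * (x * (z + k * cnt θ)) ≡⟨ eq₅ K x z (k * cnt θ) ⟩
          K * (x * (k * cnt θ)) + 5 * (x * (z + k * cnt θ)) + K * (x * z) ≡⟨ cong (λ l → K * (x * (k * cnt θ)) + 5 * (x * l) + K * (x * z)) (pad θ) ⟩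
          K * (x * (k * cnt θ)) + 5 * (x * Λ) + K * (x * z) ∎)
          where
          eq₅ : ∀ K x z c → (K + 5) * (x * (z + c)) ≡ K * (x * c) + 5 * (x * (z + c)) + K * (x * z)
          eq₅ = solve-∀

-- The nibble: iterating the phases

-- (u − x)^k = u^k − k x u^(k−1) + O(x² u^(k−2)), cleared of subtraction and negative exponents.
power-step : ∀ x y k → y ^ k * ((y + x) * (y + x)) + k * x * ((y + x) * (y + x) ^ k) ≤
    (y + x) * ((y + x) * (y + x) ^ k) + k * k * (x * x) * (y + x) ^ k
power-step x y zero = ≤-reflexive (eq x y)
  where
  eq : ∀ x y → 1 * ((y + x) * (y + x)) + 0 * x * ((y + x) * 1) ≡ (y + x) * ((y + x) * 1) + 0 * 0 * (x * x) * 1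
  eq = solve-∀
power-step x y (suc k) = +-cancelʳ-≤ (y * (k * x * (u * p))) _ _ (begin
  y * y ^ k * (u * u) + suc k * x * (u * (u * p)) + y * (k * x * (u * p)) ≡⟨ eq₁ y (y ^ k) u k x p ⟩
  y * (y ^ k * (u * u) + k * x * (u * p)) + suc k * x * (u * (u * p)) ≤⟨ +-monoˡ-≤ _ (*-monoʳ-≤ y (power-step x y k)) ⟩
  y * (u * (u * p) + k * k * (x * x) * p) + suc k * x * (u * (u * p)) ≤⟨ m≤m+n _ (k * k * (x * x) * x * p + suc k * (x * x) * (u * p)) ⟩
  y * (u * (u * p) + k * k * (x * x) * p) + suc k * x * (u * (u * p)) + (k * k * (x * x) * x * p + suc k * (x * x) * (u * p))
    ≡⟨ eq₂ y x k p ⟩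
  u * (u * (u * p)) + suc k * suc k * (x * x) * (u * p) + y * (k * x * (u * p)) ∎)
  where
  open ≤-Reasoning
  u = y + x
  p = u ^ k
  eq₁ : ∀ y q u k x p → y * q * (u * u) + suc k * x * (u * (u * p)) + y * (k * x * (u * p)) ≡
      y * (q * (u * u) + k * x * (u * p)) + suc k * x * (u * (u * p))
  eq₁ = solve-∀
  eq₂ : ∀ y x k p → y * ((y + x) * ((y + x) * p) + k * k * (x * x) * p) + suc k * x * ((y + x) * ((y + x) * p)) + (k * k * (x * x) * x * p + suc k * (x * x) * ((y + x) * p)) ≡
      (y + x) * ((y + x) * ((y + x) * p)) + suc k * suc k * (x * x) * ((y + x) * p) + y * (k * x * ((y + x) * p))
  eq₂ = solve-∀

module _ (k x y c c″ K Z ζ A : ℕ) where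
  private
    u = y + x

  -- A phase costs every test one unit 1 / Z of relative density. Half of it pays for the
  -- second-order term of (u - x) ^ k, half for the error 5 / K of the phase; the factors 2 ^ k come
  -- from u ≤ 2 y.
  density-step : 0 < u → 0 < K → x ≤ y → k * x ≤ u → suc A ≤ Z →
    K * (u * c) ≤ K * (u * c″) + (K * (x * (k * c)) + 5 * (x * (k * u ^ k))) → suc A * u ^ k ≤ Z * ζ * c →
    2 * 2 ^ k * (Z * (k * k * (x * x))) ≤ u * u → 2 * 2 ^ k * (5 * (Z * ζ) * (k * x)) ≤ K * u →
    A * y ^ k ≤ Z * ζ * c″
  density-step 0<u 0<K x≤y kx≤u A<Z retained dense small₁ small₂ = *-cancelˡ-≤ (K * (u * u)) {{>-nonZero (*-mono-≤ 0<K (*-mono-≤ 0<u 0<u))}} (+-cancelʳ-≤ (K * (u * u) * y ^ k) _ _ (begin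
    K * (u * u) * (A * y ^ k) + K * (u * u) * y ^ k ≡⟨ eq₁ K u A (y ^ k) ⟩
    K * suc A * (y ^ k * (u * u)) ≤⟨ *-monoʳ-≤ (K * suc A) lower ⟩
    K * suc A * (u * (u ^ k * v) + k * k * (x * x) * u ^ k) ≡⟨ eq₂ K (suc A) u (u ^ k) v (k * k * (x * x)) ⟩
    u * (K * v * (suc A * u ^ k)) + K * (suc A * (k * k * (x * x))) * u ^ k
      ≤⟨ +-mono-≤ (*-monoʳ-≤ u kept) (*-monoˡ-≤ (u ^ k) (*-monoʳ-≤ K (*-monoˡ-≤ (k * k * (x * x)) A<Z))) ⟩
    u * (K * u * (Z * ζ * c″) + 5 * (Z * ζ) * (k * x) * u ^ k) + K * (Z * (k * k * (x * x))) * u ^ k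
      ≡⟨ eq₃ u K (Z * ζ * c″) (5 * (Z * ζ) * (k * x)) (u ^ k) (Z * (k * k * (x * x))) ⟩
    K * (u * u) * (Z * ζ * c″) + (5 * (Z * ζ) * (k * x) * (u * u ^ k) + K * (Z * (k * k * (x * x))) * u ^ k)
      ≤⟨ +-monoʳ-≤ (K * (u * u) * (Z * ζ * c″)) error ⟩
    K * (u * u) * (Z * ζ * c″) + K * (u * u) * y ^ k ∎))
    where
    open ≤-Reasoning
    v = u ∸ k * x
    v+ : v + k * x ≡ u
    v+ = m∸n+n≡m kx≤u
    eq₁ : ∀ K u A p → K * (u * u) * (A * p) + K * (u * u) * p ≡ K * suc A * (p * (u * u))
    eq₁ = solve-∀
    eq₂ : ∀ K A u p v s → K * A * (u * (p * v) + s * p) ≡ u * (K * v * (A * p)) + K * (A * s) * p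
    eq₂ = solve-∀
    eq₃ : ∀ u K c f p s → u * (K * u * c + f * p) + K * s * p ≡ K * (u * u) * c + (f * (u * p) + K * s * p)
    eq₃ = solve-∀
    lower : y ^ k * (u * u) ≤ u * (u ^ k * v) + k * k * (x * x) * u ^ k
    lower = +-cancelʳ-≤ (k * x * (u * u ^ k)) _ _ (≤-trans (power-step x y k) (≤-reflexive (trans (cong (λ w → u * (w * u ^ k) + k * k * (x * x) * u ^ k) (sym v+)) (eq u v (k * x) (u ^ k) (k * k * (x * x))))))
      where
      eq : ∀ u v s p q → u * ((v + s) * p) + q * p ≡ u * (p * v) + q * p + s * (u * p)
      eq = solve-∀
    kept : K * v * (suc A * u ^ k) ≤ K * u * (Z * ζ * c″) + 5 * (Z * ζ) * (k * x) * u ^ k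
    kept = ≤-trans (*-monoʳ-≤ (K * v) dense) (+-cancelʳ-≤ (Z * ζ * (K * (x * (k * c)))) _ _ (begin
      K * v * (Z * ζ * c) + Z * ζ * (K * (x * (k * c))) ≡⟨ eq K v (Z * ζ) c x k ⟩
      Z * ζ * (K * ((v + k * x) * c)) ≡⟨ cong (λ w → Z * ζ * (K * (w * c))) v+ ⟩
      Z * ζ * (K * (u * c)) ≤⟨ *-monoʳ-≤ (Z * ζ) retained ⟩
      Z * ζ * (K * (u * c″) + (K * (x * (k * c)) + 5 * (x * (k * u ^ k)))) ≡⟨ eq′ (Z * ζ) K u c″ (K * (x * (k * c))) x k (u ^ k) ⟩
      K * u * (Z * ζ * c″) + 5 * (Z * ζ) * (k * x) * u ^ k + Z * ζ * (K * (x * (k * c))) ∎))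
      where
      eq : ∀ K v z c x k → K * v * (z * c) + z * (K * (x * (k * c))) ≡ z * (K * ((v + k * x) * c))
      eq = solve-∀
      eq′ : ∀ z K u c m x k p → z * (K * (u * c) + (m + 5 * (x * (k * p)))) ≡ K * u * (z * c) + 5 * z * (k * x) * p + z * m
      eq′ = solve-∀
    error : 5 * (Z * ζ) * (k * x) * (u * u ^ k) + K * (Z * (k * k * (x * x))) * u ^ k ≤ K * (u * u) * y ^ k
    error = *-cancelˡ-≤ (2 * 2 ^ k) {{m*n≢0 2 (2 ^ k) {{_}} {{m^n≢0 2 k}}}} (begin
      2 * 2 ^ k * (5 * (Z * ζ) * (k * x) * (u * u ^ k) + K * (Z * (k * k * (x * x))) * u ^ k)
        ≡⟨ eq (2 * 2 ^ k) (5 * (Z * ζ) * (k * x)) u (u ^ k) K (Z * (k * k * (x * x))) ⟩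
      2 * 2 ^ k * (5 * (Z * ζ) * (k * x)) * (u * u ^ k) + 2 * 2 ^ k * (Z * (k * k * (x * x))) * (K * u ^ k)
        ≤⟨ +-mono-≤ (*-monoˡ-≤ (u * u ^ k) small₂) (*-monoˡ-≤ (K * u ^ k) small₁) ⟩
      K * u * (u * u ^ k) + u * u * (K * u ^ k) ≡⟨ eq′ K u (u ^ k) ⟩
      2 * (K * (u * u)) * u ^ k ≤⟨ *-monoʳ-≤ (2 * (K * (u * u))) (^-monoˡ-≤ k (≤-trans (+-monoʳ-≤ y x≤y) (≤-reflexive (cong (y +_) (sym (+-identityʳ y)))))) ⟩
      2 * (K * (u * u)) * (2 * y) ^ k ≡⟨ cong (2 * (K * (u * u)) *_) (^-distribʳ-* k 2 y) ⟩
      2 * (K * (u * u)) * (2 ^ k * y ^ k) ≡⟨ eq″ (K * (u * u)) (2 ^ k) (y ^ k) ⟩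
      2 * 2 ^ k * (K * (u * u) * y ^ k) ∎)
      where
      eq : ∀ e f u p K s → e * (f * (u * p) + K * s * p) ≡ e * f * (u * p) + e * s * (K * p)
      eq = solve-∀
      eq′ : ∀ K u p → K * u * (u * p) + u * u * (K * p) ≡ 2 * (K * (u * u)) * p
      eq′ = solve-∀
      eq″ : ∀ a b c → 2 * a * (b * c) ≡ 2 * b * (a * c)
      eq″ = solve-∀

-- For sets `R` that nobody has balanced: the vertices of the absorbers, and the tiles chosen so far
-- within an unfinished phase.
crude-loss : ∀ {n} (R U′ : List (Fin n)) {U} k₁ (θ : List (Fin n) → Bool) → Unique U → U ↭ R ++ U′ →
    count U (suc k₁) θ ≤ count U′ (suc k₁) θ + suc k₁ * length U ^ k₁ * length R
crude-loss R U′ {U} k₁ θ un perm = begin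
  count U k θ ≡⟨ ∑-tuples-↭ k perm _ ⟩
  count (R ++ U′) k θ ≤⟨ ∑-tuples-loss R U′ k _ ⟩
  count U′ k θ + ∑ (tuples (R ++ U′) k) (λ y → ⟦ θ y ⟧ * hits R y) ≤⟨ +-monoʳ-≤ (count U′ k θ) (∑-mono (tuples (R ++ U′) k) (λ y → ≤-trans (*-monoˡ-≤ (hits R y) (⟦⟧≤1 (θ y))) (≤-reflexive (*-identityˡ (hits R y))))) ⟩
  count U′ k θ + ∑ (tuples (R ++ U′) k) (hits R) ≡⟨ cong (count U′ k θ +_) (trans (∑-tuples-↭ k (↭-sym perm) _) (∑-tuples-∑ U k₁ _)) ⟩
  count U′ k θ + k * length U ^ k₁ * ∑ U (λ z → ∑ R (λ v → equal v z)) ≤⟨ +-monoʳ-≤ (count U′ k θ) (*-monoʳ-≤ (k * length U ^ k₁) (≤-trans (≤-reflexive (∑-swap U R _)) (≤-trans (∑-≤ R (λ {v} _ → ∑-equal≤1′ un v)) (≤-reflexive (*-identityʳ _))))) ⟩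
  count U′ k θ + k * length U ^ k₁ * length R ∎
  where
  open ≤-Reasoning
  k = suc k₁

-- One phase removes between n / Z₂ and 2 n / Z₂ vertices, so `Z₂` phases are enough; the process
-- stops when fewer than n / b vertices are uncovered. The conditions c-... say that `Z₂`, and for
-- `c-rate` also `K`, is large in terms of the other constants.
record NibbleSetting : Set₁ where
  field
    {n} : ℕ
    k₁ p q L K Z₁ Z₂ ζ̄ b : ℕ
    IsTile : List (Fin n) → Set
    size : ∀ {P} → IsTile P → length P ≡ p
    tests : List (ℕ × (List (Fin n) → Bool))
    few : length tests ≤ 2 ^ L
    bounded : ∀ {ζ θ} → (ζ , θ) ∈ tests → ζ ≤ ζ̄
    0<n : 0 < n
    0<p : 0 < p
    0<K : 0 < K
    0<Z₁ : 0 < Z₁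
    0<Z₂ : 0 < Z₂
    removed≤ : Z₂ * (q * p) ≤ 2 * n
    removed≥ : n ≤ Z₂ * (q * p)
    long : 2 * K * K * L ≤ q
    c-short : suc (2 * K) * (2 * b) ≤ Z₂
    c-crude : 3 * Z₁ * ζ̄ * suc k₁ * (2 * b) ≤ Z₂
    c-size : suc k₁ * (2 * b) ≤ Z₂
    c-square : 2 * 2 ^ suc k₁ * (3 * Z₁ * (suc k₁ * suc k₁)) * (2 * b * (2 * b)) ≤ Z₂
    c-rate : 2 * 2 ^ suc k₁ * (15 * Z₁ * ζ̄ * suc k₁) * (2 * b) ≤ K

module Nibble (ν : NibbleSetting) where
  open NibbleSetting ν

  private
    k x Z : ℕ
    k = suc k₁
    x = q * p
    Z = 3 * Z₁ * Z₂

    Θ = map proj₂ tests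

  -- Density at least (1 - j / Z) / ζ. Since Z = 3 Z₁ Z₂, the admissible deficit 1 / Z₁ splits into
  -- three parts of `Z₂` units each: the deficit before the first phase, one unit for every phase,
  -- and the temporary deficit within a phase.
  Dense : ℕ → List (Fin n) → Set
  Dense j U = ∀ {ζ θ} → (ζ , θ) ∈ tests → (Z ∸ j) * length U ^ k ≤ Z * ζ * count U k θ

  Oracle′ : Set
  Oracle′ = ∀ U → Unique U → n ≤ 2 * b * length U → Dense (3 * Z₂) U → ∀ w →
    ∃[ P ] IsTile P × Unique P × All (_∈ U) P × suc (2 * K) * length U * ∑ P w ≤ suc (suc (2 * K)) * p * ∑ U w

  record Covering (U : List (Fin n)) : Set where
    field
      Ts : List (List (Fin n))
      U* : List (Fin n)
      tiles : All IsTile Ts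
      split : U ↭ concat Ts ++ U*
      small : b * length U* < n
      large : n ≤ 2 * b * length U*
      dense : Dense (2 * Z₂) U*

  module _ (oracle : Oracle′) where

    scale : ∀ {u} c → n ≤ b * u → c * (2 * b) ≤ Z₂ → c * x ≤ u
    scale {u} c n≤bu c≤ = *-cancelˡ-≤ Z₂ {{>-nonZero 0<Z₂}} (begin
      Z₂ * (c * x) ≡⟨ *-exchange Z₂ c x ⟩
      c * (Z₂ * x) ≤⟨ *-monoʳ-≤ c (≤-trans removed≤ (*-monoʳ-≤ 2 n≤bu)) ⟩
      c * (2 * (b * u)) ≡⟨ assoc c b u ⟩
      c * (2 * b) * u ≤⟨ *-monoˡ-≤ u c≤ ⟩
      Z₂ * u ∎)
      where
      open ≤-Reasoning
      assoc : ∀ c b u → c * (2 * (b * u)) ≡ c * (2 * b) * u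
      assoc = solve-∀

    record Stage : Set where
      field
        U : List (Fin n)
        i : ℕ
        uniq : Unique U
        n≤bu : n ≤ b * length U
        i<Z₂ : i < Z₂
        dense : Dense (Z₂ + i) U

    module _ (stage : Stage) where
      open Stage stage
      private
        u = length U
        open ≤-Reasoning

        0<u : 0 < u
        0<u = n≢0⇒n>0 λ u≡0 → <⇒≱ 0<n (≤-trans n≤bu (≤-reflexive (trans (cong (b *_) u≡0) (*-zeroʳ b))))

        short : suc (2 * K) * x ≤ u
        short = scale (suc (2 * K)) n≤bu c-short

        2x≤u : 2 * x ≤ u
        2x≤u = ≤-trans (*-monoˡ-≤ x (≤-trans (m≤m*n 2 K {{>-nonZero 0<K}}) (n≤1+n (2 * K)))) short

        half-left : ∀ {u′} → u ≤ x + u′ → n ≤ 2 * b * u′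
        half-left {u′} le = begin
          n ≤⟨ n≤bu ⟩
          b * u ≤⟨ *-monoʳ-≤ b (+-cancelˡ-≤ u _ _ (begin
            u + u ≤⟨ +-mono-≤ le le ⟩
            x + u′ + (x + u′) ≡⟨ eq x u′ ⟩
            2 * x + 2 * u′ ≤⟨ +-monoˡ-≤ (2 * u′) 2x≤u ⟩
            u + 2 * u′ ∎)) ⟩
          b * (2 * u′) ≡⟨ eq′ b u′ ⟩
          2 * b * u′ ∎
          where
          eq : ∀ x u → x + u + (x + u) ≡ 2 * x + 2 * u
          eq = solve-∀
          eq′ : ∀ b u → b * (2 * u) ≡ 2 * b * u
          eq′ = solve-∀

        -- The third part of the slack: the vertices already removed in the current phase, at most x
        -- of them, cost no more than `Z₂` units by the crude bound.
        weaken : ∀ R U′ → U ↭ R ++ U′ → length R ≤ x → Dense (3 * Z₂) U′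
        weaken R U′ perm R≤ {ζ} {θ} θ∈ = +-cancelʳ-≤ (Z₂ * u ^ k) _ _ (begin
          (Z ∸ 3 * Z₂) * length U′ ^ k + Z₂ * u ^ k ≤⟨ +-monoˡ-≤ (Z₂ * u ^ k) (*-monoʳ-≤ (Z ∸ 3 * Z₂) (^-monoˡ-≤ k u′≤u)) ⟩
          (Z ∸ 3 * Z₂) * u ^ k + Z₂ * u ^ k ≡⟨ *-distribʳ-+ (u ^ k) (Z ∸ 3 * Z₂) Z₂ ⟨
          (Z ∸ 3 * Z₂ + Z₂) * u ^ k ≤⟨ *-monoˡ-≤ (u ^ k) slack ⟩
          (Z ∸ (Z₂ + i)) * u ^ k ≤⟨ dense θ∈ ⟩
          Z * ζ * count U k θ ≤⟨ *-monoʳ-≤ (Z * ζ) (≤-trans (crude-loss R U′ k₁ θ uniq perm) (+-monoʳ-≤ (count U′ k θ) (*-monoʳ-≤ (k * u ^ k₁) R≤))) ⟩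
          Z * ζ * (count U′ k θ + k * u ^ k₁ * x) ≡⟨ eq Z₁ Z₂ ζ (count U′ k θ) k (u ^ k₁) x ⟩
          Z * ζ * count U′ k θ + Z₂ * (3 * Z₁ * ζ * k * x * u ^ k₁)
            ≤⟨ +-monoʳ-≤ (Z * ζ * count U′ k θ) (*-monoʳ-≤ Z₂ (*-monoˡ-≤ (u ^ k₁) (≤-trans (*-monoˡ-≤ x (*-monoˡ-≤ k (*-monoʳ-≤ (3 * Z₁) (bounded θ∈)))) (scale (3 * Z₁ * ζ̄ * k) n≤bu c-crude)))) ⟩
          Z * ζ * count U′ k θ + Z₂ * u ^ k ∎)
          where
          u′≤u : length U′ ≤ u
          u′≤u = ≤-trans (m≤n+m _ (length R)) (≤-reflexive (trans (sym (length-++ R)) (sym (↭-length perm))))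
          eq : ∀ Z₁ Z₂ ζ c k p x → 3 * Z₁ * Z₂ * ζ * (c + k * p * x) ≡ 3 * Z₁ * Z₂ * ζ * c + Z₂ * (3 * Z₁ * ζ * k * x * p)
          eq = solve-∀
          3Z₂≤Z : 3 * Z₂ ≤ Z
          3Z₂≤Z = *-monoˡ-≤ Z₂ (m≤m*n 3 Z₁ {{>-nonZero 0<Z₁}})
          slack : Z ∸ 3 * Z₂ + Z₂ ≤ Z ∸ (Z₂ + i)
          slack = m+n≤o⇒m≤o∸n (Z ∸ 3 * Z₂ + Z₂) (begin
            Z ∸ 3 * Z₂ + Z₂ + (Z₂ + i) ≤⟨ +-monoʳ-≤ (Z ∸ 3 * Z₂ + Z₂) (+-monoʳ-≤ Z₂ (<⇒≤ i<Z₂)) ⟩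
            Z ∸ 3 * Z₂ + Z₂ + (Z₂ + Z₂) ≡⟨ eq₂ (Z ∸ 3 * Z₂) Z₂ ⟩
            Z ∸ 3 * Z₂ + 3 * Z₂ ≡⟨ m∸n+n≡m 3Z₂≤Z ⟩
            Z ∎)
            where
            eq₂ : ∀ a z → a + z + (z + z) ≡ a + 3 * z
            eq₂ = solve-∀

      phase-setting : PhaseSetting
      phase-setting = record
        { k₁ = k₁ ; p = p ; q = q ; L = L ; K = K ; IsTile = IsTile ; size = size ; Θ = Θ
        ; few = ≤-trans (≤-reflexive (length-map proj₂ tests)) few ; 0<p = 0<p ; 0<K = 0<K
        ; U = U ; uniq = uniq ; 0<u = 0<u ; short = short ; long = long
        ; oracle = λ R U′ perm R≤ w → oracle U′ (proj₁ (proj₂ (unique-++⁻ R (unique-resp-↭ perm uniq))))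
          (half-left (≤-trans (≤-reflexive (trans (↭-length perm) (length-++ R))) (+-monoˡ-≤ (length U′) R≤))) (weaken R U′ perm R≤) w }

      open NibblePhase using (PhaseResult)

      module _ (res : PhaseResult phase-setting) where
        open PhaseResult res

        private
          y = length rest

          removed : length (concat chosen) ≡ x
          removed = trans (total tiles) (cong (_* p) number)
            where
            total : ∀ {h} → All IsTile h → length (concat h) ≡ length h * p
            total [] = refl
            total {P ∷ h} (t ∷ ts) = trans (length-++ P) (cong₂ _+_ (size t) (total ts))

          u≡ : u ≡ y + x
          u≡ = trans (↭-length split) (trans (length-++ (concat chosen)) (trans (cong (_+ y) removed) (+-comm x y)))

        rest-size : n ≤ 2 * b * y
        rest-size = half-left (≤-reflexive (trans u≡ (+-comm y x)))

        rest-fuel : ∀ {f} → u ≤ suc f * x → y ≤ f * x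
        rest-fuel le = +-cancelʳ-≤ x _ _ (≤-trans (≤-reflexive (sym u≡)) (≤-trans le (≤-reflexive (+-comm x _))))

        rest-dense : Dense (Z₂ + suc i) rest
        rest-dense {ζ} {θ} θ∈ = density-step k x y (count U k θ) (count rest k θ) K Z ζ (Z ∸ (Z₂ + suc i))
          (subst (0 <_) u≡ 0<u) 0<K x≤y (subst (k * x ≤_) u≡ (scale k n≤bu c-size)) suc-A≤Z
          (subst (λ v → K * (v * count U k θ) ≤ K * (v * count rest k θ) + (K * (x * (k * count U k θ)) + 5 * (x * (k * v ^ k)))) u≡ (retained (∈-map⁺ proj₂ θ∈)))
          (subst₂ (λ a v → a * v ^ k ≤ Z * ζ * count U k θ) (sym suc-A) u≡ (dense θ∈))
          (subst (λ v → 2 * 2 ^ k * (Z * (k * k * (x * x))) ≤ v * v) u≡ square)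
          (subst (λ v → 2 * 2 ^ k * (5 * (Z * ζ) * (k * x)) ≤ K * v) u≡ rate)
          where
          x≤y : x ≤ y
          x≤y = +-cancelʳ-≤ x x y (≤-trans (≤-reflexive (cong (x +_) (sym (+-identityʳ x)))) (≤-trans 2x≤u (≤-reflexive u≡)))
          Z₂+i<Z : Z₂ + suc i ≤ Z
          Z₂+i<Z = ≤-trans (+-monoʳ-≤ Z₂ i<Z₂) (≤-trans (≤-trans (≤-reflexive (eq₀ Z₂)) (*-monoˡ-≤ Z₂ (n≤1+n 2))) (*-monoˡ-≤ Z₂ (m≤m*n 3 Z₁ {{>-nonZero 0<Z₁}})))
            where
            eq₀ : ∀ z → z + z ≡ 2 * z
            eq₀ = solve-∀
          suc-A : suc (Z ∸ (Z₂ + suc i)) ≡ Z ∸ (Z₂ + i)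
          suc-A = trans (sym (+-∸-assoc 1 Z₂+i<Z)) (cong (suc Z ∸_) (+-suc Z₂ i))
          suc-A≤Z : suc (Z ∸ (Z₂ + suc i)) ≤ Z
          suc-A≤Z = ≤-trans (≤-reflexive suc-A) (m∸n≤m Z (Z₂ + i))
          square : 2 * 2 ^ k * (Z * (k * k * (x * x))) ≤ u * u
          square = *-cancelˡ-≤ Z₂ {{>-nonZero 0<Z₂}} (begin
            Z₂ * (2 * 2 ^ k * (Z * (k * k * (x * x)))) ≡⟨ eq₁ Z₂ (2 * 2 ^ k) Z₁ k x ⟩
            2 * 2 ^ k * (3 * Z₁ * (k * k)) * (Z₂ * x * (Z₂ * x)) ≤⟨ *-monoʳ-≤ (2 * 2 ^ k * (3 * Z₁ * (k * k))) (*-mono-≤ Z₂x≤ Z₂x≤) ⟩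
            2 * 2 ^ k * (3 * Z₁ * (k * k)) * (2 * (b * u) * (2 * (b * u))) ≡⟨ eq₂ (2 * 2 ^ k * (3 * Z₁ * (k * k))) b u ⟩
            2 * 2 ^ k * (3 * Z₁ * (k * k)) * (2 * b * (2 * b)) * (u * u) ≤⟨ *-monoˡ-≤ (u * u) c-square ⟩
            Z₂ * (u * u) ∎)
            where
            Z₂x≤ : Z₂ * x ≤ 2 * (b * u)
            Z₂x≤ = ≤-trans removed≤ (*-monoʳ-≤ 2 n≤bu)
            eq₁ : ∀ z e Z₁ k x → z * (e * (3 * Z₁ * z * (k * k * (x * x)))) ≡ e * (3 * Z₁ * (k * k)) * (z * x * (z * x))
            eq₁ = solve-∀
            eq₂ : ∀ c b u → c * (2 * (b * u) * (2 * (b * u))) ≡ c * (2 * b * (2 * b)) * (u * u)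
            eq₂ = solve-∀
          rate : 2 * 2 ^ k * (5 * (Z * ζ) * (k * x)) ≤ K * u
          rate = begin
            2 * 2 ^ k * (5 * (Z * ζ) * (k * x)) ≡⟨ eq₁ (2 * 2 ^ k) Z₁ Z₂ ζ k x ⟩
            2 * 2 ^ k * (15 * Z₁ * ζ * k) * (Z₂ * x) ≤⟨ *-mono-≤ (*-monoʳ-≤ (2 * 2 ^ k) (*-monoˡ-≤ k (*-monoʳ-≤ (15 * Z₁) (bounded θ∈)))) (≤-trans removed≤ (*-monoʳ-≤ 2 n≤bu)) ⟩
            2 * 2 ^ k * (15 * Z₁ * ζ̄ * k) * (2 * (b * u)) ≡⟨ eq₂ (2 * 2 ^ k * (15 * Z₁ * ζ̄ * k)) b u ⟩
            2 * 2 ^ k * (15 * Z₁ * ζ̄ * k) * (2 * b) * u ≤⟨ *-monoˡ-≤ u c-rate ⟩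
            K * u ∎
            where
            eq₁ : ∀ e Z₁ Z₂ ζ k x → e * (5 * (3 * Z₁ * Z₂ * ζ) * (k * x)) ≡ e * (15 * Z₁ * ζ * k) * (Z₂ * x)
            eq₁ = solve-∀
            eq₂ : ∀ c b u → c * (2 * (b * u)) ≡ c * (2 * b) * u
            eq₂ = solve-∀

    -- `f` is the number of phases left; with none left `U` would be empty, contrary to n ≤ 2 b ·
    -- `length U`. That bound persists because a phase starts only with at least n / b vertices and
    -- removes at most half of them.
    nibble : ∀ f i U → i + f ≡ Z₂ → Unique U → length U ≤ f * x → n ≤ 2 * b * length U → Dense (Z₂ + i) U → Covering U
    nibble f i U i+f uniq fuel large dense with b * length U <? n
    ... | yes lt = record { Ts = [] ; U* = U ; tiles = [] ; split = ↭-refl ; small = lt ; large = large ; dense = λ {ζ} θ∈ → ≤-trans (*-monoˡ-≤ (length U ^ k) (∸-monoʳ-≤ Z (≤-trans (+-monoʳ-≤ Z₂ (≤-trans (m≤m+n i f) (≤-reflexive i+f))) (≤-reflexive (cong (Z₂ +_) (sym (+-identityʳ Z₂))))))) (dense θ∈) }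
    nibble zero i U i+f uniq fuel large dense | no ≮n =
      ⊥-elim (<⇒≱ 0<n (≤-trans large (≤-trans (*-monoʳ-≤ (2 * b) fuel) (≤-reflexive (*-zeroʳ (2 * b))))))
    nibble (suc f) i U i+f uniq fuel large dense | no ≮n = extend (NibblePhase.phase (phase-setting stage))
      where
      i<Z₂ : i < Z₂
      i<Z₂ = ≤-trans (m≤m+n (suc i) f) (≤-reflexive (trans (sym (+-suc i f)) i+f))
      stage : Stage
      stage = record { U = U ; i = i ; uniq = uniq ; n≤bu = ≮⇒≥ ≮n ; i<Z₂ = i<Z₂ ; dense = dense }
      extend : NibblePhase.PhaseResult (phase-setting stage) → Covering U
      extend res = combine (nibble f (suc i) rest (trans (sym (+-suc i f)) i+f) (proj₁ (proj₂ (unique-++⁻ (concat chosen) (unique-resp-↭ split uniq))))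
          (rest-fuel stage res {f} fuel) (rest-size stage res) (rest-dense stage res))
        where
        open NibblePhase.PhaseResult res
        combine : Covering rest → Covering U
        combine cov = record
          { Ts = chosen ++ Covering.Ts cov ; U* = Covering.U* cov ; tiles = Allₚ.++⁺ tiles (Covering.tiles cov)
          ; split = ↭-trans split (↭-trans (Permₚ.++⁺ˡ (concat chosen) (Covering.split cov)) (↭-reflexive (trans (sym (++-assoc (concat chosen) _ _)) (cong (_++ Covering.U* cov) (concat-++ chosen (Covering.Ts cov))))))
          ; small = Covering.small cov ; large = Covering.large cov ; dense = Covering.dense cov }

-- Constraint systems and their solutions in boxes

-- Symbolic vertices: parameters, and variables named by their level in the order of choice.
data Sym : Set where
  par var : ℕ → Sym

-- A variable is either unrestricted, or the last vertex of an edge whose other vertices are given.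
data Constraint : Set where
  free : Constraint
  last : List Sym → Constraint

module _ {A : Set} (a₀ : A) where

  nth : List A → ℕ → A
  nth [] i = a₀
  nth (x ∷ xs) zero = x
  nth (x ∷ xs) (suc i) = nth xs i

  -- Lists of chosen values are stored newest first.
  level : List A → ℕ → A
  level [] i = a₀
  level (x ∷ xs) i = if? (i ≟ length xs) x (level xs i)

  eval : List A → List A → Sym → A
  eval ps xs (par i) = nth ps i
  eval ps xs (var i) = level xs i

  module _ (E : List A → Bool) (ps : List A) where

    check : Constraint → List A → A → Bool
    check free xs x = true
    check (last S) xs x = E (x ∷ map (eval ps xs) S)

    holds : List Constraint → List A → Bool
    holds [] [] = true
    holds [] (_ ∷ _) = false
    holds (_ ∷ _) [] = false
    holds (c ∷ cs) (x ∷ xs) = holds cs xs ∧ check c xs x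

    holds-length : ∀ cs xs → holds cs xs ≡ true → length xs ≡ length cs
    holds-length [] [] eq = refl
    holds-length (c ∷ cs) (x ∷ xs) eq = cong suc (holds-length cs xs (proj₁ (∧-true eq)))

  level-new : ∀ x xs → level (x ∷ xs) (length xs) ≡ x
  level-new x xs with length xs ≟ length xs
  ... | yes _ = refl
  ... | no ¬p = ⊥-elim (¬p refl)

  level-old : ∀ x xs {i} → i < length xs → level (x ∷ xs) i ≡ level xs i
  level-old x xs {i} i< with i ≟ length xs
  ... | yes refl = ⊥-elim (<-irrefl refl i<)
  ... | no _ = refl

Scoped : ℕ → Sym → Set
Scoped m (par i) = ⊤
Scoped m (var i) = i < m

scoped-weaken : ∀ {m m′} s → m ≤ m′ → Scoped m s → Scoped m′ s
scoped-weaken (par i) le sc = tt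
scoped-weaken (var i) le sc = <-≤-trans sc le

levels : List Sym → List ℕ
levels [] = []
levels (par i ∷ e) = levels e
levels (var i ∷ e) = i ∷ levels e

levels-++ : ∀ e e′ → levels (e ++ e′) ≡ levels e ++ levels e′
levels-++ [] e′ = refl
levels-++ (par i ∷ e) e′ = levels-++ e e′
levels-++ (var i ∷ e) e′ = cong (i ∷_) (levels-++ e e′)

levels-var : ∀ is → levels (map var is) ≡ is
levels-var [] = refl
levels-var (i ∷ is) = cong (i ∷_) (levels-var is)

levels-↭ : ∀ {e e′} → e ↭ e′ → levels e ↭ levels e′
levels-↭ Perm.refl = ↭-refl
levels-↭ (prep (par i) p) = levels-↭ p
levels-↭ (prep (var i) p) = prep i (levels-↭ p)
levels-↭ (swap (par i) (par j) p) = levels-↭ p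
levels-↭ (swap (par i) (var j) p) = prep j (levels-↭ p)
levels-↭ (swap (var i) (par j) p) = prep i (levels-↭ p)
levels-↭ (swap (var i) (var j) p) = swap i j (levels-↭ p)
levels-↭ (Perm.trans p q) = ↭-trans (levels-↭ p) (levels-↭ q)

levels-∈ : ∀ {i} e → i ∈ levels e → var i ∈ e
levels-∈ (par j ∷ e) i∈ = there (levels-∈ e i∈)
levels-∈ (var j ∷ e) (here refl) = here refl
levels-∈ (var j ∷ e) (there i∈) = there (levels-∈ e i∈)

-- Every solution of the constraints makes e an edge, whatever the hypergraph.
Knows : List Constraint → List Sym → Set
Knows cs e = ∀ {n} (a₀ : Fin n) (E : List (Fin n) → Bool) → (∀ {xs ys} → xs ↭ ys → E xs ≡ true → E ys ≡ true) →
    ∀ ps xs → holds a₀ E ps cs xs ≡ true → E (map (eval a₀ ps xs) e) ≡ true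

-- `distinct` allows the rows of a box to supply the variables of the edge independently of each
-- other; on the parameters it imposes nothing.
record Good (cs : List Constraint) (e : List Sym) : Set where
  field
    knows : Knows cs e
    distinct : Unique (levels e)
    scoped : All (Scoped (length cs)) e

good-resp : ∀ {cs e e′} → e ↭ e′ → Good cs e → Good cs e′
good-resp p g = record
  { knows = λ a₀ E resp ps xs h → resp (Permₚ.map⁺ (eval a₀ ps xs) p) (Good.knows g a₀ E resp ps xs h)
  ; distinct = unique-resp-↭ (levels-↭ p) (Good.distinct g)
  ; scoped = All-resp-↭ p (Good.scoped g) }

map-cong-All : ∀ {P : A → Set} {f g : A → B} → (∀ {x} → P x → f x ≡ g x) → ∀ {xs} → All P xs → map f xs ≡ map g xs
map-cong-All eq [] = refl
map-cong-All eq (p ∷ ps) = cong₂ _∷_ (eq p) (map-cong-All eq ps)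

eval-weaken : ∀ {n} (a₀ : Fin n) ps x xs {s} → Scoped (length xs) s → eval a₀ ps (x ∷ xs) s ≡ eval a₀ ps xs s
eval-weaken a₀ ps x xs {par i} sc = refl
eval-weaken a₀ ps x xs {var i} sc = level-old a₀ x xs sc

good-weaken : ∀ {cs e} c → Good cs e → Good (c ∷ cs) e
good-weaken {cs} {e} c g = record
  { knows = knows′
  ; distinct = Good.distinct g
  ; scoped = All.map (λ {s} → scoped-weaken s (n≤1+n _)) (Good.scoped g) }
  where
  knows′ : Knows (c ∷ cs) e
  knows′ a₀ E resp ps (x ∷ xs) h = subst (λ l → E l ≡ true)
    (sym (map-cong-All (eval-weaken a₀ ps x xs) (subst (λ m → All (Scoped m) e) (sym (holds-length a₀ E ps cs xs (proj₁ (∧-true h)))) (Good.scoped g))))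
    (Good.knows g a₀ E resp ps xs (proj₁ (∧-true h)))

good-extend : ∀ {cs e} new → Good cs e → Good (new ++ cs) e
good-extend [] g = g
good-extend (c ∷ new) g = good-weaken c (good-extend new g)

good-new : ∀ {cs S} → All (Scoped (length cs)) S → Unique (levels S) → Good (last S ∷ cs) (var (length cs) ∷ S)
good-new {cs} {S} sc un = record
  { knows = knows′
  ; distinct = All.tabulate (λ i∈ eq → <-irrefl (sym eq) (All.lookup sc (levels-∈ S i∈))) ∷ un
  ; scoped = ≤-refl ∷ All.map (λ {s} → scoped-weaken s (n≤1+n _)) sc }
  where
  knows′ : Knows (last S ∷ cs) (var (length cs) ∷ S)
  knows′ a₀ E resp ps (x ∷ xs) h = subst (λ l → E l ≡ true) (cong₂ _∷_
      (sym (trans (cong (level a₀ (x ∷ xs)) (sym len)) (level-new a₀ x xs)))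
      (sym (map-cong-All (eval-weaken a₀ ps x xs) (subst (λ m → All (Scoped m) S) (sym len) sc))))
    (proj₂ (∧-true {holds a₀ E ps cs xs} h))
    where
    len : length xs ≡ length cs
    len = holds-length a₀ E ps cs xs (proj₁ (∧-true h))

data WellFormed (k₁ : ℕ) : Constraint → Set where
  free : WellFormed k₁ free
  last : ∀ {S} → length S ≡ k₁ → WellFormed k₁ (last S)

module _ {n : ℕ} (a₀ : Fin n) (E : List (Fin n) → Bool) (us : List (Fin n)) (k₁ δ : ℕ)
    (degree : ∀ S → length S ≡ k₁ → δ ≤ ∑ us (λ v → ⟦ E (v ∷ S) ⟧)) (δ≤u : δ ≤ length us) where

  -- Choosing the variables in order leaves at least δ options at each step.
  greedy-count : ∀ ps {cs} → All (WellFormed k₁) cs → δ ^ length cs ≤ count us (length cs) (holds a₀ E ps cs)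
  greedy-count ps [] = ≤-refl
  greedy-count ps {c ∷ cs} (wf ∷ wfs) = begin
    δ * δ ^ r ≤⟨ *-monoʳ-≤ δ (greedy-count ps wfs) ⟩
    δ * count us r (holds a₀ E ps cs) ≡⟨ trans (*-comm δ _) (sym (∑-*ʳ (tuples us r) δ _)) ⟩
    ∑ (tuples us r) (λ xs → ⟦ holds a₀ E ps cs xs ⟧ * δ) ≤⟨ ∑-mono (tuples us r) (λ xs → *-monoʳ-≤ ⟦ holds a₀ E ps cs xs ⟧ (options wf xs)) ⟩
    ∑ (tuples us r) (λ xs → ⟦ holds a₀ E ps cs xs ⟧ * ∑ us (λ x → ⟦ check a₀ E ps c xs x ⟧))
      ≡⟨ ∑-cong (tuples us r) (λ xs → trans (sym (∑-*ˡ us ⟦ holds a₀ E ps cs xs ⟧ (λ x → ⟦ check a₀ E ps c xs x ⟧))) (∑-cong us (λ x → sym (⟦∧⟧ (holds a₀ E ps cs xs) (check a₀ E ps c xs x))))) ⟩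
    ∑ (tuples us r) (λ xs → ∑ us (λ x → ⟦ holds a₀ E ps (c ∷ cs) (x ∷ xs) ⟧)) ≡⟨ trans (∑-tuples us r _) (∑-swap us (tuples us r) _) ⟨
    count us (suc r) (holds a₀ E ps (c ∷ cs)) ∎
    where
    open ≤-Reasoning
    r = length cs
    options : ∀ {c} → WellFormed k₁ c → ∀ xs → δ ≤ ∑ us (λ x → ⟦ check a₀ E ps c xs x ⟧)
    options free xs = ≤-trans δ≤u (≤-reflexive (sym (∑-1 us)))
    options (last {S} len) xs = degree (map (eval a₀ ps xs) S) (trans (length-map (eval a₀ ps xs) S) len)

-- Rows are numbered from the end of the list, unlike in `Entry`: variables are stored newest first,
-- and the number of a variable must not change when later ones are added.
data Level {A : Set} : List (List A) → ℕ → List A → Set where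
  newest : ∀ {row z} → Level (row ∷ z) (length z) row
  older : ∀ {row row′ z i} → Level z i row → Level (row′ ∷ z) i row

level-bound : ∀ {z : List (List A)} {i row} → Level z i row → i < length z
level-bound newest = ≤-refl
level-bound (older lv) = m<n⇒m<1+n (level-bound lv)

entry-level : ∀ {z : List (List A)} {c row} → Entry z c row → Level z (length z ∸ suc c) row
entry-level here = newest
entry-level (there en) = older (entry-level en)

data Match {n} (a₀ : Fin n) (ps : List (Fin n)) (z : List (List (Fin n))) : Sym → Fin n → Set where
  parameter : ∀ i → Match a₀ ps z (par i) (nth a₀ ps i)
  member : ∀ {i row v} → Level z i row → v ∈ row → Match a₀ ps z (var i) v

module _ {n : ℕ} (a₀ : Fin n) (E : List (Fin n) → Bool) (E-resp : Invariant E) (ps : List (Fin n)) where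

  private
    data Paired : List Sym → List (Fin n) → ℕ → Fin n → Set where
      here : ∀ {i v e vs} → Paired (var i ∷ e) (v ∷ vs) i v
      there : ∀ {s v e vs i w} → Paired e vs i w → Paired (s ∷ e) (v ∷ vs) i w

    paired-levels : ∀ {e vs i v} → Paired e vs i v → i ∈ levels e
    paired-levels here = here refl
    paired-levels {par _ ∷ _} (there pr) = paired-levels pr
    paired-levels {var _ ∷ _} (there pr) = there (paired-levels pr)

    paired-functional : ∀ {e vs i v w} → Unique (levels e) → Paired e vs i v → Paired e vs i w → v ≡ w
    paired-functional un here here = refl
    paired-functional (i∉ ∷ _) here (there pr) = ⊥-elim (All.lookup i∉ (paired-levels pr) refl)
    paired-functional (i∉ ∷ _) (there pr) here = ⊥-elim (All.lookup i∉ (paired-levels pr) refl)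
    paired-functional {par _ ∷ _} un (there pr) (there pr′) = paired-functional un pr pr′
    paired-functional {var _ ∷ _} (_ ∷ un) (there pr) (there pr′) = paired-functional un pr pr′

    find : ∀ e vs i → (∃[ v ] Paired e vs i v) ⊎ (∀ v → ¬ Paired e vs i v)
    find [] vs i = inj₂ λ _ ()
    find (_ ∷ _) [] i = inj₂ λ _ ()
    find (par j ∷ e) (v ∷ vs) i with find e vs i
    ... | inj₁ (w , pr) = inj₁ (w , there pr)
    ... | inj₂ none = inj₂ λ { w (there pr) → none w pr }
    find (var j ∷ e) (v ∷ vs) i with i ≟ j
    ... | yes refl = inj₁ (v , here)
    ... | no i≢j with find e vs i
    ... | inj₁ (w , pr) = inj₁ (w , there pr)
    ... | inj₂ none = inj₂ λ { w here → i≢j refl ; w (there pr) → none w pr }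

    choose : ∀ {e vs} → Unique (levels e) → ∀ z → All (λ row → 0 < length row) z →
        (∀ {i v} → Paired e vs i v → i < length z → ∃[ row ] Level z i row × v ∈ row) →
        ∃[ xs ] Pointwise _∈_ xs z × (∀ {i v} → Paired e vs i v → i < length z → level a₀ xs i ≡ v)
    choose un [] [] place′ = [] , [] , λ _ ()
    choose {e} {vs} un (row ∷ z) (ne ∷ nes) place′ = extend (choose un z nes deeper)
      where
      strip : ∀ {i v} → i < length z → ∃[ row′ ] Level (row ∷ z) i row′ × v ∈ row′ → ∃[ row′ ] Level z i row′ × v ∈ row′
      strip i< (_ , newest , _) = ⊥-elim (<-irrefl refl i<)
      strip i< (row′ , older lv , v∈) = row′ , lv , v∈
      deeper : ∀ {i v} → Paired e vs i v → i < length z → ∃[ row′ ] Level z i row′ × v ∈ row′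
      deeper pr i< = strip i< (place′ pr (m<n⇒m<1+n i<))
      top : ∃[ x ] x ∈ row × (∀ {v} → Paired e vs (length z) v → x ≡ v)
      top with find e vs (length z)
      ... | inj₁ (v , pr) = v , in-row (place′ pr ≤-refl) , paired-functional un pr
        where
        in-row : ∀ {v} → ∃[ row′ ] Level (row ∷ z) (length z) row′ × v ∈ row′ → v ∈ row
        in-row (_ , newest , v∈) = v∈
        in-row (_ , older lv , v∈) = ⊥-elim (<-irrefl refl (level-bound lv))
      ... | inj₂ none = head row ne
        where
        head : ∀ row → 0 < length row → ∃[ x ] x ∈ row × (∀ {v} → Paired e vs (length z) v → x ≡ v)
        head (x ∷ _) _ = x , here refl , λ {v} pr → ⊥-elim (none v pr)
      extend : ∃[ xs ] Pointwise _∈_ xs z × (∀ {i v} → Paired e vs i v → i < length z → level a₀ xs i ≡ v) →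
          ∃[ xs ] Pointwise _∈_ xs (row ∷ z) × (∀ {i v} → Paired e vs i v → i < suc (length z) → level a₀ xs i ≡ v)
      extend (xs , xs∈ , agree) = proj₁ top ∷ xs , proj₁ (proj₂ top) ∷ xs∈ , agree′
        where
        len : length xs ≡ length z
        len = Pointwise-length xs∈
        agree′ : ∀ {i v} → Paired e vs i v → i < suc (length z) → level a₀ (proj₁ top ∷ xs) i ≡ v
        agree′ {i} pr i< with i ≟ length z
        ... | yes refl = trans (trans (cong (level a₀ (proj₁ top ∷ xs)) (sym len)) (level-new a₀ _ xs)) (proj₂ (proj₂ top) pr)
        ... | no i≢ = trans (level-old a₀ _ xs (subst (i <_) (sym len) i<z)) (agree pr i<z)
          where
          i<z : i < length z
          i<z = ≤∧≢⇒< (≤-pred i<) i≢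

  -- In a box of solutions, the symbols of a known edge may be matched by arbitrary members of their rows.
  box-edge : ∀ {cs e vs z} → Good cs e → length z ≡ length cs → All (λ row → 0 < length row) z → boxed (holds a₀ E ps cs) z ≡ true →
      Pointwise (Match a₀ ps z) e vs → E vs ≡ true
  box-edge {cs} {e} {vs} {z} g |z| ne bx match = conclude (choose (Good.distinct g) z ne (λ pr _ → paired-match match pr))
    where
    paired-match : ∀ {e vs i v} → Pointwise (Match a₀ ps z) e vs → Paired e vs i v → ∃[ row ] Level z i row × v ∈ row
    paired-match (member lv v∈ ∷ _) here = _ , lv , v∈
    paired-match (_ ∷ ms) (there pr) = paired-match ms pr
    conclude : ∃[ xs ] Pointwise _∈_ xs z × (∀ {i v} → Paired e vs i v → i < length z → level a₀ xs i ≡ v) → E vs ≡ true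
    conclude (xs , xs∈ , agree) = subst (λ l → E l ≡ true) (same match agree) (Good.knows g a₀ E E-resp ps xs (boxed-sound _ z bx xs∈))
      where
      same : ∀ {e vs} → Pointwise (Match a₀ ps z) e vs → (∀ {i v} → Paired e vs i v → i < length z → level a₀ xs i ≡ v) → map (eval a₀ ps xs) e ≡ vs
      same [] ag = refl
      same (parameter i ∷ ms) ag = cong (nth a₀ ps i ∷_) (same ms (ag ∘ there))
      same (member lv v∈ ∷ ms) ag = cong₂ _∷_ (ag here (level-bound lv)) (same ms (ag ∘ there))

  place-levels : ∀ (z : List (List (Fin n))) M is → All (λ row → length row ≡ M) z → length is ≤ M → All (_< length z) is → Unique (concat z) →
      ∃[ vs ] Pointwise (Match a₀ ps z) (map var is) vs × Unique vs
  place-levels z M is wid fits scope un = convert scope (place z M (map index is) wid (≤-trans (≤-reflexive (length-map index is)) fits) (Allₚ.map⁺ (All.map bound scope)) un)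
    where
    index : ℕ → ℕ
    index i = length z ∸ suc i
    bound : ∀ {i} → i < length z → index i < length z
    bound {i} i< = ∸-monoʳ-< {length z} {suc i} {0} (s≤s z≤n) i<
    involutive : ∀ {i} → i < length z → length z ∸ suc (index i) ≡ i
    involutive {i} i< = trans (cong (length z ∸_) (sym (+-∸-assoc 1 i<))) (m∸[m∸n]≡n (<⇒≤ i<))
    convert : ∀ {is} → All (_< length z) is → ∃[ vs ] Pointwise (Row z) (map index is) vs × Unique vs → ∃[ vs ] Pointwise (Match a₀ ps z) (map var is) vs × Unique vs
    convert scope (vs , ps′ , un) = vs , go scope ps′ , un
      where
      go : ∀ {is vs} → All (_< length z) is → Pointwise (Row z) (map index is) vs → Pointwise (Match a₀ ps z) (map var is) vs
      go [] [] = []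
      go (i< ∷ sc) ((row , en , v∈) ∷ rest) = member (subst (λ j → Level z j row) (involutive i<) (entry-level en)) v∈ ∷ go sc rest

-- Forced extensions of ℓ symbols in both directions

module Connectors (σ : Shape) where
  open Words σ
  open Tokens σ
  open Gadgets σ

  GoodLevels : List Constraint → List ℕ → Set
  GoodLevels cs is = Good cs (map var is)

  SymChain : List Constraint → List Sym → Set
  SymChain cs = Chain (Good cs)

  chain-weaken : ∀ {cs e} new → SymChain cs e → SymChain (new ++ cs) e
  chain-weaken {cs} {e} new ch = chain-map {G = Good cs} {H = Good (new ++ cs)} (good-extend new) {e} ch

  extend-scoped : ∀ {m N o is} → m ≤ N → All (Scoped m) o → (∀ {i} → i ∈ is → i < N) → All (Scoped N) (o ++ map var is)
  extend-scoped m≤N sc bound = Allₚ.++⁺ (All.map (λ {s} → scoped-weaken s m≤N) sc) (Allₚ.map⁺ (All.tabulate bound))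

  extend-unique : ∀ {m} o {is} → All (Scoped m) o → Unique (levels o) → Unique is → (∀ {i} → i ∈ is → m ≤ i) → Unique (levels (o ++ map var is))
  extend-unique o {is} sc un un′ above = subst Unique (sym (trans (levels-++ o _) (cong (levels o ++_) (levels-var is))))
    (unique-++⁺ un un′ (λ i∈ i∈′ → <⇒≱ (All.lookup sc (levels-∈ o i∈)) (above i∈′)))

  range-bound : ∀ m N {i} → i ∈ range m N → m ≤ i × i < m + N
  range-bound m N i∈ with j , j< , refl ← ∈-range⁻ m N i∈ = m≤m+n m j , +-monoʳ-< m j<

  NewBlock : List Constraint → List Sym → Set
  NewBlock cs o = ∃[ new ] length new ≡ d × All (WellFormed k₁) new × Good (new ++ cs) (o ++ map var (range (length cs) d))

  -- All but the last of the d new variables are free; the last completes an edge with the ℓ + (d -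
  -- 1) = k - 1 symbols before it. Only degrees of (k - 1)-tuples are ever used.
  add-block : ∀ cs o → length o ≡ ℓ → All (Scoped (length cs)) o → Unique (levels o) → NewBlock cs o
  add-block cs o |o| sc un = new , cong suc (length-replicate (r₁ + e)) , wf , good-resp perm g
    where
    m = length cs
    d₁ = r₁ + e
    S₁ = o ++ map var (range m d₁)
    new = last S₁ ∷ replicate d₁ free
    |cs′| : length (replicate d₁ free ++ cs) ≡ m + d₁
    |cs′| = trans (length-++ (replicate d₁ free)) (trans (cong (_+ m) (length-replicate d₁)) (+-comm d₁ m))
    wf : All (WellFormed k₁) new
    wf = last |S₁| ∷ Allₚ.replicate⁺ d₁ free
      where
      |S₁| : length S₁ ≡ k₁
      |S₁| = trans (length-++ o) (trans (cong₂ _+_ |o| (length-map-range var m d₁)) (trans (+-comm ℓ d₁) (sym (+-assoc d₁ (s₂ * d) r))))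
    g : Good (new ++ cs) (var (length (replicate d₁ free ++ cs)) ∷ S₁)
    g = good-new (extend-scoped (≤-trans (m≤m+n m d₁) (≤-reflexive (sym |cs′|))) sc (λ i∈ → subst (_ <_) (sym |cs′|) (proj₂ (range-bound m d₁ i∈))))
      (extend-unique o sc un (unique-range m d₁) (λ i∈ → proj₁ (range-bound m d₁ i∈)))
    perm : var (length (replicate d₁ free ++ cs)) ∷ S₁ ↭ o ++ map var (range m d)
    perm = ↭-trans (Permₚ.∷↭∷ʳ _ S₁) (↭-reflexive (trans (++-assoc o _ _) (cong (o ++_) (trans
      (cong (λ j → map var (range m d₁) ++ [ var j ]) |cs′|)
      (trans (sym (map-++ var (range m d₁) (range (m + d₁) 1))) (cong (map var) (trans (sym (range-++ m d₁ 1)) (cong (range m) (+-comm d₁ 1)))))))))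

  record Run (cs : List Constraint) (h : ℕ) (word : List Sym) : Set where
    field
      new : List Constraint
      number : length new ≡ h * d
      wf : All (WellFormed k₁) new
      chain : SymChain (new ++ cs) word

  module _ (cs : List Constraint) (o : List Sym) (|o| : length o ≡ ℓ) (sc : All (Scoped (length cs)) o) (un : Unique (levels o)) where
    private
      m = length cs

    forward : ∀ h → Run cs h (o ++ map var (range m (h * d)))
    forward zero = record { new = [] ; number = refl ; wf = [] ; chain = chain-short {G = Good cs} (o ++ []) (trans (cong length (++-identityʳ o)) |o|) }
    forward (suc h) = extend (add-block (new ++ cs) o′ |o′| (Allₚ.drop⁺ (h * d) scoped-w) unique-o′)
      where
      open Run (forward h)
      w as o′ : List Sym
      w = o ++ map var (range m (h * d))
      as = take (h * d) w
      o′ = drop (h * d) w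
      |cs′| : length (new ++ cs) ≡ m + h * d
      |cs′| = trans (length-++ new) (trans (cong (_+ m) number) (+-comm (h * d) m))
      |w| : length w ≡ ℓ + h * d
      |w| = trans (length-++ o) (cong₂ _+_ |o| (length-map-range var m (h * d)))
      |as| : length as ≡ h * d
      |as| = trans (length-take (h * d) w) (m≤n⇒m⊓n≡m (≤-trans (m≤n+m (h * d) ℓ) (≤-reflexive (sym |w|))))
      |o′| : length o′ ≡ ℓ
      |o′| = trans (length-drop (h * d) w) (trans (cong (_∸ h * d) |w|) (m+n∸n≡m ℓ (h * d)))
      scoped-w : All (Scoped (length (new ++ cs))) w
      scoped-w = extend-scoped (≤-trans (m≤m+n m (h * d)) (≤-reflexive (sym |cs′|))) sc (λ i∈ → subst (_ <_) (sym |cs′|) (proj₂ (range-bound m (h * d) i∈)))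
      unique-w : Unique (levels w)
      unique-w = extend-unique o sc un (unique-range m (h * d)) (λ i∈ → proj₁ (range-bound m (h * d) i∈))
      unique-o′ : Unique (levels o′)
      unique-o′ = proj₁ (proj₂ (unique-++⁻ (levels as) (subst Unique (trans (cong levels (sym (take++drop≡id (h * d) w))) (levels-++ as o′)) unique-w)))
      extend : NewBlock (new ++ cs) o′ → Run cs (suc h) (o ++ map var (range m (suc h * d)))
      extend (new′ , |new′| , wf′ , good) = record
        { new = new′ ++ new
        ; number = trans (length-++ new′) (cong₂ _+_ |new′| number)
        ; wf = Allₚ.++⁺ wf′ wf
        ; chain = subst₂ SymChain (sym (++-assoc new′ new cs)) word
          (chain-++ {G = Good (new′ ++ new ++ cs)} as o′ block h |as| (≤-reflexive (sym |o′|))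
          (subst (SymChain _) (sym (take++drop≡id (h * d) w)) (chain-weaken new′ chain))
          (chain-single {G = Good (new′ ++ new ++ cs)} (o′ ++ block) (trans (length-++ o′) (trans (cong₂ _+_ |o′| (length-map-range var _ d)) (trans (+-comm ℓ d) (sym k≡d+ℓ)))) good)) }
        where
        block = map var (range (length (new ++ cs)) d)
        word : as ++ o′ ++ block ≡ o ++ map var (range m (suc h * d))
        word = begin
          as ++ o′ ++ block ≡⟨ ++-assoc as o′ block ⟨
          (as ++ o′) ++ block ≡⟨ cong (_++ block) (take++drop≡id (h * d) w) ⟩
          (o ++ map var (range m (h * d))) ++ block ≡⟨ ++-assoc o _ block ⟩
          o ++ map var (range m (h * d)) ++ block ≡⟨ cong (o ++_) (map-++ var (range m (h * d)) _) ⟨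
          o ++ map var (range m (h * d) ++ range (length (new ++ cs)) d) ≡⟨ cong (λ a → o ++ map var (range m (h * d) ++ range a d)) |cs′| ⟩
          o ++ map var (range m (h * d) ++ range (m + h * d) d) ≡⟨ cong (λ l → o ++ map var l) (range-++ m (h * d) d) ⟨
          o ++ map var (range m (h * d + d)) ≡⟨ cong (λ N → o ++ map var (range m N)) (+-comm (h * d) d) ⟩
          o ++ map var (range m (suc h * d)) ∎
          where open ≡-Reasoning

    -- Blocks are prepended, the newest first, but each is written in increasing order: all windows
    -- begin at multiples of d, so the order inside a block is immaterial.
    descending : ℕ → List ℕ
    descending zero = []
    descending (suc h) = range (m + h * d) d ++ descending h

    descending-bound : ∀ h {i} → i ∈ descending h → m ≤ i × i < m + h * d
    descending-bound (suc h) i∈ with ∈-++⁻ (range (m + h * d) d) i∈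
    ... | inj₁ i∈₁ with j , j< , refl ← ∈-range⁻ (m + h * d) d i∈₁ =
      ≤-trans (m≤m+n m (h * d)) (m≤m+n _ j) , subst (m + h * d + j <_) (trans (+-assoc m (h * d) d) (cong (m +_) (+-comm (h * d) d))) (+-monoʳ-< (m + h * d) j<)
    ... | inj₂ i∈₂ with le , lt ← descending-bound h i∈₂ = le , <-≤-trans lt (+-monoʳ-≤ m (m≤n+m (h * d) d))

    descending-unique : ∀ h → Unique (descending h)
    descending-unique zero = []
    descending-unique (suc h) = unique-++⁺ (unique-range _ d) (descending-unique h)
      (λ i∈ i∈′ → <⇒≱ (proj₂ (descending-bound h i∈′)) (above i∈))
      where
      above : ∀ {i} → i ∈ range (m + h * d) d → m + h * d ≤ i
      above i∈ with j , _ , refl ← ∈-range⁻ (m + h * d) d i∈ = m≤m+n _ j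

    descending-length : ∀ h → length (descending h) ≡ h * d
    descending-length zero = refl
    descending-length (suc h) = trans (length-++ (range (m + h * d) d)) (cong₂ _+_ (length-range _ d) (descending-length h))

    backward : ∀ h → Run cs h (map var (descending h) ++ o)
    backward zero = record { new = [] ; number = refl ; wf = [] ; chain = chain-short {G = Good cs} o |o| }
    backward (suc h) = extend (add-block (new ++ cs) o′ |o′| (Allₚ.take⁺ ℓ scoped-w) unique-o′)
      where
      open Run (backward h)
      w o′ rest : List Sym
      w = map var (descending h) ++ o
      o′ = take ℓ w
      rest = drop ℓ w
      |cs′| : length (new ++ cs) ≡ m + h * d
      |cs′| = trans (length-++ new) (trans (cong (_+ m) number) (+-comm (h * d) m))
      |w| : length w ≡ h * d + ℓ
      |w| = trans (length-++ (map var (descending h))) (cong₂ _+_ (trans (length-map var (descending h)) (descending-length h)) |o|)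
      |o′| : length o′ ≡ ℓ
      |o′| = trans (length-take ℓ w) (m≤n⇒m⊓n≡m (≤-trans (m≤n+m ℓ (h * d)) (≤-reflexive (sym |w|))))
      scoped-w : All (Scoped (length (new ++ cs))) w
      scoped-w = All-resp-↭ (Permₚ.++-comm o _) (extend-scoped (≤-trans (m≤m+n m (h * d)) (≤-reflexive (sym |cs′|))) sc (λ i∈ → subst (_ <_) (sym |cs′|) (proj₂ (descending-bound h i∈))))
      unique-w : Unique (levels w)
      unique-w = unique-resp-↭ (levels-↭ (Permₚ.++-comm o _)) (extend-unique o sc un (descending-unique h) (λ i∈ → proj₁ (descending-bound h i∈)))
      unique-o′ : Unique (levels o′)
      unique-o′ = proj₁ (unique-++⁻ (levels o′) (subst Unique (trans (cong levels (sym (take++drop≡id ℓ w))) (levels-++ o′ rest)) unique-w))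
      extend : NewBlock (new ++ cs) o′ → Run cs (suc h) (map var (descending (suc h)) ++ o)
      extend (new′ , |new′| , wf′ , good) = record
        { new = new′ ++ new
        ; number = trans (length-++ new′) (cong₂ _+_ |new′| number)
        ; wf = Allₚ.++⁺ wf′ wf
        ; chain = subst₂ SymChain (sym (++-assoc new′ new cs)) word
          (chain-++ {G = Good (new′ ++ new ++ cs)} block o′ rest 1 (trans |block| (sym (*-identityˡ d))) (≤-reflexive (sym |o′|))
          (chain-single {G = Good (new′ ++ new ++ cs)} (block ++ o′) (trans (length-++ block) (trans (cong₂ _+_ |block| |o′|) (sym k≡d+ℓ))) (good-resp (Permₚ.++-comm o′ block) good))
          (subst (SymChain _) (sym (take++drop≡id ℓ w)) (chain-weaken new′ chain))) }
        where
        block = map var (range (length (new ++ cs)) d)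
        |block| : length block ≡ d
        |block| = length-map-range var _ d
        word : block ++ o′ ++ rest ≡ map var (descending (suc h)) ++ o
        word = begin
          block ++ o′ ++ rest ≡⟨ cong (block ++_) (take++drop≡id ℓ w) ⟩
          block ++ map var (descending h) ++ o ≡⟨ ++-assoc block _ o ⟨
          (block ++ map var (descending h)) ++ o ≡⟨ cong (_++ o) (map-++ var (range _ d) _) ⟨
          map var (range (length (new ++ cs)) d ++ descending h) ++ o ≡⟨ cong (λ a → map var (range a d ++ descending h) ++ o) |cs′| ⟩
          map var (descending (suc h)) ++ o ∎
          where open ≡-Reasoning

-- Moving from one edge to another, token by token

record Link (σ : Shape) (cs : List Constraint) (u v : List ℕ) : Set where
  open Words σ
  field
    between : List ℕ
    rounds : ℕ
    -- The second edge begins a whole number of token periods after the first. There the tokens read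
    -- 0, ..., k - 1 again, so links can be composed.
    aligned : length (u ++ between) ≡ rounds * Q * d
    chain : Chain (λ is → Good cs (map var is)) (u ++ between ++ v)
    scope : All (_< length cs) (u ++ between ++ v)

module Switching (σ : Shape) where
  open Words σ
  open Tokens σ
  open Gadgets σ
  open Connectors σ using (GoodLevels)
  open Link

  private
    Link′ = Link σ

  link-weaken : ∀ {cs u v} new → Link′ cs u v → Link′ (new ++ cs) u v
  link-weaken {cs} {u} {v} new l = record
    { between = between l ; rounds = rounds l ; aligned = aligned l
    ; chain = chain-map {G = GoodLevels cs} {H = GoodLevels (new ++ cs)} (good-extend new) {u ++ between l ++ v} (chain l)
    ; scope = All.map (λ i< → <-≤-trans i< (≤-trans (m≤n+m _ (length new)) (≤-reflexive (sym (length-++ new))))) (scope l) }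

  link-trans : ∀ {cs u v w} → length v ≡ k → Link′ cs u v → Link′ cs v w → Link′ cs u w
  link-trans {cs} {u} {v} {w} |v| l₁ l₂ = record
    { between = between l₁ ++ v ++ between l₂
    ; rounds = rounds l₁ + rounds l₂
    ; aligned = begin
      length (u ++ between l₁ ++ v ++ between l₂) ≡⟨ cong length (++-assoc u (between l₁) _) ⟨
      length ((u ++ between l₁) ++ v ++ between l₂) ≡⟨ length-++ (u ++ between l₁) ⟩
      length (u ++ between l₁) + length (v ++ between l₂) ≡⟨ cong₂ _+_ (aligned l₁) (aligned l₂) ⟩
      rounds l₁ * Q * d + rounds l₂ * Q * d ≡⟨ distrib (rounds l₁) (rounds l₂) Q d ⟩
      (rounds l₁ + rounds l₂) * Q * d ∎
    ; chain = subst (Chain (GoodLevels cs)) (sym (trans (cong (u ++_) (regroup (between l₁))) (sym (++-assoc u (between l₁) _))))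
      (chain-++ {G = GoodLevels cs} (u ++ between l₁) v (between l₂ ++ w) (rounds l₁ * Q) (aligned l₁) (≤-trans (m≤n+m ℓ d) (≤-reflexive (trans (sym k≡d+ℓ) (sym |v|))))
      (subst (Chain (GoodLevels cs)) (sym (++-assoc u (between l₁) v)) (chain l₁)) (chain l₂))
    ; scope = subst (All (_< length cs)) (sym (cong (u ++_) (regroup (between l₁))))
      (Allₚ.++⁺ (Allₚ.++⁻ˡ u (scope l₁)) (Allₚ.++⁺ (Allₚ.++⁻ˡ (between l₁) (Allₚ.++⁻ʳ u (scope l₁))) (scope l₂))) }
    where
    open ≡-Reasoning
    distrib : ∀ a b q d → a * q * d + b * q * d ≡ (a + b) * q * d
    distrib = solve-∀
    regroup : ∀ b₁ → (b₁ ++ v ++ between l₂) ++ w ≡ b₁ ++ v ++ between l₂ ++ w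
    regroup b₁ = trans (++-assoc b₁ _ w) (cong (b₁ ++_) (++-assoc v (between l₂) w))

  -- The word begins with `α`, switches after block `j₀`, and runs on to position (j₀ + 1) Q d: a
  -- multiple of the period which certainly lies behind the switch.
  switch-link : ∀ {cs} (α α′ : ℕ → ℕ) j₀ → (∀ {x} → x < k → α x ≡ α′ x ⊎ ∃[ i ] i < d × x ≡ c (j₀ * d + i)) →
      GoodLevels cs (letters α) → GoodLevels cs (letters α′) →
      (∀ {x} → x < k → α x < length cs) → (∀ {x} → x < k → α′ x < length cs) →
      Link′ cs (letters α) (letters α′)
  switch-link {cs} α α′ j₀ differ g g′ bd bd′ = record
    { between = map f (range k y) ; rounds = suc j₀
    ; aligned = trans (length-++ (letters α)) (trans (cong₂ _+_ (length-map-range α 0 k) (length-map-range f k y)) k+y)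
    ; chain = subst (Chain (GoodLevels cs)) word (switch-chain α α′ j₀ differ {G = GoodLevels cs} (λ p → good-resp (Permₚ.map⁺ var p)) g g′ (N + k))
    ; scope = subst (All (_< length cs)) word (Allₚ.map⁺ (All.universal bounded (range 0 (N + k)))) }
    where
    f = switch α α′ j₀
    N = suc j₀ * Q * d
    k≤N : k ≤ N
    k≤N = ≤-trans (<⇒≤ (subst (k <_) (+-comm (suc s₂ * d) d) (+-monoʳ-< (suc s₂ * d) r<d))) (*-monoˡ-≤ d {S} {suc j₀ * Q} (≤-trans (m≤n*m S (suc s₂)) (m≤n*m Q (suc j₀))))
    y = N ∸ k
    k+y : k + y ≡ N
    k+y = m+[n∸m]≡n k≤N
    bounded : ∀ x → f x < length cs
    bounded x with x <? suc j₀ * d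
    ... | yes _ = bd (c<k x)
    ... | no _ = bd′ (c<k x)
    word : map f (range 0 (N + k)) ≡ letters α ++ map f (range k y) ++ letters α′
    word = trans (cong (λ M → map f (range 0 M)) (trans (cong (_+ k) (sym k+y)) (+-assoc k y k))) (trans (map-range-++ f 0 k (y + k)) (cong₂ _++_
      (map-range-cong 0 0 k (λ i i<k → trans (switch-early α α′ j₀ differ 0 z≤n i<k) (cong α (c-id i<k))))
      (trans (map-range-++ f k y k) (cong (map f (range k y) ++_) (trans (cong (λ a → map f (range a k)) k+y)
        (map-range-cong N 0 k (λ i i<k → trans (switch-after α α′ j₀ (≤-trans (*-monoˡ-≤ d (m≤m*n (suc j₀) Q)) (m≤m+n N i))) (cong α′ (trans (c-period (suc j₀) i) (c-id i<k))))))))))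

  -- The tokens in 0 ∷ todo have not been moved to their targets yet.
  record Stage (cs : List Constraint) (target : ℕ → ℕ) (todo : List ℕ) (lv : ℕ → ℕ) : Set where
    field
      injective : ∀ {x y} → x < k → y < k → lv x ≡ lv y → x ≡ y
      pending : ∀ {x y} → x < k → x ∈ 0 ∷ todo → y < k → lv x ≢ target y
      settled : ∀ {x} → x < k → x ∉ 0 ∷ todo → lv x ≡ target x
      bound : ∀ {x} → x < k → lv x < length cs
      good : GoodLevels cs (letters lv)

  Together : ℕ → ℕ → Set
  Together a b = ∃[ j₀ ] (∃[ i ] i < d × a ≡ c (j₀ * d + i)) × (∃[ i ] i < d × b ≡ c (j₀ * d + i))

  update : ℕ → ℕ → ℕ → ℕ → (ℕ → ℕ) → ℕ → ℕ
  update a a′ b b′ f x = if? (x ≟ b) b′ (if? (x ≟ a) a′ (f x))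

  module _ {cs : List Constraint} {target : ℕ → ℕ} (target-inj : ∀ {x y} → x < k → y < k → target x ≡ target y → x ≡ y)
      (target-bound : ∀ {x} → x < k → target x < length cs) where

    -- Move token a to its target; token b, which occurs in the same block, takes a new value completing the edge.
    advance : ∀ {a b todo lv} → Stage cs target (a ∷ todo) lv → a < k → b < k → a ∉ 0 ∷ todo → b ∈ 0 ∷ todo → Together a b →
        ∃₂ λ c₀ lv′ → WellFormed k₁ c₀ × Stage (c₀ ∷ cs) target todo lv′ × Link′ (c₀ ∷ cs) (letters lv) (letters lv′)
    advance {a} {b} {todo} {lv} st a<k b<k a∉ b∈ (j₀ , a-in , b-in) = last S₁ , lv′ , last |S₁| , stage , link
      where
      open Stage st
      m = length cs
      lv′ : ℕ → ℕ
      lv′ = update a (target a) b m lv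
      b≢a : b ≢ a
      b≢a b≡a = a∉ (subst (_∈ 0 ∷ todo) b≡a b∈)
      at-b : ∀ {x} → x ≡ b → lv′ x ≡ m
      at-b {x} x≡b with x ≟ b
      ... | yes _ = refl
      ... | no ¬p = ⊥-elim (¬p x≡b)
      below : ∀ {x} → x < k → x ≢ b → lv′ x < m
      below {x} x<k x≢b with x ≟ b
      ... | yes x≡b = ⊥-elim (x≢b x≡b)
      ... | no _ with x ≟ a
      ... | yes _ = target-bound a<k
      ... | no _ = bound x<k
      lv≢target : ∀ {x} → x < k → x ≢ a → lv x ≢ target a
      lv≢target {x} x<k x≢a eq with _∈?_ _≟_ x (0 ∷ a ∷ todo)
      ... | yes x∈ = pending x<k x∈ a<k eq
      ... | no x∉ = x≢a (target-inj x<k a<k (trans (sym (settled x<k x∉)) eq))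
      injective′ : ∀ {x y} → x < k → y < k → lv′ x ≡ lv′ y → x ≡ y
      injective′ {x} {y} x<k y<k eq with x ≟ b | y ≟ b | x ≟ a | y ≟ a
      ... | yes x≡b | yes y≡b | _ | _ = trans x≡b (sym y≡b)
      ... | yes x≡b | no y≢b | yes p | _ = ⊥-elim (b≢a (trans (sym x≡b) p))
      ... | yes x≡b | no y≢b | no _ | yes y≡a = ⊥-elim (<⇒≢ (target-bound a<k) (sym eq))
      ... | yes x≡b | no y≢b | no _ | no y≢a = ⊥-elim (<⇒≢ (bound y<k) (sym eq))
      ... | no x≢b | yes y≡b | yes x≡a | _ = ⊥-elim (<⇒≢ (target-bound a<k) eq)
      ... | no x≢b | yes y≡b | no x≢a | _ = ⊥-elim (<⇒≢ (bound x<k) eq)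
      ... | no _ | no _ | yes x≡a | yes y≡a = trans x≡a (sym y≡a)
      ... | no _ | no _ | yes x≡a | no y≢a = ⊥-elim (lv≢target y<k y≢a (sym eq))
      ... | no _ | no _ | no x≢a | yes y≡a = ⊥-elim (lv≢target x<k x≢a eq)
      ... | no _ | no _ | no x≢a | no y≢a = injective x<k y<k eq
      others : List ℕ
      others = proj₁ (remove (∈-range⁺ 0 b<k))
      others-↭ : range 0 k ↭ b ∷ others
      others-↭ = proj₂ (remove (∈-range⁺ 0 b<k))
      others≢ : ∀ {x} → x ∈ others → x < k × x ≢ b
      others≢ x∈ with i , i<k , refl ← ∈-range⁻ 0 k (∈-resp-↭ (↭-sym others-↭) (there x∈)) =
        i<k , λ { refl → All.lookup (AllPairs.head (unique-resp-↭ others-↭ (unique-range 0 k))) x∈ refl }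
      S₁ : List Sym
      S₁ = map var (map lv′ others)
      |S₁| : length S₁ ≡ k₁
      |S₁| = trans (length-map var (map lv′ others)) (trans (length-map lv′ others) (suc-injective (trans (sym (↭-length others-↭)) (length-range 0 k))))
      window-unique : Unique (letters lv′)
      window-unique = unique-map lv′ (λ x∈ y∈ → injective′ (in-range x∈) (in-range y∈)) (unique-range 0 k)
        where
        in-range : ∀ {x} → x ∈ range 0 k → x < k
        in-range x∈ with i , i<k , refl ← ∈-range⁻ 0 k x∈ = i<k
      window-↭′ : letters lv′ ↭ m ∷ map lv′ others
      window-↭′ = ↭-trans (Permₚ.map⁺ lv′ others-↭) (↭-reflexive (cong (_∷ map lv′ others) (at-b refl)))
      good′ : GoodLevels (last S₁ ∷ cs) (letters lv′)
      good′ = good-resp (↭-sym (Permₚ.map⁺ var window-↭′)) (good-new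
        (Allₚ.map⁺ (Allₚ.map⁺ (All.tabulate (λ x∈ → below (proj₁ (others≢ x∈)) (proj₂ (others≢ x∈))))))
        (subst Unique (sym (levels-var (map lv′ others))) (AllPairs.tail (unique-resp-↭ window-↭′ window-unique))))
      bound′ : ∀ {x} → x < k → lv′ x < suc m
      bound′ {x} x<k with x ≟ b
      ... | yes _ = ≤-refl
      ... | no x≢b with x ≟ a
      ... | yes _ = m<n⇒m<1+n (target-bound a<k)
      ... | no _ = m<n⇒m<1+n (bound x<k)
      stage : Stage (last S₁ ∷ cs) target todo lv′
      stage = record
        { injective = injective′
        ; pending = pending′
        ; settled = settled′
        ; bound = bound′
        ; good = good′ }
        where
        pending′ : ∀ {x y} → x < k → x ∈ 0 ∷ todo → y < k → lv′ x ≢ target y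
        pending′ {x} x<k x∈ y<k eq with x ≟ b
        ... | yes _ = <⇒≢ (target-bound y<k) (sym eq)
        ... | no _ with x ≟ a
        ... | yes refl = a∉ x∈
        ... | no _ = pending x<k (insert x∈) y<k eq
          where
          insert : ∀ {x} → x ∈ 0 ∷ todo → x ∈ 0 ∷ a ∷ todo
          insert (here eq) = here eq
          insert (there x∈) = there (there x∈)
        settled′ : ∀ {x} → x < k → x ∉ 0 ∷ todo → lv′ x ≡ target x
        settled′ {x} x<k x∉ with x ≟ b
        ... | yes refl = ⊥-elim (x∉ b∈)
        ... | no _ with x ≟ a
        ... | yes refl = refl
        ... | no x≢a = settled x<k λ { (here eq) → x∉ (here eq) ; (there (here eq)) → x≢a eq ; (there (there x∈)) → x∉ (there x∈) }
      link : Link′ (last S₁ ∷ cs) (letters lv) (letters lv′)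
      link = switch-link lv lv′ j₀ differ (good-weaken (last S₁) good) good′ (λ x<k → m<n⇒m<1+n (bound x<k)) bound′
        where
        differ : ∀ {x} → x < k → lv x ≡ lv′ x ⊎ ∃[ i ] i < d × x ≡ c (j₀ * d + i)
        differ {x} x<k with x ≟ b
        ... | yes refl = inj₂ b-in
        ... | no _ with x ≟ a
        ... | yes refl = inj₂ a-in
        ... | no _ = inj₁ refl

  -- Chinese remainder theorem for s and s - 1: the block must be i modulo s to show x, and 0 modulo
  -- s - 1 to show r. Since the square of s - 1 is 1 modulo s, block i (s - 1) (s - 1) will do.
  long-together : ∀ {x} → x < k → x % d < r → Together x r
  long-together {x} x<k o<r = j₀ ,
    (x % d , m%n<n x d , trans (sym (c-id x<k)) (trans (tok-long i o<r) (trans (cong (λ m → m * d + x % d) (sym j₀-mod-S)) (sym (trans (c-tok j₀ (m%n<n x d)) (tok-long j₀ o<r)))))) ,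
    (r , r<d , sym (trans (c-tok j₀ r<d) (trans (tok-short j₀ ≤-refl) (cong (λ m → m * d + r) j₀-mod-s))))
    where
    i = x / d
    j₀ = i * suc s₂ * suc s₂
    j₀-mod-s : j₀ % suc s₂ ≡ 0
    j₀-mod-s = m*n%n≡0 (i * suc s₂) (suc s₂)
    j₀-mod-S : j₀ % S ≡ i % S
    j₀-mod-S = trans (cong (_% S) (eq i s₂)) ([m+kn]%n≡m%n i (i * s₂) S)
      where
      eq : ∀ i s → i * suc s * suc s ≡ i + i * s * suc (suc s)
      eq = solve-∀

  -- Here the block must be i modulo s - 1 and 0 modulo s; as s is 1 modulo s - 1, block i s will
  -- do.
  short-together : ∀ {x} → x < k → r ≤ x % d → Together x 0
  short-together {x} x<k r≤o = j₀ ,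
    (x % d , m%n<n x d , trans (sym (c-id x<k)) (trans (tok-short i r≤o) (trans (cong (λ m → m * d + x % d) (sym j₀-mod-s)) (sym (trans (c-tok j₀ (m%n<n x d)) (tok-short j₀ r≤o)))))) ,
    (0 , s≤s z≤n , sym (trans (c-tok j₀ (s≤s z≤n)) (trans (tok-long j₀ (s≤s z≤n)) (cong (λ m → m * d + 0) j₀-mod-S))))
    where
    i = x / d
    j₀ = i * S
    j₀-mod-S : j₀ % S ≡ 0
    j₀-mod-S = m*n%n≡0 i S
    j₀-mod-s : j₀ % suc s₂ ≡ i % suc s₂
    j₀-mod-s = trans (cong (_% suc s₂) (eq i s₂)) ([m+kn]%n≡m%n i i (suc s₂))
      where
      eq : ∀ i s → i * suc (suc s) ≡ i + i * suc s
      eq = solve-∀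

  -- Equality is allowed for the sake of an empty run of moves: a link between windows always has
  -- positive length.
  Reach : List Constraint → (ℕ → ℕ) → (ℕ → ℕ) → Set
  Reach cs α β = letters α ≡ letters β ⊎ Link′ cs (letters α) (letters β)

  reach-cons : ∀ {cs} new (α β γ : ℕ → ℕ) → Link′ cs (letters α) (letters β) → Reach (new ++ cs) β γ → Reach (new ++ cs) α γ
  reach-cons new α β γ l (inj₁ eq) = inj₂ (subst (Link′ _ (letters α)) eq (link-weaken new l))
  reach-cons new α β γ l (inj₂ l′) = inj₂ (link-trans (length-letters β) (link-weaken new l) l′)

  module _ {target : ℕ → ℕ} (target-inj : ∀ {x y} → x < k → y < k → target x ≡ target y → x ≡ y) where

    Progress : List Constraint → List ℕ → (ℕ → ℕ) → Set
    Progress cs rest lv = ∃₂ λ new lv′ → All (WellFormed k₁) new × Stage (new ++ cs) target rest lv′ × Reach (new ++ cs) lv lv′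

    run : ∀ b todo rest {cs lv} → (∀ {x} → x < k → target x < length cs) → Stage cs target (todo ++ rest) lv → Unique (0 ∷ todo ++ rest) →
        All (λ a → a < k × Together a b) todo → b < k → b ∈ 0 ∷ rest →
        Progress cs rest lv
    run b [] rest bd st un [] b<k b∈ = [] , _ , [] , st , inj₁ refl
    run b (a ∷ todo) rest {cs} {lv} bd st (0∉ ∷ a∉ ∷ un) ((a<k , tg) ∷ all) b<k b∈ = continue (advance target-inj bd st a<k b<k a∉′ (insert b∈) tg)
      where
      a∉′ : a ∉ 0 ∷ todo ++ rest
      a∉′ (here eq) = All.lookup 0∉ (here refl) (sym eq)
      a∉′ (there a∈) = All.lookup a∉ a∈ refl
      insert : ∀ {x} → x ∈ 0 ∷ rest → x ∈ 0 ∷ todo ++ rest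
      insert (here eq) = here eq
      insert (there x∈) = there (∈-++⁺ʳ todo x∈)
      continue : ∃₂ (λ c₀ lv′ → WellFormed k₁ c₀ × Stage (c₀ ∷ cs) target (todo ++ rest) lv′ × Link′ (c₀ ∷ cs) (letters lv) (letters lv′)) → Progress cs rest lv
      continue (c₀ , lv′ , wf , st′ , l) = finish (run b todo rest (λ x<k → m<n⇒m<1+n (bd x<k)) st′ (All.tail 0∉ ∷ un) all b<k b∈)
        where
        finish : Progress (c₀ ∷ cs) rest lv′ → Progress cs rest lv
        finish (new , lv″ , wfs , st″ , rc) = new ++ [ c₀ ] , lv″ , Allₚ.++⁺ wfs (wf ∷ []) ,
          subst (λ cs′ → Stage cs′ target rest lv″) assoc st″ , subst (λ cs′ → Reach cs′ lv lv″) assoc (reach-cons new lv lv′ lv″ l rc)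
          where
          assoc : new ++ c₀ ∷ cs ≡ (new ++ [ c₀ ]) ++ cs
          assoc = sym (++-assoc new [ c₀ ] cs)

    longs shorts : List ℕ
    longs = filter (λ x → x % d <? r) (range 1 k₁)
    shorts = filter (λ x → ¬? (x % d <? r)) (range 1 k₁)

    all-tokens : ∀ {x} → x < k → x ∈ 0 ∷ longs ++ shorts
    all-tokens {zero} x<k = here refl
    all-tokens {suc x} (s≤s x<k₁) with suc x % d <? r
    ... | yes p = there (∈-++⁺ˡ (∈-filter⁺ (λ x → x % d <? r) (∈-range⁺ 1 x<k₁) p))
    ... | no ¬p = there (∈-++⁺ʳ longs (∈-filter⁺ (λ x → ¬? (x % d <? r)) (∈-range⁺ 1 x<k₁) ¬p))

    tokens-unique : Unique (0 ∷ longs ++ shorts)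
    tokens-unique = All.tabulate (λ x∈ 0≡x → positive (∈-++⁻ longs x∈) 0≡x) ∷
      unique-++⁺ (Uniqueₚ.filter⁺ (λ x → x % d <? r) (unique-range 1 k₁)) (Uniqueₚ.filter⁺ (λ x → ¬? (x % d <? r)) (unique-range 1 k₁))
        (λ x∈ x∈′ → proj₂ (∈-filter⁻ (λ x → ¬? (x % d <? r)) {xs = range 1 k₁} x∈′) (proj₂ (∈-filter⁻ (λ x → x % d <? r) {xs = range 1 k₁} x∈)))
      where
      positive : ∀ {x} → x ∈ longs ⊎ x ∈ shorts → 0 ≢ x
      positive (inj₁ x∈) refl with ∈-range⁻ 1 k₁ (proj₁ (∈-filter⁻ (λ x → x % d <? r) {xs = range 1 k₁} x∈))
      ... | _ , _ , ()
      positive (inj₂ x∈) refl with ∈-range⁻ 1 k₁ (proj₁ (∈-filter⁻ (λ x → ¬? (x % d <? r)) {xs = range 1 k₁} x∈))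
      ... | _ , _ , ()

    -- The helper of a move must still be unsettled and share a block with the moved token. So the
    -- long-period tokens other than 0 go first, helped by r; then the short-period ones, r among
    -- them, helped by 0. Token 0 comes last and needs no helper, because the target window is an
    -- edge already.
    transfer : ∀ {cs lv} → (∀ {x} → x < k → target x < length cs) → GoodLevels cs (letters target) →
        Stage cs target (longs ++ shorts) lv →
        ∃[ new ] All (WellFormed k₁) new × Link′ (new ++ cs) (letters lv) (letters target)
    transfer {cs} {lv} bd good-target st = first (run r longs shorts bd st tokens-unique long-ok r<k (there r∈shorts))
      where
      in-k : ∀ {x} → x ∈ range 1 k₁ → x < k
      in-k x∈ with i , i< , refl ← ∈-range⁻ 1 k₁ x∈ = s≤s i<
      long-ok : All (λ a → a < k × Together a r) longs
      long-ok = All.tabulate (λ x∈ → let x∈r , lt = ∈-filter⁻ (λ x → x % d <? r) {xs = range 1 k₁} x∈ in in-k x∈r , long-together (in-k x∈r) lt)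
      short-ok : All (λ a → a < k × Together a 0) shorts
      short-ok = All.tabulate (λ x∈ → let x∈r , nlt = ∈-filter⁻ (λ x → ¬? (x % d <? r)) {xs = range 1 k₁} x∈ in in-k x∈r , short-together (in-k x∈r) (≮⇒≥ nlt))
      r∈shorts : r ∈ shorts
      r∈shorts = ∈-filter⁺ (λ x → ¬? (x % d <? r)) (∈-range⁺ 1 (≤-pred r<k)) (λ lt → <-irrefl (m<n⇒m%n≡m r<d) lt)
      Result : Set
      Result = ∃[ new ] All (WellFormed k₁) new × Link′ (new ++ cs) (letters lv) (letters target)
      bd-extend : ∀ new {x} → x < k → target x < length (new ++ cs)
      bd-extend new x<k = <-≤-trans (bd x<k) (≤-trans (m≤n+m (length cs) (length new)) (≤-reflexive (sym (length-++ new))))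
      short-unique : Unique (0 ∷ shorts)
      short-unique = All.tabulate (λ x∈ → All.lookup (AllPairs.head tokens-unique) (∈-++⁺ʳ longs x∈)) ∷ proj₁ (proj₂ (unique-++⁻ longs (AllPairs.tail tokens-unique)))
      first : Progress cs shorts lv → Result
      first (new , lv′ , wf , st′ , rc) = second (run 0 shorts [] (bd-extend new) (subst (λ l → Stage (new ++ cs) target l lv′) (sym (++-identityʳ shorts)) st′)
          (subst (λ l → Unique (0 ∷ l)) (sym (++-identityʳ shorts)) short-unique) short-ok (s≤s z≤n) (here refl))
        where
        second : Progress (new ++ cs) [] lv′ → Result
        second (new′ , lv″ , wf′ , st″ , rc′) = new′ ++ new , Allₚ.++⁺ wf′ wf ,
          subst (λ cs′ → Link′ cs′ (letters lv) (letters target)) (sym (++-assoc new′ new cs)) (join (weaken rc) (join rc′ final))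
          where
          join : ∀ {cs α β γ} → Reach cs α β → Link′ cs (letters β) (letters γ) → Link′ cs (letters α) (letters γ)
          join {cs} {γ = γ} (inj₁ eq) l = subst (λ u → Link′ cs u (letters γ)) (sym eq) l
          join {β = β} (inj₂ l′) l = link-trans (length-letters β) l′ l
          weaken : Reach (new ++ cs) lv lv′ → Reach (new′ ++ new ++ cs) lv lv′
          weaken (inj₁ eq) = inj₁ eq
          weaken (inj₂ l) = inj₂ (link-weaken new′ l)
          good-final : GoodLevels (new′ ++ new ++ cs) (letters target)
          good-final = good-extend new′ (good-extend new good-target)
          bd-final : ∀ {x} → x < k → target x < length (new′ ++ new ++ cs)
          bd-final x<k = subst (λ l → target _ < length l) (++-assoc new′ new cs) (bd-extend (new′ ++ new) x<k)
          final : Link′ (new′ ++ new ++ cs) (letters lv″) (letters target)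
          final = switch-link lv″ target 0 differ (Stage.good st″) good-final (Stage.bound st″) bd-final
            where
            differ : ∀ {x} → x < k → lv″ x ≡ target x ⊎ ∃[ i ] i < d × x ≡ c (0 * d + i)
            differ {zero} x<k = inj₂ (0 , s≤s z≤n , sym (c-id (s≤s z≤n)))
            differ {suc x} x<k = inj₁ (Stage.settled st″ x<k λ { (here ()) ; (there ()) })

-- Symbolic connectors with a prescribed residue

map-nth : ∀ (a₀ : A) xs → map (nth a₀ xs) (range 0 (length xs)) ≡ xs
map-nth a₀ [] = refl
map-nth a₀ (x ∷ xs) = cong (x ∷_) (trans (map-range-cong {f = nth a₀ (x ∷ xs)} {g = nth a₀ xs} 1 0 (length xs) (λ _ _ → refl)) (map-nth a₀ xs))

-- `extra` prescribes the number of blocks modulo `Q`; with its help the number of vertices left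
-- over for absorption becomes a multiple of Q d.
record SymConnector (σ : Shape) (extra : ℕ) : Set where
  open Words σ
  field
    cs : List Constraint
    wf : All (WellFormed k₁) cs
    mids : List ℕ
    scope : All (_< length cs) mids
    rounds : ℕ
    aligned : ℓ + length mids ≡ (suc s₂ + extra + rounds * Q + S) * d
    chain : Chain (Good cs) (map par (range 0 ℓ) ++ map var mids ++ map par (range ℓ ℓ))

module BuildConnector (σ : Shape) (extra : ℕ) where
  open Words σ
  open Tokens σ
  open Gadgets σ
  open Connectors σ
  open Switching σ

  private
    pars : ℕ → List Sym
    pars a = map par (range a ℓ)

    |pars| : ∀ a → length (pars a) ≡ ℓ
    |pars| a = length-map-range par a ℓ

    pars-scoped : ∀ m a → All (Scoped m) (pars a)
    pars-scoped m a = Allₚ.map⁺ (All.universal (λ _ → tt) (range a ℓ))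

    levels-pars : ∀ xs → levels (map par xs) ≡ []
    levels-pars [] = refl
    levels-pars (x ∷ xs) = levels-pars xs

    pars-unique : ∀ a → Unique (levels (pars a))
    pars-unique a = subst Unique (sym (levels-pars (range a ℓ))) []

    module F = Run (forward [] (pars 0) (|pars| 0) (pars-scoped 0 0) (pars-unique 0) (S + extra))

    cs₁ : List Constraint
    cs₁ = F.new ++ []
    -- The forward run introduces `m₁` variables. As k < S d, its last k letters, from level `y` on,
    -- contain no parameter; this window is where the transfer to the backward run starts.
    m₁ y : ℕ
    m₁ = (S + extra) * d
    y = extra * d + e

    |cs₁| : length cs₁ ≡ m₁
    |cs₁| = trans (cong length (++-identityʳ F.new)) F.number

    y+k : y + k ≡ m₁
    y+k = eq s₂ r e extra
      where
      eq : ∀ s r e x → x * (r + e) + e + (suc s * (r + e) + r) ≡ (suc (suc s) + x) * (r + e)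
      eq = solve-∀

    desc : List ℕ
    desc = descending cs₁ (pars ℓ) (|pars| ℓ) (pars-scoped _ ℓ) (pars-unique ℓ) S

    module Bk = Run (backward cs₁ (pars ℓ) (|pars| ℓ) (pars-scoped _ ℓ) (pars-unique ℓ) S)

    cs₂ : List Constraint
    cs₂ = Bk.new ++ cs₁

    |cs₂| : length cs₂ ≡ m₁ + S * d
    |cs₂| = trans (length-++ Bk.new) (trans (cong₂ _+_ Bk.number |cs₁|) (+-comm (S * d) m₁))

    |desc| : length desc ≡ S * d
    |desc| = descending-length cs₁ (pars ℓ) (|pars| ℓ) (pars-scoped _ ℓ) (pars-unique ℓ) S

    desc-bound : ∀ {i} → i ∈ desc → m₁ ≤ i × i < length cs₂
    desc-bound {i} i∈ with le , lt ← descending-bound cs₁ (pars ℓ) (|pars| ℓ) (pars-scoped _ ℓ) (pars-unique ℓ) S i∈ =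
      subst (_≤ i) |cs₁| le , subst (i <_) (trans (cong (_+ S * d) |cs₁|) (sym |cs₂|)) lt

    pl : ℕ → ℕ
    pl x = y + x

    pl-window : letters pl ≡ range y k
    pl-window = trans (map-range-cong {f = pl} {g = id} 0 y k (λ _ _ → refl)) (map-id (range y k))

    head-word : List Sym
    head-word = pars 0 ++ map var (range 0 y)

    |head-word| : length head-word ≡ (suc s₂ + extra) * d
    |head-word| = trans (length-++ (pars 0)) (trans (cong₂ _+_ (|pars| 0) (length-map-range var 0 y)) (eq s₂ r e extra))
      where
      eq : ∀ s r e x → s * (r + e) + r + (x * (r + e) + e) ≡ (suc s + x) * (r + e)
      eq = solve-∀

    chain₁ : SymChain cs₁ (head-word ++ map var (range y k))
    chain₁ = subst (SymChain cs₁) word F.chain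
      where
      word : pars 0 ++ map var (range 0 ((S + extra) * d)) ≡ head-word ++ map var (range y k)
      word = trans (cong (λ N → pars 0 ++ map var (range 0 N)) (sym y+k)) (trans (cong (λ l → pars 0 ++ map var l) (range-++ 0 y k))
        (trans (cong (pars 0 ++_) (map-++ var (range 0 y) _)) (sym (++-assoc (pars 0) _ _))))

    chain-window : ∀ {cs} (w : List Sym) → length w ≡ k → SymChain cs w → Good cs w
    chain-window {cs} w |w| ch = subst (Good cs) (take-all k w (≤-reflexive |w|)) (ch 0 (≤-reflexive (sym |w|)))

    good-p : GoodLevels cs₁ (letters pl)
    good-p = subst (GoodLevels cs₁) (sym pl-window) (chain-window (map var (range y k)) (length-map-range var y k)
      (chain-suffix {G = Good cs₁} head-word (map var (range y k)) (suc s₂ + extra) |head-word| chain₁))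

    q : List ℕ
    q = take k desc

    k≤desc : k ≤ length desc
    k≤desc = subst (k ≤_) (sym |desc|) (<⇒≤ (subst (k <_) (+-comm (suc s₂ * d) d) (+-monoʳ-< (suc s₂ * d) r<d)))

    |q| : length q ≡ k
    |q| = trans (length-take k desc) (m≤n⇒m⊓n≡m k≤desc)

    target : ℕ → ℕ
    target = nth 0 q

    target-window : letters target ≡ q
    target-window = subst (λ m → map target (range 0 m) ≡ q) |q| (map-nth 0 q)

    q⊆desc : ∀ {i} → i ∈ q → i ∈ desc
    q⊆desc {i} i∈ = subst (i ∈_) (take++drop≡id k desc) (∈-++⁺ˡ i∈)

    q-unique : Unique q
    q-unique = proj₁ (unique-++⁻ q (subst Unique (sym (take++drop≡id k desc)) (descending-unique cs₁ (pars ℓ) (|pars| ℓ) (pars-scoped _ ℓ) (pars-unique ℓ) S)))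

    good-q : GoodLevels cs₂ (letters target)
    good-q = subst (GoodLevels cs₂) (sym target-window) (subst (Good cs₂) window (Bk.chain 0 fits))
      where
      fits : k ≤ length (map var desc ++ pars ℓ)
      fits = ≤-trans k≤desc (≤-trans (≤-reflexive (sym (length-map var desc))) (≤-trans (m≤m+n _ _) (≤-reflexive (sym (length-++ (map var desc))))))
      window : take k (map var desc ++ pars ℓ) ≡ map var q
      window = trans (take-++ˡ k (map var desc) (≤-trans k≤desc (≤-reflexive (sym (length-map var desc))))) (take-map k desc)

    in-window : ∀ {x} → x < k → target x ∈ q
    in-window {x} x<k = subst (target x ∈_) target-window (∈-map⁺ target (∈-range⁺ 0 x<k))

    target-inj : ∀ {x x′} → x < k → x′ < k → target x ≡ target x′ → x ≡ x′
    target-inj x<k x′<k = unique-map-injective target (subst Unique (sym target-window) q-unique) (∈-range⁺ 0 x<k) (∈-range⁺ 0 x′<k)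

    target-bound : ∀ {x} → x < k → target x < length cs₂
    target-bound x<k = proj₂ (desc-bound (q⊆desc (in-window x<k)))

    pl<m₁ : ∀ {x} → x < k → pl x < m₁
    pl<m₁ {x} x<k = subst (pl x <_) y+k (+-monoʳ-< y x<k)

    stage : Stage cs₂ target (longs target-inj ++ shorts target-inj) pl
    stage = record
      { injective = λ {x} {x′} _ _ → +-cancelˡ-≡ y x x′
      ; pending = λ x<k _ x′<k eq → <⇒≱ (pl<m₁ x<k) (subst (m₁ ≤_) (sym eq) (proj₁ (desc-bound (q⊆desc (in-window x′<k)))))
      ; settled = λ x<k x∉ → ⊥-elim (x∉ (all-tokens target-inj x<k))
      ; bound = λ x<k → <-≤-trans (pl<m₁ x<k) (≤-trans (m≤m+n m₁ (S * d)) (≤-reflexive (sym |cs₂|)))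
      ; good = good-extend Bk.new good-p }

    transferred : ∃[ new ] All (WellFormed k₁) new × Link σ (new ++ cs₂) (letters pl) (letters target)
    transferred = transfer target-inj target-bound good-q stage

  build-connector : SymConnector σ extra
  build-connector = assemble transferred
    where
    assemble : ∃[ new ] All (WellFormed k₁) new × Link σ (new ++ cs₂) (letters pl) (letters target) → SymConnector σ extra
    assemble (new , wf₃ , link) = record
      { cs = cs₃ ; wf = Allₚ.++⁺ wf₃ (Allₚ.++⁺ Bk.wf (Allₚ.++⁺ F.wf [])) ; mids = mids ; scope = scope′ ; rounds = rounds ; aligned = aligned′ ; chain = chain′ }
      where
      open Link link
      cs₃ = new ++ cs₂
      p : List ℕ
      p = letters pl
      rest mids : List ℕ
      rest = drop k desc
      mids = range 0 y ++ p ++ between ++ desc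
      |cs₃| : length cs₂ ≤ length cs₃
      |cs₃| = ≤-trans (m≤n+m _ (length new)) (≤-reflexive (sym (length-++ new)))
      scope′ : All (_< length cs₃) mids
      scope′ = Allₚ.++⁺ (All.tabulate (λ i∈ → small (∈-range⁻ 0 y i∈)))
        (Allₚ.++⁺ (Allₚ.++⁻ˡ p scope) (Allₚ.++⁺ (Allₚ.++⁻ˡ between (Allₚ.++⁻ʳ p scope)) (All.tabulate (λ i∈ → <-≤-trans (proj₂ (desc-bound i∈)) |cs₃|))))
        where
        small : ∀ {i} → ∃[ j ] j < y × i ≡ 0 + j → i < length cs₃
        small (j , j<y , refl) = <-≤-trans j<y (≤-trans (m≤m+n y k) (≤-trans (≤-reflexive y+k) (≤-trans (m≤m+n m₁ (S * d)) (≤-trans (≤-reflexive (sym |cs₂|)) |cs₃|))))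
      aligned′ : ℓ + length mids ≡ (suc s₂ + extra + rounds * Q + S) * d
      aligned′ = begin
        ℓ + length mids ≡⟨ cong (ℓ +_) (trans (length-++ (range 0 y)) (cong (length (range 0 y) +_) (trans (cong length (sym (++-assoc p between desc))) (length-++ (p ++ between))))) ⟩
        ℓ + (length (range 0 y) + (length (p ++ between) + length desc)) ≡⟨ cong (ℓ +_) (cong₂ _+_ (length-range 0 y) (cong₂ _+_ aligned |desc|)) ⟩
        ℓ + (y + (rounds * Q * d + S * d)) ≡⟨ eq s₂ r e extra (rounds * Q) ⟩
        (suc s₂ + extra + rounds * Q + S) * d ∎
        where
        open ≡-Reasoning
        eq : ∀ s r e x n → s * (r + e) + r + (x * (r + e) + e + (n * (r + e) + suc (suc s) * (r + e))) ≡ (suc s + x + n + suc (suc s)) * (r + e)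
        eq = solve-∀
      A₁ B₁ P₁ Q₂ R₁ : List Sym
      A₁ = head-word
      P₁ = map var p
      B₁ = map var between
      Q₂ = map var (letters target)
      R₁ = map var rest ++ pars ℓ
      ch₁ : SymChain cs₃ (A₁ ++ P₁)
      ch₁ = chain-weaken {e = A₁ ++ P₁} new (chain-weaken {e = A₁ ++ P₁} Bk.new (subst (λ l → SymChain cs₁ (A₁ ++ map var l)) (sym pl-window) chain₁))
      ch₂ : SymChain cs₃ (P₁ ++ B₁ ++ Q₂)
      ch₂ = subst (SymChain cs₃) (trans (map-++ var p _) (cong (P₁ ++_) (map-++ var between _)))
        (chain-pointwise {R = λ i s → s ≡ var i} {G = GoodLevels cs₃} {H = Good cs₃} (λ g ps → subst (Good cs₃) (vars ps) g) (vars′ (p ++ between ++ letters target)) chain)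
        where
        vars : ∀ {xs ys} → Pointwise (λ i s → s ≡ var i) xs ys → map var xs ≡ ys
        vars [] = refl
        vars (eq ∷ eqs) = cong₂ _∷_ (sym eq) (vars eqs)
        vars′ : ∀ xs → Pointwise (λ i s → s ≡ var i) xs (map var xs)
        vars′ [] = []
        vars′ (x ∷ xs) = refl ∷ vars′ xs
      q-desc : map var (letters target) ++ map var rest ≡ map var desc
      q-desc = trans (cong (λ l → map var l ++ map var rest) target-window) (trans (sym (map-++ var q rest)) (cong (map var) (take++drop≡id k desc)))
      ch₃ : SymChain cs₃ (Q₂ ++ R₁)
      ch₃ = chain-weaken {e = Q₂ ++ R₁} new (subst (SymChain cs₂) (trans (cong (_++ pars ℓ) (sym q-desc)) (++-assoc Q₂ (map var rest) (pars ℓ))) Bk.chain)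
      ℓ≤k : ∀ (α : ℕ → ℕ) → ℓ ≤ length (map var (letters α))
      ℓ≤k α = subst (ℓ ≤_) (sym (trans (length-map var (letters α)) (length-letters α))) (subst (ℓ ≤_) (sym k≡d+ℓ) (m≤n+m ℓ d))
      ch₁₂ : SymChain cs₃ ((A₁ ++ P₁ ++ B₁) ++ Q₂)
      ch₁₂ = subst (SymChain cs₃) (trans (cong (A₁ ++_) (sym (++-assoc P₁ B₁ Q₂))) (sym (++-assoc A₁ (P₁ ++ B₁) Q₂)))
        (chain-++ {G = Good cs₃} A₁ P₁ (B₁ ++ Q₂) (suc s₂ + extra) |head-word| (ℓ≤k pl) ch₁ ch₂)
      front : length (A₁ ++ P₁ ++ B₁) ≡ (suc s₂ + extra + rounds * Q) * d
      front = trans (length-++ A₁) (trans (cong₂ _+_ |head-word| (trans (cong length (sym (map-++ var p between))) (trans (length-map var (p ++ between)) aligned))) (sym (*-distribʳ-+ d (suc s₂ + extra) (rounds * Q))))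
      chain′ : SymChain cs₃ (pars 0 ++ map var mids ++ pars ℓ)
      chain′ = subst (SymChain cs₃) word (chain-++ {G = Good cs₃} (A₁ ++ P₁ ++ B₁) Q₂ R₁ (suc s₂ + extra + rounds * Q) front (ℓ≤k target) ch₁₂ ch₃)
        where
        open ≡-Reasoning
        word : (A₁ ++ P₁ ++ B₁) ++ Q₂ ++ R₁ ≡ pars 0 ++ map var mids ++ pars ℓ
        word = begin
          (A₁ ++ P₁ ++ B₁) ++ Q₂ ++ R₁ ≡⟨ cong ((A₁ ++ P₁ ++ B₁) ++_) (trans (sym (++-assoc Q₂ (map var rest) (pars ℓ))) (cong (_++ pars ℓ) q-desc)) ⟩
          (A₁ ++ P₁ ++ B₁) ++ map var desc ++ pars ℓ ≡⟨ trans (++-assoc A₁ (P₁ ++ B₁) _) (cong (A₁ ++_) (++-assoc P₁ B₁ _)) ⟩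
          A₁ ++ P₁ ++ B₁ ++ map var desc ++ pars ℓ ≡⟨ ++-assoc (pars 0) (map var (range 0 y)) _ ⟩
          pars 0 ++ map var (range 0 y) ++ P₁ ++ B₁ ++ map var desc ++ pars ℓ ≡⟨ cong (pars 0 ++_) flatten ⟨
          pars 0 ++ map var mids ++ pars ℓ ∎
          where
          flatten : map var mids ++ pars ℓ ≡ map var (range 0 y) ++ P₁ ++ B₁ ++ map var desc ++ pars ℓ
          flatten = trans (cong (_++ pars ℓ) (trans (map-++ var (range 0 y) _) (cong (map var (range 0 y) ++_) (trans (map-++ var p _) (cong (P₁ ++_) (map-++ var between desc))))))
            (trans (++-assoc (map var (range 0 y)) _ _) (cong (map var (range 0 y) ++_) (trans (++-assoc P₁ _ _) (cong (P₁ ++_) (++-assoc B₁ (map var desc) (pars ℓ))))))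

  abstract
    connector : SymConnector σ extra
    connector = build-connector

-- Connections, pieces and routes in the hypergraph

pointwise-split : ∀ {R : A → B → Set} xs {xs′ ys} → Pointwise R (xs ++ xs′) ys → ∃₂ λ ys₁ ys₂ → ys ≡ ys₁ ++ ys₂ × Pointwise R xs ys₁ × Pointwise R xs′ ys₂
pointwise-split [] ps = [] , _ , refl , [] , ps
pointwise-split (x ∷ xs) (p ∷ ps) with ys₁ , ys₂ , refl , ps₁ , ps₂ ← pointwise-split xs ps = _ ∷ ys₁ , ys₂ , refl , p ∷ ps₁ , ps₂

nth-++ˡ : ∀ (a₀ : A) xs {ys i} → i < length xs → nth a₀ (xs ++ ys) i ≡ nth a₀ xs i
nth-++ˡ a₀ (x ∷ xs) {i = zero} i< = refl
nth-++ˡ a₀ (x ∷ xs) {i = suc i} (s≤s i<) = nth-++ˡ a₀ xs i<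

nth-++ʳ : ∀ (a₀ : A) xs {ys} i → nth a₀ (xs ++ ys) (length xs + i) ≡ nth a₀ ys i
nth-++ʳ a₀ [] i = refl
nth-++ʳ a₀ (x ∷ xs) i = nth-++ʳ a₀ xs i

match-pars : ∀ {n} (a₀ : Fin n) ps z a xs → (∀ i → i < length xs → nth a₀ ps (a + i) ≡ nth a₀ xs i) →
    Pointwise (Match a₀ ps z) (map par (range a (length xs))) xs
match-pars a₀ ps z a [] eq = []
match-pars a₀ ps z a (x ∷ xs) eq =
  subst (Match a₀ ps z (par a)) (trans (cong (nth a₀ ps) (sym (+-identityʳ a))) (eq 0 (s≤s z≤n))) (parameter a) ∷
  match-pars a₀ ps z (suc a) xs (λ i i< → trans (cong (nth a₀ ps) (sym (+-suc a i))) (eq (suc i) (s≤s i<)))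

∑-remove : ∀ {U R U′ : List A} (f : A → ℕ) → U ↭ R ++ U′ → (∀ v → f v ≤ 1) → ∑ U f ≤ ∑ U′ f + length R
∑-remove {R = R} {U′} f perm f≤1 = ≤-trans (≤-reflexive (trans (∑-↭ f perm) (trans (∑-++ R U′ f) (+-comm (∑ R f) _))))
  (+-monoʳ-≤ (∑ U′ f) (≤-trans (∑-≤ R (λ {v} _ → f≤1 v)) (≤-reflexive (*-identityʳ (length R)))))

module Paths (σ : Shape) (Γ : Host) where
  open Host Γ
  open Words σ
  open Tiles σ Γ

  Degree≥ : ℕ → List (Fin n) → Set
  Degree≥ δ U = ∀ S → length S ≡ k₁ → δ ≤ ∑ U (λ v → ⟦ E (v ∷ S) ⟧)

  degree-remove : ∀ {δ b U R U′} → U ↭ R ++ U′ → length R ≤ b → Degree≥ (δ + b) U → Degree≥ δ U′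
  degree-remove {δ} {b} {R = R} perm R≤b deg S |S| = +-cancelʳ-≤ b _ _ (≤-trans (deg S |S|) (≤-trans (∑-remove {R = R} _ perm (λ v → ⟦⟧≤1 (E (v ∷ S)))) (+-monoʳ-≤ _ R≤b)))

  degree≤length : ∀ {δ U} → Degree≥ δ U → δ ≤ length U
  degree≤length {U = U} deg = ≤-trans (deg (replicate k₁ a₀) (length-replicate k₁)) (≤-trans (∑-≤ U (λ {v} _ → ⟦⟧≤1 (E (v ∷ replicate k₁ a₀)))) (≤-reflexive (*-identityʳ (length U))))

  module _ {extra : ℕ} (sym-conn : SymConnector σ extra) where
    open SymConnector sym-conn

    link-size width : ℕ
    link-size = length mids
    width = suc link-size

    link-threshold : ℕ → ℕ
    link-threshold C = 2 * (C ^ length cs) ^ (width ^ length cs) * (length cs * width * (length cs * width))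

    record Connection (U x y : List (Fin n)) : Set where
      field
        inner : List (Fin n)
        size : length inner ≡ link-size
        distinct : Unique inner
        within : All (_∈ U) inner
        path : EChain (x ++ inner ++ y)

    -- The ends x and y are the values of the parameters. By `greedy-count` the solutions have
    -- density at least 1 / C ^ m, so there is a box of them inside `U`; its rows are long enough to
    -- give each position of the link a vertex of its own, and the successor in `width` keeps them
    -- nonempty.
    connect : ∀ {U δ} C → Unique U → Degree≥ δ U → length U ≤ C * δ → link-threshold C < length U →
        ∀ x y → length x ≡ ℓ → length y ≡ ℓ → Connection U x y
    connect {U} {δ} C uniq deg u≤Cδ big x y |x| |y| = build (fresh-box U uniq width m (holds a₀ E ps cs) (C ^ m) dense big)
      where
      m = length cs
      ps = x ++ y
      u = length U
      dense : u ^ m ≤ C ^ m * count U m (holds a₀ E ps cs)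
      dense = begin
        u ^ m ≤⟨ ^-monoˡ-≤ m u≤Cδ ⟩
        (C * δ) ^ m ≡⟨ ^-distribʳ-* m C δ ⟩
        C ^ m * δ ^ m ≤⟨ *-monoʳ-≤ (C ^ m) (greedy-count a₀ E U k₁ δ deg (degree≤length {δ} {U} deg) ps wf) ⟩
        C ^ m * count U m (holds a₀ E ps cs) ∎
        where open ≤-Reasoning
      build : FreshBox U uniq width m (holds a₀ E ps cs) → Connection U x y
      build fb = conclude (place-levels a₀ E E-resp ps rows width mids widths (n≤1+n _) (subst (λ l → All (_< l) mids) (sym number) scope) distinct)
        where
        open FreshBox fb
        nonempty : All (λ row → 0 < length row) rows
        nonempty = All.map (λ eq → subst (0 <_) (sym eq) (s≤s z≤n)) widths
        conclude : ∃[ vs ] Pointwise (Match a₀ ps rows) (map var mids) vs × Unique vs → Connection U x y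
        conclude (vs , ms , un) = record
          { inner = vs ; size = trans (sym (Pointwise-length ms)) (length-map var mids) ; distinct = un
          ; within = All.tabulate (λ v∈ → in-U (pointwise-∈ ms v∈))
          ; path = chain-pointwise {R = Match a₀ ps rows} {G = Good cs} {H = λ xs → E xs ≡ true}
            (λ g ms → box-edge a₀ E E-resp ps g number nonempty holds′ ms)
            (Pw.++⁺ left (Pw.++⁺ ms right)) chain }
          where
          holds′ = FreshBox.holds fb
          in-row : ∀ {i row} → Level rows i row → row ∈ rows
          in-row lv = go lv
            where
            go : ∀ {z : List (List (Fin n))} {i row} → Level z i row → row ∈ z
            go newest = here refl
            go (older lv) = there (go lv)
          in-U : ∀ {v} → ∃[ s ] s ∈ map var mids × Match a₀ ps rows s v → v ∈ U
          in-U (s , s∈ , member lv v∈) = All.lookup (All.lookup (FreshBox.within fb) (in-row lv)) v∈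
          in-U (s , s∈ , parameter i) with _ , _ , () ← ∈-map⁻ var s∈
          left : Pointwise (Match a₀ ps rows) (map par (range 0 ℓ)) x
          left = subst (λ l → Pointwise (Match a₀ ps rows) (map par (range 0 l)) x) |x| (match-pars a₀ ps rows 0 x (λ i i< → nth-++ˡ a₀ x i<))
          right : Pointwise (Match a₀ ps rows) (map par (range ℓ ℓ)) y
          right = subst₂ (λ a l → Pointwise (Match a₀ ps rows) (map par (range a l)) y) |x| |y| (match-pars a₀ ps rows (length x) y (λ i i< → nth-++ʳ a₀ x i))

  -- Joints see only `head` and `tail`. Absorption changes `mid` alone, so it can take place after
  -- all pieces have been connected.
  record Piece : Set where
    field
      head mid tail : List (Fin n)
      |head| : length head ≡ ℓ
      |tail| : length tail ≡ ℓ
      blocks : ℕ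
      aligned : length (head ++ mid) ≡ blocks * d
      path : EChain (head ++ mid ++ tail)

  -- A replacement for the interior of a piece.
  record Alternative (p : Piece) : Set where
    open Piece p
    field
      mid′ : List (Fin n)
      blocks′ : ℕ
      aligned′ : length (head ++ mid′) ≡ blocks′ * d
      path′ : EChain (head ++ mid′ ++ tail)

  keep : ∀ p → Alternative p
  keep p = record { mid′ = mid ; blocks′ = blocks ; aligned′ = aligned ; path′ = path }
    where open Piece p

  vertices : Piece → List (Fin n)
  vertices p = head ++ mid ++ tail
    where open Piece p

  next : List Piece → Piece → Piece
  next [] q = q
  next (p ∷ _) q = p

  record Joint (p q : Piece) : Set where
    field
      inner : List (Fin n)
      blocks : ℕ
      aligned : length (Piece.tail p ++ inner) ≡ blocks * d
      path : EChain (Piece.tail p ++ inner ++ Piece.head q)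

  infixr 5 _∷_

  -- Joints leading through the pieces ps, in order, to the piece q.
  data Links : List Piece → Piece → Set where
    [] : ∀ {q} → Links [] q
    _∷_ : ∀ {p ps q} → Joint p (next ps q) → Links ps q → Links (p ∷ ps) q

  inners : ∀ {ps q} → Links ps q → List (Fin n)
  inners [] = []
  inners (j ∷ js) = Joint.inner j ++ inners js

  links-++ : ∀ {ps q qs z} → Links ps q → Links (q ∷ qs) z → Links (ps ++ q ∷ qs) z
  links-++ [] ks = ks
  links-++ {p ∷ []} (j ∷ js) ks = j ∷ links-++ js ks
  links-++ {p ∷ _ ∷ _} (j ∷ js) ks = j ∷ links-++ js ks

  inners-++ : ∀ {ps q qs z} (js : Links ps q) (ks : Links (q ∷ qs) z) → inners (links-++ js ks) ≡ inners js ++ inners ks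
  inners-++ [] ks = refl
  inners-++ {p ∷ []} (j ∷ js) ks = trans (cong (Joint.inner j ++_) (inners-++ js ks)) (sym (++-assoc (Joint.inner j) _ _))
  inners-++ {p ∷ _ ∷ _} (j ∷ js) ks = trans (cong (Joint.inner j ++_) (inners-++ js ks)) (sym (++-assoc (Joint.inner j) _ _))

  route : ∀ {ps q} → Links ps q → All Alternative ps → List (Fin n)
  route [] [] = []
  route {p ∷ _} (j ∷ js) (alt ∷ alts) = Piece.head p ++ Alternative.mid′ alt ++ Piece.tail p ++ Joint.inner j ++ route js alts

  mids′ : ∀ {ps} → All Alternative ps → List (Fin n)
  mids′ [] = []
  mids′ (alt ∷ alts) = Alternative.mid′ alt ++ mids′ alts

  keep-all : ∀ ps → All Alternative ps
  keep-all ps = All.universal keep ps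

  route-head : ∀ {ps q} (js : Links ps q) alts → ∃[ rest ] route js alts ++ Piece.head q ≡ Piece.head (next ps q) ++ rest
  route-head {q = q} [] [] = [] , sym (++-identityʳ (Piece.head q))
  route-head {p ∷ _} (j ∷ js) (alt ∷ alts) = _ , ++-assoc (Piece.head p) _ _

  route-path : ∀ {ps q} (js : Links ps q) alts → EChain (route js alts ++ Piece.head q)
  route-path {q = q} [] [] = chain-short {G = λ xs → E xs ≡ true} (Piece.head q) (Piece.|head| q)
  route-path {p ∷ ps} {q} (j ∷ js) (alt ∷ alts) = subst EChain word
    (chain-++ {G = G} (head ++ mid′) tail (inner ++ route js alts ++ Piece.head q) blocks′ aligned′ (≤-reflexive (sym |tail|))
      (subst EChain (sym (++-assoc head mid′ tail)) path′) inner-path)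
    where
    G : List (Fin n) → Set
    G xs = E xs ≡ true
    open Piece p using (head; tail; |tail|)
    open Alternative alt
    open Joint j using (inner)
    h = Piece.head (next ps q)
    rest = proj₁ (route-head js alts)
    rest-eq : route js alts ++ Piece.head q ≡ h ++ rest
    rest-eq = proj₂ (route-head js alts)
    inner-path : EChain (tail ++ inner ++ route js alts ++ Piece.head q)
    inner-path = subst EChain (trans (++-assoc tail inner _) (cong (λ l → tail ++ inner ++ l) (sym rest-eq)))
      (chain-++ {G = G} (tail ++ inner) h rest (Joint.blocks j) (Joint.aligned j) (≤-reflexive (sym (Piece.|head| (next ps q))))
        (subst EChain (sym (++-assoc tail inner h)) (Joint.path j)) (subst EChain rest-eq (route-path js alts)))
    word : (head ++ mid′) ++ tail ++ inner ++ route js alts ++ Piece.head q ≡ route (j ∷ js) (alt ∷ alts) ++ Piece.head q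
    word = trans (++-assoc head mid′ _) (sym (trans (++-assoc head _ _) (cong (head ++_) (trans (++-assoc mid′ _ _) (cong (mid′ ++_)
      (trans (++-assoc tail _ _) (cong (tail ++_) (++-assoc inner (route js alts) (Piece.head q)))))))))

  route-↭ : ∀ {ps q} (js : Links ps q) alts →
      route js alts ↭ mids′ alts ++ concat (map (λ p → Piece.head p ++ Piece.tail p) ps) ++ inners js
  route-↭ [] [] = ↭-refl
  route-↭ {p ∷ ps} (j ∷ js) (alt ∷ alts) = begin
    h ++ m ++ tl ++ i ++ route js alts ↭⟨ shifts h m ⟩
    m ++ h ++ tl ++ i ++ route js alts ↭⟨ Permₚ.++⁺ˡ m (Permₚ.++⁺ˡ h (Permₚ.++⁺ˡ tl (Permₚ.++⁺ˡ i (route-↭ js alts)))) ⟩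
    m ++ h ++ tl ++ i ++ M ++ H ++ I ↭⟨ Permₚ.++⁺ˡ m (Permₚ.++⁺ˡ h (Permₚ.++⁺ˡ tl (shifts i M))) ⟩
    m ++ h ++ tl ++ M ++ i ++ H ++ I ↭⟨ Permₚ.++⁺ˡ m (Permₚ.++⁺ˡ h (Permₚ.++⁺ˡ tl (Permₚ.++⁺ˡ M (shifts i H)))) ⟩
    m ++ h ++ tl ++ M ++ H ++ i ++ I ↭⟨ Permₚ.++⁺ˡ m (Permₚ.++⁺ˡ h (shifts tl M)) ⟩
    m ++ h ++ M ++ tl ++ H ++ i ++ I ↭⟨ Permₚ.++⁺ˡ m (shifts h M) ⟩
    m ++ M ++ h ++ tl ++ H ++ i ++ I ≡⟨ cong (λ l → m ++ M ++ l) (trans (sym (++-assoc h tl _)) (sym (++-assoc (h ++ tl) H _))) ⟩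
    m ++ M ++ ((h ++ tl) ++ H) ++ i ++ I ≡⟨ ++-assoc m M _ ⟨
    (m ++ M) ++ ((h ++ tl) ++ H) ++ i ++ I ∎
    where
    open Perm.PermutationReasoning
    h = Piece.head p
    tl = Piece.tail p
    m = Alternative.mid′ alt
    i = Joint.inner j
    M = mids′ alts
    H = concat (map (λ p → Piece.head p ++ Piece.tail p) ps)
    I = inners js

  module _ {extra : ℕ} (sym-conn : SymConnector σ extra) where
    open SymConnector sym-conn using (aligned; rounds)

    joint : ∀ {U δ} C → Unique U → Degree≥ δ U → length U ≤ C * δ → link-threshold sym-conn C < length U →
        ∀ p q → Σ[ j ∈ Joint p q ] Unique (Joint.inner j) × All (_∈ U) (Joint.inner j) × length (Joint.inner j) ≡ link-size sym-conn
    joint C uniq deg u≤ big p q = record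
        { inner = inner ; blocks = suc s₂ + extra + rounds * Q + S
        ; aligned = trans (length-++ (Piece.tail p)) (trans (cong₂ _+_ (Piece.|tail| p) size) aligned) ; path = path } , distinct , within , size
      where open Connection (connect sym-conn C uniq deg u≤ big (Piece.tail p) (Piece.head q) (Piece.|tail| p) (Piece.|head| q))

    record Connected (U : List (Fin n)) (ps : List Piece) (q : Piece) : Set where
      field
        links : Links ps q
        rest : List (Fin n)
        split : U ↭ inners links ++ rest
        size : length (inners links) ≡ length ps * link-size sym-conn

    -- Joints are chosen one after the other and their vertices removed. `b` is the number of
    -- vertices that may still be spent, and the degree is assumed with this reserve.
    connect-all : ∀ {U δ} C ps q b → length ps * link-size sym-conn ≤ b → Unique U → Degree≥ (δ + b) U → length U ≤ C * δ →
        link-threshold sym-conn C + b < length U → Connected U ps q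
    connect-all {U} C [] q b le uniq deg u≤ big = record { links = [] ; rest = U ; split = ↭-refl ; size = refl }
    connect-all {U} {δ} C (p ∷ ps) q b le uniq deg u≤ big = extend (joint C uniq deg (≤-trans u≤ (*-monoʳ-≤ C (m≤m+n δ b))) (≤-<-trans (m≤m+n _ b) big) p (next ps q))
      where
      L = link-size sym-conn
      b′ = b ∸ L
      b-split : b′ + L ≡ b
      b-split = m∸n+n≡m (≤-trans (m≤m+n L _) le)
      extend : Σ[ j ∈ Joint p (next ps q) ] Unique (Joint.inner j) × All (_∈ U) (Joint.inner j) × length (Joint.inner j) ≡ L → Connected U (p ∷ ps) q
      extend (j , un , win , size-j) = prepend (subset-↭ un win)
        where
        prepend : ∃[ U′ ] U ↭ Joint.inner j ++ U′ → Connected U (p ∷ ps) q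
        prepend (U′ , perm) = finish (connect-all {U′} {δ} C ps q b′ (+-cancelʳ-≤ L _ _ (≤-trans (≤-reflexive (+-comm _ L)) (≤-trans le (≤-reflexive (sym b-split)))))
            (proj₁ (proj₂ (unique-++⁻ (Joint.inner j) (unique-resp-↭ perm uniq))))
            (degree-remove {δ = δ + b′} {b = L} {R = Joint.inner j} perm (≤-reflexive size-j) (λ S |S| → ≤-trans (≤-reflexive (trans (+-assoc δ b′ L) (cong (δ +_) b-split))) (deg S |S|)))
            (≤-trans U′≤U u≤)
            (+-cancelʳ-< L _ _ (≤-trans (≤-reflexive (cong suc (trans (+-assoc _ b′ L) (cong (link-threshold sym-conn C +_) b-split)))) (≤-trans big (≤-reflexive (trans |U| (trans (cong (_+ length U′) size-j) (+-comm L _))))))))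
          where
          |U| : length U ≡ length (Joint.inner j) + length U′
          |U| = trans (↭-length perm) (length-++ (Joint.inner j))
          U′≤U : length U′ ≤ length U
          U′≤U = ≤-trans (m≤n+m _ _) (≤-reflexive (sym |U|))
          finish : Connected U′ ps q → Connected U (p ∷ ps) q
          finish cn = record
            { links = j ∷ links ; rest = rest
            ; split = ↭-trans perm (↭-trans (Permₚ.++⁺ˡ (Joint.inner j) split) (↭-reflexive (sym (++-assoc (Joint.inner j) _ rest))))
            ; size = trans (length-++ (Joint.inner j)) (cong₂ _+_ size-j size) }
            where open Connected cn

-- Absorbers as constraint systems

module SymbolicAbsorber (σ : Shape) where
  open Words σ
  open Tokens σ
  open Gadgets σ

  -- The edge on token levels lv 0, …, lv (k − 1), whose token-0 vertex may be replaced by the parameter i;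
  -- its token r is shared with the main edge.
  record SwitchGadget (cs : List Constraint) (i : ℕ) : Set where
    field
      lv : ℕ → ℕ
      pivot : lv r ≡ c i
      plain : Good cs (map (var ∘ lv) (range 0 k))
      switched : Good cs (par i ∷ map (var ∘ lv) (range 1 k₁))

  gadget-extend : ∀ {cs i} new → SwitchGadget cs i → SwitchGadget (new ++ cs) i
  gadget-extend new g = record { lv = lv ; pivot = pivot ; plain = good-extend new plain ; switched = good-extend new switched }
    where open SwitchGadget g

  d≤k₁ : d ≤ k₁
  d≤k₁ = ≤-pred (≤-<-trans d≤suc-s₂*d (m<m+n (suc s₂ * d) (s≤s z≤n)))

  k₂ : ℕ
  k₂ = pred k₁

  k₁≡ : k₁ ≡ suc k₂
  k₁≡ = sym (suc-pred k₁ {{>-nonZero (≤-trans (s≤s z≤n) d≤k₁)}})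

  -- Two completions of edges: first token k - 1 completes one in which the parameter plays token 0,
  -- then token 0 itself completes one with tokens 1, ..., k - 1. Token r is borrowed from the main
  -- edge, whose levels lie below k and so differ from all new ones.
  add-gadget : ∀ cs i → k ≤ length cs → ∃[ new ] All (WellFormed k₁) new × SwitchGadget (new ++ cs) i
  add-gadget cs i k≤m = last S₂ ∷ last S₁ ∷ replicate k₁ free , last |S₂| ∷ last |S₁| ∷ Allₚ.replicate⁺ k₁ free ,
    record { lv = lv ; pivot = at-r ; plain = plain ; switched = switched }
    where
    m = length cs
    cs′ = replicate k₁ free ++ cs
    |cs′| : length cs′ ≡ m + k₁
    |cs′| = trans (length-++ (replicate k₁ free)) (trans (cong (_+ m) (length-replicate k₁)) (+-comm k₁ m))
    lv : ℕ → ℕ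
    lv x = if? (x ≟ r) (c i) (if? (x ≟ 0) (m + k) (m + x))
    at-r : lv r ≡ c i
    at-r with r ≟ r
    ... | yes _ = refl
    ... | no ¬p = ⊥-elim (¬p refl)
    at-k₁ : lv k₁ ≡ m + k₁
    at-k₁ with k₁ ≟ r
    ... | yes eq = ⊥-elim (<⇒≢ (<-≤-trans r<d d≤k₁) (sym eq))
    ... | no _ with k₁ ≟ 0
    ... | yes eq = ⊥-elim (<⇒≱ (s≤s z≤n) (≤-trans d≤k₁ (≤-reflexive eq)))
    ... | no _ = refl
    below : ∀ {x y} → 1 ≤ x → x < y → lv x < m + y
    below {x} {y} 1≤x x<y with x ≟ r
    ... | yes _ = <-≤-trans (c<k i) (≤-trans k≤m (m≤m+n m y))
    ... | no _ with x ≟ 0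
    ... | yes refl = ⊥-elim (<⇒≱ 1≤x z≤n)
    ... | no _ = +-monoʳ-< m x<y
    injective : ∀ {x y} → 1 ≤ x → 1 ≤ y → lv x ≡ lv y → x ≡ y
    injective {x} {y} 1≤x 1≤y eq with x ≟ r | y ≟ r
    ... | yes p | yes q = trans p (sym q)
    ... | yes p | no _ with y ≟ 0
    ... | yes refl = ⊥-elim (<⇒≱ 1≤y z≤n)
    ... | no _ = ⊥-elim (<⇒≢ (<-≤-trans (c<k i) (≤-trans k≤m (m≤m+n m y))) eq)
    injective {x} {y} 1≤x 1≤y eq | no _ | yes q with x ≟ 0
    ... | yes refl = ⊥-elim (<⇒≱ 1≤x z≤n)
    ... | no _ = ⊥-elim (<⇒≢ (<-≤-trans (c<k i) (≤-trans k≤m (m≤m+n m x))) (sym eq))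
    injective {x} {y} 1≤x 1≤y eq | no _ | no _ with x ≟ 0 | y ≟ 0
    ... | yes refl | _ = ⊥-elim (<⇒≱ 1≤x z≤n)
    ... | no _ | yes refl = ⊥-elim (<⇒≱ 1≤y z≤n)
    ... | no _ | no _ = +-cancelˡ-≡ m x y eq
    positive : ∀ a M {x} → x ∈ range (suc a) M → 1 ≤ x × x < suc a + M
    positive a M x∈ with j , j<M , refl ← ∈-range⁻ (suc a) M x∈ = s≤s z≤n , +-monoʳ-< (suc a) j<M
    unique-lv : ∀ {xs} → (∀ {x} → x ∈ xs → 1 ≤ x) → Unique xs → Unique (map lv xs)
    unique-lv pos [] = []
    unique-lv pos (x∉ ∷ un) = Allₚ.map⁺ (All.tabulate (λ y∈ eq → All.lookup x∉ y∈ (injective (pos (here refl)) (pos (there y∈)) eq))) ∷ unique-lv (pos ∘ there) un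
    vars : List ℕ → List Sym
    vars = map (var ∘ lv)
    levels-vars : ∀ xs → levels (vars xs) ≡ map lv xs
    levels-vars xs = trans (cong levels (map-∘ xs)) (levels-var (map lv xs))
    S₁ S₂ : List Sym
    S₁ = par i ∷ vars (range 1 k₂)
    S₂ = vars (range 1 k₁)
    |S₁| : length S₁ ≡ k₁
    |S₁| = trans (cong suc (length-map-range (var ∘ lv) 1 k₂)) (sym k₁≡)
    |S₂| : length S₂ ≡ k₁
    |S₂| = length-map-range (var ∘ lv) 1 k₁
    g₁ : Good (last S₁ ∷ cs′) (var (length cs′) ∷ S₁)
    g₁ = good-new (tt ∷ Allₚ.map⁺ (All.tabulate (λ {x} x∈ → subst (lv x <_) (sym |cs′|) (below (proj₁ (positive 0 k₂ x∈)) (subst (x <_) (sym k₁≡) (proj₂ (positive 0 k₂ x∈)))))))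
      (subst Unique (sym (levels-vars (range 1 k₂))) (unique-lv (λ x∈ → proj₁ (positive 0 k₂ x∈)) (unique-range 1 k₂)))
    switched : Good (last S₂ ∷ last S₁ ∷ cs′) (par i ∷ vars (range 1 k₁))
    switched = good-weaken (last S₂) (good-resp (↭-trans (swap _ _ ↭-refl) (prep (par i) perm)) g₁)
      where
      perm : var (length cs′) ∷ vars (range 1 k₂) ↭ vars (range 1 k₁)
      perm = ↭-trans (Permₚ.∷↭∷ʳ _ _) (↭-reflexive (trans
        (cong (λ j → vars (range 1 k₂) ++ [ var j ]) (trans |cs′| (trans (sym at-k₁) (cong lv k₁≡))))
        (trans (sym (map-++ (var ∘ lv) (range 1 k₂) (range (1 + k₂) 1))) (cong vars (trans (sym (range-++ 1 k₂ 1)) (cong (range 1) (trans (+-comm k₂ 1) (sym k₁≡))))))))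
    plain : Good (last S₂ ∷ last S₁ ∷ cs′) (vars (range 0 k))
    plain = subst (λ j → Good (last S₂ ∷ last S₁ ∷ cs′) (var j ∷ S₂)) at-0
      (good-new (Allₚ.map⁺ (All.tabulate (λ {x} x∈ → subst (lv x <_) (sym |c₁|) (below (proj₁ (positive 0 k₁ x∈)) (proj₂ (positive 0 k₁ x∈))))))
        (subst Unique (sym (levels-vars (range 1 k₁))) (unique-lv (λ x∈ → proj₁ (positive 0 k₁ x∈)) (unique-range 1 k₁))))
      where
      |c₁| : length (last S₁ ∷ cs′) ≡ m + k
      |c₁| = trans (cong suc |cs′|) (sym (+-suc m k₁))
      at-0 : length (last S₁ ∷ cs′) ≡ lv 0
      at-0 = |c₁|

  record SymAbsorber : Set where
    field
      cs : List Constraint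
      wf : All (WellFormed k₁) cs
      main : Good cs (letters var)
      gadgets : All (SwitchGadget cs) (range 0 D)

  build-absorber : SymAbsorber
  build-absorber = let cs , wf , _ , main , gs = build 0 D in record { cs = cs ; wf = wf ; main = main ; gadgets = gs }
    where
    base : List Constraint
    base = last (map var (range 0 k₁)) ∷ replicate k₁ free
    |free| : length (replicate k₁ free) ≡ k₁
    |free| = length-replicate k₁
    base-good : Good base (letters var)
    base-good = good-resp (↭-trans (Permₚ.∷↭∷ʳ _ _) (↭-reflexive (trans (cong (λ j → map var (range 0 k₁) ++ [ var j ]) |free|)
        (trans (sym (map-++ var (range 0 k₁) (range k₁ 1))) (cong (map var) (trans (sym (range-++ 0 k₁ 1)) (cong (range 0) (+-comm k₁ 1))))))))
      (good-new (Allₚ.map⁺ (All.tabulate (λ {x} x∈ → subst (x <_) (sym |free|) (small (∈-range⁻ 0 k₁ x∈)))))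
        (subst Unique (sym (levels-var (range 0 k₁))) (unique-range 0 k₁)))
      where
      small : ∀ {x} → ∃[ i ] i < k₁ × x ≡ 0 + i → x < k₁
      small (i , i< , refl) = i<
    build : ∀ a N → ∃[ cs ] All (WellFormed k₁) cs × k ≤ length cs × Good cs (letters var) × All (SwitchGadget cs) (range a N)
    build a zero = base , last (length-map-range var 0 k₁) ∷ Allₚ.replicate⁺ k₁ free , ≤-reflexive (cong suc (sym |free|)) , base-good , []
    build a (suc N) with cs , wf , k≤ , main , gs ← build (suc a) N with new , wf′ , g ← add-gadget cs a k≤ =
      new ++ cs , Allₚ.++⁺ wf′ wf , ≤-trans k≤ (≤-trans (m≤n+m _ (length new)) (≤-reflexive (sym (length-++ new)))) , good-extend new main , g ∷ All.map (gadget-extend new) gs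

  abstract
    absorber : SymAbsorber
    absorber = build-absorber

-- Absorbers in the hypergraph

pointwise-unmap : ∀ {R : B → A → Set} (f : ℕ → B) xs {ys} → Pointwise R (map f xs) ys → Pointwise (λ x y → R (f x) y) xs ys
pointwise-unmap f [] [] = []
pointwise-unmap f (x ∷ xs) (p ∷ ps) = p ∷ pointwise-unmap f xs ps

module AbsorberWord (σ : Shape) where
  open Words σ
  open Tokens σ
  open Gadgets σ
  open SymbolicAbsorber σ
  open SymAbsorber absorber

  gadget-word : ∀ {i} → SwitchGadget cs i → List ℕ
  gadget-word g = map (SwitchGadget.lv g) (before ++ middle ++ after)

  gadget-words : ∀ {is} → All (SwitchGadget cs) is → List ℕ
  gadget-words [] = []
  gadget-words (g ∷ gs) = gadget-word g ++ gadget-words gs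

  loop-word total-word : List ℕ
  loop-word = tokens 0 D ++ tokens 0 ℓ
  total-word = loop-word ++ gadget-words gadgets

  absorber-width : ℕ
  absorber-width = suc (length total-word)

module Absorbing (σ : Shape) (Γ : Host) where
  open Host Γ
  open Words σ
  open Tokens σ
  open Gadgets σ
  open Tiles σ Γ
  open Paths σ Γ
  open SymbolicAbsorber σ
  open SymAbsorber absorber
  open AbsorberWord σ public

  -- The vertices to be absorbed enter only as parameters, so the same box serves every `T` that it
  -- solves. Below, one such tuple T₀ is fixed to guarantee the edges without parameters.
  Solves : List (List (Fin n)) → List (Fin n) → Set
  Solves z T = boxed (holds a₀ E T cs) z ≡ true

  below-k : ∀ xs → All (_< k) (map c xs)
  below-k xs = Allₚ.map⁺ (All.universal c<k xs)

  words-below : All (_< k) (before ++ middle ++ after)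
  words-below = Allₚ.++⁺ (below-k (range 0 (D + d))) (Allₚ.++⁺ (Allₚ.++⁺ (below-k (range d (Q₁ * d))) (below-k (range 0 d))) (below-k (range d (Q₁ * d + ℓ))))

  scoped-lv : ∀ {m} (f : ℕ → ℕ) → All (Scoped m) (map (var ∘ f) (range 0 k)) → ∀ {xs} → All (_< k) xs → All (_< m) (map f xs)
  scoped-lv f sc xs<k = Allₚ.map⁺ (All.map (λ x<k → All.lookup sc (∈-map⁺ (var ∘ f) (∈-range⁺ 0 x<k))) xs<k)

  total-scoped : All (_< length cs) total-word
  total-scoped = Allₚ.++⁺ (subst (All (_< length cs)) (map-id loop-word) (scoped-lv id (Good.scoped main) (Allₚ.++⁺ (below-k (range 0 D)) (below-k (range 0 ℓ))))) (go gadgets)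
    where
    go : ∀ {is} (gs : All (SwitchGadget cs) is) → All (_< length cs) (gadget-words gs)
    go [] = []
    go (g ∷ gs) = Allₚ.++⁺ (scoped-lv (SwitchGadget.lv g) (Good.scoped (SwitchGadget.plain g)) words-below) (go gs)

  module _ (z : List (List (Fin n))) (|z| : length z ≡ length cs) (widths : All (λ row → length row ≡ absorber-width) z)
      (uniq : Unique (concat z)) (T₀ : List (Fin n)) (solves₀ : Solves z T₀) where

    private
      In : ℕ → Fin n → Set
      In i v = ∃[ row ] Level z i row × v ∈ row

      nonempty : All (λ row → 0 < length row) z
      nonempty = All.map (λ eq → subst (0 <_) (sym eq) (s≤s z≤n)) widths

      to-match : ∀ T {xs vs} → Pointwise In xs vs → Pointwise (Match a₀ T z) (map var xs) vs
      to-match T [] = []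
      to-match T ((_ , lv , v∈) ∷ ps) = member lv v∈ ∷ to-match T ps

      main-blow : ∀ {vs} → Pointwise In (range 0 k) vs → E vs ≡ true
      main-blow ps = box-edge a₀ E E-resp T₀ main |z| nonempty solves₀ (to-match T₀ ps)

      ℓ≤D : ℓ ≤ D
      ℓ≤D = ≤-trans (+-monoʳ-≤ (s₂ * d) (<⇒≤ r<d)) (≤-trans (≤-reflexive (+-comm (s₂ * d) d)) (*-monoˡ-≤ d {suc s₂} {Q} (m≤m*n (suc s₂) S)))

      word-split : ∀ N → ℓ ≤ N → tokens 0 N ≡ tokens 0 ℓ ++ tokens ℓ (N ∸ ℓ)
      word-split N le = trans (cong (λ m → tokens 0 m) (sym (m+[n∸m]≡n le))) (map-range-++ c 0 ℓ (N ∸ ℓ))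

      matched-length : ∀ {R : ℕ → Fin n → Set} {a N vs} → Pointwise R (tokens a N) vs → length vs ≡ N
      matched-length {a = a} {N} ps = trans (sym (Pointwise-length ps)) (length-map-range c a N)

    -- The released vertex lies in row c i of the main edge: exactly the row required at position i
    -- of the period inserted by `loop-after`.
    Exchange : List (Fin n) → ℕ → Piece → Set
    Exchange T i p = Σ[ alt ∈ Alternative p ] ∃[ w ] In (c i) w × nth a₀ T i ∷ Piece.mid p ↭ w ∷ Alternative.mid′ alt

    Exchanges : List (Fin n) → List ℕ → List Piece → Set
    Exchanges T is ps = Σ[ alts ∈ All Alternative ps ] ∃[ zs ] Pointwise In (map c is) zs × map (nth a₀ T) is ++ mids′ (keep-all ps) ↭ zs ++ mids′ alts

    record Group (is : List ℕ) (vs : List (Fin n)) : Set where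
      field
        pieces : List Piece
        total : concat (map vertices pieces) ≡ vs
        swap-in : ∀ T → Solves z T → Exchanges T is pieces

    module _ {i : ℕ} (g : SwitchGadget cs i) where
      open SwitchGadget g

      private
        P : ℕ → Fin n → Set
        P x v = In (lv x) v

        -- Token 0 may also be represented by the vertex to be absorbed. A window contains token 0
        -- only once, so the plain and the switched edges cover all cases.
        PT : List (Fin n) → ℕ → Fin n → Set
        PT T x v = P x v ⊎ (x ≡ 0 × v ≡ nth a₀ T i)

        blow : ∀ T → Solves z T → ∀ {vs} → Pointwise (PT T) (range 0 k) vs → E vs ≡ true
        blow T solves {v ∷ vs} (p ∷ ps) = by p
          where
          rest : ∀ a {M vs} → Pointwise (PT T) (range (suc a) M) vs → Pointwise (Match a₀ T z) (map (var ∘ lv) (range (suc a) M)) vs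
          rest a {zero} [] = []
          rest a {suc M} (inj₁ (_ , l , v∈) ∷ ps) = member l v∈ ∷ rest (suc a) ps
          rest a {suc M} (inj₂ (() , _) ∷ ps)
          by : PT T 0 v → E (v ∷ vs) ≡ true
          by (inj₁ (_ , l , v∈)) = box-edge a₀ E E-resp T plain |z| nonempty solves (member l v∈ ∷ rest 0 ps)
          by (inj₂ (_ , refl)) = box-edge a₀ E E-resp T switched |z| nonempty solves (parameter i ∷ rest 0 ps)

      gadget-piece : ∀ {vs} → Pointwise In (gadget-word g) vs →
        Σ[ p ∈ Piece ] vertices p ≡ vs × (∀ T → Solves z T → Exchange T i p)
      gadget-piece {vs} ps = build (pointwise-split before (pointwise-unmap lv (before ++ middle ++ after) ps))
        where
        Goal : Set
        Goal = Σ[ p ∈ Piece ] vertices p ≡ vs × (∀ T → Solves z T → Exchange T i p)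
        M₁ = D + d ∸ ℓ
        before≡ : before ≡ tokens 0 ℓ ++ tokens ℓ M₁
        before≡ = word-split (D + d) (≤-trans ℓ≤D (m≤m+n D d))
        after≡ : after ≡ tokens d (Q₁ * d) ++ tokens (d + Q₁ * d) ℓ
        after≡ = map-range-++ c d (Q₁ * d) ℓ
        build : ∃₂ (λ b ma → vs ≡ b ++ ma × Pointwise P before b × Pointwise P (middle ++ after) ma) → Goal
        build (b , ma , refl , pb , pma) = build₁ (pointwise-split middle pma)
          where
          build₁ : ∃₂ (λ m a → ma ≡ m ++ a × Pointwise P middle m × Pointwise P after a) → Goal
          build₁ (m , a , refl , pm , pa) = build₂ (pointwise-split (tokens 0 ℓ) (subst (λ l → Pointwise P l b) before≡ pb))
              (pointwise-split (tokens d (Q₁ * d)) (subst (λ l → Pointwise P l a) after≡ pa))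
            where
            build₂ : ∃₂ (λ h b′ → b ≡ h ++ b′ × Pointwise P (tokens 0 ℓ) h × Pointwise P (tokens ℓ M₁) b′) →
                ∃₂ (λ a′ l → a ≡ a′ ++ l × Pointwise P (tokens d (Q₁ * d)) a′ × Pointwise P (tokens (d + Q₁ * d) ℓ) l) → Goal
            build₂ (h , b′ , refl , ph , pb′) (a′ , l , refl , pa′ , pl) = piece , shape m , alternative
              where
              shape : ∀ m → h ++ (b′ ++ m ++ a′) ++ l ≡ (h ++ b′) ++ m ++ a′ ++ l
              shape m = trans (cong (h ++_) (trans (++-assoc b′ _ l) (cong (b′ ++_) (++-assoc m a′ l)))) (sym (++-assoc h b′ _))
              |middle| : length middle ≡ Q₁ * d + d
              |middle| = trans (length-++ (tokens d (Q₁ * d))) (cong₂ _+_ (length-map-range c d (Q₁ * d)) (length-map-range c 0 d))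
              aligned-with : ∀ m → length m ≡ Q₁ * d + d → length (h ++ b′ ++ m ++ a′) ≡ (Q + Q + Q) * d
              aligned-with m |m| = begin
                length (h ++ b′ ++ m ++ a′) ≡⟨ cong length (sym (++-assoc h b′ (m ++ a′))) ⟩
                length ((h ++ b′) ++ m ++ a′) ≡⟨ trans (length-++ (h ++ b′)) (cong (length (h ++ b′) +_) (length-++ m)) ⟩
                length (h ++ b′) + (length m + length a′) ≡⟨ cong₂ _+_ (trans (sym (Pointwise-length pb)) (length-map-range c 0 (D + d))) (cong₂ _+_ |m| (matched-length pa′)) ⟩
                D + d + (Q₁ * d + d + Q₁ * d) ≡⟨ eq Q₁ d ⟩
                (Q + Q + Q) * d ∎
                where
                open ≡-Reasoning
                eq : ∀ q d → suc q * d + d + (q * d + d + q * d) ≡ (suc q + suc q + suc q) * d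
                eq = solve-∀
              piece : Piece
              piece = record
                { head = h ; mid = b′ ++ m ++ a′ ; tail = l ; |head| = matched-length ph ; |tail| = matched-length pl
                ; blocks = Q + Q + Q ; aligned = aligned-with m (trans (sym (Pointwise-length pm)) |middle|)
                ; path = subst EChain (sym (shape m)) (blow-chain {P = P} (λ ps → blow T₀ solves₀ (Pw.map inj₁ ps)) exchange-before (Pw.++⁺ pb (Pw.++⁺ pm pa))) }
              alternative : ∀ T → Solves z T → Exchange T i piece
              -- The absorbed vertex and the old middle are redistributed along `middle-surplus`:
              -- the vertex matched to the extra r is released, the others fill the transposed
              -- middle.
              alternative T solves = choose (pointwise-↭ (↭-sym middle-surplus) (inj₂ (refl , refl) ∷ Pw.map inj₁ pm))
                where
                choose : ∃[ ys ] Pointwise (PT T) (r ∷ map τ middle) ys × nth a₀ T i ∷ m ↭ ys →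
                    Exchange T i piece
                choose (w ∷ m′ , inj₁ w-in ∷ pm′ , perm) = record
                  { mid′ = b′ ++ m′ ++ a′ ; blocks′ = Q + Q + Q
                  ; aligned′ = aligned-with m′ (trans (sym (Pointwise-length pm′)) (trans (length-map τ middle) |middle|))
                  ; path′ = subst EChain (sym (shape m′)) (blow-chain {P = PT T} (blow T solves) exchange-after (Pw.++⁺ (Pw.map inj₁ pb) (Pw.++⁺ pm′ (Pw.map inj₁ pa)))) } ,
                  w , subst (λ j → In j w) pivot w-in ,
                  ↭-trans (↭-sym (shift (nth a₀ T i) b′ (m ++ a′))) (↭-trans (Permₚ.++⁺ˡ b′ (Permₚ.++⁺ʳ a′ perm)) (shift w b′ (m′ ++ a′)))

    gadget-group : ∀ {is} (gs : All (SwitchGadget cs) is) {vs} → Pointwise In (gadget-words gs) vs → Group is vs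
    gadget-group [] [] = record { pieces = [] ; total = refl ; swap-in = λ T solves → [] , [] , [] , ↭-refl }
    gadget-group {i ∷ is} (g ∷ gs) {vs} ps = build (pointwise-split (gadget-word g) ps)
      where
      build : ∃₂ (λ vs₁ vs₂ → vs ≡ vs₁ ++ vs₂ × Pointwise In (gadget-word g) vs₁ × Pointwise In (gadget-words gs) vs₂) → Group (i ∷ is) vs
      build (vs₁ , vs₂ , refl , ps₁ , ps₂) = combine (gadget-piece g ps₁) (gadget-group gs ps₂)
        where
        combine : Σ[ p ∈ Piece ] vertices p ≡ vs₁ × (∀ T → Solves z T → Exchange T i p) →
            Group is vs₂ → Group (i ∷ is) (vs₁ ++ vs₂)
        combine (p , total₁ , alt₁) grp = record
          { pieces = p ∷ pieces
          ; total = cong₂ _++_ total₁ total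
          ; swap-in = λ T solves → both T (alt₁ T solves) (swap-in T solves) }
          where
          open Group grp
          both : ∀ T → Exchange T i p →
              Exchanges T is pieces →
              Exchanges T (i ∷ is) (p ∷ pieces)
          both T (alt , w , w-in , perm) (alts , zs , zs-in , perms) = alt ∷ alts , w ∷ zs , w-in ∷ zs-in , (begin
            t₀ ∷ ts ++ m ++ ms ↭⟨ prep t₀ (shifts ts m) ⟩
            (t₀ ∷ m) ++ ts ++ ms ↭⟨ Permₚ.++⁺ perm perms ⟩
            w ∷ m′ ++ zs ++ ms′ ↭⟨ prep w (shifts m′ zs) ⟩
            w ∷ zs ++ m′ ++ ms′ ∎)
            where
            open Perm.PermutationReasoning
            t₀ = nth a₀ T i
            ts = map (nth a₀ T) is
            m = Piece.mid p
            m′ = Alternative.mid′ alt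
            ms = mids′ (keep-all pieces)
            ms′ = mids′ alts

    record Absorber : Set where
      field
        pieces : List Piece
        unique : Unique (concat (map vertices pieces))
        within : All (_∈ concat z) (concat (map vertices pieces))
        size : length pieces ≡ suc D
        absorbs : ∀ T → length T ≡ D → Solves z T → Σ[ alts ∈ All Alternative pieces ] T ++ mids′ (keep-all pieces) ↭ mids′ alts

    build-real-absorber : Absorber
    build-real-absorber = start (place-levels a₀ E E-resp [] z absorber-width total-word widths (n≤1+n _) (subst (λ l → All (_< l) total-word) (sym |z|) total-scoped) uniq)
      where
      start : ∃[ vs ] Pointwise (Match a₀ [] z) (map var total-word) vs × Unique vs → Absorber
      start (vs , ms , un) = build (pointwise-split loop-word ins)
        where
        from-match : ∀ {xs vs} → Pointwise (Match a₀ [] z) (map var xs) vs → Pointwise In xs vs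
        from-match {[]} [] = []
        from-match {x ∷ xs} (member lv v∈ ∷ rest) = (_ , lv , v∈) ∷ from-match rest
        ins : Pointwise In total-word vs
        ins = from-match ms
        level-∈ : ∀ {z : List (List (Fin n))} {i row} → Level z i row → row ∈ z
        level-∈ newest = here refl
        level-∈ (older lv) = there (level-∈ lv)
        in-z : All (_∈ concat z) vs
        in-z = All.tabulate (λ v∈ → let _ , _ , row , lv , v∈row = pointwise-∈ ins v∈ in ∈-concat⁺′ v∈row (level-∈ lv))
        build : ∃₂ (λ xs ys → vs ≡ xs ++ ys × Pointwise In loop-word xs × Pointwise In (gadget-words gadgets) ys) → Absorber
        build (xs , ys , refl , pxs , pys) = build₁ (pointwise-split (tokens 0 D) pxs)
          where
          grp : Group (range 0 D) ys
          grp = gadget-group gadgets pys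
          build₁ : ∃₂ (λ x₁ x₂ → xs ≡ x₁ ++ x₂ × Pointwise In (tokens 0 D) x₁ × Pointwise In (tokens 0 ℓ) x₂) → Absorber
          build₁ (x₁ , x₂ , refl , p₁ , p₂) = build₂ (pointwise-split (tokens 0 ℓ) (subst (λ l → Pointwise In l x₁) (word-split D ℓ≤D) p₁))
            where
            build₂ : ∃₂ (λ h m → x₁ ≡ h ++ m × Pointwise In (tokens 0 ℓ) h × Pointwise In (tokens ℓ (D ∸ ℓ)) m) → Absorber
            build₂ (h , m , refl , ph , pm) = record
              { pieces = piece ∷ pieces
              ; unique = subst Unique (sym total′) un
              ; within = subst (All (_∈ concat z)) (sym total′) in-z
              ; size = cong suc size′
              ; absorbs = λ T |T| solves → absorb T |T| (swap-in T solves) }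
              where
              open Group grp
              piece : Piece
              piece = record
                { head = h ; mid = m ; tail = x₂ ; |head| = matched-length ph ; |tail| = matched-length p₂ ; blocks = Q ; aligned = matched-length p₁
                ; path = subst EChain (++-assoc h m x₂) (blow-chain {P = In} main-blow loop-before (Pw.++⁺ p₁ p₂)) }
              total′ : concat (map vertices (piece ∷ pieces)) ≡ ((h ++ m) ++ x₂) ++ ys
              total′ = cong₂ _++_ (sym (++-assoc h m x₂)) total
              size′ : length pieces ≡ D
              size′ = trans (count-pieces gadgets pys) (length-range 0 D)
                where
                count-pieces : ∀ {is} (gs : All (SwitchGadget cs) is) {vs} (ps : Pointwise In (gadget-words gs) vs) → length (Group.pieces (gadget-group gs ps)) ≡ length is
                count-pieces [] [] = refl
                count-pieces (g ∷ gs) ps with pointwise-split (gadget-word g) ps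
                ... | vs₁ , vs₂ , refl , ps₁ , ps₂ = cong suc (count-pieces gs ps₂)
              absorb : ∀ T → length T ≡ D → Σ[ alts ∈ All Alternative pieces ] ∃[ zs ] Pointwise In (tokens 0 D) zs × map (nth a₀ T) (range 0 D) ++ mids′ (keep-all pieces) ↭ zs ++ mids′ alts →
                  Σ[ alts ∈ All Alternative (piece ∷ pieces) ] T ++ mids′ (keep-all (piece ∷ pieces)) ↭ mids′ alts
              absorb T |T| (alts , zs , zs-in , perm) = alt ∷ alts , (begin
                T ++ m ++ kept ↭⟨ shifts T m ⟩
                m ++ T ++ kept ≡⟨ cong (λ l → m ++ l ++ kept) (trans (cong (λ N → map (nth a₀ T) (range 0 N)) (sym |T|)) (map-nth a₀ T)) ⟨
                m ++ map (nth a₀ T) (range 0 D) ++ kept ↭⟨ Permₚ.++⁺ˡ m perm ⟩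
                m ++ zs ++ mids′ alts ≡⟨ ++-assoc m zs _ ⟨
                (m ++ zs) ++ mids′ alts ∎)
                where
                open Perm.PermutationReasoning
                kept = mids′ (keep-all pieces)
                shape : (h ++ m) ++ zs ++ x₂ ≡ h ++ (m ++ zs) ++ x₂
                shape = trans (++-assoc h m _) (cong (h ++_) (sym (++-assoc m zs x₂)))
                alt : Alternative piece
                alt = record
                  { mid′ = m ++ zs ; blocks′ = Q + Q
                  ; aligned′ = trans (cong length (sym (++-assoc h m zs))) (trans (length-++ (h ++ m)) (trans (cong₂ _+_ (matched-length p₁) (matched-length zs-in)) (sym (*-distribʳ-+ d Q Q))))
                  ; path′ = subst EChain shape (blow-chain {P = In} main-blow loop-after (Pw.++⁺ p₁ (Pw.++⁺ zs-in p₂))) }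

    abstract
      real-absorber : Absorber
      real-absorber = build-real-absorber

-- A disjoint family of absorbers

fresh-++-unique : ∀ {n} (W xs : List (Fin n)) → fresh W xs ≡ true → Unique W → Unique (xs ++ W)
fresh-++-unique W xs fr un = unique-++⁺ (fresh-unique W xs fr) un (λ v∈ → All.lookup (fresh-avoids W xs fr) v∈)

allFin-unique : ∀ n → Unique (allFin n)
allFin-unique n = Uniqueₚ.allFin⁺ n

length-allFin : ∀ n → length (allFin n) ≡ n
length-allFin n = length-tabulate id

module AbsorberFamily (σ : Shape) (Γ : Host)
  (C δ q L : ℕ) (0<n : 0 < Host.n Γ) where
  open Host Γ hiding (N; N⇒E)
  open Words σ
  open Gadgets σ using (D)
  open Paths σ Γ
  open SymbolicAbsorber σ using (absorber; module SymAbsorber)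
  open SymAbsorber absorber using (cs; wf)
  open Absorbing σ Γ
  open ≤-Reasoning

  private
    V = allFin n

    |V| : length V ≡ n
    |V| = length-allFin n

  m M N C₁ C′ : ℕ
  m = length cs
  M = absorber-width
  N = m * M
  C₁ = C ^ m
  C′ = 2 * C₁ ^ (M ^ m)

  record Candidate : Set where
    field
      z : List (List (Fin n))
      number : length z ≡ m
      widths : All (λ row → length row ≡ M) z
      unique : Unique (concat z)
      T₀ : List (Fin n)
      solves : Solves z T₀

    body : Absorber z number widths unique T₀ solves
    body = real-absorber z number widths unique T₀ solves

  solved : List (Fin n) → Candidate → ℕ
  solved T cd = ⟦ boxed (holds a₀ E T cs) (Candidate.z cd) ⟧

  record Family : Set where
    field
      candidates : List Candidate
      size : length candidates ≡ q
      disjoint : Unique (concat (map (concat ∘ Candidate.z) candidates))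
      abundant : ∀ T → length T ≡ D → q ≤ 2 * C′ * ∑ candidates (solved T) + (4 * (C′ * C′) + 2 * C′) * L

  module _ (deg : Degree≥ δ V) (n≤Cδ : n ≤ C * δ) (0<C : 0 < C) (few : n ^ D ≤ 2 ^ L) (room : C′ * (N * (q * N + N)) ≤ n) where
    private
      x : ℕ
      x = pred C′

      C′≡ : C′ ≡ suc x
      C′≡ = sym (suc-pred C′ {{m*n≢0 2 (C₁ ^ (M ^ m)) {{_}} {{m^n≢0 C₁ (M ^ m) {{m^n≢0 C m {{>-nonZero 0<C}}}}}}}})

      Θ : List (List (Fin n))
      Θ = tuples V D

      Item = List (List (Fin n))

      good : List (Fin n) → Item → Bool
      good T z = boxed (holds a₀ E T cs) z

      -- The tests are the tuples `T`; a box that does not solve `T` costs 2 C′. For any weights on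
      -- the tuples some fresh box solves a share of at least 1 / C′, which gives average cost at
      -- most 2 (C′ - 1). The selection raises this to 2 (C′ - 1) + 1, one below 2 C′, and so leaves
      -- q / (2 C′) good boxes for every `T`, up to a logarithmic term.
      cost : List (Fin n) → Item → ℕ
      cost T z = 2 * C′ * ⟦ not (good T z) ⟧

      Fine : Item → Set
      Fine z = z ∈ boxes V M m × ∃[ T ] good T z ≡ true

      Valid : List Item → Set
      Valid h = All Fine h × Unique (concat (map concat h))

      dense : ∀ T → length V ^ m ≤ C₁ * count V m (holds a₀ E T cs)
      dense T = begin
        length V ^ m ≤⟨ ^-monoˡ-≤ m (≤-trans (≤-reflexive |V|) n≤Cδ) ⟩
        (C * δ) ^ m ≡⟨ ^-distribʳ-* m C δ ⟩
        C₁ * δ ^ m ≤⟨ *-monoʳ-≤ C₁ (greedy-count a₀ E V k₁ δ deg (degree≤length {δ} {V} deg) T wf) ⟩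
        C₁ * count V m (holds a₀ E T cs) ∎

      concat-size : ∀ {z} → z ∈ boxes V M m → length (concat z) ≡ N
      concat-size z∈ with len , wid , _ ← ∈-boxes V (allFin-unique n) M m z∈ = trans (go wid) (cong (_* M) len)
        where
        go : ∀ {z} → All (λ row → length row ≡ M) z → length (concat z) ≡ length z * M
        go [] = refl
        go {row ∷ z} (w ∷ ws) = trans (length-++ row) (cong₂ _+_ w (go ws))

      used-size : ∀ {h} → All Fine h → length (concat (map concat h)) ≡ length h * N
      used-size [] = refl
      used-size {z ∷ h} ((z∈ , _) ∷ fs) = trans (length-++ (concat z)) (cong₂ _+_ (concat-size z∈) (used-size fs))

      0<Θ : 0 < length Θ
      0<Θ = subst (0 <_) (sym (trans (length-tuples V D) (cong (_^ D) |V|))) (m^n>0 n {{>-nonZero 0<n}} D)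

      number-of-boxes : ∀ c → ∑ (boxes V M m) (λ _ → c) ≡ length V ^ N * c
      number-of-boxes c = trans (∑-boxes-concat V M m (λ _ → c)) (trans (∑-const (tuples V N) c) (cong (_* c) (length-tuples V N)))

      step : ∀ h → Valid h → length h < q → ∀ φ → (∀ T → 0 < φ T) → ∃[ z ] Valid (z ∷ h) × ∑ Θ (λ T → φ T * cost T z) ≤ 2 * x * ∑ Θ φ
      step h (fine , un) h<q φ φ>0 = choose (∑-pick≤ (boxes V M m) {λ _ → Φ} {λ z → C′ * (fr z * gain z)} nonempty average)
        where
        W = concat (map concat h)
        Φ = ∑ Θ φ
        fr gain : Item → ℕ
        fr z = ⟦ fresh W (concat z) ⟧
        gain z = ∑ Θ (λ T → φ T * ⟦ good T z ⟧)
        0<u^N : 0 < length V ^ N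
        0<u^N = subst (λ u → 0 < u ^ N) (sym |V|) (m^n>0 n {{>-nonZero 0<n}} N)
        nonempty : 0 < length (boxes V M m)
        nonempty = subst (0 <_) (trans (trans (sym (*-identityʳ _)) (sym (number-of-boxes 1))) (∑-1 (boxes V M m))) 0<u^N
        big : C′ * (N * (length W + N)) ≤ length V
        big = ≤-trans (*-monoʳ-≤ C′ (*-monoʳ-≤ N (+-monoˡ-≤ N (≤-trans (≤-reflexive (used-size fine)) (*-monoˡ-≤ N (<⇒≤ h<q)))))) (≤-trans room (≤-reflexive (sym |V|)))
        Φ>0 : 0 < Φ
        Φ>0 = <-≤-trans 0<Θ (≤-trans (≤-reflexive (sym (∑-1 Θ))) (∑-mono Θ φ>0))
        average : ∑ (boxes V M m) (λ _ → Φ) ≤ ∑ (boxes V M m) (λ z → C′ * (fr z * gain z))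
        average = begin
          ∑ (boxes V M m) (λ _ → Φ) ≡⟨ number-of-boxes Φ ⟩
          length V ^ N * Φ ≡⟨ ∑-*ˡ Θ (length V ^ N) φ ⟨
          ∑ Θ (λ T → length V ^ N * φ T) ≤⟨ ∑-mono Θ (λ T → *-monoˡ-≤ (φ T)
            (fresh-box-density V (allFin-unique n) M m (holds a₀ E T cs) W C₁ (subst (0 <_) (sym |V|) 0<n) (dense T) big)) ⟩
          ∑ Θ (λ T → C′ * ∑ (boxes V M m) (λ z → fr z * ⟦ good T z ⟧) * φ T) ≡⟨ ∑-cong Θ (λ T → trans (*-assoc C′ _ (φ T)) (cong (C′ *_) (sym (∑-*ʳ (boxes V M m) (φ T) _)))) ⟩
          ∑ Θ (λ T → C′ * ∑ (boxes V M m) (λ z → fr z * ⟦ good T z ⟧ * φ T)) ≡⟨ trans (∑-*ˡ Θ C′ _) (cong (C′ *_) (∑-swap Θ (boxes V M m) _)) ⟩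
          C′ * ∑ (boxes V M m) (λ z → ∑ Θ (λ T → fr z * ⟦ good T z ⟧ * φ T)) ≡⟨ cong (C′ *_) (∑-cong (boxes V M m) (λ z → trans (∑-cong Θ (λ T → regroup (fr z) ⟦ good T z ⟧ (φ T))) (∑-*ˡ Θ (fr z) _))) ⟩
          C′ * ∑ (boxes V M m) (λ z → fr z * gain z) ≡⟨ ∑-*ˡ (boxes V M m) C′ _ ⟨
          ∑ (boxes V M m) (λ z → C′ * (fr z * gain z)) ∎
          where
          regroup : ∀ a b c → a * b * c ≡ a * (c * b)
          regroup = solve-∀
        choose : ∃[ z ] z ∈ boxes V M m × Φ ≤ C′ * (fr z * gain z) → ∃[ z ] Valid (z ∷ h) × ∑ Θ (λ T → φ T * cost T z) ≤ 2 * x * Φ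
        choose (z , z∈ , le) with fresh W (concat z) in is-fresh
        ... | false = ⊥-elim (<⇒≱ Φ>0 (≤-trans le (≤-reflexive (*-zeroʳ C′))))
        ... | true = z , ((z∈ , some) ∷ fine , fresh-++-unique W (concat z) is-fresh un) , bound
          where
          le′ : Φ ≤ C′ * gain z
          le′ = ≤-trans le (≤-reflexive (cong (C′ *_) (*-identityˡ (gain z))))
          some : ∃[ T ] good T z ≡ true
          some = let T , _ , pos = ∑-pick< Θ {λ _ → 0} {λ T → φ T * ⟦ good T z ⟧} (≤-<-trans (≤-reflexive (∑-zero Θ)) gain>0) in T , positive T pos
            where
            gain>0 : 0 < gain z
            gain>0 = n≢0⇒n>0 λ eq → <⇒≱ Φ>0 (≤-trans le′ (≤-reflexive (trans (cong (C′ *_) eq) (*-zeroʳ C′))))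
            positive : ∀ T → 0 < φ T * ⟦ good T z ⟧ → good T z ≡ true
            positive T pos = ⟦⟧>0 (n≢0⇒n>0 λ eq → <⇒≢ pos (sym (trans (cong (φ T *_) eq) (*-zeroʳ (φ T)))))
          bound : ∑ Θ (λ T → φ T * cost T z) ≤ 2 * x * Φ
          bound = +-cancelʳ-≤ (2 * Φ) _ _ (begin
            ∑ Θ (λ T → φ T * cost T z) + 2 * Φ ≤⟨ +-monoʳ-≤ (∑ Θ (λ T → φ T * cost T z)) (*-monoʳ-≤ 2 le′) ⟩
            ∑ Θ (λ T → φ T * cost T z) + 2 * (C′ * gain z) ≡⟨ cong (∑ Θ (λ T → φ T * cost T z) +_) (trans (sym (*-assoc 2 C′ _)) (sym (∑-*ˡ Θ (2 * C′) _))) ⟩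
            ∑ Θ (λ T → φ T * cost T z) + ∑ Θ (λ T → 2 * C′ * (φ T * ⟦ good T z ⟧)) ≡⟨ ∑-+ Θ _ _ ⟨
            ∑ Θ (λ T → φ T * cost T z + 2 * C′ * (φ T * ⟦ good T z ⟧)) ≡⟨ ∑-cong Θ (λ T → both (φ T) C′ (good T z)) ⟩
            ∑ Θ (λ T → 2 * C′ * φ T) ≡⟨ ∑-*ˡ Θ (2 * C′) φ ⟩
            2 * C′ * Φ ≡⟨ trans (cong (λ c → 2 * c * Φ) C′≡) (expand x Φ) ⟩
            2 * x * Φ + 2 * Φ ∎)
            where
            both : ∀ f c b → f * (2 * c * ⟦ not b ⟧) + 2 * c * (f * ⟦ b ⟧) ≡ 2 * c * f
            both f c true = eq f c
              where
              eq : ∀ f c → f * (2 * c * 0) + 2 * c * (f * 1) ≡ 2 * c * f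
              eq = solve-∀
            both f c false = eq f c
              where
              eq : ∀ f c → f * (2 * c * 1) + 2 * c * (f * 0) ≡ 2 * c * f
              eq = solve-∀
            expand : ∀ x p → 2 * suc x * p ≡ 2 * x * p + 2 * p
            expand = solve-∀

      shrink : ∀ {z h} → Valid (z ∷ h) → Valid h
      shrink {z} (_ ∷ fine , un) = fine , proj₁ (proj₂ (unique-++⁻ (concat z) un))

      rate : 2 * x * (4 * (C′ * C′) + 2 * C′) ≤ suc (2 * x) * (4 * (C′ * C′))
      rate = subst (λ c → 2 * x * (4 * (c * c) + 2 * c) ≤ suc (2 * x) * (4 * (c * c))) (sym C′≡) (≤-trans (m≤m+n _ (4 * x + 4)) (≤-reflexive (eq x)))
        where
        eq : ∀ x → 2 * x * (4 * (suc x * suc x) + 2 * suc x) + (4 * x + 4) ≡ suc (2 * x) * (4 * (suc x * suc x))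
        eq = solve-∀

      0<C′ : 0 < C′
      0<C′ = subst (0 <_) (sym C′≡) (s≤s z≤n)

      open GuidedSelection Θ cost Valid (2 * C′) (2 * x) (4 * (C′ * C′)) (suc (2 * x)) L q
        (*-mono-≤ (s≤s {0} {3} z≤n) (*-mono-≤ 0<C′ 0<C′)) (≤-trans (≤-reflexive (trans (length-tuples V D) (cong (_^ D) |V|))) few) rate ([] , [])
        (λ T {z} _ → ≤-trans (*-monoʳ-≤ (2 * C′) (⟦⟧≤1 (not (good T z)))) (≤-reflexive (*-identityʳ (2 * C′)))) (λ {z} {h} → shrink {z} {h}) step

      convert : ∀ {h} → All Fine h → Unique (concat (map concat h)) → Σ[ cds ∈ List Candidate ] map Candidate.z cds ≡ h
      convert [] un = [] , refl
      convert {z ∷ h} ((z∈ , T , solves) ∷ fine) un = build (convert fine (proj₁ (proj₂ (unique-++⁻ (concat z) un)))) (∈-boxes V (allFin-unique n) M m z∈)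
        where
        build : Σ[ cds ∈ List Candidate ] map Candidate.z cds ≡ h → length z ≡ m × All (λ row → length row ≡ M) z × All (All (_∈ V)) z →
            Σ[ cds ∈ List Candidate ] map Candidate.z cds ≡ z ∷ h
        build (cds , eq) (len , wid , _) = record
          { z = z ; number = len ; widths = wid ; unique = proj₁ (unique-++⁻ (concat z) un) ; T₀ = T ; solves = solves } ∷ cds , cong (z ∷_) eq

    family : Family
    family = conclude select
      where
      conclude : ∃[ h ] Valid h × length h ≡ q × (∀ {T} → T ∈ Θ → ∑ h (cost T) ≤ suc (2 * x) * q + (4 * (C′ * C′) + 2 * C′) * L) → Family
      conclude (h , (fine , un) , len , total) = finish (convert fine un)
        where
        finish : Σ[ cds ∈ List Candidate ] map Candidate.z cds ≡ h → Family
        finish (cds , refl) = record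
          { candidates = cds
          ; size = trans (sym (length-map Candidate.z cds)) len
          ; disjoint = subst Unique (cong concat (sym (map-∘ cds))) un
          ; abundant = abundant }
          where
          abundant : ∀ T → length T ≡ D → q ≤ 2 * C′ * ∑ cds (solved T) + (4 * (C′ * C′) + 2 * C′) * L
          abundant T |T| = +-cancelˡ-≤ (suc (2 * x) * q) _ _ (begin
            suc (2 * x) * q + q ≡⟨ trans (expand x q) (cong (λ c → 2 * c * q) (sym C′≡)) ⟩
            2 * C′ * q ≡⟨ trans (*-comm (2 * C′) q) (cong (_* (2 * C′)) (sym len)) ⟩
            length (map Candidate.z cds) * (2 * C′) ≡⟨ ∑-const (map Candidate.z cds) (2 * C′) ⟨
            ∑ (map Candidate.z cds) (λ _ → 2 * C′) ≡⟨ ∑-cong (map Candidate.z cds) (λ z → both C′ (good T z)) ⟨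
            ∑ (map Candidate.z cds) (λ z → cost T z + 2 * C′ * ⟦ good T z ⟧) ≡⟨ trans (∑-+ (map Candidate.z cds) _ _) (cong (∑ (map Candidate.z cds) (cost T) +_)
              (trans (∑-*ˡ (map Candidate.z cds) (2 * C′) _) (cong (2 * C′ *_) (∑-map Candidate.z cds _)))) ⟩
            ∑ (map Candidate.z cds) (cost T) + 2 * C′ * ∑ cds (solved T) ≤⟨ +-monoˡ-≤ _ (total T∈) ⟩
            suc (2 * x) * q + (4 * (C′ * C′) + 2 * C′) * L + 2 * C′ * ∑ cds (solved T) ≡⟨ trans (+-assoc (suc (2 * x) * q) _ _) (cong (suc (2 * x) * q +_) (+-comm _ (2 * C′ * ∑ cds (solved T)))) ⟩
            suc (2 * x) * q + (2 * C′ * ∑ cds (solved T) + (4 * (C′ * C′) + 2 * C′) * L) ∎)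
            where
            T∈ : T ∈ Θ
            T∈ = subst (λ N → T ∈ tuples V N) |T| (∈-tuples⁺ V (All.universal (λ v → ∈-allFin v) T))
            expand : ∀ x q → suc (2 * x) * q + q ≡ 2 * suc x * q
            expand = solve-∀
            both : ∀ c b → 2 * c * ⟦ not b ⟧ + 2 * c * ⟦ b ⟧ ≡ 2 * c
            both c true = trans (cong (_+ 2 * c * 1) (*-zeroʳ (2 * c))) (*-identityʳ (2 * c))
            both c false = trans (cong (2 * c * 1 +_) (*-zeroʳ (2 * c))) (trans (+-identityʳ _) (*-identityʳ (2 * c)))

-- Distributing the leftover vertices among the absorbers

chunk : ∀ {A : Set} D → 0 < D → ∀ w (W : List A) → length W ≡ w * D → ∃[ Ts ] concat Ts ≡ W × All (λ T → length T ≡ D) Ts × length Ts ≡ w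
chunk D 0<D zero [] eq = [] , refl , [] , refl
chunk D 0<D (suc w) W eq with Ts , concat≡ , all , len ← chunk D 0<D w (drop D W) (trans (length-drop D W) (trans (cong (_∸ D) eq) (m+n∸m≡n D (w * D)))) =
  take D W ∷ Ts , trans (cong (take D W ++_) concat≡) (take++drop≡id D W) , trans (length-take D W) (m≤n⇒m⊓n≡m (≤-trans (m≤m+n D (w * D)) (≤-reflexive (sym eq)))) ∷ all , cong suc len

-- As q a is - a modulo q + 1, the remainder of y + q a solves a + x ≡ y. Both multiples of the
-- modulus are kept, to avoid subtraction.
residue : ∀ q y a → ∃[ x ] x < suc q × ∃₂ λ c c′ → y + c * suc q ≡ a + x + c′ * suc q
residue q y a = (y + q * a) % suc q , m%n<n (y + q * a) (suc q) , a , (y + q * a) / suc q , (begin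
  y + a * suc q ≡⟨ eq y a q ⟩
  a + (y + q * a) ≡⟨ cong (a +_) (m≡m%n+[m/n]*n (y + q * a) (suc q)) ⟩
  a + ((y + q * a) % suc q + (y + q * a) / suc q * suc q) ≡⟨ +-assoc a _ _ ⟨
  a + (y + q * a) % suc q + (y + q * a) / suc q * suc q ∎)
  where
  open ≡-Reasoning
  eq : ∀ y a q → y + a * suc q ≡ a + (y + q * a)
  eq = solve-∀

module Assignment (σ : Shape) (Γ : Host)
  (C δ q L : ℕ) (0<n : 0 < Host.n Γ) where
  open Host Γ hiding (N; N⇒E)
  open Words σ
  open Gadgets σ using (D)
  open Tiles σ Γ using (EChain)
  open Paths σ Γ
  open SymbolicAbsorber σ using (absorber; module SymAbsorber)
  open Absorbing σ Γ using (Absorber; Solves)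
  open AbsorberFamily σ Γ C δ q L 0<n

  pieces : Candidate → List Piece
  pieces cd = Absorber.pieces (Candidate.body cd)

  all-pieces : List Candidate → List Piece
  all-pieces = concatMap pieces

  -- The state of one absorber: its current interior, and the vertices absorbed so far.
  record Slot (cd : Candidate) : Set where
    field
      used : Bool
      payload : List (Fin n)
      alts : All Alternative (pieces cd)
      balance : payload ++ mids′ (keep-all (pieces cd)) ↭ mids′ alts

  empty : ∀ cd → Slot cd
  empty cd = record { used = false ; payload = [] ; alts = keep-all (pieces cd) ; balance = ↭-refl }

  occupied : ∀ {cds} → All Slot cds → ℕ
  occupied [] = 0
  occupied (s ∷ ss) = ⟦ Slot.used s ⟧ + occupied ss

  load : ∀ {cds} → All Slot cds → List (Fin n)
  load [] = []
  load (s ∷ ss) = Slot.payload s ++ load ss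

  Blank : ∀ {cds} → All Slot cds → Set
  Blank [] = ⊤
  Blank (s ∷ ss) = (Slot.used s ≡ false → Slot.payload s ≡ []) × Blank ss

  Inserted : ∀ {cds} → All Slot cds → List (Fin n) → Set
  Inserted {cds} ss T = Σ[ ss′ ∈ All Slot cds ] occupied ss′ ≡ suc (occupied ss) × T ++ load ss ↭ load ss′ × Blank ss′

  insert : ∀ {cds} (ss : All Slot cds) T → length T ≡ D → occupied ss < ∑ cds (solved T) → Blank ss → Inserted ss T
  insert {cd ∷ cds} (s ∷ ss) T |T| lt (e , es) = decide (Slot.used s) refl (boxed (holds a₀ E T (SymAbsorber.cs absorber)) (Candidate.z cd)) refl
    where
    later : occupied ss < ∑ cds (solved T) → Inserted (s ∷ ss) T
    later lt′ = extend (insert ss T |T| lt′ es)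
      where
      extend : Inserted ss T → Inserted (s ∷ ss) T
      extend (ss′ , occ , perm , es′) = s ∷ ss′ , trans (cong (⟦ Slot.used s ⟧ +_) occ) (+-suc _ _) ,
        ↭-trans (shifts T (Slot.payload s)) (Permₚ.++⁺ˡ (Slot.payload s) perm) , e , es′
    decide : ∀ u → Slot.used s ≡ u → ∀ g → boxed (holds a₀ E T (SymAbsorber.cs absorber)) (Candidate.z cd) ≡ g → Inserted (s ∷ ss) T
    decide true u g b = later (≤-pred (<-≤-trans (subst (λ v → ⟦ v ⟧ + occupied ss < ∑ (cd ∷ cds) (solved T)) u lt) (+-monoˡ-≤ (∑ cds (solved T)) (⟦⟧≤1 (boxed (holds a₀ E T (SymAbsorber.cs absorber)) (Candidate.z cd))))))
    decide false u false b = later (subst₂ (λ v w → ⟦ v ⟧ + occupied ss < ⟦ w ⟧ + ∑ cds (solved T)) u b lt)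
    decide false u true b = fill (Absorber.absorbs (Candidate.body cd) T |T| b)
      where
      fill : Σ[ alts ∈ All Alternative (pieces cd) ] T ++ mids′ (keep-all (pieces cd)) ↭ mids′ alts → Inserted (s ∷ ss) T
      fill (alts , perm) = record { used = true ; payload = T ; alts = alts ; balance = perm } ∷ ss , cong (λ v → suc (⟦ v ⟧ + occupied ss)) (sym u) ,
        ↭-reflexive (cong (λ l → T ++ l ++ load ss) (e u)) , (λ ()) , es

  insert-all : ∀ {cds} (ss : All Slot cds) Ts w → All (λ T → length T ≡ D) Ts → occupied ss + length Ts ≤ w → (∀ T → length T ≡ D → w ≤ ∑ cds (solved T)) →
      Blank ss →
      Σ[ ss′ ∈ All Slot cds ] concat Ts ++ load ss ↭ load ss′
  insert-all ss [] w [] le many es = ss , ↭-refl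
  insert-all ss (T ∷ Ts) w (|T| ∷ |Ts|) le many es = continue (insert ss T |T| (≤-trans (≤-trans (m≤m+n (suc (occupied ss)) (length Ts)) (≤-reflexive (sym (+-suc _ _)))) (≤-trans le (many T |T|))) es)
    where
    continue : Inserted ss T → Σ[ ss′ ∈ All Slot _ ] concat (T ∷ Ts) ++ load ss ↭ load ss′
    continue (ss₁ , occ , perm , es₁) = finish (insert-all ss₁ Ts w |Ts| (≤-trans (≤-reflexive (trans (cong (_+ length Ts) occ) (sym (+-suc _ _)))) le) many es₁)
      where
      finish : Σ[ ss′ ∈ All Slot _ ] concat Ts ++ load ss₁ ↭ load ss′ → Σ[ ss′ ∈ All Slot _ ] concat (T ∷ Ts) ++ load ss ↭ load ss′
      finish (ss₂ , perm₂) = ss₂ , ↭-trans (↭-reflexive (++-assoc T (concat Ts) _)) (↭-trans (shifts T (concat Ts)) (↭-trans (Permₚ.++⁺ˡ (concat Ts) perm) perm₂))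

  all-alts : ∀ {cds} → All Slot cds → All Alternative (all-pieces cds)
  all-alts [] = []
  all-alts (s ∷ ss) = Allₚ.++⁺ (Slot.alts s) (all-alts ss)

  mids′-++ : ∀ {ps qs} (as : All Alternative ps) (bs : All Alternative qs) → mids′ (Allₚ.++⁺ as bs) ≡ mids′ as ++ mids′ bs
  mids′-++ [] bs = refl
  mids′-++ (a ∷ as) bs = trans (cong (Alternative.mid′ a ++_) (mids′-++ as bs)) (sym (++-assoc (Alternative.mid′ a) _ _))

  keep-++ : ∀ ps qs → mids′ (keep-all (ps ++ qs)) ≡ mids′ (keep-all ps) ++ mids′ (keep-all qs)
  keep-++ [] qs = refl
  keep-++ (p ∷ ps) qs = trans (cong (Piece.mid p ++_) (keep-++ ps qs)) (sym (++-assoc (Piece.mid p) _ _))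

  total-balance : ∀ {cds} (ss : All Slot cds) → load ss ++ mids′ (keep-all (all-pieces cds)) ↭ mids′ (all-alts ss)
  total-balance [] = ↭-refl
  total-balance {cd ∷ cds} (s ∷ ss) = begin
    (P ++ load ss) ++ mids′ (keep-all (pieces cd ++ all-pieces cds)) ≡⟨ trans (cong ((P ++ load ss) ++_) (keep-++ (pieces cd) (all-pieces cds))) (++-assoc P (load ss) _) ⟩
    P ++ load ss ++ K₁ ++ mids′ (keep-all (all-pieces cds)) ↭⟨ Permₚ.++⁺ˡ P (shifts (load ss) K₁) ⟩
    P ++ K₁ ++ load ss ++ mids′ (keep-all (all-pieces cds)) ≡⟨ ++-assoc P K₁ _ ⟨
    (P ++ K₁) ++ load ss ++ mids′ (keep-all (all-pieces cds)) ↭⟨ Permₚ.++⁺ (Slot.balance s) (total-balance ss) ⟩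
    mids′ (Slot.alts s) ++ mids′ (all-alts ss) ≡⟨ mids′-++ (Slot.alts s) (all-alts ss) ⟨
    mids′ (all-alts (s ∷ ss)) ∎
    where
    open Perm.PermutationReasoning
    P = Slot.payload s
    K₁ = mids′ (keep-all (pieces cd))

  absorb-all : ∀ {cds} Ts → All (λ T → length T ≡ D) Ts → (∀ T → length T ≡ D → length Ts ≤ ∑ cds (solved T)) →
      Σ[ alts ∈ All Alternative (all-pieces cds) ] concat Ts ++ mids′ (keep-all (all-pieces cds)) ↭ mids′ alts
  absorb-all {cds} Ts |Ts| many = finish (insert-all initial Ts (length Ts) |Ts| (≤-reflexive (cong (_+ length Ts) (none cds))) many (blank cds))
    where
    initial : All Slot cds
    initial = All.universal empty cds
    none : ∀ cds → occupied (All.universal empty cds) ≡ 0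
    none [] = refl
    none (cd ∷ cds) = none cds
    bare : ∀ cds → load (All.universal empty cds) ≡ []
    bare [] = refl
    bare (cd ∷ cds) = bare cds
    blank : ∀ cds → Blank (All.universal empty cds)
    blank [] = tt
    blank (cd ∷ cds) = (λ _ → refl) , blank cds
    finish : Σ[ ss ∈ All Slot cds ] concat Ts ++ load initial ↭ load ss → Σ[ alts ∈ All Alternative (all-pieces cds) ] concat Ts ++ mids′ (keep-all (all-pieces cds)) ↭ mids′ alts
    finish (ss , perm) = all-alts ss , ↭-trans (Permₚ.++⁺ʳ _ (↭-trans (↭-reflexive (sym (trans (cong (concat Ts ++_) (bare cds)) (++-identityʳ (concat Ts))))) perm)) (total-balance ss)

  bodies : List Candidate → List (Fin n)
  bodies cds = concat (map vertices (all-pieces cds))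

  bodies-++ : ∀ ps qs → concat (map vertices (ps ++ qs)) ≡ concat (map vertices ps) ++ concat (map vertices qs)
  bodies-++ [] qs = refl
  bodies-++ (p ∷ ps) qs = trans (cong (vertices p ++_) (bodies-++ ps qs)) (sym (++-assoc (vertices p) _ _))

  bodies-within : ∀ cds {v} → v ∈ bodies cds → v ∈ concat (map (concat ∘ Candidate.z) cds)
  bodies-within (cd ∷ cds) v∈ with ∈-++⁻ (concat (map vertices (pieces cd))) (subst (_ ∈_) (bodies-++ (pieces cd) (all-pieces cds)) v∈)
  ... | inj₁ v∈₁ = ∈-++⁺ˡ (All.lookup (Absorber.within (Candidate.body cd)) v∈₁)
  ... | inj₂ v∈₂ = ∈-++⁺ʳ (concat (Candidate.z cd)) (bodies-within cds v∈₂)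

  bodies-unique : ∀ cds → Unique (concat (map (concat ∘ Candidate.z) cds)) → Unique (bodies cds)
  bodies-unique [] un = []
  bodies-unique (cd ∷ cds) un with un₁ , un₂ , dis ← unique-++⁻ (concat (Candidate.z cd)) un =
    subst Unique (sym (bodies-++ (pieces cd) (all-pieces cds))) (unique-++⁺ (Absorber.unique (Candidate.body cd)) (bodies-unique cds un₂)
      (λ v∈ v∈′ → dis (All.lookup (Absorber.within (Candidate.body cd)) v∈) (bodies-within cds v∈′)))

  bodies-size : ∀ cds → length (bodies cds) ≤ length cds * N
  bodies-size [] = z≤n
  bodies-size (cd ∷ cds) = ≤-trans (≤-reflexive (trans (cong length (bodies-++ (pieces cd) (all-pieces cds))) (length-++ (concat (map vertices (pieces cd)))))) (+-mono-≤ one (bodies-size cds))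
    where
    open Candidate cd
    size : ∀ {z : List (List (Fin n))} → All (λ row → length row ≡ M) z → length (concat z) ≡ length z * M
    size [] = refl
    size {row ∷ z} (w ∷ ws) = trans (length-++ row) (cong₂ _+_ w (size ws))
    one : length (concat (map vertices (pieces cd))) ≤ N
    one with rest , perm ← subset-↭ (Absorber.unique body) (Absorber.within body) =
      ≤-trans (m≤m+n _ (length rest)) (≤-reflexive (trans (sym (length-++ (concat (map vertices (pieces cd))))) (trans (sym (↭-length perm)) (trans (size widths) (cong (_* M) number)))))

  pieces-number : ∀ cds → length (all-pieces cds) ≡ length cds * suc D
  pieces-number [] = refl
  pieces-number (cd ∷ cds) = trans (length-++ (pieces cd)) (cong₂ _+_ (Absorber.size (Candidate.body cd)) (pieces-number cds))

  vertices-split : ∀ ps → concat (map vertices ps) ↭ mids′ (keep-all ps) ++ concat (map (λ p → Piece.head p ++ Piece.tail p) ps)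
  vertices-split [] = ↭-refl
  vertices-split (p ∷ ps) = begin
    (h ++ md ++ l) ++ concat (map vertices ps) ↭⟨ Permₚ.++⁺ (shifts h md) (vertices-split ps) ⟩
    (md ++ h ++ l) ++ M₁ ++ H ≡⟨ ++-assoc md (h ++ l) _ ⟩
    md ++ (h ++ l) ++ M₁ ++ H ↭⟨ Permₚ.++⁺ˡ md (shifts (h ++ l) M₁) ⟩
    md ++ M₁ ++ (h ++ l) ++ H ≡⟨ ++-assoc md M₁ _ ⟨
    (md ++ M₁) ++ (h ++ l) ++ H ∎
    where
    open Perm.PermutationReasoning
    h = Piece.head p
    md = Piece.mid p
    l = Piece.tail p
    M₁ = mids′ (keep-all ps)
    H = concat (map (λ p → Piece.head p ++ Piece.tail p) ps)

  -- B S d + r equals (B S - s₂) d + ℓ, and B ≥ 2 keeps the two ends of ℓ vertices from overlapping.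
  tile-piece : ∀ B → 2 ≤ B → ∀ P → length P ≡ B * t + r → EChain P → Σ[ p ∈ Piece ] vertices p ≡ P
  tile-piece B 2≤B P |P| ch = record
      { head = take ℓ P ; mid = take x (drop ℓ P) ; tail = drop x (drop ℓ P)
      ; |head| = |h| ; |tail| = trans (length-drop x (drop ℓ P)) (trans (cong (_∸ x) |rest|) (m+n∸m≡n x ℓ))
      ; blocks = B * S ∸ s₂
      ; aligned = trans (length-++ (take ℓ P)) (trans (cong₂ _+_ |h| (trans (length-take x (drop ℓ P)) (m≤n⇒m⊓n≡m (≤-trans (m≤m+n x ℓ) (≤-reflexive (sym |rest|)))))) ℓ+x)
      ; path = subst EChain (sym whole) ch } , whole
    where
    open ≤-Reasoning
    y x : ℕ
    y = (B * S ∸ s₂) * d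
    x = y ∸ ℓ
    s₂≤ : s₂ ≤ B * S
    s₂≤ = ≤-trans (≤-trans (n≤1+n s₂) (n≤1+n (suc s₂))) (m≤n*m S B {{>-nonZero (≤-trans (s≤s z≤n) 2≤B)}})
    ℓ≤y : ℓ ≤ y
    ℓ≤y = begin
      s₂ * d + r ≤⟨ +-monoʳ-≤ (s₂ * d) (m≤m+n r e) ⟩
      s₂ * d + d ≡⟨ +-comm (s₂ * d) d ⟩
      suc s₂ * d ≤⟨ *-monoˡ-≤ d (+-cancelʳ-≤ s₂ (suc s₂) (B * S ∸ s₂) (begin
        suc s₂ + s₂ ≤⟨ +-mono-≤ (n≤1+n (suc s₂)) (≤-trans (n≤1+n s₂) (n≤1+n (suc s₂))) ⟩
        S + S ≡⟨ cong (S +_) (+-identityʳ S) ⟨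
        2 * S ≤⟨ *-monoˡ-≤ S 2≤B ⟩
        B * S ≡⟨ m∸n+n≡m s₂≤ ⟨
        B * S ∸ s₂ + s₂ ∎)) ⟩
      y ∎
    ℓ+x : ℓ + x ≡ y
    ℓ+x = m+[n∸m]≡n ℓ≤y
    total : length P ≡ y + ℓ
    total = begin-equality
      length P ≡⟨ |P| ⟩
      B * (S * d) + r ≡⟨ cong (_+ r) (*-assoc B S d) ⟨
      B * S * d + r ≡⟨ cong (λ a → a * d + r) (m∸n+n≡m s₂≤) ⟨
      (B * S ∸ s₂ + s₂) * d + r ≡⟨ trans (cong (_+ r) (*-distribʳ-+ d (B * S ∸ s₂) s₂)) (+-assoc y (s₂ * d) r) ⟩
      y + ℓ ∎
    |h| : length (take ℓ P) ≡ ℓ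
    |h| = trans (length-take ℓ P) (m≤n⇒m⊓n≡m (≤-trans (m≤n+m ℓ y) (≤-reflexive (sym total))))
    |rest| : length (drop ℓ P) ≡ x + ℓ
    |rest| = trans (length-drop ℓ P) (trans (cong (_∸ ℓ) total) (trans (m+n∸n≡m y ℓ) (trans (sym ℓ+x) (+-comm ℓ x))))
    whole : take ℓ P ++ take x (drop ℓ P) ++ drop x (drop ℓ P) ≡ P
    whole = trans (cong (take ℓ P ++_) (take++drop≡id x (drop ℓ P))) (take++drop≡id ℓ P)

-- Degrees and spread as density tests

module Densities (σ : Shape) (Γ : Host) (Δ₁ K B : ℕ) (0<Δ₁ : 0 < Δ₁) (0<K : 0 < K) where
  open Host Γ
  open Words σ
  open Tiles σ Γ using (Tile; EChain)
  open ≤-Reasoning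

  V : List (Fin n)
  V = allFin n

  |V| : length V ≡ n
  |V| = length-allFin n

  0<Δ₂ : 0 < 4 * Δ₁
  0<Δ₂ = *-mono-≤ (s≤s {0} {3} z≤n) 0<Δ₁

  open Oracle σ Γ K (4 * Δ₁) B 0<K 0<Δ₂ public

  -- Padding by arbitrary further entries turns the size of a link into the density of a relation on
  -- k-tuples, a test of the same kind as `avoiding`.
  neighbour : List (Fin n) → List (Fin n) → Bool
  neighbour S [] = false
  neighbour S (v ∷ _) = N S v

  -- The number of tests is polynomial in n, so it contributes only the logarithmic `L` to the
  -- weights argument. The first components are the reciprocals of the expected densities.
  tests : List (ℕ × (List (Fin n) → Bool))
  tests = map (λ S → t , neighbour S) (tuples V k₁) ++ map (λ S → 2 * Δ₁ , avoiding S) (tuples V k₁)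

  length-tests : length tests ≡ 2 * n ^ k₁
  length-tests = trans (length-++ (map (λ S → t , neighbour S) (tuples V k₁))) (cong₂ _+_
    (trans (length-map _ (tuples V k₁)) |S|) (trans (length-map _ (tuples V k₁)) (trans |S| (sym (+-identityʳ _)))))
    where
    |S| : length (tuples V k₁) ≡ n ^ k₁
    |S| = trans (length-tuples V k₁) (cong (_^ k₁) |V|)

  tests-bounded : ∀ {ζ θ} → (ζ , θ) ∈ tests → ζ ≤ t + 2 * Δ₁
  tests-bounded ζ∈ with ∈-++⁻ (map (λ S → t , neighbour S) (tuples V k₁)) ζ∈
  ... | inj₁ ζ∈₁ with _ , _ , refl ← ∈-map⁻ _ ζ∈₁ = m≤m+n t _
  ... | inj₂ ζ∈₂ with _ , _ , refl ← ∈-map⁻ _ ζ∈₂ = m≤n+m _ t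

  tuple-V : ∀ S → length S ≡ k₁ → S ∈ tuples V k₁
  tuple-V S |S| = subst (λ m → S ∈ tuples V m) |S| (∈-tuples⁺ V (All.universal ∈-allFin S))

  neighbour∈ : ∀ S → length S ≡ k₁ → (t , neighbour S) ∈ tests
  neighbour∈ S |S| = ∈-++⁺ˡ (∈-map⁺ _ (tuple-V S |S|))

  avoiding∈ : ∀ S → length S ≡ k₁ → (2 * Δ₁ , avoiding S) ∈ tests
  avoiding∈ S |S| = ∈-++⁺ʳ (map (λ S → t , neighbour S) (tuples V k₁)) (∈-map⁺ _ (tuple-V S |S|))

  count-neighbour : ∀ U S → count U k (neighbour S) ≡ ∑ U (λ v → ⟦ N S v ⟧) * length U ^ k₁
  count-neighbour U S = trans (∑-tuples U k₁ _) (trans (∑-cong U (λ v → trans (∑-const (tuples U k₁) ⟦ N S v ⟧) (trans (*-comm _ ⟦ N S v ⟧) (cong (⟦ N S v ⟧ *_) (length-tuples U k₁))))) (∑-*ʳ U _ _))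

  Dense : ℕ → ℕ → List (Fin n) → Set
  Dense Z j U = ∀ {ζ θ} → (ζ , θ) ∈ tests → (Z ∸ j) * length U ^ k ≤ Z * ζ * count U k θ

  2≤Z₁ : 2 ≤ Z₁
  2≤Z₁ = ≤-trans (s≤s (s≤s z≤n)) (≤-trans (≤-reflexive (sym (*-identityʳ 4))) (*-monoʳ-≤ 4 (*-mono-≤ (s≤s {0} {k₁} z≤n) 0<Δ₂)))

  private
    scaled : ∀ Z₂ ζ j (U : List (Fin n)) (θ : List (Fin n) → Bool) → 0 < Z₂ → j ≤ 3 * Z₂ → (3 * Z₁ * Z₂ ∸ j) * length U ^ k ≤ 3 * Z₁ * Z₂ * ζ * count U k θ →
        Z₁ * length U ^ k ≤ length U ^ k + Z₁ * ζ * count U k θ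
    scaled Z₂ ζ j U θ 0<Z₂ j≤ dense = *-cancelˡ-≤ (3 * Z₂) {{m*n≢0 3 Z₂ {{_}} {{>-nonZero 0<Z₂}}}} (begin
      3 * Z₂ * (Z₁ * x) ≡⟨ eq₁ Z₂ Z₁ x ⟩
      3 * Z₁ * Z₂ * x ≡⟨ cong (_* x) (m∸n+n≡m j≤Z) ⟨
      (3 * Z₁ * Z₂ ∸ j + j) * x ≡⟨ *-distribʳ-+ x (3 * Z₁ * Z₂ ∸ j) j ⟩
      (3 * Z₁ * Z₂ ∸ j) * x + j * x ≤⟨ +-mono-≤ dense (*-monoˡ-≤ x j≤) ⟩
      3 * Z₁ * Z₂ * ζ * count U k θ + 3 * Z₂ * x ≡⟨ eq₂ Z₁ Z₂ ζ (count U k θ) x ⟩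
      3 * Z₂ * (x + Z₁ * ζ * count U k θ) ∎)
      where
      x = length U ^ k
      j≤Z : j ≤ 3 * Z₁ * Z₂
      j≤Z = ≤-trans j≤ (*-monoˡ-≤ Z₂ (m≤m*n 3 Z₁ {{>-nonZero (≤-trans (n≤1+n 1) 2≤Z₁)}}))
      eq₁ : ∀ z Z x → 3 * z * (Z * x) ≡ 3 * Z * z * x
      eq₁ = solve-∀
      eq₂ : ∀ Z z ζ c x → 3 * Z * z * ζ * c + 3 * z * x ≡ 3 * z * (x + Z * ζ * c)
      eq₂ = solve-∀

  module _ (Z₂ j : ℕ) (0<Z₂ : 0 < Z₂) (j≤ : j ≤ 3 * Z₂) {U : List (Fin n)} (0<u : 0 < length U) (dense : Dense (3 * Z₁ * Z₂) j U) where
    private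
      u = length U
      instance
        u≢0 : NonZero u
        u≢0 = >-nonZero 0<u

    degree-dense : ∀ S → length S ≡ k₁ → Z₁ * u ≤ u + Z₁ * (t * ∑ U (λ v → ⟦ N S v ⟧))
    degree-dense S |S| = *-cancelʳ-≤ _ _ (u ^ k₁) {{m^n≢0 u k₁}} (begin
      Z₁ * u * u ^ k₁ ≡⟨ *-assoc Z₁ u (u ^ k₁) ⟩
      Z₁ * u ^ k ≤⟨ scaled Z₂ t j U (neighbour S) 0<Z₂ j≤ (dense (neighbour∈ S |S|)) ⟩
      u ^ k + Z₁ * t * count U k (neighbour S) ≡⟨ cong (λ c → u ^ k + Z₁ * t * c) (count-neighbour U S) ⟩
      u ^ k + Z₁ * t * (∑ U (λ v → ⟦ N S v ⟧) * u ^ k₁) ≡⟨ eq u (u ^ k₁) Z₁ t (∑ U (λ v → ⟦ N S v ⟧)) ⟩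
      (u + Z₁ * (t * ∑ U (λ v → ⟦ N S v ⟧))) * u ^ k₁ ∎)
      where
      eq : ∀ u p Z t s → u * p + Z * t * (s * p) ≡ (u + Z * (t * s)) * p
      eq = solve-∀

    half-degree : ∀ S → length S ≡ k₁ → u ≤ 2 * t * ∑ U (λ v → ⟦ N S v ⟧)
    half-degree S |S| = *-cancelˡ-≤ Z₁ {{>-nonZero (≤-trans (n≤1+n 1) 2≤Z₁)}} (+-cancelʳ-≤ (Z₁ * u) _ _ (begin
      Z₁ * u + Z₁ * u ≤⟨ +-mono-≤ (degree-dense S |S|) (degree-dense S |S|) ⟩
      u + Z₁ * (t * s) + (u + Z₁ * (t * s)) ≡⟨ eq u Z₁ t s ⟩
      Z₁ * (2 * t * s) + 2 * u ≤⟨ +-monoʳ-≤ (Z₁ * (2 * t * s)) (*-monoˡ-≤ u 2≤Z₁) ⟩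
      Z₁ * (2 * t * s) + Z₁ * u ∎))
      where
      s = ∑ U (λ v → ⟦ N S v ⟧)
      eq : ∀ u Z t s → u + Z * (t * s) + (u + Z * (t * s)) ≡ Z * (2 * t * s) + 2 * u
      eq = solve-∀

    spread-dense : ∀ S → length S ≡ k₁ → u ^ k ≤ 4 * Δ₁ * count U k (avoiding S)
    spread-dense S |S| = *-cancelˡ-≤ Z₁ {{>-nonZero (≤-trans (n≤1+n 1) 2≤Z₁)}} (+-cancelʳ-≤ (Z₁ * u ^ k) _ _ (begin
      Z₁ * u ^ k + Z₁ * u ^ k ≤⟨ +-mono-≤ half half ⟩
      u ^ k + Z₁ * (2 * Δ₁) * cnt + (u ^ k + Z₁ * (2 * Δ₁) * cnt) ≡⟨ eq (u ^ k) Z₁ Δ₁ cnt ⟩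
      Z₁ * (4 * Δ₁ * cnt) + 2 * u ^ k ≤⟨ +-monoʳ-≤ (Z₁ * (4 * Δ₁ * cnt)) (*-monoˡ-≤ (u ^ k) 2≤Z₁) ⟩
      Z₁ * (4 * Δ₁ * cnt) + Z₁ * u ^ k ∎))
      where
      cnt = count U k (avoiding S)
      half : Z₁ * u ^ k ≤ u ^ k + Z₁ * (2 * Δ₁) * cnt
      half = scaled Z₂ (2 * Δ₁) j U (avoiding S) 0<Z₂ j≤ (dense (avoiding∈ S |S|))
      eq : ∀ p Z Δ c → p + Z * (2 * Δ) * c + (p + Z * (2 * Δ) * c) ≡ Z * (4 * Δ * c) + 2 * p
      eq = solve-∀

    rich : Unique U → 2 * C₁ ^ (M ^ k) * ((k * M) * (k * M)) < u → 2 * C₂ ^ (M ^ k) * ((k * M) * (k * M)) < u → Rich U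
    rich uniq large₁ large₂ = record
      { unique = uniq
      ; degree = λ {S} S∈ → degree-dense S (proj₁ (∈-tuples⁻ U k₁ S∈))
      ; spread = λ {S} S∈ → spread-dense S (proj₁ (∈-tuples⁻ U k₁ S∈))
      ; large₁ = large₁ ; large₂ = large₂ }

  module _ (deg : ∀ S → length S ≡ k₁ → 6 * Z₁ * n ≤ n + 6 * Z₁ * (t * ∑ V (λ v → ⟦ N S v ⟧)))
      (spread : ∀ S → length S ≡ k₁ → n ^ k ≤ Δ₁ * count V k (avoiding S))
      (R U : List (Fin n)) (perm : V ↭ R ++ U) (few-removed : 12 * Z₁ * t * (k * Δ₁) * length R ≤ n) where
    private
      u = length U

      u≤n : u ≤ n
      u≤n = ≤-trans (m≤n+m u (length R)) (≤-reflexive (trans (sym (length-++ R)) (trans (sym (↭-length perm)) |V|)))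

      removed : ∀ c → c ≤ 12 * Z₁ * t * (k * Δ₁) → c * length R ≤ n
      removed c c≤ = ≤-trans (*-monoˡ-≤ (length R) c≤) few-removed

      0<kΔ : 0 < k * Δ₁
      0<kΔ = *-mono-≤ (s≤s {0} {k₁} z≤n) 0<Δ₁

      0<Z₁ : 0 < Z₁
      0<Z₁ = ≤-trans (n≤1+n 1) 2≤Z₁

    -- The first third of the slack, 1 / (3 Z₁). For links, half of it is the deficit 1 / (6 Z₁) in
    -- `deg` and half pays for `R`. For edges avoiding a link, `R` destroys at most half of them,
    -- whence 2 Δ₁ in place of Δ₁.
    initial-dense : ∀ Z₂ → Dense (3 * Z₁ * Z₂) Z₂ U
    initial-dense Z₂ {ζ} {θ} ζ∈ = ≤-trans (≤-reflexive (cong (_* u ^ k) Z∸)) (≤-trans (≤-reflexive (exch (3 * Z₁ ∸ 1) Z₂ (u ^ k))) (≤-trans (*-monoʳ-≤ Z₂ (core (∈-++⁻ (map (λ S → t , neighbour S) (tuples V k₁)) ζ∈))) (≤-reflexive (exch′ Z₂ Z₁ ζ (count U k θ)))))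
      where
      Z∸ : 3 * Z₁ * Z₂ ∸ Z₂ ≡ (3 * Z₁ ∸ 1) * Z₂
      Z∸ = trans (cong (3 * Z₁ * Z₂ ∸_) (sym (*-identityˡ Z₂))) (sym (*-distribʳ-∸ Z₂ (3 * Z₁) 1))
      exch : ∀ a z x → a * z * x ≡ z * (a * x)
      exch = solve-∀
      exch′ : ∀ z Z ζ c → z * (3 * Z * ζ * c) ≡ 3 * Z * z * ζ * c
      exch′ = solve-∀
      pred-bound : ∀ {x y} → 3 * Z₁ * x ≤ x + y → (3 * Z₁ ∸ 1) * x ≤ y
      pred-bound {x} {y} le = +-cancelˡ-≤ x _ _ (≤-trans (≤-reflexive (trans (cong (_+ (3 * Z₁ ∸ 1) * x) (sym (*-identityˡ x))) (trans (sym (*-distribʳ-+ x 1 (3 * Z₁ ∸ 1))) (cong (_* x) (m+[n∸m]≡n {1} {3 * Z₁} (*-mono-≤ (s≤s {0} {2} z≤n) 0<Z₁)))))) le)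
      core : (ζ , θ) ∈ map (λ S → t , neighbour S) (tuples V k₁) ⊎ (ζ , θ) ∈ map (λ S → 2 * Δ₁ , avoiding S) (tuples V k₁) →
          (3 * Z₁ ∸ 1) * u ^ k ≤ 3 * Z₁ * ζ * count U k θ
      core (inj₁ ζ∈₁) with S , S∈ , refl ← ∈-map⁻ _ ζ∈₁ = begin
        (3 * Z₁ ∸ 1) * (u * u ^ k₁) ≡⟨ *-assoc (3 * Z₁ ∸ 1) u (u ^ k₁) ⟨
        (3 * Z₁ ∸ 1) * u * u ^ k₁ ≤⟨ *-monoˡ-≤ (u ^ k₁) (≤-trans (*-monoʳ-≤ (3 * Z₁ ∸ 1) u≤n) (pred-bound bound)) ⟩
        3 * Z₁ * t * sU * u ^ k₁ ≡⟨ trans (*-assoc (3 * Z₁ * t) sU _) (cong (3 * Z₁ * t *_) (sym (count-neighbour U S))) ⟩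
        3 * Z₁ * t * count U k (neighbour S) ∎
        where
        sV sU : ℕ
        sV = ∑ V (λ v → ⟦ N S v ⟧)
        sU = ∑ U (λ v → ⟦ N S v ⟧)
        bound : 3 * Z₁ * n ≤ n + 3 * Z₁ * t * sU
        bound = *-cancelˡ-≤ 2 (begin
          2 * (3 * Z₁ * n) ≡⟨ eq₁ Z₁ n ⟩
          6 * Z₁ * n ≤⟨ deg S (proj₁ (∈-tuples⁻ V k₁ S∈)) ⟩
          n + 6 * Z₁ * (t * sV) ≤⟨ +-monoʳ-≤ n (*-monoʳ-≤ (6 * Z₁) (*-monoʳ-≤ t (∑-remove {R = R} _ perm (λ v → ⟦⟧≤1 (N S v))))) ⟩
          n + 6 * Z₁ * (t * (sU + length R)) ≡⟨ eq₂ n Z₁ t sU (length R) ⟩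
          n + 6 * Z₁ * t * length R + 2 * (3 * Z₁ * t * sU) ≤⟨ +-monoˡ-≤ (2 * (3 * Z₁ * t * sU)) (+-monoʳ-≤ n (removed (6 * Z₁ * t) small)) ⟩
          n + n + 2 * (3 * Z₁ * t * sU) ≡⟨ eq₃ n (3 * Z₁ * t * sU) ⟩
          2 * (n + 3 * Z₁ * t * sU) ∎)
          where
          small : 6 * Z₁ * t ≤ 12 * Z₁ * t * (k * Δ₁)
          small = ≤-trans (*-monoˡ-≤ t (*-monoˡ-≤ Z₁ (m≤m+n 6 6))) (m≤m*n (12 * Z₁ * t) (k * Δ₁) {{>-nonZero 0<kΔ}})
          eq₁ : ∀ Z n → 2 * (3 * Z * n) ≡ 6 * Z * n
          eq₁ = solve-∀
          eq₂ : ∀ n Z t s r → n + 6 * Z * (t * (s + r)) ≡ n + 6 * Z * t * r + 2 * (3 * Z * t * s)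
          eq₂ = solve-∀
          eq₃ : ∀ n x → n + n + 2 * x ≡ 2 * (n + x)
          eq₃ = solve-∀
      core (inj₂ ζ∈₂) with S , S∈ , refl ← ∈-map⁻ _ ζ∈₂ = begin
        (3 * Z₁ ∸ 1) * u ^ k ≤⟨ *-mono-≤ (m∸n≤m (3 * Z₁) 1) (^-monoˡ-≤ k u≤n) ⟩
        3 * Z₁ * n ^ k ≤⟨ *-monoʳ-≤ (3 * Z₁) kept ⟩
        3 * Z₁ * (2 * Δ₁ * cnt) ≡⟨ *-assoc (3 * Z₁) (2 * Δ₁) cnt ⟨
        3 * Z₁ * (2 * Δ₁) * cnt ∎
        where
        cnt = count U k (avoiding S)
        kept : n ^ k ≤ 2 * Δ₁ * cnt
        kept = +-cancelʳ-≤ (n ^ k) _ _ (begin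
          n ^ k + n ^ k ≡⟨ eq₁ (n ^ k) ⟩
          2 * n ^ k ≤⟨ *-monoʳ-≤ 2 (spread S (proj₁ (∈-tuples⁻ V k₁ S∈))) ⟩
          2 * (Δ₁ * count V k (avoiding S)) ≤⟨ *-monoʳ-≤ 2 (*-monoʳ-≤ Δ₁ (crude-loss R U k₁ (avoiding S) (allFin-unique n) perm)) ⟩
          2 * (Δ₁ * (cnt + k * length V ^ k₁ * length R)) ≡⟨ cong (λ v → 2 * (Δ₁ * (cnt + k * v ^ k₁ * length R))) |V| ⟩
          2 * (Δ₁ * (cnt + k * n ^ k₁ * length R)) ≡⟨ eq₂ Δ₁ cnt k (n ^ k₁) (length R) ⟩
          2 * Δ₁ * cnt + 2 * (k * Δ₁) * length R * n ^ k₁ ≤⟨ +-monoʳ-≤ (2 * Δ₁ * cnt) (*-monoˡ-≤ (n ^ k₁) (removed (2 * (k * Δ₁)) small)) ⟩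
          2 * Δ₁ * cnt + n ^ k ∎)
          where
          small : 2 * (k * Δ₁) ≤ 12 * Z₁ * t * (k * Δ₁)
          small = *-monoˡ-≤ (k * Δ₁) (≤-trans (≤-trans (m≤m+n 2 10) (m≤m*n 12 Z₁ {{>-nonZero 0<Z₁}})) (m≤m*n (12 * Z₁) t))
          eq₁ : ∀ p → p + p ≡ 2 * p
          eq₁ = solve-∀
          eq₂ : ∀ Δ c k p r → 2 * (Δ * (c + k * p * r)) ≡ 2 * Δ * c + 2 * (k * Δ) * r * p
          eq₂ = solve-∀

-- Closing pieces and joints up to a cycle

count-↭ : ∀ {n} (xs ys : List (Fin n)) → (∀ v → ∑ xs (equal v) ≡ ∑ ys (equal v)) → xs ↭ ys
count-↭ [] [] eq = ↭-refl
count-↭ [] (y ∷ ys) eq = ⊥-elim (<⇒≢ (<-≤-trans (≤-reflexive (sym (equal-refl y))) (m≤m+n _ _)) (eq y))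
count-↭ {n} (x ∷ xs) ys eq = extend (remove (occurs ys positive))
  where
  positive : 0 < ∑ ys (equal x)
  positive = subst (0 <_) (eq x) (<-≤-trans (≤-reflexive (sym (equal-refl x))) (m≤m+n _ _))
  occurs : ∀ ys → 0 < ∑ ys (equal x) → x ∈ ys
  occurs (y ∷ ys) pos with x Finₚ.≟ y
  ... | yes refl = here refl
  ... | no _ = there (occurs ys pos)
  extend : ∃[ zs ] ys ↭ x ∷ zs → x ∷ xs ↭ ys
  extend (zs , perm) = ↭-trans (prep x (count-↭ xs zs (λ v → +-cancelˡ-≡ (equal v x) _ _ (trans (eq v) (∑-↭ (equal v) perm))))) (↭-sym perm)

module AssemblyTools (σ : Shape) (Γ : Host) where
  open Host Γ
  open Words σ
  open Tiles σ Γ using (EChain)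
  open Paths σ Γ

  -- Half of the expected degree is u / (2 t) = 4 u / C. It has to pay for the degree u / C, for the
  -- successor that rounds it up, and for the reserve `β`, each at most u / C.
  C : ℕ
  C = 8 * t

  ceiling : ∀ u → u ≤ C * suc (u / C)
  ceiling u = ≤-trans (≤-reflexive (m≡m%n+[m/n]*n u C)) (≤-trans (+-monoˡ-≤ _ (<⇒≤ (m%n<n u C))) (≤-reflexive (eq C (u / C))))
    where
    eq : ∀ c q → c + q * c ≡ c * suc q
    eq = solve-∀

  module _ (N : List (Fin n) → Fin n → Bool) (N⇒E : ∀ S v → N S v ≡ true → E (v ∷ S) ≡ true) where

    half⇒degree : ∀ u {U} β → (∀ S → length S ≡ k₁ → u ≤ 2 * t * ∑ U (λ v → ⟦ N S v ⟧)) → C * β ≤ u → C ≤ u → Degree≥ (suc (u / C) + β) U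
    half⇒degree u {U} β half β≤ C≤ S |S| = *-cancelˡ-≤ C (begin
      C * (suc (u / C) + β) ≡⟨ eq₁ C (u / C) β ⟩
      C + u / C * C + C * β ≤⟨ +-mono-≤ (+-mono-≤ C≤ (m/n*n≤m u C)) β≤ ⟩
      u + u + u ≤⟨ m≤m+n _ u ⟩
      u + u + u + u ≡⟨ eq₂ u ⟩
      4 * u ≤⟨ *-monoʳ-≤ 4 (half S |S|) ⟩
      4 * (2 * t * ∑ U (λ v → ⟦ N S v ⟧)) ≡⟨ eq₃ t _ ⟩
      C * ∑ U (λ v → ⟦ N S v ⟧) ≤⟨ *-monoʳ-≤ C (∑-mono U (λ v → implies (N S v) (E (v ∷ S)) (N⇒E S v))) ⟩
      C * ∑ U (λ v → ⟦ E (v ∷ S) ⟧) ∎)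
      where
      open ≤-Reasoning
      implies : ∀ a b → (a ≡ true → b ≡ true) → ⟦ a ⟧ ≤ ⟦ b ⟧
      implies false b imp = z≤n
      implies true b imp = ≤-reflexive (sym (cong ⟦_⟧ (imp refl)))
      eq₁ : ∀ c q β → c * (suc q + β) ≡ c + q * c + c * β
      eq₁ = solve-∀
      eq₂ : ∀ u → u + u + u + u ≡ 4 * u
      eq₂ = solve-∀
      eq₃ : ∀ t s → 4 * (2 * t * s) ≡ 8 * t * s
      eq₃ = solve-∀

  degree-weaken : ∀ {δ δ′ U} → δ′ ≤ δ → Degree≥ δ U → Degree≥ δ′ U
  degree-weaken le deg S |S| = ≤-trans le (deg S |S|)

  bodies-of : List Piece → List (Fin n)
  bodies-of ps = concat (map vertices ps)

  piece-length : ∀ p → length (vertices p) ≡ Piece.blocks p * d + ℓ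
  piece-length p = trans (cong length (sym (++-assoc head mid tail))) (trans (length-++ (head ++ mid)) (cong₂ _+_ aligned |tail|))
    where open Piece p

  links-length : ∀ {ps q} (js : Links ps q) → ∃[ y ] length (bodies-of ps) + length (inners js) ≡ y * d
  links-length [] = 0 , refl
  links-length {p ∷ ps} (j ∷ js) with y , eq ← links-length js = Piece.blocks p + Joint.blocks j + y , (begin
    length (vertices p ++ bodies-of ps) + length (Joint.inner j ++ inners js) ≡⟨ cong₂ _+_ (length-++ (vertices p)) (length-++ (Joint.inner j)) ⟩
    length (vertices p) + length (bodies-of ps) + (length (Joint.inner j) + length (inners js)) ≡⟨ cong (λ l → l + length (bodies-of ps) + (length (Joint.inner j) + length (inners js))) (piece-length p) ⟩
    Piece.blocks p * d + ℓ + length (bodies-of ps) + (length (Joint.inner j) + length (inners js)) ≡⟨ regroup (Piece.blocks p * d) ℓ (length (bodies-of ps)) (length (Joint.inner j)) (length (inners js)) ⟩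
    Piece.blocks p * d + (ℓ + length (Joint.inner j)) + (length (bodies-of ps) + length (inners js)) ≡⟨ cong₂ (λ x z → Piece.blocks p * d + x + z) joint-length eq ⟩
    Piece.blocks p * d + Joint.blocks j * d + y * d ≡⟨ distrib (Piece.blocks p) (Joint.blocks j) y d ⟩
    (Piece.blocks p + Joint.blocks j + y) * d ∎)
    where
    open ≡-Reasoning
    regroup : ∀ a l b i r → a + l + b + (i + r) ≡ a + (l + i) + (b + r)
    regroup = solve-∀
    distrib : ∀ a b y d → a * d + b * d + y * d ≡ (a + b + y) * d
    distrib = solve-∀
    joint-length : ℓ + length (Joint.inner j) ≡ Joint.blocks j * d
    joint-length = trans (cong (_+ length (Joint.inner j)) (sym (Piece.|tail| p))) (trans (sym (length-++ (Piece.tail p))) (Joint.aligned j))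

  route-start : ∀ {p ps q} (js : Links (p ∷ ps) q) alts → take ℓ (route js alts) ≡ Piece.head p
  route-start {p} (j ∷ js) (alt ∷ alts) = trans (take-++ˡ ℓ (Piece.head p) (≤-reflexive (sym (Piece.|head| p)))) (take-all ℓ (Piece.head p) (≤-reflexive (Piece.|head| p)))

  heads-tails : List Piece → List (Fin n)
  heads-tails ps = concat (map (λ p → Piece.head p ++ Piece.tail p) ps)

  heads-tails-++ : ∀ ps qs → heads-tails (ps ++ qs) ≡ heads-tails ps ++ heads-tails qs
  heads-tails-++ [] qs = refl
  heads-tails-++ (p ∷ ps) qs = trans (cong ((Piece.head p ++ Piece.tail p) ++_) (heads-tails-++ ps qs)) (sym (++-assoc (Piece.head p ++ Piece.tail p) _ _))

  -- Close up the pieces p₀ ∷ ps and the further pieces qs into one cycle, absorbing W into p₀ ∷ ps.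
  module _ {p₀ ps qs} (js : Links ps p₀) (j : Joint p₀ (next qs (next ps p₀))) (ks : Links qs (next ps p₀)) {W : List (Fin n)}
      (alts : All Alternative (p₀ ∷ ps)) (absorbed : W ++ mids′ (keep-all (p₀ ∷ ps)) ↭ mids′ alts)
      (mids-++ : ∀ {ps qs} (as : All Alternative ps) (bs : All Alternative qs) → mids′ (Allₚ.++⁺ as bs) ≡ mids′ as ++ mids′ bs)
      (bodies-split : ∀ ps → bodies-of ps ↭ mids′ (keep-all ps) ++ heads-tails ps) where
    private
      cycle-links : Links (ps ++ p₀ ∷ qs) (next ps p₀)
      cycle-links = links-++ js (j ∷ ks)

      cycle-alts : All Alternative (ps ++ p₀ ∷ qs)
      cycle-alts = Allₚ.++⁺ (All.tail alts) (All.head alts ∷ keep-all qs)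

    closed : List (Fin n)
    closed = route cycle-links cycle-alts

    closed-path : EChain (closed ++ take ℓ closed)
    closed-path = subst (λ h → EChain (closed ++ h)) (sym (start≡ ps js j ks cycle-alts)) (route-path cycle-links cycle-alts)
      where
      start≡ : ∀ ps (js : Links ps p₀) (j : Joint p₀ (next qs (next ps p₀))) (ks : Links qs (next ps p₀)) (alts : All Alternative (ps ++ p₀ ∷ qs)) →
          take ℓ (route (links-++ js (j ∷ ks)) alts) ≡ Piece.head (next ps p₀)
      start≡ [] js j ks alts = route-start (links-++ js (j ∷ ks)) alts
      start≡ (p ∷ ps) js j ks alts = route-start (links-++ js (j ∷ ks)) alts

    -- Each vertex occurs equally often on both sides; counting occurrences turns the rearrangement
    -- of many concatenations into arithmetic.
    closed-↭ : closed ↭ bodies-of (p₀ ∷ ps) ++ inners js ++ bodies-of qs ++ inners ks ++ Joint.inner j ++ W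
    closed-↭ = ↭-trans (route-↭ cycle-links cycle-alts) (count-↭ _ _ same)
      where
      open ≡-Reasoning
      same : ∀ v → ∑ (mids′ cycle-alts ++ heads-tails (ps ++ p₀ ∷ qs) ++ inners cycle-links) (equal v) ≡
          ∑ (bodies-of (p₀ ∷ ps) ++ inners js ++ bodies-of qs ++ inners ks ++ Joint.inner j ++ W) (equal v)
      same v = begin
        # (mids′ cycle-alts ++ heads-tails (ps ++ p₀ ∷ qs) ++ inners cycle-links)
          ≡⟨ cong # (cong₂ _++_ (mids-++ (All.tail alts) (All.head alts ∷ keep-all qs)) (cong₂ _++_ (heads-tails-++ ps (p₀ ∷ qs)) (inners-++ js (j ∷ ks)))) ⟩
        # ((mt ++ m₀ ++ kq) ++ (hp ++ (h₀ ++ l₀) ++ hq) ++ inners js ++ Joint.inner j ++ inners ks)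
          ≡⟨ expand₁ ⟩
        # mt + (# m₀ + # kq) + (# hp + (# h₀ + # l₀ + # hq) + (# (inners js) + (# (Joint.inner j) + # (inners ks))))
          ≡⟨ arrange (# mt) (# m₀) (# kq) (# hp) (# h₀) (# l₀) (# hq) (# (inners js)) (# (Joint.inner j)) (# (inners ks)) ⟩
        (# m₀ + # mt) + (# h₀ + # l₀ + # hp) + # (inners js) + (# kq + # hq) + # (inners ks) + # (Joint.inner j)
          ≡⟨ cong (λ x → x + (# h₀ + # l₀ + # hp) + # (inners js) + (# kq + # hq) + # (inners ks) + # (Joint.inner j)) absorbed# ⟩
        (# W + (# k₀ + # kp)) + (# h₀ + # l₀ + # hp) + # (inners js) + (# kq + # hq) + # (inners ks) + # (Joint.inner j)
          ≡⟨ arrange′ (# W) (# k₀) (# kp) (# h₀) (# l₀) (# hp) (# (inners js)) (# kq) (# hq) (# (inners ks)) (# (Joint.inner j)) ⟩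
        # k₀ + # kp + (# h₀ + # l₀ + # hp) + (# (inners js) + ((# kq + # hq) + (# (inners ks) + (# (Joint.inner j) + # W))))
          ≡⟨ cong₂ (λ x y → x + (# (inners js) + (y + (# (inners ks) + (# (Joint.inner j) + # W))))) (sym body₀) (sym bodyq) ⟩
        # (bodies-of (p₀ ∷ ps)) + (# (inners js) + (# (bodies-of qs) + (# (inners ks) + (# (Joint.inner j) + # W))))
          ≡⟨ expand₂ ⟨
        # (bodies-of (p₀ ∷ ps) ++ inners js ++ bodies-of qs ++ inners ks ++ Joint.inner j ++ W) ∎
        where
        # : List (Fin n) → ℕ
        # xs = ∑ xs (equal v)
        ++# : ∀ xs ys → # (xs ++ ys) ≡ # xs + # ys
        ++# xs ys = ∑-++ xs ys (equal v)
        mt m₀ kq hp h₀ l₀ hq k₀ kp : List (Fin n)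
        mt = mids′ (All.tail alts)
        m₀ = Alternative.mid′ (All.head alts)
        kq = mids′ (keep-all qs)
        hp = heads-tails ps
        h₀ = Piece.head p₀
        l₀ = Piece.tail p₀
        hq = heads-tails qs
        k₀ = Piece.mid p₀
        kp = mids′ (keep-all ps)
        mids-cons : ∀ (as : All Alternative (p₀ ∷ ps)) → mids′ as ≡ Alternative.mid′ (All.head as) ++ mids′ (All.tail as)
        mids-cons (a ∷ as) = refl
        absorbed# : # m₀ + # mt ≡ # W + (# k₀ + # kp)
        absorbed# = trans (sym (trans (cong # (mids-cons alts)) (++# m₀ mt))) (trans (sym (∑-↭ (equal v) absorbed)) (trans (++# W (k₀ ++ kp)) (cong (# W +_) (++# k₀ kp))))
        body₀ : # (bodies-of (p₀ ∷ ps)) ≡ # k₀ + # kp + (# h₀ + # l₀ + # hp)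
        body₀ = trans (∑-↭ (equal v) (bodies-split (p₀ ∷ ps))) (trans (++# (k₀ ++ kp) ((h₀ ++ l₀) ++ hp)) (cong₂ _+_ (++# k₀ kp) (trans (++# (h₀ ++ l₀) hp) (cong (_+ # hp) (++# h₀ l₀)))))
        bodyq : # (bodies-of qs) ≡ # kq + # hq
        bodyq = trans (∑-↭ (equal v) (bodies-split qs)) (++# kq hq)
        expand₁ : # ((mt ++ m₀ ++ kq) ++ (hp ++ (h₀ ++ l₀) ++ hq) ++ inners js ++ Joint.inner j ++ inners ks) ≡
            # mt + (# m₀ + # kq) + (# hp + (# h₀ + # l₀ + # hq) + (# (inners js) + (# (Joint.inner j) + # (inners ks))))
        expand₁ = trans (++# (mt ++ m₀ ++ kq) _) (cong₂ _+_ (trans (++# mt _) (cong (# mt +_) (++# m₀ kq)))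
          (trans (++# (hp ++ (h₀ ++ l₀) ++ hq) _) (cong₂ _+_ (trans (++# hp _) (cong (# hp +_) (trans (++# (h₀ ++ l₀) hq) (cong (_+ # hq) (++# h₀ l₀)))))
          (trans (++# (inners js) _) (cong (# (inners js) +_) (++# (Joint.inner j) (inners ks)))))))
        expand₂ : # (bodies-of (p₀ ∷ ps) ++ inners js ++ bodies-of qs ++ inners ks ++ Joint.inner j ++ W) ≡
            # (bodies-of (p₀ ∷ ps)) + (# (inners js) + (# (bodies-of qs) + (# (inners ks) + (# (Joint.inner j) + # W))))
        expand₂ = trans (++# (bodies-of (p₀ ∷ ps)) _) (cong (# (bodies-of (p₀ ∷ ps)) +_) (trans (++# (inners js) _) (cong (# (inners js) +_)
          (trans (++# (bodies-of qs) _) (cong (# (bodies-of qs) +_) (trans (++# (inners ks) _) (cong (# (inners ks) +_) (++# (Joint.inner j) W))))))))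
        arrange : ∀ mt m₀ kq hp h₀ l₀ hq a b c → mt + (m₀ + kq) + (hp + (h₀ + l₀ + hq) + (a + (b + c))) ≡ (m₀ + mt) + (h₀ + l₀ + hp) + a + (kq + hq) + c + b
        arrange = solve-∀
        arrange′ : ∀ w k₀ kp h₀ l₀ hp a kq hq c b → (w + (k₀ + kp)) + (h₀ + l₀ + hp) + a + (kq + hq) + c + b ≡ k₀ + kp + (h₀ + l₀ + hp) + (a + ((kq + hq) + (c + (b + w))))
        arrange′ = solve-∀

-- Assembling the cycle under explicit size conditions

record Params : Set where
  field
    Δ₁ b Bₜ K Z₂ qₐ Lₐ q L : ℕ

-- The quantities in the size conditions that do not depend on the hypergraph.
module Constants (σ : Shape) (pr : Params) where
  open Params pr
  open Words σ
  open Gadgets σ using (D)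
  open SymbolicAbsorber σ using (absorber; module SymAbsorber)

  links-of : ∀ x → SymConnector σ x
  links-of x = BuildConnector.connector σ x

  H Δ₂ Z₁ C C₁ C₂ p ζ̄ : ℕ
  H = 2 * suc (suc (2 * K))
  Δ₂ = 4 * Δ₁
  Z₁ = 4 * (k * Δ₂)
  C = 8 * t
  C₁ = 4 * Δ₂
  C₂ = H ^ k₁ * (Z₁ * t)
  p = Bₜ * t + r
  ζ̄ = t + 2 * Δ₁

  size-of : ℕ → ℕ
  size-of x = length (SymConnector.mids (links-of x))

  threshold-of : ℕ → ℕ
  threshold-of x = 2 * (C ^ m) ^ (w ^ m) * (m * w * (m * w))
    where
    m = length (SymConnector.cs (links-of x))
    w = suc (size-of x)

-- A tuple is solved by about q / c absorbers, and `capacity` makes this exceed n / b, hence the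
-- number of tuples that have to be absorbed.
enough-solved : ∀ b c s t x q n → c * n + b * x < b * q → q ≤ c * s + x → b * t ≤ n → t ≤ s
enough-solved b c s t x q n capacity abundant bt≤n = ≮⇒≥ λ lt → <⇒≱ capacity (begin
  b * q ≤⟨ *-monoʳ-≤ b (≤-trans abundant (+-monoˡ-≤ x (*-monoʳ-≤ c (<⇒≤ lt)))) ⟩
  b * (c * t + x) ≡⟨ eq b c t x ⟩
  c * (b * t) + b * x ≤⟨ +-monoˡ-≤ (b * x) (*-monoʳ-≤ c bt≤n) ⟩
  c * n + b * x ∎)
  where
  open ≤-Reasoning
  eq : ∀ b c t x → b * (c * t + x) ≡ c * (b * t) + b * x
  eq = solve-∀

module Assembly (σ : Shape) (pr : Params) (Γ : Host) (0<Δ₁ : 0 < Params.Δ₁ pr) (0<K : 0 < Params.K pr) (0<n : 0 < Host.n Γ) where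
  open Host Γ
  open Params pr
  open Words σ
  open Gadgets σ using (D)
  open Constants σ pr using (links-of; size-of; threshold-of; p; ζ̄)
  open Tiles σ Γ using (Tile; EChain)
  open Paths σ Γ
  open Densities σ Γ Δ₁ (suc (2 * K)) Bₜ 0<Δ₁ (s≤s z≤n)
  open AssemblyTools σ Γ
  open ≤-Reasoning
  module A = Assignment σ Γ C (suc (n / C)) qₐ Lₐ 0<n
  module F = AbsorberFamily σ Γ C (suc (n / C)) qₐ Lₐ 0<n

  L₀ budget removed : ℕ
  L₀ = size-of 0
  budget = qₐ * (suc D * L₀)
  removed = qₐ * F.N + budget

  record Sizes : Set where
    field
      0<b : 0 < b
      0<qₐ : 0 < qₐ
      0<Z₂ : 0 < Z₂
      2≤Bₜ : 2 ≤ Bₜ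
      few-removed : 12 * Z₁ * t * (k * Δ₁) * removed ≤ n
      family-few : n ^ D ≤ 2 ^ Lₐ
      family-room : F.C′ * (F.N * (qₐ * F.N + F.N)) ≤ n
      capacity : 2 * F.C′ * n + b * ((4 * (F.C′ * F.C′) + 2 * F.C′) * Lₐ) < b * qₐ
      tests-few : 2 * n ^ k₁ ≤ 2 ^ L
      removed≤ : Z₂ * (q * p) ≤ 2 * n
      removed≥ : n ≤ Z₂ * (q * p)
      long : 2 * K * K * L ≤ q
      c-short : suc (2 * K) * (2 * b) ≤ Z₂
      c-crude : 3 * Z₁ * ζ̄ * k * (2 * b) ≤ Z₂
      c-size : k * (2 * b) ≤ Z₂
      c-square : 2 * 2 ^ k * (3 * Z₁ * (k * k)) * (2 * b * (2 * b)) ≤ Z₂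
      c-rate : 2 * 2 ^ k * (15 * Z₁ * ζ̄ * k) * (2 * b) ≤ K
      large₁ : 2 * b * (2 * C₁ ^ (M ^ k) * ((k * M) * (k * M))) < n
      large₂ : 2 * b * (2 * C₂ ^ (M ^ k) * ((k * M) * (k * M))) < n
      large-C : 2 * b * C ≤ n
      large-link₀ : 4 * threshold-of 0 < n
      large-link : ∀ x → x < Q → 2 * b * (4 * threshold-of x) < n
      sparse-tiles : 2 * b * C * L₀ ≤ Bₜ

  record Input : Set where
    field
      sizes : Sizes
      degrees : ∀ S → length S ≡ k₁ → 6 * Z₁ * n ≤ n + 6 * Z₁ * (t * ∑ V (λ v → ⟦ N S v ⟧))
      spread : ∀ S → length S ≡ k₁ → n ^ k ≤ Δ₁ * count V k (avoiding S)
      d∣n : d ∣ n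

  module _ (input : Input) where
    open Input input
    open Sizes sizes

    private
      0<Z₁ : 0 < Z₁
      0<Z₁ = ≤-trans (n≤1+n 1) 2≤Z₁

      half-V : ∀ S → length S ≡ k₁ → n ≤ 2 * t * ∑ V (λ v → ⟦ N S v ⟧)
      half-V S |S| = *-cancelˡ-≤ (6 * Z₁) {{m*n≢0 6 Z₁ {{_}} {{>-nonZero 0<Z₁}}}} (+-cancelʳ-≤ (6 * Z₁ * n) _ _ (begin
        6 * Z₁ * n + 6 * Z₁ * n ≤⟨ +-mono-≤ (degrees S |S|) (degrees S |S|) ⟩
        n + 6 * Z₁ * (t * s) + (n + 6 * Z₁ * (t * s)) ≡⟨ eq n Z₁ t s ⟩
        6 * Z₁ * (2 * t * s) + 2 * n ≤⟨ +-monoʳ-≤ (6 * Z₁ * (2 * t * s)) (*-monoˡ-≤ n (≤-trans (≤-trans (m≤m+n 2 4) (≤-reflexive (sym (*-identityʳ 6)))) (*-monoʳ-≤ 6 0<Z₁))) ⟩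
        6 * Z₁ * (2 * t * s) + 6 * Z₁ * n ∎))
        where
        s = ∑ V (λ v → ⟦ N S v ⟧)
        eq : ∀ n Z t s → n + 6 * Z * (t * s) + (n + 6 * Z * (t * s)) ≡ 6 * Z * (2 * t * s) + 2 * n
        eq = solve-∀

      scaled-removed : ∀ c → c ≤ 12 * Z₁ * t * (k * Δ₁) → c * removed ≤ n
      scaled-removed c c≤ = ≤-trans (*-monoˡ-≤ removed c≤) few-removed

      C-removed : C * removed ≤ n
      C-removed = scaled-removed C (begin
        8 * t ≤⟨ *-monoˡ-≤ t (≤-trans (m≤m+n 8 4) (m≤m*n 12 Z₁ {{>-nonZero 0<Z₁}})) ⟩
        12 * Z₁ * t ≤⟨ m≤m*n (12 * Z₁ * t) (k * Δ₁) {{>-nonZero (*-mono-≤ (s≤s {0} {k₁} z≤n) 0<Δ₁)}} ⟩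
        12 * Z₁ * t * (k * Δ₁) ∎)

      C≤n : C ≤ n
      C≤n = ≤-trans (m≤n*m C (2 * b) {{m*n≢0 2 b {{_}} {{>-nonZero 0<b}}}}) large-C

      degree-V : Degree≥ (suc (n / C) + removed) V
      degree-V = half⇒degree N N⇒E n {V} removed half-V C-removed C≤n

      fam : F.Family
      fam = F.family (degree-weaken {suc (n / C) + removed} {suc (n / C)} {V} (m≤m+n _ removed) degree-V) (ceiling n) (s≤s z≤n) family-few family-room

      cds : List F.Candidate
      cds = F.Family.candidates fam

      Absorbable : List Piece → Set
      Absorbable ps = ∀ Ts → All (λ T → length T ≡ D) Ts → b * length Ts ≤ n →
          Σ[ alts ∈ All Alternative ps ] concat Ts ++ mids′ (keep-all ps) ↭ mids′ alts

      absorbable : Absorbable (A.all-pieces cds)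
      absorbable Ts |Ts| bTs≤n = A.absorb-all {cds} Ts |Ts| λ T |T| → enough-solved b (2 * F.C′) _ _ _ qₐ n capacity (F.Family.abundant fam T |T|) bTs≤n

    HamiltonList : Set
    HamiltonList = Σ[ cyc ∈ List (Fin n) ] cyc ↭ V × EChain (cyc ++ take ℓ cyc)

    private
      IsTile : List (Fin n) → Set
      IsTile P = length P ≡ p × EChain P

      nibble-setting : NibbleSetting
      nibble-setting = record
        { k₁ = k₁ ; p = p ; q = q ; L = L ; K = K ; Z₁ = Z₁ ; Z₂ = Z₂ ; ζ̄ = ζ̄ ; b = b ; IsTile = IsTile ; size = proj₁ ; tests = tests
        ; few = ≤-trans (≤-reflexive length-tests) tests-few ; bounded = tests-bounded ; 0<n = 0<n ; 0<p = <-≤-trans (s≤s z≤n) (m≤n+m r (Bₜ * t))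
        ; 0<K = 0<K ; 0<Z₁ = 0<Z₁ ; 0<Z₂ = 0<Z₂ ; removed≤ = removed≤ ; removed≥ = removed≥ ; long = long
        ; c-short = c-short ; c-crude = c-crude ; c-size = c-size ; c-square = c-square ; c-rate = c-rate }

      module Nb = Nibble nibble-setting

      instance
        2b≢0 : NonZero (2 * b)
        2b≢0 = m*n≢0 2 b {{_}} {{>-nonZero 0<b}}

      big-u : ∀ {u x} → n ≤ 2 * b * u → 2 * b * x < n → x < u
      big-u {u} {x} n≤ lt = *-cancelˡ-< (2 * b) x u (<-≤-trans lt n≤)

      quadruple : ∀ u → u + u + 2 * u ≡ 4 * u
      quadruple = solve-∀

      0<u-of : ∀ {u} → n ≤ 2 * b * u → 0 < u
      0<u-of n≤ = big-u n≤ (≤-<-trans (≤-reflexive (*-zeroʳ (2 * b))) 0<n)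

      oracle : Nb.Oracle′
      oracle U uniq n≤ dense w = convert (light-tile (rich Z₂ (3 * Z₂) 0<Z₂ ≤-refl {U} (0<u-of n≤) dense uniq (big-u n≤ large₁) (big-u n≤ large₂)) w)
        where
        convert : Σ[ T ∈ Tile U Bₜ ] suc (2 * K) * length U * ∑ (Tile.vertices T) w ≤ suc (suc (2 * K)) * M * ∑ U w →
            ∃[ P ] IsTile P × Unique P × All (_∈ U) P × suc (2 * K) * length U * ∑ P w ≤ suc (suc (2 * K)) * p * ∑ U w
        convert (T , le) = Tile.vertices T , (Tile.size T , Tile.chain T) , Tile.distinct T , Tile.within T , le

      -- `p₀` is set apart because the joint leaving it is built last: its residue can be fitted to
      -- the number of vertices that all other parts leave over.
      record Prepared : Set where
        field
          p₀ : Piece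
          ps : List Piece
          number : length (p₀ ∷ ps) ≡ qₐ * suc D
          size : length (bodies-of (p₀ ∷ ps)) ≤ qₐ * F.N
          absorb : Absorbable (p₀ ∷ ps)
          U₁ : List (Fin n)
          split₁ : V ↭ bodies-of (p₀ ∷ ps) ++ U₁

      module _ (prepared : Prepared) where
        open Prepared prepared

        z : Piece
        z = next ps p₀

        unique-U₁ : Unique U₁
        unique-U₁ = proj₁ (proj₂ (unique-++⁻ (bodies-of (p₀ ∷ ps)) (unique-resp-↭ split₁ (allFin-unique n))))

        |U₁|+ : length (bodies-of (p₀ ∷ ps)) + length U₁ ≡ n
        |U₁|+ = trans (sym (length-++ (bodies-of (p₀ ∷ ps)))) (trans (sym (↭-length split₁)) |V|)

        links-budget : length ps * L₀ ≤ budget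
        links-budget = ≤-trans (*-monoˡ-≤ L₀ (≤-trans (n≤1+n _) (≤-reflexive number))) (≤-reflexive (*-assoc qₐ (suc D) L₀))

        degree-U₁ : Degree≥ (suc (n / C) + budget) U₁
        degree-U₁ = degree-remove {δ = suc (n / C) + budget} {b = qₐ * F.N} {R = bodies-of (p₀ ∷ ps)} split₁ size
          (degree-weaken {suc (n / C) + removed} {suc (n / C) + budget + qₐ * F.N} {V} (≤-reflexive (eq (suc (n / C)) budget (qₐ * F.N))) degree-V)
          where
          eq : ∀ a b c → a + b + c ≡ a + (c + b)
          eq = solve-∀

        4removed : 4 * removed ≤ n
        4removed = ≤-trans (*-monoˡ-≤ removed {4} {C} (≤-trans (m≤m+n 4 4) (m≤m*n 8 t))) C-removed

        room₁ : link-threshold (links-of 0) C + budget < length U₁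
        room₁ = *-cancelˡ-< 4 _ _ (+-cancelʳ-< (4 * (qₐ * F.N)) _ _ (begin-strict
          4 * (thr + budget) + 4 * (qₐ * F.N) ≡⟨ eq thr budget (qₐ * F.N) ⟩
          4 * thr + 4 * removed <⟨ +-mono-<-≤ large-link₀ 4removed ⟩
          n + n ≤⟨ m≤m+n (n + n) (2 * n) ⟩
          n + n + 2 * n ≡⟨ quadruple n ⟩
          4 * n ≡⟨ cong (4 *_) |U₁|+ ⟨
          4 * (length (bodies-of (p₀ ∷ ps)) + length U₁) ≤⟨ *-monoʳ-≤ 4 (+-monoˡ-≤ (length U₁) size) ⟩
          4 * (qₐ * F.N + length U₁) ≡⟨ eq₃ (qₐ * F.N) (length U₁) ⟩
          4 * length U₁ + 4 * (qₐ * F.N) ∎))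
          where
          thr = link-threshold (links-of 0) C
          eq : ∀ t b q → 4 * (t + b) + 4 * q ≡ 4 * t + 4 * (q + b)
          eq = solve-∀
          eq₃ : ∀ q u → 4 * (q + u) ≡ 4 * u + 4 * q
          eq₃ = solve-∀

        connected₁ : Connected (links-of 0) U₁ ps p₀
        connected₁ = connect-all (links-of 0) {U₁} {suc (n / C)} C ps p₀ budget links-budget unique-U₁ degree-U₁
          (≤-trans (≤-trans (m≤n+m _ _) (≤-reflexive |U₁|+)) (ceiling n)) room₁

        open Connected connected₁ renaming (links to links₁; rest to U₀; split to split₀; size to size₁)

        R₀ : List (Fin n)
        R₀ = bodies-of (p₀ ∷ ps) ++ inners links₁

        split₀′ : V ↭ R₀ ++ U₀
        split₀′ = ↭-trans split₁ (↭-trans (Permₚ.++⁺ˡ (bodies-of (p₀ ∷ ps)) split₀) (↭-reflexive (sym (++-assoc (bodies-of (p₀ ∷ ps)) (inners links₁) U₀))))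

        |R₀| : length R₀ ≤ removed
        |R₀| = ≤-trans (≤-reflexive (length-++ (bodies-of (p₀ ∷ ps)))) (+-mono-≤ size (≤-trans (≤-reflexive size₁) links-budget))

        unique-U₀ : Unique U₀
        unique-U₀ = proj₁ (proj₂ (unique-++⁻ R₀ (unique-resp-↭ split₀′ (allFin-unique n))))

        |U₀|+ : length R₀ + length U₀ ≡ n
        |U₀|+ = trans (sym (length-++ R₀)) (trans (sym (↭-length split₀′)) |V|)

        n≤2bU₀ : n ≤ 2 * b * length U₀
        n≤2bU₀ = +-cancelˡ-≤ n _ _ (begin
          n + n ≡⟨ cong₂ _+_ |U₀|+ |U₀|+ ⟨
          length R₀ + length U₀ + (length R₀ + length U₀) ≡⟨ eq (length R₀) (length U₀) ⟩
          2 * length R₀ + 2 * length U₀ ≤⟨ +-mono-≤ (≤-trans (*-mono-≤ {2} {4} (m≤m+n 2 2) |R₀|) 4removed) (*-monoˡ-≤ (length U₀) (m≤m*n 2 b {{>-nonZero 0<b}})) ⟩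
          n + 2 * b * length U₀ ∎)
          where
          eq : ∀ r u → r + u + (r + u) ≡ 2 * r + 2 * u
          eq = solve-∀

        covering : Nb.Covering U₀
        covering = Nb.nibble oracle Z₂ 0 U₀ refl unique-U₀ (≤-trans (≤-trans (m≤n+m _ (length R₀)) (≤-reflexive |U₀|+)) removed≥) n≤2bU₀
          (subst (λ i → Dense (3 * Z₁ * Z₂) i U₀) (sym (+-identityʳ Z₂))
            (initial-dense degrees spread R₀ U₀ split₀′ (≤-trans (*-monoʳ-≤ (12 * Z₁ * t * (k * Δ₁)) |R₀|) few-removed) Z₂))

        to-pieces : ∀ {Ts} → All IsTile Ts → Σ[ qs ∈ List Piece ] map vertices qs ≡ Ts
        to-pieces [] = [] , refl
        to-pieces {P ∷ _} ((|P| , ch) ∷ ts) = cons (A.tile-piece Bₜ 2≤Bₜ P |P| ch) (to-pieces ts)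
          where
          cons : ∀ {Ts} → Σ[ q ∈ Piece ] vertices q ≡ P → Σ[ qs ∈ List Piece ] map vertices qs ≡ Ts → Σ[ qs ∈ List Piece ] map vertices qs ≡ P ∷ Ts
          cons (q , eq) (qs , eqs) = q ∷ qs , cong₂ _∷_ eq eqs

        module _ (covering : Nb.Covering U₀) where
          open Nb.Covering covering renaming (split to split*; small to bu<n; large to n≤2bu; dense to dense*)

          u : ℕ
          u = length U*

          qs : List Piece
          qs = proj₁ (to-pieces tiles)

          qs≡ : bodies-of qs ≡ concat Ts
          qs≡ = cong concat (proj₂ (to-pieces tiles))

          |qs| : length qs ≡ length Ts
          |qs| = trans (sym (length-map vertices qs)) (cong length (proj₂ (to-pieces tiles)))

          unique-U* : Unique U*
          unique-U* = proj₁ (proj₂ (unique-++⁻ (concat Ts) (unique-resp-↭ split* unique-U₀)))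

          tile-count : length Ts * p ≤ n
          tile-count = ≤-trans (≤-reflexive (sym (total tiles))) (≤-trans (≤-trans (m≤m+n _ (length U*)) (≤-reflexive (trans (sym (length-++ (concat Ts))) (sym (↭-length split*))))) (≤-trans (m≤n+m _ (length R₀)) (≤-reflexive |U₀|+)))
            where
            total : ∀ {Ts} → All IsTile Ts → length (concat Ts) ≡ length Ts * p
            total [] = refl
            total {P ∷ _} ((|P| , _) ∷ ts) = trans (length-++ P) (cong₂ _+_ |P| (total ts))

          β : ℕ
          β = length qs * L₀

          Cβ≤u : C * β ≤ u
          Cβ≤u = *-cancelˡ-≤ (2 * b) (begin
            2 * b * (C * (length qs * L₀)) ≡⟨ eq b C (length qs) L₀ ⟩
            length qs * (2 * b * C * L₀) ≤⟨ *-mono-≤ (≤-reflexive |qs|) (≤-trans sparse-tiles (≤-trans (m≤m*n Bₜ t) (m≤m+n (Bₜ * t) r))) ⟩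
            length Ts * p ≤⟨ ≤-trans tile-count n≤2bu ⟩
            2 * b * u ∎)
            where
            eq : ∀ b c q l → 2 * b * (c * (q * l)) ≡ q * (2 * b * c * l)
            eq = solve-∀

          C≤u : C ≤ u
          C≤u = *-cancelˡ-≤ (2 * b) (≤-trans large-C n≤2bu)

          degree* : Degree≥ (suc (u / C) + β) U*
          degree* = half⇒degree N N⇒E u {U*} β (half-degree Z₂ (2 * Z₂) 0<Z₂ (*-monoˡ-≤ Z₂ (n≤1+n 2)) {U*} (0<u-of n≤2bu) dense*) Cβ≤u C≤u

          4β≤u : 4 * β ≤ u
          4β≤u = ≤-trans (*-monoˡ-≤ β {4} {C} (≤-trans (m≤m+n 4 4) (m≤m*n 8 t))) Cβ≤u

          0<Q : 0 < Q
          0<Q = s≤s z≤n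

          room* : ∀ x → x < Q → 4 * threshold-of x < u
          room* x x<Q = big-u n≤2bu (large-link x x<Q)

          connected* : Connected (links-of 0) U* qs z
          connected* = connect-all (links-of 0) {U*} {suc (u / C)} C qs z β ≤-refl unique-U* degree* (ceiling u)
            (*-cancelˡ-< 4 _ _ (begin-strict
              4 * (threshold-of 0 + β) ≡⟨ *-distribˡ-+ 4 (threshold-of 0) β ⟩
              4 * threshold-of 0 + 4 * β <⟨ +-mono-<-≤ (room* 0 0<Q) 4β≤u ⟩
              u + u ≤⟨ m≤m+n (u + u) (2 * u) ⟩
              u + u + 2 * u ≡⟨ quadruple u ⟩
              4 * u ∎))

          open Connected connected* renaming (links to links*; rest to rest*; split to split-rest; size to size*)

          |rest*|+ : β + length rest* ≡ u
          |rest*|+ = trans (cong (_+ length rest*) (sym size*)) (trans (sym (length-++ (inners links*))) (sym (↭-length split-rest)))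

          unique-rest : Unique rest*
          unique-rest = proj₁ (proj₂ (unique-++⁻ (inners links*) (unique-resp-↭ split-rest unique-U*)))

          degree-rest : Degree≥ (suc (u / C)) rest*
          degree-rest = degree-remove {δ = suc (u / C)} {b = β} {R = inners links*} split-rest (≤-reflexive size*) degree*

          rest≤u : length rest* ≤ u
          rest≤u = ≤-trans (m≤n+m _ β) (≤-reflexive |rest*|+)

          room-rest : ∀ x → x < Q → link-threshold (links-of x) C < length rest*
          room-rest x x<Q = *-cancelˡ-< 4 _ _ (+-cancelˡ-< (4 * β) _ _ (begin-strict
            4 * β + 4 * threshold-of x <⟨ +-mono-≤-< 4β≤u (room* x x<Q) ⟩
            u + u ≤⟨ m≤m+n (u + u) (2 * u) ⟩
            u + u + 2 * u ≡⟨ quadruple u ⟩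
            4 * u ≡⟨ cong (4 *_) |rest*|+ ⟨
            4 * (β + length rest*) ≡⟨ *-distribˡ-+ 4 β _ ⟩
            4 * β + 4 * length rest* ∎))

          -- All pieces and joints are accounted for by multiples of d up to the final ℓ vertices.
          rest-residue : d ∣ ℓ + length rest*
          rest-residue = conclude (links-length links₁) (links-length links*)
            where
            conclude : ∃[ y ] length (bodies-of ps) + length (inners links₁) ≡ y * d → ∃[ y ] length (bodies-of qs) + length (inners links*) ≡ y * d → d ∣ ℓ + length rest*
            conclude (y , eq) (y′ , eq′) = ∣m+n∣m⇒∣n (subst (d ∣_) total d∣n) (divides (Piece.blocks p₀ + y + y′) refl)
              where
              total : n ≡ (Piece.blocks p₀ + y + y′) * d + (ℓ + length rest*)
              total = begin-equality
                n ≡⟨ |U₀|+ ⟨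
                length R₀ + length U₀ ≡⟨ cong₂ _+_ (trans (length-++ (bodies-of (p₀ ∷ ps))) (cong (_+ length (inners links₁)) (length-++ (vertices p₀))))
                  (trans (↭-length split*) (length-++ (concat Ts))) ⟩
                length (vertices p₀) + length (bodies-of ps) + length (inners links₁) + (length (concat Ts) + u)
                  ≡⟨ cong₂ (λ a c → a + length (bodies-of ps) + length (inners links₁) + c) (piece-length p₀)
                  (cong₂ _+_ (cong length (sym qs≡)) (trans (↭-length split-rest) (length-++ (inners links*)))) ⟩
                Piece.blocks p₀ * d + ℓ + length (bodies-of ps) + length (inners links₁) + (length (bodies-of qs) + (length (inners links*) + length rest*))
                  ≡⟨ regroup (Piece.blocks p₀ * d) ℓ (length (bodies-of ps)) (length (inners links₁)) (length (bodies-of qs)) (length (inners links*)) (length rest*) ⟩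
                Piece.blocks p₀ * d + (length (bodies-of ps) + length (inners links₁)) + (length (bodies-of qs) + length (inners links*)) + (ℓ + length rest*)
                  ≡⟨ cong₂ (λ a c → Piece.blocks p₀ * d + a + c + (ℓ + length rest*)) eq eq′ ⟩
                Piece.blocks p₀ * d + y * d + y′ * d + (ℓ + length rest*) ≡⟨ cong (_+ (ℓ + length rest*)) (distrib (Piece.blocks p₀) y y′ d) ⟩
                (Piece.blocks p₀ + y + y′) * d + (ℓ + length rest*) ∎
                where
                regroup : ∀ a l b i c j r → a + l + b + i + (c + (j + r)) ≡ a + (b + i) + (c + j) + (l + r)
                regroup = solve-∀
                distrib : ∀ a b c d → a * d + b * d + c * d ≡ (a + b + c) * d
                distrib = solve-∀

          close-up : HamiltonList
          close-up = close rest-residue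
            where
            close : d ∣ ℓ + length rest* → HamiltonList
            -- y blocks remain if the ℓ vertices at one end of the last joint are included. Of these
            -- the joint with parameter x uses s - 1 + x + S modulo Q, so x is chosen to leave a
            -- multiple of Q blocks.
            close (divides y y≡) = adjust (residue (pred Q) y (suc s₂ + S))
              where
              adjust : ∃[ x ] x < suc (pred Q) × ∃₂ (λ c c′ → y + c * suc (pred Q) ≡ suc s₂ + S + x + c′ * suc (pred Q)) → HamiltonList
              adjust (x , x<Q , c , c′ , x≡) = with-joint (joint (links-of x) C unique-rest degree-rest (≤-trans rest≤u (ceiling u)) (room-rest x x<Q) p₀ (next qs z))
                where
                sx : ℕ
                sx = link-size (links-of x)
                with-joint : Σ[ j ∈ Joint p₀ (next qs z) ] Unique (Joint.inner j) × All (_∈ rest*) (Joint.inner j) × length (Joint.inner j) ≡ sx → HamiltonList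
                with-joint (j , un , win , |j|) = with-rest (subset-↭ un win)
                  where
                  with-rest : ∃[ W ] rest* ↭ Joint.inner j ++ W → HamiltonList
                  with-rest (W , split-W) = divide D∣W
                    where
                    ρ : ℕ
                    ρ = SymConnector.rounds (links-of x)
                    |W|+ : sx + length W ≡ length rest*
                    |W|+ = trans (cong (_+ length W) (sym |j|)) (trans (sym (length-++ (Joint.inner j))) (sym (↭-length split-W)))
                    D∣W : D ∣ length W
                    D∣W = ∣m+n∣m⇒∣n {D} {(ρ + c) * D} {length W} (divides c′ balance) (n∣m*n (ρ + c))
                      where
                      a = suc s₂ + S
                      balance′ : (ρ + c) * D + length W + (a + x) * d ≡ c′ * D + (a + x) * d
                      balance′ = begin-equality
                        (ρ + c) * D + length W + (a + x) * d ≡⟨ eq₁ s₂ S ρ c Q d (length W) x ⟩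
                        (suc s₂ + x + ρ * Q + S) * d + length W + c * Q * d ≡⟨ cong (λ l → l + length W + c * Q * d) (SymConnector.aligned (links-of x)) ⟨
                        ℓ + sx + length W + c * Q * d ≡⟨ cong (_+ c * Q * d) (trans (+-assoc ℓ sx (length W)) (trans (cong (ℓ +_) |W|+) y≡)) ⟩
                        y * d + c * Q * d ≡⟨ *-distribʳ-+ d y (c * Q) ⟨
                        (y + c * Q) * d ≡⟨ cong (_* d) x≡ ⟩
                        (a + x + c′ * Q) * d ≡⟨ eq₂ (a + x) c′ Q d ⟩
                        c′ * D + (a + x) * d ∎
                        where
                        eq₁ : ∀ s S ρ c Q d w x → (ρ + c) * (Q * d) + w + (suc s + S + x) * d ≡ (suc s + x + ρ * Q + S) * d + w + c * Q * d
                        eq₁ = solve-∀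
                        eq₂ : ∀ a c Q d → (a + c * Q) * d ≡ c * (Q * d) + a * d
                        eq₂ = solve-∀
                      balance : (ρ + c) * D + length W ≡ c′ * D
                      balance = +-cancelʳ-≡ ((a + x) * d) _ _ balance′
                    divide : D ∣ length W → HamiltonList
                    divide (divides w |W|) = with-chunks (chunk D (s≤s z≤n) w W |W|)
                      where
                      with-chunks : ∃[ Ws ] concat Ws ≡ W × All (λ T → length T ≡ D) Ws × length Ws ≡ w → HamiltonList
                      with-chunks (Ws , refl , |Ws| , nW) = with-alts (absorb Ws |Ws| few)
                        where
                        few : b * length Ws ≤ n
                        few = ≤-trans (*-monoʳ-≤ b (≤-trans (≤-reflexive nW) (≤-trans (m≤m*n w D) (≤-trans (≤-reflexive (sym |W|)) (≤-trans (≤-trans (m≤n+m _ sx) (≤-reflexive |W|+)) rest≤u))))) (<⇒≤ bu<n)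
                        with-alts : Σ[ alts ∈ All Alternative (p₀ ∷ ps) ] concat Ws ++ mids′ (keep-all (p₀ ∷ ps)) ↭ mids′ alts → HamiltonList
                        with-alts (alts , absorbed) = closed links₁ j links* {concat Ws} alts absorbed A.mids′-++ A.vertices-split ,
                          ↭-trans (closed-↭ links₁ j links* {concat Ws} alts absorbed A.mids′-++ A.vertices-split) (↭-sym everything) ,
                          closed-path links₁ j links* {concat Ws} alts absorbed A.mids′-++ A.vertices-split
                          where
                          everything : V ↭ bodies-of (p₀ ∷ ps) ++ inners links₁ ++ bodies-of qs ++ inners links* ++ Joint.inner j ++ concat Ws
                          everything = ↭-trans split₁ (Permₚ.++⁺ˡ (bodies-of (p₀ ∷ ps)) (↭-trans split₀ (Permₚ.++⁺ˡ (inners links₁)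
                            (↭-trans split* (↭-trans (↭-reflexive (cong (_++ U*) (sym qs≡))) (Permₚ.++⁺ˡ (bodies-of qs) (↭-trans split-rest (Permₚ.++⁺ˡ (inners links*) split-W))))))))

    hamilton-list : HamiltonList
    hamilton-list = assemble (A.all-pieces cds) refl
      where
      all-in-V : ∀ xs → All (_∈ V) xs
      all-in-V xs = All.universal ∈-allFin xs
      assemble : ∀ pcs → A.all-pieces cds ≡ pcs → HamiltonList
      assemble [] eq = ⊥-elim (<⇒≢ (*-mono-≤ 0<qₐ (s≤s {0} {D} z≤n)) (trans (cong length (sym eq)) number))
        where
        number : length (A.all-pieces cds) ≡ qₐ * suc D
        number = trans (A.pieces-number cds) (cong (_* suc D) (F.Family.size fam))
      assemble (p₀ ∷ ps) eq = split (subset-↭ (subst (λ l → Unique (bodies-of l)) eq (A.bodies-unique cds (F.Family.disjoint fam))) (all-in-V (bodies-of (p₀ ∷ ps))))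
        where
        split : ∃[ U₁ ] V ↭ bodies-of (p₀ ∷ ps) ++ U₁ → HamiltonList
        split (U₁ , perm) = close-up prepared (covering prepared)
          where
          prepared : Prepared
          prepared = record
            { p₀ = p₀ ; ps = ps ; number = trans (cong length (sym eq)) (trans (A.pieces-number cds) (cong (_* suc D) (F.Family.size fam)))
            ; size = subst (λ l → length (bodies-of l) ≤ qₐ * F.N) eq (≤-trans (A.bodies-size cds) (≤-reflexive (cong (_* F.N) (F.Family.size fam))))
            ; absorb = subst Absorbable eq absorbable ; U₁ = U₁ ; split₁ = perm }

-- Choosing the constants

module _ (c : ℕ) .{{c≢0 : NonZero c}} where
  quotient-≤ : ∀ {x n} → c * x ≤ n → x ≤ n / c
  quotient-≤ {x} {n} cx≤n = ≤-trans (≤-reflexive (sym (m*n/n≡m x c))) (/-mono-≤ (≤-trans (≤-reflexive (*-comm x c)) cx≤n) (≤-refl {c}))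

  below-quotient : ∀ n → n < c * suc (n / c)
  below-quotient n = begin-strict
    n ≡⟨ m≡m%n+[m/n]*n n c ⟩
    n % c + n / c * c <⟨ +-monoˡ-< _ (m%n<n n c) ⟩
    c + n / c * c ≡⟨ cong (c +_) (*-comm (n / c) c) ⟩
    c + c * (n / c) ≡⟨ *-suc c (n / c) ⟨
    c * suc (n / c) ∎
    where open ≤-Reasoning

-- λ = n / c has n ≤ c (λ + 1) ≤ 2 ^ λ once λ ≥ 2 c + 1.
module _ (c D : ℕ) where
  private
    c′ : ℕ
    c′ = suc (c * suc D)

    suc≤2^ : ∀ x → suc x ≤ 2 ^ x
    suc≤2^ zero = ≤-refl
    suc≤2^ (suc x) = begin
      suc (suc x) ≤⟨ +-mono-≤ (s≤s {0} z≤n) (suc≤2^ x) ⟩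
      1 + 2 ^ x ≤⟨ +-monoˡ-≤ (2 ^ x) (≤-trans (s≤s z≤n) (suc≤2^ x)) ⟩
      2 ^ x + 2 ^ x ≡⟨ cong (2 ^ x +_) (+-identityʳ _) ⟨
      2 ^ suc x ∎
      where open ≤-Reasoning

    growth : ∀ y → c′ * suc (suc (c′ + c′) + y) ≤ 2 ^ (suc (c′ + c′) + y)
    growth zero = begin
      c′ * suc (suc (c′ + c′) + 0) ≤⟨ m≤m+n _ (2 * suc c′) ⟩
      c′ * suc (suc (c′ + c′) + 0) + 2 * suc c′ ≡⟨ eq c′ ⟩
      2 * (suc c′ * suc c′) ≤⟨ *-monoʳ-≤ 2 (*-mono-≤ (suc≤2^ c′) (suc≤2^ c′)) ⟩
      2 * (2 ^ c′ * 2 ^ c′) ≡⟨ cong (2 *_) (^-distribˡ-+-* 2 c′ c′) ⟨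
      2 ^ suc (c′ + c′) ≡⟨ cong (2 ^_) (+-identityʳ (suc (c′ + c′))) ⟨
      2 ^ (suc (c′ + c′) + 0) ∎
      where
      open ≤-Reasoning
      eq : ∀ c → c * suc (suc (c + c) + 0) + 2 * suc c ≡ 2 * (suc c * suc c)
      eq = solve-∀
    growth (suc y) = begin
      c′ * suc (x + suc y) ≡⟨ cong (λ z → c′ * suc z) (+-suc x y) ⟩
      c′ * suc (suc (x + y)) ≤⟨ *-monoʳ-≤ c′ (+-monoˡ-≤ (suc (x + y)) (s≤s {0} {x + y} z≤n)) ⟩
      c′ * (suc (x + y) + suc (x + y)) ≡⟨ *-distribˡ-+ c′ (suc (x + y)) (suc (x + y)) ⟩
      c′ * suc (x + y) + c′ * suc (x + y) ≤⟨ +-mono-≤ (growth y) (growth y) ⟩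
      2 ^ (x + y) + 2 ^ (x + y) ≡⟨ cong (2 ^ (x + y) +_) (+-identityʳ _) ⟨
      2 ^ suc (x + y) ≡⟨ cong (2 ^_) (+-suc x y) ⟨
      2 ^ (x + suc y) ∎
      where
      open ≤-Reasoning
      x = suc (c′ + c′)

  log-room : ℕ
  log-room = c′ * suc (c′ + c′)

  log-bound : ∀ n → log-room ≤ n → ∃[ L ] 2 * n ^ D ≤ 2 ^ L × c * L ≤ n
  log-bound n large = suc (D * l) , power , linear
    where
    open ≤-Reasoning
    l : ℕ
    l = n / c′
    l≥ : suc (c′ + c′) ≤ l
    l≥ = quotient-≤ c′ large
    n≤2^l : n ≤ 2 ^ l
    n≤2^l = ≤-trans (<⇒≤ (below-quotient c′ n)) (subst (λ l → c′ * suc l ≤ 2 ^ l) (m+[n∸m]≡n l≥) (growth (l ∸ suc (c′ + c′))))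
    power : 2 * n ^ D ≤ 2 ^ suc (D * l)
    power = *-monoʳ-≤ 2 (≤-trans (^-monoˡ-≤ D n≤2^l) (≤-reflexive (trans (^-*-assoc 2 l D) (cong (2 ^_) (*-comm l D)))))
    linear : c * suc (D * l) ≤ n
    linear = begin
      c * suc (D * l) ≤⟨ *-monoʳ-≤ c (+-monoˡ-≤ (D * l) (≤-trans (s≤s z≤n) l≥)) ⟩
      c * (suc D * l) ≡⟨ *-assoc c (suc D) l ⟨
      c * suc D * l ≤⟨ *-monoˡ-≤ l (n≤1+n (c * suc D)) ⟩
      c′ * l ≡⟨ *-comm c′ l ⟩
      l * c′ ≤⟨ m/n*n≤m n c′ ⟩
      n ∎

module Choice (σ : Shape) (Δ₁ : ℕ) (0<Δ₁ : 0 < Δ₁) where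
  open Words σ
  open Gadgets σ using (D)
  open SymbolicAbsorber σ using (absorber; module SymAbsorber)
  open AbsorberWord σ using (absorber-width)
  open ≤-Reasoning

  -- The order of dependence: connectors and absorbers come from the shape alone; then n / cₐ is the
  -- number of absorbers, where `x₁` limits the damage they do to densities and `x₂` leaves room to
  -- choose them disjoint; then `b`, such that they can absorb n / b vertices; then `K` and `Bₜ`;
  -- finally `Z₂`, the sum of all that is required of it.
  Z₁ C ζ̄ L₀ mₐ Nₐ C′ X x₁ x₂ cₐ b K Bₜ p z₁ z₂ z₃ z₄ Z₂ : ℕ
  Z₁ = 4 * (k * (4 * Δ₁))
  C = 8 * t
  ζ̄ = t + 2 * Δ₁
  L₀ = length (SymConnector.mids (BuildConnector.connector σ 0))
  mₐ = length (SymAbsorber.cs absorber)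
  Nₐ = mₐ * absorber-width
  C′ = 2 * (C ^ mₐ) ^ (absorber-width ^ mₐ)
  X = 4 * (C′ * C′) + 2 * C′
  x₁ = 12 * Z₁ * t * (k * Δ₁) * (Nₐ + suc D * L₀)
  x₂ = 2 * (C′ * (Nₐ * Nₐ))
  cₐ = suc (x₁ + x₂)
  b = 16 * C′ * cₐ
  K = suc (2 * 2 ^ k * (15 * Z₁ * ζ̄ * k) * (2 * b))
  Bₜ = 2 + 2 * b * C * L₀
  p = Bₜ * t + r
  z₁ = suc (2 * K) * (2 * b)
  z₂ = 3 * Z₁ * ζ̄ * k * (2 * b)
  z₃ = k * (2 * b)
  z₄ = 2 * 2 ^ k * (3 * Z₁ * (k * k)) * (2 * b * (2 * b))
  Z₂ = suc (z₁ + (z₂ + (z₃ + z₄)))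

  0<C′ : 0 < C′
  0<C′ = *-mono-≤ (s≤s {0} {1} z≤n) (m^n>0 (C ^ mₐ) {{m^n≢0 C mₐ}} (absorber-width ^ mₐ))

  0<b : 0 < b
  0<b = *-mono-≤ (*-mono-≤ (s≤s {0} {15} z≤n) 0<C′) (s≤s {0} z≤n)

  0<p : 0 < p
  0<p = <-≤-trans (s≤s z≤n) (m≤n+m r (Bₜ * t))

  absorber-log path-log : ℕ
  absorber-log = 4 * cₐ * X
  path-log = Z₂ * p * (2 * K * K)

  params : ℕ → ℕ → ℕ → Params
  params n Lₐ L = record { Δ₁ = Δ₁ ; b = b ; Bₜ = Bₜ ; K = K ; Z₂ = Z₂ ; qₐ = n / cₐ ; Lₐ = Lₐ ; q = suc ((n / (Z₂ * p)) {{Z₂p≢0}}) ; L = L }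
    where
    Z₂p≢0 : NonZero (Z₂ * p)
    Z₂p≢0 = m*n≢0 Z₂ p {{_}} {{>-nonZero 0<p}}

  open Constants σ (params 0 0 0) using (threshold-of; C₁; C₂)

  bounds : List ℕ
  bounds = cₐ ∷ Z₂ * p ∷ log-room absorber-log D ∷ log-room path-log k₁ ∷
      suc (2 * b * (2 * C₁ ^ (p ^ k) * ((k * p) * (k * p)))) ∷ suc (2 * b * (2 * C₂ ^ (p ^ k) * ((k * p) * (k * p)))) ∷
      2 * b * C ∷ suc (4 * threshold-of 0) ∷ map (λ x → suc (2 * b * (4 * threshold-of x))) (range 0 Q)

  room : ℕ
  room = ∑ bounds id

  module _ (Γ : Host) (large : room ≤ Host.n Γ) where
    open Host Γ using (n)

    at : ∀ {x} → x ∈ bounds → x ≤ n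
    at x∈ = ≤-trans (∈⇒≤∑ id x∈) large

    instance
      Z₂p≢0 : NonZero (Z₂ * p)
      Z₂p≢0 = m*n≢0 Z₂ p {{_}} {{>-nonZero 0<p}}

    Lₐ,bound : ∃[ L ] 2 * n ^ D ≤ 2 ^ L × absorber-log * L ≤ n
    Lₐ,bound = log-bound absorber-log D n (at (there (there (here refl))))

    L,bound : ∃[ L ] 2 * n ^ k₁ ≤ 2 ^ L × path-log * L ≤ n
    L,bound = log-bound path-log k₁ n (at (there (there (there (here refl)))))

    pr : Params
    pr = params n (proj₁ Lₐ,bound) (proj₁ L,bound)

    qₐ q : ℕ
    qₐ = Params.qₐ pr
    q = Params.q pr

    0<qₐ : 0 < qₐ
    0<qₐ = quotient-≤ cₐ (≤-trans (≤-reflexive (*-identityʳ cₐ)) (at (here refl)))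

    cₐqₐ≤n : qₐ * cₐ ≤ n
    cₐqₐ≤n = m/n*n≤m n cₐ

    few-removed : 12 * Z₁ * t * (k * Δ₁) * (qₐ * Nₐ + qₐ * (suc D * L₀)) ≤ n
    few-removed = ≤-trans (≤-reflexive (eq (12 * Z₁ * t * (k * Δ₁)) qₐ Nₐ (suc D * L₀))) (≤-trans (*-monoʳ-≤ qₐ (m≤n⇒m≤1+n (m≤m+n x₁ x₂))) cₐqₐ≤n)
      where
      eq : ∀ c q N l → c * (q * N + q * l) ≡ q * (c * (N + l))
      eq = solve-∀

    family-room : C′ * (Nₐ * (qₐ * Nₐ + Nₐ)) ≤ n
    family-room = begin
      C′ * (Nₐ * (qₐ * Nₐ + Nₐ)) ≤⟨ *-monoʳ-≤ C′ (*-monoʳ-≤ Nₐ (+-monoʳ-≤ (qₐ * Nₐ) (≤-trans (≤-reflexive (sym (+-identityʳ Nₐ))) (*-monoˡ-≤ Nₐ 0<qₐ)))) ⟩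
      C′ * (Nₐ * (qₐ * Nₐ + qₐ * Nₐ)) ≡⟨ eq C′ Nₐ qₐ ⟩
      qₐ * (2 * (C′ * (Nₐ * Nₐ))) ≤⟨ *-monoʳ-≤ qₐ (m≤n⇒m≤1+n (m≤n+m x₂ x₁)) ⟩
      qₐ * cₐ ≤⟨ cₐqₐ≤n ⟩
      n ∎
      where
      eq : ∀ c N q → c * (N * (q * N + q * N)) ≡ q * (2 * (c * (N * N)))
      eq = solve-∀

    -- The factor 16 in `b`: an absorber solves a given tuple with frequency 1 / (2 C′), the
    -- logarithmic term takes at most 4 C′ n, and rounding in n / cₐ costs a factor of at most 2.
    capacity : 2 * C′ * n + b * (X * proj₁ Lₐ,bound) < b * qₐ
    capacity = begin-strict
      2 * C′ * n + b * (X * L) ≡⟨ eq₁ C′ n cₐ X L ⟩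
      2 * C′ * n + 4 * C′ * (4 * cₐ * X * L) ≤⟨ +-monoʳ-≤ (2 * C′ * n) (*-monoʳ-≤ (4 * C′) (proj₂ (proj₂ Lₐ,bound))) ⟩
      2 * C′ * n + 4 * C′ * n ≡⟨ eq₂ C′ n ⟩
      6 * C′ * n ≤⟨ *-monoˡ-≤ n (*-monoˡ-≤ C′ (m≤m+n 6 2)) ⟩
      8 * C′ * n <⟨ *-monoʳ-< (8 * C′) {{m*n≢0 8 C′ {{_}} {{>-nonZero 0<C′}}}} (below-quotient cₐ n) ⟩
      8 * C′ * (cₐ * suc qₐ) ≤⟨ *-monoʳ-≤ (8 * C′) (*-monoʳ-≤ cₐ (+-monoˡ-≤ qₐ 0<qₐ)) ⟩
      8 * C′ * (cₐ * (qₐ + qₐ)) ≡⟨ eq₃ C′ cₐ qₐ ⟩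
      b * qₐ ∎
      where
      L = proj₁ Lₐ,bound
      eq₁ : ∀ C n c X L → 2 * C * n + 16 * C * c * (X * L) ≡ 2 * C * n + 4 * C * (4 * c * X * L)
      eq₁ = solve-∀
      eq₂ : ∀ C n → 2 * C * n + 4 * C * n ≡ 6 * C * n
      eq₂ = solve-∀
      eq₃ : ∀ C c q → 8 * C * (c * (q + q)) ≡ 16 * C * c * q
      eq₃ = solve-∀

    removed≤ : Z₂ * (q * p) ≤ 2 * n
    removed≤ = begin
      Z₂ * (q * p) ≡⟨ eq Z₂ (n / (Z₂ * p)) p ⟩
      Z₂ * p + n / (Z₂ * p) * (Z₂ * p) ≤⟨ +-mono-≤ (at (there (here refl))) (m/n*n≤m n (Z₂ * p)) ⟩
      n + n ≡⟨ cong (n +_) (+-identityʳ n) ⟨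
      2 * n ∎
      where
      eq : ∀ Z y p → Z * (suc y * p) ≡ Z * p + y * (Z * p)
      eq = solve-∀

    removed≥ : n ≤ Z₂ * (q * p)
    removed≥ = ≤-trans (<⇒≤ (below-quotient (Z₂ * p) n)) (≤-reflexive (eq Z₂ p (suc (n / (Z₂ * p)))))
      where
      eq : ∀ Z p y → Z * p * y ≡ Z * (y * p)
      eq = solve-∀

    long : 2 * K * K * proj₁ L,bound ≤ q
    long = m≤n⇒m≤1+n (quotient-≤ (Z₂ * p) (≤-trans (≤-reflexive (sym (*-assoc (Z₂ * p) (2 * K * K) _))) (proj₂ (proj₂ L,bound))))

    sizes : ∀ (0<n : 0 < n) → Assembly.Sizes σ pr Γ 0<Δ₁ (s≤s z≤n) 0<n
    sizes 0<n = record
      { 0<b = 0<b ; 0<qₐ = 0<qₐ ; 0<Z₂ = s≤s z≤n ; 2≤Bₜ = s≤s (s≤s z≤n)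
      ; few-removed = few-removed
      ; family-few = ≤-trans (m≤n*m (n ^ D) 2) (proj₁ (proj₂ Lₐ,bound))
      ; family-room = family-room
      ; capacity = capacity
      ; tests-few = proj₁ (proj₂ L,bound)
      ; removed≤ = removed≤ ; removed≥ = removed≥ ; long = long
      ; c-short = m≤n⇒m≤1+n (m≤m+n z₁ (z₂ + (z₃ + z₄)))
      ; c-crude = m≤n⇒m≤1+n (≤-trans (m≤m+n z₂ (z₃ + z₄)) (m≤n+m (z₂ + (z₃ + z₄)) z₁))
      ; c-size = m≤n⇒m≤1+n (≤-trans (≤-trans (m≤m+n z₃ z₄) (m≤n+m (z₃ + z₄) z₂)) (m≤n+m (z₂ + (z₃ + z₄)) z₁))
      ; c-square = m≤n⇒m≤1+n (≤-trans (≤-trans (m≤n+m z₄ z₃) (m≤n+m (z₃ + z₄) z₂)) (m≤n+m (z₂ + (z₃ + z₄)) z₁))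
      ; c-rate = n≤1+n (2 * 2 ^ k * (15 * Z₁ * ζ̄ * k) * (2 * b))
      ; large₁ = at (there (there (there (there (here refl)))))
      ; large₂ = at (there (there (there (there (there (here refl))))))
      ; large-C = at (there (there (there (there (there (there (here refl)))))))
      ; large-link₀ = at (there (there (there (there (there (there (there (here refl))))))))
      ; large-link = λ x x<Q → at (there (there (there (there (there (there (there (there (∈-map⁺ _ (∈-range⁺ 0 x<Q))))))))))
      ; sparse-tiles = m≤n+m (2 * b * C * L₀) 2
      }

-- Hypergraphs as predicates on lists

set : ∀ {n} → List (Fin n) → Subset n
set xs = ⋃ (map ⁅_⁆ xs)

module _ {n : ℕ} where
  set-∈⁺ : ∀ {xs : List (Fin n)} {v} → v ∈ xs → v Subset.∈ set xs
  set-∈⁺ {x ∷ xs} (here refl) = Subsetₚ.x∈p∪q⁺ (inj₁ (Subsetₚ.x∈⁅x⁆ x))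
  set-∈⁺ {x ∷ xs} (there v∈) = Subsetₚ.x∈p∪q⁺ (inj₂ (set-∈⁺ v∈))

  set-∈⁻ : ∀ (xs : List (Fin n)) {v} → v Subset.∈ set xs → v ∈ xs
  set-∈⁻ [] v∈ = ⊥-elim (Subsetₚ.∉⊥ v∈)
  set-∈⁻ (x ∷ xs) v∈ with Subsetₚ.x∈p∪q⁻ ⁅ x ⁆ (set xs) v∈
  ... | inj₁ v∈₁ = here (Subsetₚ.x∈⁅y⁆⇒x≡y x v∈₁)
  ... | inj₂ v∈₂ = there (set-∈⁻ xs v∈₂)

  set-≡ : ∀ (xs : List (Fin n)) {p} → (∀ {v} → v ∈ xs → v Subset.∈ p) → (∀ {v} → v Subset.∈ p → v ∈ xs) → set xs ≡ p
  set-≡ xs to from = Subsetₚ.⊆-antisym (λ v∈ → to (set-∈⁻ xs v∈)) (λ v∈ → set-∈⁺ (from v∈))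

  set-↭ : ∀ {xs ys : List (Fin n)} → xs ↭ ys → set xs ≡ set ys
  set-↭ {xs} {ys} perm = set-≡ xs (λ v∈ → set-∈⁺ (∈-resp-↭ perm v∈)) (λ v∈ → ∈-resp-↭ (↭-sym perm) (set-∈⁻ ys v∈))

  elements : Subset n → List (Fin n)
  elements p = filter (Subsetₚ._∈? p) (allFin n)

  elements-∈⁺ : ∀ {p v} → v Subset.∈ p → v ∈ elements p
  elements-∈⁺ {p} {v} v∈ = ∈-filter⁺ (Subsetₚ._∈? p) (∈-allFin v) v∈

  elements-∈⁻ : ∀ {p v} → v ∈ elements p → v Subset.∈ p
  elements-∈⁻ {p} v∈ = proj₂ (∈-filter⁻ (Subsetₚ._∈? p) {xs = allFin n} v∈)

  elements-unique : ∀ p → Unique (elements p)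
  elements-unique p = Uniqueₚ.filter⁺ (Subsetₚ._∈? p) (allFin-unique n)

  set-elements : ∀ p → set (elements p) ≡ p
  set-elements p = set-≡ (elements p) elements-∈⁻ elements-∈⁺

∣insert∣ : ∀ {n} (v : Fin n) p → ¬ v Subset.∈ p → ∣ ⁅ v ⁆ ∪ p ∣ ≡ suc ∣ p ∣
∣insert∣ Fin.zero (true Vec.∷ p) v∉ = ⊥-elim (v∉ Vec.here)
∣insert∣ Fin.zero (false Vec.∷ p) v∉ = cong (λ q → suc ∣ q ∣) (Subsetₚ.∪-identityˡ p)
∣insert∣ (Fin.suc v) (true Vec.∷ p) v∉ = cong suc (∣insert∣ v p (v∉ ∘ Vec.there))
∣insert∣ (Fin.suc v) (false Vec.∷ p) v∉ = ∣insert∣ v p (v∉ ∘ Vec.there)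

∣set∣ : ∀ {n} {xs : List (Fin n)} → Unique xs → ∣ set xs ∣ ≡ length xs
∣set∣ {n} [] = Subsetₚ.∣⊥∣≡0 n
∣set∣ {xs = x ∷ xs} (x∉ ∷ un) = trans (∣insert∣ x (set xs) (λ x∈ → All.lookup x∉ (set-∈⁻ xs x∈) refl)) (cong suc (∣set∣ un))

length-elements : ∀ {n} (p : Subset n) → length (elements p) ≡ ∣ p ∣
length-elements p = trans (sym (∣set∣ (elements-unique p))) (cong ∣_∣ (set-elements p))

∈-subsets : ∀ {n} (p : Subset n) → p ∈ subsets n
∈-subsets Vec.[] = here refl
∈-subsets {suc n} (false Vec.∷ p) = ∈-++⁺ˡ (∈-map⁺ (false Vec.∷_) (∈-subsets p))
∈-subsets {suc n} (true Vec.∷ p) = ∈-++⁺ʳ (map (false Vec.∷_) (subsets n)) (∈-map⁺ (true Vec.∷_) (∈-subsets p))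

subsets-unique : ∀ n → Unique (subsets n)
subsets-unique zero = [] ∷ []
subsets-unique (suc n) = Uniqueₚ.++⁺ (Uniqueₚ.map⁺ ∷-injectiveʳ (subsets-unique n)) (Uniqueₚ.map⁺ ∷-injectiveʳ (subsets-unique n))
  (λ { (v∈ , v∈′) → clash (∈-map⁻ (false Vec.∷_) v∈) (∈-map⁻ (true Vec.∷_) v∈′) })
  where
  clash : ∀ {v : Subset (suc n)} {xs ys : List (Subset n)} → ∃[ p ] p ∈ xs × v ≡ false Vec.∷ p → ∃[ p ] p ∈ ys × v ≡ true Vec.∷ p → ⊥
  clash (p , _ , refl) (q , _ , ())

unique-count : ∀ (R : A → Bool) {xs ys} → Unique xs → All (_∈ ys) xs → (∀ {x} → x ∈ xs → R x ≡ true) → length xs ≤ ∑ ys (λ y → ⟦ R y ⟧)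
unique-count R {xs} {ys} un xs⊆ys holds with ws , perm ← subset-↭ un xs⊆ys = begin
  length xs ≡⟨ ∑-1 xs ⟨
  ∑ xs (λ _ → 1) ≤⟨ ∑-mono-∈ xs (λ x∈ → ≤-reflexive (sym (cong ⟦_⟧ (holds x∈)))) ⟩
  ∑ xs (λ y → ⟦ R y ⟧) ≤⟨ m≤m+n _ _ ⟩
  ∑ xs (λ y → ⟦ R y ⟧) + ∑ ws (λ y → ⟦ R y ⟧) ≡⟨ trans (∑-↭ _ perm) (∑-++ xs ws _) ⟨
  ∑ ys (λ y → ⟦ R y ⟧) ∎
  where open ≤-Reasoning

length-filter-≤ : ∀ {P : A → Set} (P? : Decidable P) (R : A → Bool) xs → (∀ {x} → P x → R x ≡ true) → length (filter P? xs) ≤ ∑ xs (λ x → ⟦ R x ⟧)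
length-filter-≤ P? R [] imp = z≤n
length-filter-≤ P? R (x ∷ xs) imp with P? x
... | yes px = +-mono-≤ (≤-reflexive (sym (cong ⟦_⟧ (imp px)))) (length-filter-≤ P? R xs imp)
... | no _ = ≤-trans (length-filter-≤ P? R xs imp) (m≤n+m _ _)

module EdgePredicate {k n : ℕ} (G : KGraph k n) where
  open UniqueDec (Finₚ._≟_ {n}) using (unique?)

  -- Lists with a repeated vertex count as edges, so that degrees of (k - 1)-tuples with repetitions are harmless.
  E : List (Fin n) → Bool
  E xs = if? (unique? xs) (does (edge? G (set xs))) true

  E-edge : ∀ {xs} → Unique xs → E xs ≡ true → Edge G (set xs)
  E-edge {xs} un eq with unique? xs
  ... | no ¬un = ⊥-elim (¬un un)
  ... | yes _ with edge? G (set xs)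
  ... | yes edge = edge
  E-edge un () | yes _ | no _

  edge-E : ∀ {xs} → (Unique xs → Edge G (set xs)) → E xs ≡ true
  edge-E {xs} edge with unique? xs
  ... | no _ = refl
  ... | yes un with edge? G (set xs)
  ... | yes _ = refl
  ... | no ¬e = ⊥-elim (¬e (edge un))

  E-resp : Invariant E
  E-resp perm eq = edge-E (λ un → subst (Edge G) (set-↭ perm) (E-edge (unique-resp-↭ (↭-sym perm) un) eq))

  -- If `S` has a repeated entry then all n vertices count on the right, and n, the default value in
  -- `minCodegree`, bounds the minimum.
  minCodegree≤ : ∀ S → length S ≡ k ∸ 1 → minCodegree G ≤ ∑ (allFin n) (λ v → ⟦ E (v ∷ S) ⟧)
  minCodegree≤ S |S| = cases (unique? S)
    where
    V = allFin n
    degs = map (deg G) (filter (λ S → ∣ S ∣ ≟ k ∸ 1) (subsets n))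
    cases : Dec (Unique S) → minCodegree G ≤ ∑ V (λ v → ⟦ E (v ∷ S) ⟧)
    cases (no ¬un) = ≤-trans (min≤v⁺ n degs (inj₁ (≤-reflexive (sym (length-allFin n)))))
      (unique-count _ (allFin-unique n) (All.universal ∈-allFin _) (λ {v} _ → edge-E {v ∷ S} (λ { (_ ∷ un) → ⊥-elim (¬un un) })))
    cases (yes un) = ≤-trans
      (min≤v⁺ n degs (inj₂ (Anyₚ.map⁺ (Any.map (λ { refl → ≤-refl }) (∈-filter⁺ (λ S → ∣ S ∣ ≟ k ∸ 1) (∈-subsets (set S)) (trans (∣set∣ un) |S|))))))
      (length-filter-≤ _ _ V (λ {v} p → edge-E {v ∷ S} (λ _ → subst (Edge G) (Subsetₚ.∪-comm (set S) ⁅ v ⁆) (proj₂ p))))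

  module _ (q : ℕ) where
    -- With q = n / t the complement contains sets of the size in the definition of extremality,
    -- however large the link itself may be.
    neighbours : List (Fin n) → List (Fin n)
    neighbours S = take q (filterᵇ (λ v → E (v ∷ S)) (allFin n))

    N : List (Fin n) → Fin n → Bool
    N S v = ⟨ v ∈ neighbours S ⟩

    ∈-take : ∀ q {xs : List (Fin n)} {v} → v ∈ take q xs → v ∈ xs
    ∈-take (suc q) {x ∷ xs} (here eq) = here eq
    ∈-take (suc q) {x ∷ xs} (there v∈) = there (∈-take q v∈)

    N⇒E : ∀ S v → N S v ≡ true → E (v ∷ S) ≡ true
    N⇒E S v eq = true-of (proj₂ (∈-filter⁻ (λ v → T? (E (v ∷ S))) {xs = allFin n} (∈-take q (⟨∈⟩-sound eq))))
      where
      true-of : ∀ {b} → Bool.T b → b ≡ true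
      true-of {true} _ = refl

    neighbours-unique : ∀ S → Unique (neighbours S)
    neighbours-unique S = Uniqueₚ.take⁺ q (Uniqueₚ.filter⁺ (λ v → T? (E (v ∷ S))) (allFin-unique n))

    neighbours-number : ∀ S → length S ≡ k ∸ 1 → q ⊓ minCodegree G ≤ ∑ (allFin n) (λ v → ⟦ N S v ⟧)
    neighbours-number S |S| = begin
      q ⊓ minCodegree G ≤⟨ ⊓-monoʳ-≤ q (≤-trans (minCodegree≤ S |S|) (≤-reflexive (∑-filter (λ v → E (v ∷ S)) (allFin n)))) ⟩
      q ⊓ length (filterᵇ (λ v → E (v ∷ S)) (allFin n)) ≡⟨ length-take q _ ⟨
      length (neighbours S) ≤⟨ unique-count (N S) (neighbours-unique S) (All.universal ∈-allFin _) ⟨∈⟩-complete ⟩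
      ∑ (allFin n) (λ v → ⟦ N S v ⟧) ∎
      where open ≤-Reasoning

    avoiding : List (Fin n) → List (Fin n) → Bool
    avoiding S y = allᵇ (not ∘ N S) y ∧ E y

    -- An edge inside `B` is counted in just one of its k! orders, by listing its vertices
    -- increasingly; for a lower bound this is enough.
    edges-avoiding : ∀ S B → (∀ {v} → v Subset.∈ B → v ∉ neighbours S) → edgesWithin G B ≤ count (allFin n) k (avoiding S)
    edges-avoiding S B disjoint = ≤-trans (≤-reflexive (sym (length-map elements es))) (unique-count (avoiding S) (Uniqueₚ.map⁺ injective (Uniqueₚ.filter⁺ P? (subsets-unique n))) tuple avoids)
      where
      P? = λ e → edge? G e ×-dec e Subsetₚ.⊆? B
      es = filter P? (subsets n)
      injective : ∀ {p q} → elements p ≡ elements q → p ≡ q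
      injective {p} {q} eq = trans (sym (set-elements p)) (trans (cong set eq) (set-elements q))
      edge-of : ∀ {y} → y ∈ map elements es → ∃[ e ] y ≡ elements e × Edge G e × e Subset.⊆ B
      edge-of y∈ with e , e∈ , eq ← ∈-map⁻ elements y∈ = e , eq , proj₂ (∈-filter⁻ P? {xs = subsets n} e∈)
      tuple : All (_∈ tuples (allFin n) k) (map elements es)
      tuple = All.tabulate λ y∈ → place-tuple (edge-of y∈)
        where
        place-tuple : ∀ {y} → ∃[ e ] y ≡ elements e × Edge G e × e Subset.⊆ B → y ∈ tuples (allFin n) k
        place-tuple (e , refl , edge , _) = subst (λ m → elements e ∈ tuples (allFin n) m) (trans (length-elements e) (uniform G edge)) (∈-tuples⁺ (allFin n) (All.universal ∈-allFin (elements e)))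
      avoids : ∀ {y} → y ∈ map elements es → avoiding S y ≡ true
      avoids y∈ = both (edge-of y∈)
        where
        beyond-N : ∀ {e} → e Subset.⊆ B → ∀ {v} → v ∈ elements e → not (N S v) ≡ true
        beyond-N e⊆B {v} v∈ with N S v in eq
        ... | false = refl
        ... | true = ⊥-elim (disjoint (e⊆B (elements-∈⁻ v∈)) (⟨∈⟩-sound eq))
        both : ∀ {y} → ∃[ e ] y ≡ elements e × Edge G e × e Subset.⊆ B → avoiding S y ≡ true
        both (e , refl , edge , e⊆B) = cong₂ _∧_ (∈-allᵇ (not ∘ N S) (elements e) (beyond-N e⊆B)) (edge-E {elements e} (λ _ → subst (Edge G) (sym (set-elements e)) edge))

    -- Any β vertices outside the truncated link form a set to which non-extremality applies, and
    -- the edges inside it avoid the link.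
    spread : ∀ {Δ₁ x β} → (∀ B → ∣ B ∣ ≡ β → x ≤ Δ₁ * edgesWithin G B) → β ≤ n ∸ q → ∀ S → x ≤ Δ₁ * count (allFin n) k (avoiding S)
    spread {Δ₁} {x} {β} within β≤ S = with-rest (subset-↭ (neighbours-unique S) (All.universal ∈-allFin (neighbours S)))
      where
      with-rest : ∃[ ws ] allFin n ↭ neighbours S ++ ws → x ≤ Δ₁ * count (allFin n) k (avoiding S)
      with-rest (ws , perm) = ≤-trans (within (set bs) |bs|) (*-monoʳ-≤ Δ₁ (edges-avoiding S (set bs) (λ v∈ v∈N → proj₂ (proj₂ split) v∈N (∈-take β (set-∈⁻ bs v∈)))))
        where
        bs = take β ws
        split : Unique (neighbours S) × Unique ws × (∀ {v} → v ∈ neighbours S → v ∉ ws)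
        split = unique-++⁻ (neighbours S) (unique-resp-↭ perm (allFin-unique n))
        |ws| : n ∸ q ≤ length ws
        |ws| = m≤n+o⇒m∸n≤o n q (begin
          n ≡⟨ length-allFin n ⟨
          length (allFin n) ≡⟨ trans (↭-length perm) (length-++ (neighbours S)) ⟩
          length (neighbours S) + length ws ≤⟨ +-monoˡ-≤ (length ws) (≤-trans (≤-reflexive (length-take q _)) (m⊓n≤m q _)) ⟩
          q + length ws ∎)
          where open ≤-Reasoning
        |bs| : ∣ set bs ∣ ≡ β
        |bs| = trans (∣set∣ (Uniqueₚ.take⁺ β (proj₁ (proj₂ split)))) (trans (length-take β ws) (m≤n⇒m⊓n≡m (≤-trans β≤ |ws|)))

-- From a cyclic list to a Hamilton cycle

nth-index : ∀ (a : A) {xs x} (x∈ : x ∈ xs) → nth a xs (toℕ (index-of x∈)) ≡ x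
nth-index a (here refl) = refl
nth-index a (there x∈) = nth-index a x∈

applyUpTo-range : ∀ a m {f : ℕ → ℕ} → (∀ i → f i ≡ a + i) → applyUpTo f m ≡ range a m
applyUpTo-range a zero eq = refl
applyUpTo-range a (suc m) eq = cong₂ _∷_ (trans (eq 0) (+-identityʳ a)) (applyUpTo-range (suc a) m (λ i → trans (eq (suc i)) (+-suc a i)))

%-injective : ∀ n .{{_ : NonZero n}} a {i j} → i < n → j < n → (a + i) % n ≡ (a + j) % n → i ≡ j
%-injective n a {i} {j} i<n j<n eq = +-cancelˡ-≡ a i j
  (trans (m≡m%n+[m/n]*n (a + i) n) (trans (cong₂ (λ x y → x + y * n) eq same) (sym (m≡m%n+[m/n]*n (a + j) n))))
  where
  apart : ∀ {i j} → i < n → j < n → (a + i) % n ≡ (a + j) % n → (a + i) / n < (a + j) / n → ⊥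
  apart {i} {j} i<n j<n eq lt = <⇒≱ (<-≤-trans j<n (m≤n+m n i)) (+-cancelˡ-≤ a _ _ (begin
    a + (i + n) ≡⟨ +-assoc a i n ⟨
    a + i + n ≡⟨ cong (_+ n) (m≡m%n+[m/n]*n (a + i) n) ⟩
    (a + i) % n + (a + i) / n * n + n ≡⟨ eq₁ ((a + i) % n) ((a + i) / n) n ⟩
    (a + i) % n + suc ((a + i) / n) * n ≤⟨ +-mono-≤ (≤-reflexive eq) (*-monoˡ-≤ n lt) ⟩
    (a + j) % n + (a + j) / n * n ≡⟨ m≡m%n+[m/n]*n (a + j) n ⟨
    a + j ∎))
    where
    open ≤-Reasoning
    eq₁ : ∀ x y n → x + y * n + n ≡ x + suc y * n
    eq₁ = solve-∀
  same : (a + i) / n ≡ (a + j) / n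
  same = ≤-antisym (≮⇒≥ (apart j<n i<n (sym eq))) (≮⇒≥ (apart i<n j<n eq))

module HamiltonCycle (σ : Shape) {n : ℕ} (G : KGraph (Words.k σ) n) where
  open Words σ
  open EdgePredicate G

  module _ .{{n≢0 : NonZero n}} (a₀ : Fin n) {cyc : List (Fin n)} (perm : cyc ↭ allFin n) (chain : Chain (λ xs → E xs ≡ true) (cyc ++ take ℓ cyc))
      {size : ℕ} (n≡ : n ≡ size * d) (d+k≤n : d + k ≤ n) where

    at around : ℕ → Fin n
    at = nth a₀ cyc
    around x = at (x % n)

    |cyc| : length cyc ≡ n
    |cyc| = trans (↭-length perm) (length-allFin n)

    cyc≡ : cyc ≡ map at (range 0 n)
    cyc≡ = sym (trans (cong (λ m → map at (range 0 m)) (sym |cyc|)) (map-nth a₀ cyc))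

    k≤n : k ≤ n
    k≤n = ≤-trans (m≤n+m k d) d+k≤n

    ℓ≤n : ℓ ≤ n
    ℓ≤n = ≤-trans (≤-trans (m≤n+m ℓ d) (≤-reflexive (sym k≡d+ℓ))) k≤n

    closed≡ : cyc ++ take ℓ cyc ≡ map around (range 0 (n + ℓ))
    closed≡ = begin
      cyc ++ take ℓ cyc ≡⟨ cong (λ c → c ++ take ℓ c) cyc≡ ⟩
      map at (range 0 n) ++ take ℓ (map at (range 0 n)) ≡⟨ cong₂ _++_ (map-range-cong 0 0 n (λ i i<n → cong at (sym (m<n⇒m%n≡m i<n))))
        (trans (take-map ℓ (range 0 n)) (cong (map at) (take-range ℓ 0 n ℓ≤n))) ⟩
      map around (range 0 n) ++ map at (range 0 ℓ) ≡⟨ cong (map around (range 0 n) ++_) (map-range-cong 0 n ℓ (λ i i<ℓ → cong at (sym (wrap i (<-≤-trans i<ℓ ℓ≤n))))) ⟩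
      map around (range 0 n) ++ map around (range n ℓ) ≡⟨ map-++ around (range 0 n) (range n ℓ) ⟨
      map around (range 0 n ++ range n ℓ) ≡⟨ cong (map around) (range-++ 0 n ℓ) ⟨
      map around (range 0 (n + ℓ)) ∎
      where
      open ≡-Reasoning
      wrap : ∀ i → i < n → (n + i) % n ≡ i
      wrap i i<n = trans (cong (_% n) (+-comm n i)) (trans ([m+n]%n≡m%n i n) (m<n⇒m%n≡m i<n))

    at-injective : ∀ {i j} → i < n → j < n → at i ≡ at j → i ≡ j
    at-injective i<n j<n = unique-map-injective at (subst Unique cyc≡ (unique-resp-↭ (↭-sym perm) (allFin-unique n))) (∈-range⁺ 0 i<n) (∈-range⁺ 0 j<n)

    around-injective : ∀ x {i j} → i < n → j < n → around (x + i) ≡ around (x + j) → i ≡ j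
    around-injective x i<n j<n eq = %-injective n x i<n j<n (at-injective (m%n<n _ n) (m%n<n _ n) eq)

    arc : ℕ → ℕ → List (Fin n)
    arc x m = map around (range x m)

    arc-unique : ∀ x {m} → m ≤ n → Unique (arc x m)
    arc-unique x {m} m≤n = unique-map around injective (unique-range x m)
      where
      injective : ∀ {y z} → y ∈ range x m → z ∈ range x m → around y ≡ around z → y ≡ z
      injective y∈ z∈ eq with i , i< , refl ← ∈-range⁻ x m y∈ | j , j< , refl ← ∈-range⁻ x m z∈ = cong (x +_) (around-injective x (<-≤-trans i< m≤n) (<-≤-trans j< m≤n) eq)

    ∣arc∣ : ∀ x {m} → m ≤ n → ∣ set (arc x m) ∣ ≡ m
    ∣arc∣ x {m} m≤n = trans (∣set∣ (arc-unique x m≤n)) (length-map-range around x m)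

    ∈-arc⁺ : ∀ x {m i} → i < m → around (x + i) ∈ arc x m
    ∈-arc⁺ x i<m = ∈-map⁺ around (∈-range⁺ x i<m)

    ∈-arc⁻ : ∀ x m {v} → v ∈ arc x m → ∃[ i ] i < m × v ≡ around (x + i)
    ∈-arc⁻ x m v∈ with y , y∈ , refl ← ∈-map⁻ around v∈ with i , i< , refl ← ∈-range⁻ x m y∈ = i , i< , refl

    arc-edge : ∀ {i} → i < size → E (arc (i * d) k) ≡ true
    arc-edge {i} i< = subst (λ xs → E xs ≡ true) (trans (cong (λ xs → take k (drop (i * d) xs)) closed≡) (window-range around 0 i fits))
      (chain i (≤-trans fits (≤-reflexive (sym (trans (cong length closed≡) (length-map-range around 0 (n + ℓ)))))))
      where
      open ≤-Reasoning
      fits : i * d + k ≤ n + ℓ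
      fits = begin
        i * d + k ≡⟨ cong (i * d +_) k≡d+ℓ ⟩
        i * d + (d + ℓ) ≡⟨ eq (i * d) d ℓ ⟩
        suc i * d + ℓ ≤⟨ +-monoˡ-≤ ℓ (*-monoˡ-≤ d i<) ⟩
        size * d + ℓ ≡⟨ cong (_+ ℓ) n≡ ⟨
        n + ℓ ∎
        where
        eq : ∀ a b c → a + (b + c) ≡ b + a + c
        eq = solve-∀

    position : ∀ v → v ∈ cyc
    position v = ∈-resp-↭ (↭-sym perm) (∈-allFin v)

    index : Fin n → Fin n
    index v = fromℕ< (<-≤-trans (Finₚ.toℕ<n (index-of (position v))) (≤-reflexive |cyc|))

    at-index : ∀ v → at (toℕ (index v)) ≡ v
    at-index v = trans (cong at (Finₚ.toℕ-fromℕ< _)) (nth-index a₀ (position v))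

    order : Permutation′ n
    order = permutation (at ∘ toℕ) index at-index (λ i → Finₚ.toℕ-injective (at-injective (Finₚ.toℕ<n _) (Finₚ.toℕ<n i) (at-index (at (toℕ i)))))

    segment≡ : ∀ p → segment order k p ≡ set (arc (toℕ p) k)
    segment≡ p = cong ⋃ (begin
      map (λ j → ⁅ at (toℕ (p ⊕ j)) ⁆) (upTo k) ≡⟨ map-cong (λ j → cong (λ x → ⁅ at x ⁆) (Finₚ.toℕ-fromℕ< _)) (upTo k) ⟩
      map (λ j → ⁅ around (toℕ p + j) ⁆) (upTo k) ≡⟨ cong (map _) (applyUpTo-range 0 k (λ _ → refl)) ⟩
      map (λ j → ⁅ around (toℕ p + j) ⁆) (range 0 k) ≡⟨ map-range-cong 0 (toℕ p) k (λ _ _ → refl) ⟩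
      map (λ x → ⁅ around x ⁆) (range (toℕ p) k) ≡⟨ map-∘ (range (toℕ p) k) ⟩
      map ⁅_⁆ (arc (toℕ p) k) ∎)
      where open ≡-Reasoning

    beginning< : ∀ (i : Fin size) → toℕ i * d < n
    beginning< i = <-≤-trans (*-monoˡ-< d (Finₚ.toℕ<n i)) (≤-reflexive (sym n≡))

    beginning : Fin size → Fin n
    beginning i = fromℕ< (beginning< i)

    segment-beginning : ∀ i → segment order k (beginning i) ≡ set (arc (toℕ i * d) k)
    segment-beginning i = trans (segment≡ (beginning i)) (cong (λ x → set (arc x k)) (Finₚ.toℕ-fromℕ< (beginning< i)))

    -- One step past the last segment starts at n, which around identifies with 0.
    next-arc : ∀ (i : Fin size) → arc (toℕ (i ⊕ 1) * d) k ≡ arc (toℕ i * d + d) k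
    next-arc i = map-range-cong _ _ k (λ j _ → cong at (shifted j))
      where
      instance
        size≢0 : NonZero size
        size≢0 = Finₚ.nonZeroIndex i
      toℕ-⊕ : toℕ (i ⊕ 1) ≡ (toℕ i + 1) % size
      toℕ-⊕ = Finₚ.toℕ-fromℕ< _
      shifted : ∀ j → (toℕ (i ⊕ 1) * d + j) % n ≡ (toℕ i * d + d + j) % n
      shifted j = trans (cong (λ x → (x * d + j) % n) toℕ-⊕) (cases (m≤n⇒m<n∨m≡n (≤-trans (≤-reflexive (+-comm (toℕ i) 1)) (Finₚ.toℕ<n i))))
        where
        cases : toℕ i + 1 < size ⊎ toℕ i + 1 ≡ size → ((toℕ i + 1) % size * d + j) % n ≡ (toℕ i * d + d + j) % n
        cases (inj₁ lt) = cong (λ x → (x + j) % n) (trans (cong (_* d) (m<n⇒m%n≡m lt)) (trans (*-distribʳ-+ d (toℕ i) 1) (cong (toℕ i * d +_) (*-identityˡ d))))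
        cases (inj₂ eq) = begin
          ((toℕ i + 1) % size * d + j) % n ≡⟨ cong (λ x → (x * d + j) % n) (trans (cong (_% size) eq) (n%n≡0 size)) ⟩
          j % n ≡⟨ [m+n]%n≡m%n j n ⟨
          (j + n) % n ≡⟨ cong (_% n) (trans (+-comm j n) (cong (_+ j) (trans n≡ (trans (cong (_* d) (sym eq)) (trans (*-distribʳ-+ d (toℕ i) 1) (cong (toℕ i * d +_) (*-identityˡ d))))))) ⟩
          (toℕ i * d + d + j) % n ∎
          where open ≡-Reasoning

    -- Together the two arcs span d + k ≤ n consecutive positions, so they cannot meet a second time
    -- on the other side of the cycle.
    arcs-meet : ∀ x → set (arc x k) ∩ set (arc (x + d) k) ≡ set (arc (x + d) ℓ)
    arcs-meet x = sym (set-≡ (arc (x + d) ℓ) common (λ v∈ → overlapping (∈-arc⁻ x k (set-∈⁻ _ (proj₁ (Subsetₚ.x∈p∩q⁻ _ _ v∈)))) (∈-arc⁻ (x + d) k (set-∈⁻ _ (proj₂ (Subsetₚ.x∈p∩q⁻ _ _ v∈))))))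
      where
      ℓ<k : ∀ {i} → i < ℓ → d + i < k
      ℓ<k i<ℓ = <-≤-trans (+-monoʳ-< d i<ℓ) (≤-reflexive (sym k≡d+ℓ))
      common : ∀ {v} → v ∈ arc (x + d) ℓ → v Subset.∈ set (arc x k) ∩ set (arc (x + d) k)
      common v∈ with i , i<ℓ , refl ← ∈-arc⁻ (x + d) ℓ v∈ = Subsetₚ.x∈p∩q⁺
        ( set-∈⁺ (subst (λ y → around y ∈ arc x k) (sym (+-assoc x d i)) (∈-arc⁺ x (ℓ<k i<ℓ)))
        , set-∈⁺ (∈-arc⁺ (x + d) (≤-<-trans (m≤n+m i d) (ℓ<k i<ℓ))))
      overlapping : ∀ {v} → ∃[ i ] i < k × v ≡ around (x + i) → ∃[ j ] j < k × v ≡ around (x + d + j) → v ∈ arc (x + d) ℓ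
      overlapping (i , i<k , refl) (j , j<k , eq) = subst (_∈ arc (x + d) ℓ) (sym eq) (∈-arc⁺ (x + d) (+-cancelˡ-< d j ℓ (begin-strict
        d + j ≡⟨ around-injective x (<-≤-trans i<k k≤n) (<-≤-trans (+-monoʳ-< d j<k) d+k≤n) (trans eq (cong around (+-assoc x d j))) ⟨
        i <⟨ i<k ⟩
        k ≡⟨ k≡d+ℓ ⟩
        d + ℓ ∎)))
        where open ≤-Reasoning

    cycle : KGraph k n
    cycle = record
      { Edge = λ e → ∃[ i ] e ≡ segment order k (beginning i)
      ; edge? = λ e → Finₚ.any? (λ i → Vecₚ.≡-dec Boolₚ._≟_ e (segment order k (beginning i)))
      ; uniform = λ { (i , eq) → trans (cong ∣_∣ (trans eq (segment-beginning i))) (∣arc∣ (toℕ i * d) k≤n) }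
      }

    hamilton-cycle : HasHamiltonCycle ℓ G
    hamilton-cycle = cycle , record
      { order = order
      ; size = size
      ; start = beginning
      ; increasing = λ {i} {j} i<j → subst₂ _<_ (sym (Finₚ.toℕ-fromℕ< (beginning< i))) (sym (Finₚ.toℕ-fromℕ< (beginning< j))) (*-monoˡ-< d i<j)
      ; edges = λ e → mk⇔ id id
      ; covering = covering
      ; sharing = λ i → trans (cong ∣_∣ (trans (cong₂ _∩_ (segment-beginning i) (trans (segment-beginning (i ⊕ 1)) (cong set (next-arc i)))) (arcs-meet (toℕ i * d)))) (∣arc∣ (toℕ i * d + d) ℓ≤n)
      } , λ { (i , refl) → subst (Edge G) (sym (segment-beginning i)) (E-edge (arc-unique (toℕ i * d) k≤n) (arc-edge (Finₚ.toℕ<n i))) }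
      where
      covering : ∀ v → ∃[ i ] v Subset.∈ segment order k (beginning i)
      covering v = i , subst (v Subset.∈_) (sym (segment-beginning i)) (set-∈⁺ (subst (_∈ arc (toℕ i * d) k) v≡ (∈-arc⁺ (toℕ i * d) (<-≤-trans (m%n<n x d) d≤k))))
        where
        open ≡-Reasoning
        x = toℕ (index v)
        x/d< : x / d < size
        x/d< = m<n*o⇒m/o<n (<-≤-trans (Finₚ.toℕ<n (index v)) (≤-reflexive n≡))
        i : Fin size
        i = fromℕ< x/d<
        d≤k : d ≤ k
        d≤k = ≤-trans (m≤m+n d ℓ) (≤-reflexive (sym k≡d+ℓ))
        v≡ : around (toℕ i * d + x % d) ≡ v
        v≡ = begin
          around (toℕ i * d + x % d) ≡⟨ cong (λ y → around (y * d + x % d)) (Finₚ.toℕ-fromℕ< x/d<) ⟩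
          around (x / d * d + x % d) ≡⟨ cong around (trans (+-comm (x / d * d) (x % d)) (sym (m≡m%n+[m/n]*n x d))) ⟩
          at (x % n) ≡⟨ cong at (m<n⇒m%n≡m (Finₚ.toℕ<n (index v))) ⟩
          at x ≡⟨ at-index v ⟩
          v ∎

-- Rational hypotheses as inequalities of natural numbers

fraction : ∀ i d → toℚᵘ (i ℚ./ suc d) ℚᵘ.≃ mkℚᵘ i d
fraction i d = ℚₚ.toℚᵘ-fromℚᵘ (mkℚᵘ i d)

-- Both sides of an inequality p · x ≤ y are moved to ℚᵘ, where numerators and denominators are not normalised.
scaled-difference : ∀ i d j d′ x → toℚᵘ ((i ℚ./ suc d ℚ.- j ℚ./ suc d′) ℚ.* fromℕ x) ℚᵘ.≃ (mkℚᵘ i d ℚᵘ.- mkℚᵘ j d′) ℚᵘ.* mkℚᵘ (ℤ.+ x) 0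
scaled-difference i d j d′ x = ℚᵘₚ.≃-trans (ℚₚ.toℚᵘ-homo-* (i ℚ./ suc d ℚ.- j ℚ./ suc d′) (fromℕ x)) (ℚᵘₚ.*-cong
  (ℚᵘₚ.≃-trans (ℚₚ.toℚᵘ-homo-+ (i ℚ./ suc d) (ℚ.- (j ℚ./ suc d′))) (ℚᵘₚ.+-cong (fraction i d) (ℚᵘₚ.≃-trans (ℚₚ.toℚᵘ-homo‿- (j ℚ./ suc d′)) (ℚᵘₚ.-‿cong (fraction j d′)))))
  (fraction (ℤ.+ x) 0))

module _ (T : ℕ) .{{T≢0 : NonZero T}} where
  -- Multiplication by Z T clears the denominators; the subtracted fraction moves to the right as
  -- the summand n.
  codegree-bound : ∀ Z .{{_ : NonZero (Z * T)}} n m → (ℤ.+ 1 ℚ./ T ℚ.- ℤ.+ 1 ℚ./ (Z * T)) ℚ.* fromℕ n ℚ.≤ fromℕ m → Z * n ≤ n + Z * (T * m)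
  codegree-bound Z n m le = *-cancelˡ-≤ T (≤-trans (≤-reflexive (eq₁ T Z n)) (≤-trans (convert T (Z * T) le) (≤-reflexive (eq₂ T Z n m))))
    where
    eq₁ : ∀ t z n → t * (z * n) ≡ z * t * n
    eq₁ = solve-∀
    eq₂ : ∀ t z n m → t * n + m * (t * (z * t) * 1) ≡ t * (n + z * (t * m))
    eq₂ = solve-∀
    rearrange : ∀ a b c e → (ℤ.+ 1 ℤ.* a ℤ.+ ℤ.- (ℤ.+ 1) ℤ.* b) ℤ.* c ℤ.* ℤ.+ 1 ℤ.≤ e → a ℤ.* c ℤ.≤ b ℤ.* c ℤ.+ e
    rearrange a b c e le = ℤₚ.≤-trans (ℤₚ.≤-reflexive (eq a b c)) (ℤₚ.+-monoʳ-≤ (b ℤ.* c) le)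
      where
      eq : ∀ a b c → a ℤ.* c ≡ b ℤ.* c ℤ.+ (ℤ.+ 1 ℤ.* a ℤ.+ ℤ.- (ℤ.+ 1) ℤ.* b) ℤ.* c ℤ.* ℤ.+ 1
      eq = ℤ-Solver.solve-∀
    convert : ∀ T X .{{_ : NonZero T}} .{{_ : NonZero X}} → (ℤ.+ 1 ℚ./ T ℚ.- ℤ.+ 1 ℚ./ X) ℚ.* fromℕ n ℚ.≤ fromℕ m → X * n ≤ T * n + m * (T * X * 1)
    convert (suc T′) (suc X′) le with ℚᵘₚ.≤-respˡ-≃ (scaled-difference (ℤ.+ 1) T′ (ℤ.+ 1) X′ n) (ℚᵘₚ.≤-respʳ-≃ (fraction (ℤ.+ m) 0) (ℚₚ.toℚᵘ-mono-≤ le))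
    ... | *≤* le′ = ℤₚ.drop‿+≤+ (subst₂ ℤ._≤_ (sym (ℤₚ.pos-* (suc X′) n)) (trans (cong₂ ℤ._+_ (sym (ℤₚ.pos-* (suc T′) n)) (sym (ℤₚ.pos-* m (suc T′ * suc X′ * 1)))) (sym (ℤₚ.pos-+ (suc T′ * n) _)))
      (rearrange (ℤ.+ suc X′) (ℤ.+ suc T′) (ℤ.+ n) (ℤ.+ m ℤ.* ℤ.+ (suc T′ * suc X′ * 1)) le′))

  floor-complement : ∀ n → floor ((1ℚ ℚ.- ℤ.+ 1 ℚ./ T) ℚ.* fromℕ n) ≡ ℤ.+ (pred T * n / T)
  floor-complement n = go T
    where
    floor-fraction : ∀ p x d → toℚᵘ p ℚᵘ.≃ mkℚᵘ (ℤ.+ x) d → floor p ≡ ℤ.+ (x / suc d)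
    floor-fraction (mkℚ (ℤ.+ y) c _) x d (*≡* eq) = trans (ℤₚ.*-identityˡ _) (cong ℤ.+_ (begin
      y / suc c ≡⟨ m*n/o*n≡m/o y (suc d) (suc c) ⟨
      y * suc d / (suc c * suc d) ≡⟨ cong (_/ (suc c * suc d)) (ℤₚ.+-injective (trans (ℤₚ.pos-* y (suc d)) (trans eq (sym (ℤₚ.pos-* x (suc c)))))) ⟩
      x * suc c / (suc c * suc d) ≡⟨ cong (λ z → z / (suc c * suc d)) (*-comm x (suc c)) ⟩
      suc c * x / (suc c * suc d) ≡⟨ m*n/m*o≡n/o (suc c) x (suc d) ⟩
      x / suc d ∎))
      where open ≡-Reasoning
    floor-fraction (mkℚ ℤ.-[1+ y ] c _) x d (*≡* eq) with trans eq (sym (ℤₚ.pos-* x (suc c)))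
    ... | ()
    go : ∀ T .{{_ : NonZero T}} → floor ((1ℚ ℚ.- ℤ.+ 1 ℚ./ T) ℚ.* fromℕ n) ≡ ℤ.+ (pred T * n / T)
    go (suc T′) = floor-fraction _ (T′ * n) T′ (ℚᵘₚ.≃-trans (scaled-difference (ℤ.+ 1) 0 (ℤ.+ 1) T′ n) (*≡* (begin
      (ℤ.+ 1 ℤ.* ℤ.+ suc T′ ℤ.+ ℤ.- (ℤ.+ 1) ℤ.* ℤ.+ 1) ℤ.* ℤ.+ n ℤ.* ℤ.+ suc T′ ≡⟨ cong (λ t → (ℤ.+ 1 ℤ.* t ℤ.+ ℤ.- (ℤ.+ 1) ℤ.* ℤ.+ 1) ℤ.* ℤ.+ n ℤ.* ℤ.+ suc T′) (ℤₚ.pos-+ 1 T′) ⟩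
      (ℤ.+ 1 ℤ.* (ℤ.+ 1 ℤ.+ ℤ.+ T′) ℤ.+ ℤ.- (ℤ.+ 1) ℤ.* ℤ.+ 1) ℤ.* ℤ.+ n ℤ.* ℤ.+ suc T′ ≡⟨ eq (ℤ.+ T′) (ℤ.+ n) (ℤ.+ suc T′) ⟩
      ℤ.+ T′ ℤ.* ℤ.+ n ℤ.* ℤ.+ suc T′ ≡⟨ cong₂ ℤ._*_ (sym (ℤₚ.pos-* T′ n)) (cong ℤ.+_ (sym (trans (*-identityʳ _) (*-identityˡ (suc T′))))) ⟩
      ℤ.+ (T′ * n) ℤ.* ℤ.+ (1 * suc T′ * 1) ∎)))
      where
      open ≡-Reasoning
      eq : ∀ t n s → (ℤ.+ 1 ℤ.* (ℤ.+ 1 ℤ.+ t) ℤ.+ ℤ.- (ℤ.+ 1) ℤ.* ℤ.+ 1) ℤ.* n ℤ.* s ≡ t ℤ.* n ℤ.* s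
      eq = ℤ-Solver.solve-∀

unit-fraction-positive : ∀ X .{{_ : NonZero X}} → 0ℚ ℚ.< ℤ.+ 1 ℚ./ X
unit-fraction-positive (suc X) = ℚₚ.toℚᵘ-cancel-< (ℚᵘₚ.<-respʳ-≃ (ℚᵘₚ.≃-sym (fraction (ℤ.+ 1) X)) (*<* (ℤ.+<+ (s≤s z≤n))))

-- A positive rational is at least the reciprocal of its denominator, so the denominator of `Δ` can
-- serve as the integer Δ₁.
scaled-below : ∀ (Δ : ℚ) → 0ℚ ℚ.< Δ → ∀ x y → ¬ fromℕ y ℚ.≤ Δ ℚ.* fromℕ x → x ≤ ↧ₙ Δ * y
scaled-below (mkℚ (ℤ.+ suc a) c co) 0<Δ x y ≰ = ≮⇒≥ λ lt → ≰ (ℚₚ.toℚᵘ-cancel-≤ (ℚᵘₚ.≤-respˡ-≃ (ℚᵘₚ.≃-sym (fraction (ℤ.+ y) 0))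
  (ℚᵘₚ.≤-respʳ-≃ (ℚᵘₚ.≃-sym (ℚᵘₚ.≃-trans (ℚₚ.toℚᵘ-homo-* (mkℚ (ℤ.+ suc a) c co) (fromℕ x)) (ℚᵘₚ.*-congˡ (fraction (ℤ.+ x) 0))))
    (*≤* (subst₂ ℤ._≤_ (ℤₚ.pos-* y (suc c * 1)) (trans (ℤₚ.pos-* (suc a * x) 1) (cong (ℤ._* ℤ.+ 1) (ℤₚ.pos-* (suc a) x))) (ℤ.+≤+ (begin
    y * (suc c * 1) ≡⟨ trans (cong (y *_) (*-identityʳ (suc c))) (*-comm y (suc c)) ⟩
    suc c * y ≤⟨ <⇒≤ lt ⟩
    x ≤⟨ m≤m+n x (a * x) ⟩
    suc a * x ≡⟨ *-identityʳ _ ⟨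
    suc a * x * 1 ∎)))))))
  where open ≤-Reasoning
scaled-below (mkℚ (ℤ.+ zero) c _) (ℚ.*<* (ℤ.+<+ ())) x y ≰
scaled-below (mkℚ ℤ.-[1+ a ] c _) (ℚ.*<* ()) x y ≰

-- Arithmetic of k and ℓ, and the theorem

shape : ∀ k ℓ → ℓ < k → ¬ (k ∸ ℓ ∣ k) → ∃[ σ ] k ≡ Words.k σ × ℓ ≡ Words.ℓ σ
shape k ℓ ℓ<k ∤ = go (k % d′) (k / d′) (m≡m%n+[m/n]*n k d′) (m%n<n k d′) (λ eq → ∤ (m%n≡0⇒n∣m k d′ eq))
  where
  d′ = k ∸ ℓ
  instance
    d′≢0 : NonZero d′
    d′≢0 = k∸ℓ-nonZero k ℓ ℓ<k
  d′+ℓ : d′ + ℓ ≡ k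
  d′+ℓ = m∸n+n≡m (<⇒≤ ℓ<k)
  go : ∀ r q → k ≡ r + q * d′ → r < d′ → ¬ r ≡ 0 → ∃[ σ ] k ≡ Words.k σ × ℓ ≡ Words.ℓ σ
  go zero q k≡ r<d r≢0 = ⊥-elim (r≢0 refl)
  go (suc r₁) zero k≡ r<d r≢0 = ⊥-elim (<⇒≱ (subst (_< d′) (sym (trans k≡ (+-identityʳ _))) r<d) (m∸n≤m k ℓ))
  go (suc r₁) (suc s₂) k≡ r<d r≢0 with e₁ , eq ← m≤n⇒∃[o]m+o≡n r<d = σ , k≡′ , +-cancelˡ-≡ d ℓ _ (trans (trans (cong (_+ ℓ) (sym d≡)) (trans d′+ℓ k≡′)) k≡d+ℓ)
    where
    σ : Shape
    σ = record { s₂ = s₂ ; r₁ = r₁ ; e₁ = e₁ }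
    open Words σ using (d; k≡d+ℓ)
    d≡ : d′ ≡ d
    d≡ = trans (sym eq) (cong suc (sym (+-suc r₁ e₁)))
    k≡′ : k ≡ Words.k σ
    k≡′ = trans k≡ (trans (+-comm (suc r₁) _) (cong (λ z → suc s₂ * z + suc r₁) d≡))

-- `T` and `d` are variables because s (k - ℓ) and k - ℓ agree with the values of the shape only up
-- to provable equality, along which this type is then transported.
Conclusion : (T : ℕ) .{{_ : NonZero T}} (k ℓ d : ℕ) → ℚ → Set₁
Conclusion T k ℓ d Δ =
  Σ[ γ ∈ ℚ ] (0ℚ ℚ.< γ × (Σ[ N ∈ ℕ ]
    (∀ (n : ℕ) → N ≤ n → d ∣ n → ∀ (G : KGraph k n) →
    ¬ (Σ[ B ∈ Subset n ] ℤ.+ ∣ B ∣ ≡ floor ((1ℚ ℚ.- ℤ.+ 1 ℚ./ T) ℚ.* fromℕ n) × fromℕ (edgesWithin G B) ℚ.≤ Δ ℚ.* fromℕ (n ^ k)) →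
    (ℤ.+ 1 ℚ./ T ℚ.- γ) ℚ.* fromℕ n ℚ.≤ fromℕ (minCodegree G) →
    HasHamiltonCycle ℓ G)))

module _ (σ : Shape) where
  open Words σ

  k∸ℓ≡d : k ∸ ℓ ≡ d
  k∸ℓ≡d = trans (cong (_∸ ℓ) k≡d+ℓ) (m+n∸n≡m d ℓ)

  s≡S : (ℓ<k : ℓ < k) → Defs.s k ℓ ℓ<k ≡ S
  s≡S ℓ<k = at (k ∸ ℓ) {{k∸ℓ-nonZero k ℓ ℓ<k}} k∸ℓ≡d
    where
    open ≡-Reasoning
    eq : ∀ s d r e → (suc s * d + suc r) + (r + suc e) ≡ r + (suc s * d + (suc r + suc e))
    eq = solve-∀
    at : ∀ D .{{_ : NonZero D}} → D ≡ d → (k + (D ∸ 1)) / D ≡ S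
    at D refl = begin
      (k + (r₁ + e)) / d ≡⟨ cong (_/ d) (trans (eq s₂ d r₁ e₁) (cong (r₁ +_) (+-comm (suc s₂ * d) d))) ⟩
      (r₁ + S * d) / d ≡⟨ +-distrib-/-∣ʳ r₁ (divides S refl) ⟩
      r₁ / d + S * d / d ≡⟨ cong₂ _+_ (m<n⇒m/n≡0 (m≤m+n r e)) (m*n/n≡m S d) ⟩
      S ∎

  main : ∀ T .{{_ : NonZero T}} → T ≡ t → ∀ (Δ : ℚ) → 0ℚ ℚ.< Δ → Conclusion T k ℓ d Δ
  -- Relative to the threshold 1 / t this γ is a deficit of 1 / (6 Z₁), the amount reserved for it
  -- in `initial-dense`. Besides `room`, n exceeds 6 Z₁ t, which pays for rounding n / t, and d + k,
  -- which keeps consecutive edges from overlapping twice.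
  main T refl Δ 0<Δ = ℤ.+ 1 ℚ./ (6 * Z₁ * t) , unit-fraction-positive (6 * Z₁ * t) , room + (6 * Z₁ * t + (d + k)) , cycle
    where
    open Choice σ (↧ₙ Δ) (s≤s z≤n) using (Z₁; room; pr; sizes)
    cycle : ∀ n → room + (6 * Z₁ * t + (d + k)) ≤ n → d ∣ n → ∀ (G : KGraph k n) →
       ¬ (Σ[ B ∈ Subset n ] ℤ.+ ∣ B ∣ ≡ floor ((1ℚ ℚ.- ℤ.+ 1 ℚ./ t) ℚ.* fromℕ n) × fromℕ (edgesWithin G B) ℚ.≤ Δ ℚ.* fromℕ (n ^ k)) →
       (ℤ.+ 1 ℚ./ t ℚ.- ℤ.+ 1 ℚ./ (6 * Z₁ * t)) ℚ.* fromℕ n ℚ.≤ fromℕ (minCodegree G) → HasHamiltonCycle ℓ G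
    cycle n large d∣n@(divides size n≡) G not-extremal codegree = close (Assembly.hamilton-list σ (pr Γ room≤n) Γ (s≤s z≤n) (s≤s z≤n) 0<n
      (record { sizes = sizes Γ room≤n 0<n ; degrees = degrees ; spread = λ S _ → spread q {↧ₙ Δ} within complement S ; d∣n = d∣n }))
      where
      open EdgePredicate G
      q = n / t
      room≤n : room ≤ n
      room≤n = ≤-trans (m≤m+n room _) large
      6Z₁t≤n : 6 * Z₁ * t ≤ n
      6Z₁t≤n = ≤-trans (≤-trans (m≤m+n (6 * Z₁ * t) (d + k)) (m≤n+m _ room)) large
      d+k≤n : d + k ≤ n
      d+k≤n = ≤-trans (≤-trans (m≤n+m (d + k) (6 * Z₁ * t)) (m≤n+m _ room)) large
      0<n : 0 < n
      0<n = <-≤-trans (s≤s z≤n) d+k≤n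
      a₀ : Fin n
      a₀ = fromℕ< 0<n
      Γ : Host
      Γ = record { a₀ = a₀ ; E = E ; E-resp = E-resp ; N = N q ; N⇒E = N⇒E q }
      degrees : ∀ S → length S ≡ k₁ → 6 * Z₁ * n ≤ n + 6 * Z₁ * (t * ∑ (allFin n) (λ v → ⟦ N q S v ⟧))
      degrees S |S| = from-min (⊓-sel q (minCodegree G)) (neighbours-number q S |S|)
        where
        open ≤-Reasoning
        total = ∑ (allFin n) (λ v → ⟦ N q S v ⟧)
        from-min : q ⊓ minCodegree G ≡ q ⊎ q ⊓ minCodegree G ≡ minCodegree G → q ⊓ minCodegree G ≤ total → 6 * Z₁ * n ≤ n + 6 * Z₁ * (t * total)
        from-min (inj₁ eq) le = begin
          6 * Z₁ * n ≤⟨ *-monoʳ-≤ (6 * Z₁) (<⇒≤ (below-quotient t n)) ⟩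
          6 * Z₁ * (t * suc q) ≡⟨ distrib (6 * Z₁) t q ⟩
          6 * Z₁ * t + 6 * Z₁ * (t * q) ≤⟨ +-mono-≤ 6Z₁t≤n (*-monoʳ-≤ (6 * Z₁) (*-monoʳ-≤ t (subst (_≤ total) eq le))) ⟩
          n + 6 * Z₁ * (t * total) ∎
          where
          distrib : ∀ z t q → z * (t * suc q) ≡ z * t + z * (t * q)
          distrib = solve-∀
        from-min (inj₂ eq) le = begin
          6 * Z₁ * n ≤⟨ codegree-bound t (6 * Z₁) n (minCodegree G) codegree ⟩
          n + 6 * Z₁ * (t * minCodegree G) ≤⟨ +-monoʳ-≤ n (*-monoʳ-≤ (6 * Z₁) (*-monoʳ-≤ t (subst (_≤ total) eq le))) ⟩
          n + 6 * Z₁ * (t * total) ∎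
      within : ∀ B → ∣ B ∣ ≡ pred t * n / t → n ^ k ≤ ↧ₙ Δ * edgesWithin G B
      within B |B| = scaled-below Δ 0<Δ (n ^ k) (edgesWithin G B) (λ le → not-extremal (B , trans (cong ℤ.+_ |B|) (sym (floor-complement t n)) , le))
      complement : pred t * n / t ≤ n ∸ q
      complement = begin
        pred t * n / t ≡⟨ cong (_/ t) (m+n∸m≡n n (pred t * n)) ⟨
        (t * n ∸ n) / t ≤⟨ /-mono-≤ (∸-monoʳ-≤ (t * n) (m/n*n≤m n t)) (≤-refl {t}) ⟩
        (t * n ∸ q * t) / t ≡⟨ cong (λ x → (x ∸ q * t) / t) (*-comm t n) ⟩
        (n * t ∸ q * t) / t ≡⟨ cong (_/ t) (*-distribʳ-∸ t n q) ⟨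
        (n ∸ q) * t / t ≡⟨ m*n/n≡m (n ∸ q) t ⟩
        n ∸ q ∎
        where open ≤-Reasoning
      close : Σ[ cyc ∈ List (Fin n) ] cyc ↭ allFin n × Chain (λ xs → E xs ≡ true) (cyc ++ take ℓ cyc) → HasHamiltonCycle ℓ G
      close (cyc , perm , chain) = HamiltonCycle.hamilton-cycle σ G {{>-nonZero 0<n}} a₀ perm chain {size} n≡ d+k≤n

theorem1p6 :
    ∀ (k ℓ : ℕ) → 3 ≤ k → 1 ≤ ℓ → (ℓ<k : ℓ < k) → ¬ ((k ∸ ℓ) ∣ k) →
    ∀ (Δ : ℚ) → 0ℚ ℚ.< Δ → Δ ℚ.< 1ℚ →
    Σ[ γ ∈ ℚ ] (0ℚ ℚ.< γ × (Σ[ N ∈ ℕ ]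
    (∀ (n : ℕ) → N ≤ n → (k ∸ ℓ) ∣ n →
    ∀ (H : KGraph k n) →
    ¬ Extremal k ℓ ℓ<k Δ H →
    (threshold k ℓ ℓ<k ℚ.- γ) ℚ.* fromℕ n ℚ.≤ fromℕ (minCodegree H) →
    HasHamiltonCycle ℓ H)))
theorem1p6 k ℓ 3≤k 1≤ℓ ℓ<k ∤ Δ 0<Δ Δ<1 = from-shape (shape k ℓ ℓ<k ∤)
  where
  T : ℕ
  T = Defs.s k ℓ ℓ<k * (k ∸ ℓ)
  T≢0 : NonZero T
  T≢0 = m*n≢0 (Defs.s k ℓ ℓ<k) (k ∸ ℓ) {{s-nonZero k ℓ ℓ<k}} {{k∸ℓ-nonZero k ℓ ℓ<k}}
  from-shape : ∃[ σ ] k ≡ Words.k σ × ℓ ≡ Words.ℓ σ → Conclusion T {{T≢0}} k ℓ (k ∸ ℓ) Δ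
  from-shape (σ , refl , refl) = subst (λ d → Conclusion T {{T≢0}} k ℓ d Δ) (sym (k∸ℓ≡d σ))
    (main σ T {{T≢0}} (cong₂ _*_ (s≡S σ ℓ<k) (k∸ℓ≡d σ)) Δ 0<Δ)
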